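{- Let $M=p_i^2p_j^2p_k^2$ with $p_i,p_j,p_k$ distinct odd primes, $A,B\subset\mathbb{Z}_M$ with $A\oplus B=\mathbb{Z}_M$, $|A|=|B|=p_ip_jp_k$, $\Phi_M\mid A$, and assume that for every $a\in A$ the set $A\cap\Lambda(a,D(M))$ is $M$-fibered in at least one direction. Let $\mathcal I=\{a\in A:a*F_i\subset A\}$, $\mathcal J=\{a\in A:a*F_j\subset A\}$, $\mathcal K=\{a\in A:a*F_k\subset A\}$. (I) If $\mathcal I\cap\mathcal J\cap\mathcal K\neq\emptyset$, then the tiling $A\oplus B=\mathbb{Z}_M$ is T2-equivalent to $\Lambda\oplus B=\mathbb{Z}_M$, where $\Lambda=\Lambda(0,D(M))$, and both $A$ and $B$ satisfy (T2). (II) If $\mathcal I\cap\mathcal J\cap\mathcal K=\emptyset$, then, after a permutation of the indices $i,j,k$ if necessary: (IIa) at least one of $\mathcal I,\mathcal J,\mathcal K$ is empty, and we may take $\mathcal I=\emptyset$, so $A\subset\mathcal J\cup\mathcal K$; (IIb) if $A\subset\mathcal J$ (resp. $A\subset\mathcal K$), then $A$ is $M$-fibered in the $p_j$ (resp. $p_k$) direction, and, with $\nu=j$ (resp. $\nu=k$), $\Phi_{p_\nu^2}\mid A$ and for every $d$ with $p_\nu^2\mid d\mid M$ either $\Phi_d\mid A$ or $\Phi_{d/p_\nu}\Phi_{d/p_\nu^2}\mid B$; both $A$ and $B$ satisfy (T2); (IIc) if $\mathcal I=\emptyset$ and $\mathcal J\setminus\mathcal K$, $\mathcal K\setminus\mathcal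 J$ are both nonempty: if $\Phi_{p_i}\mid A$, then $\Phi_{p_i^2}\mid B$ and for every $d$ with $p_i^2\mid d\mid M$ either $\Phi_d\mid B$ or $\Phi_{d/p_i}\Phi_{d/p_i^2}\mid A$, and both $A$ and $B$ satisfy (T2); if $\Phi_{p_i^2}\mid A$, then $A\subset\Pi(a,p_i)$ for any $a\in A$, and both $A$ and $B$ satisfy (T2).
   Context: $A\oplus B=\mathbb{Z}_M$: unique representation $a+b$. Masks mod $X^M-1$; $\Phi_s$ cyclotomic. (T2): with $S_A$ the prime powers $s\mid M$ with $\Phi_s\mid A$, any product of elements of $S_A$ that are powers of distinct primes indexes a cyclotomic polynomial dividing $A$. $D(M)=p_ip_jp_k$, $\Lambda(x,D)=x+D\mathbb{Z}_M$, $\Pi(x,p_\nu^\alpha)=\{y:p_\nu^\alpha\mid x-y\}$. $F_\nu=\{0,M/p_\nu,\dots,(p_\nu-1)M/p_\nu\}$, $x*F_\nu=x+F_\nu$; $S$ is $M$-fibered in the $p_\nu$ direction if $S=S'+F_\nu$ for some $S'\subset S$. T2-equivalent: both $A$ and $\Lambda$ tile $\mathbb{Z}_M$ with $B$, and $A$ satisfies (T2) iff $\Lambda$ does. -}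

module Defs where

open import Data.Nat as ℕ using (ℕ; zero; suc; _<_; _≤_; _^_)
open import Data.Nat.Divisibility as ND using (_∣?_)
open import Data.Nat.Primality using (Prime)
open import Data.Integer as ℤ using (ℤ; +_; -_)
open import Data.Integer.Divisibility as ZD using ()
open import Data.Fin using (Fin; toℕ)
open import Data.Fin.Subset using (Subset; _∈_; _⊆_; _∩_)
open import Data.Vec as Vec using (Vec; tabulate)
open import Data.List as List using (List; []; _∷_; length; reverse; map; filter; upTo; replicate; _++_; foldr)
open import Data.List.Relation.Unary.All using (All)
open import Data.List.Relation.Unary.AllPairs using (AllPairs)
open import Data.Bool using (Bool; true; false; if_then_else_)
open import Data.Product using (Σ; ∃; ∃-syntax; _×_; _,_; proj₁; proj₂)
open import Data.Sum using (_⊎_)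
open import Relation.Nullary using (¬_; does)
open import Relation.Binary.PropositionalEquality using (_≡_; _≢_)
open import Function using (_⇔_)
open import Data.Nat.ListAction using (product)

-- Integer polynomials as coefficient lists (constant term first).

Poly : Set
Poly = List ℤ

coeff : Poly → ℕ → ℤ
coeff []       _       = + 0
coeff (c ∷ _)  zero    = c
coeff (_ ∷ cs) (suc n) = coeff cs n

-- equality of polynomials (insensitive to trailing zeros)
_≈P_ : Poly → Poly → Set
P ≈P Q = ∀ n → coeff P n ≡ coeff Q n

_+P_ : Poly → Poly → Poly
[]       +P q        = q
p        +P []       = p
(a ∷ p)  +P (b ∷ q)  = (a ℤ.+ b) ∷ (p +P q)

_*P_ : Poly → Poly → Poly
[]      *P q = []
(a ∷ p) *P q = map (a ℤ.*_) q +P (+ 0 ∷ (p *P q))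

XnMinus1 : ℕ → Poly
XnMinus1 zero    = []
XnMinus1 (suc n) = (- (+ 1)) ∷ (replicate n (+ 0) ++ (+ 1 ∷ []))

-- long division by a monic polynomial, on descending coefficient lists
private
  subPrefix : ℤ → List ℤ → List ℤ → List ℤ
  subPrefix c (n ∷ ns) (d ∷ ds) = (n ℤ.- c ℤ.* d) ∷ subPrefix c ns ds
  subPrefix c ns       []       = ns
  subPrefix c []       (_ ∷ _)  = []

  divDesc : ℕ → List ℤ → List ℤ → List ℤ
  divDesc zero     _        _ = []
  divDesc (suc f)  []       _ = []
  divDesc (suc f)  (c ∷ ns) d with length d ℕ.≤? suc (length ns)
  ... | Relation.Nullary.yes _ = c ∷ divDesc f (drop1 (subPrefix c (c ∷ ns) d)) d
    where
      drop1 : List ℤ → List ℤ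
      drop1 []       = []
      drop1 (_ ∷ xs) = xs
  ... | Relation.Nullary.no _  = []

-- quotient of N by the monic polynomial D (D given without trailing zeros)
quotMonic : Poly → Poly → Poly
quotMonic N D = reverse (divDesc (length N) (reverse N) (reverse D))

properDivisors : ℕ → List ℕ
properDivisors n = filter (λ d → d ∣? n) (List.drop 1 (upTo n))

-- Φ_n computed by X^n - 1 = ∏_{d ∣ n} Φ_d  (fuel f ≥ n)
cycF : ℕ → ℕ → Poly
cycF zero    n = + 1 ∷ []
cycF (suc f) n = quotMonic (XnMinus1 n) (foldr (λ d acc → cycF f d *P acc) (+ 1 ∷ []) (properDivisors n))

Φ : ℕ → Poly
Φ n = cycF n n

_≡_[mod_] : ℕ → ℕ → ℕ → Set
x ≡ y [mod m ] = (+ m) ZD.∣ ((+ x) ℤ.- (+ y))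

mask : {M : ℕ} → Subset M → Poly
mask A = map (λ b → if b then + 1 else + 0) (Vec.toList A)

DividesMask : (M : ℕ) → Poly → Subset M → Set
DividesMask M P A = ∃[ Q ] ∃[ R ] (mask A ≈P ((P *P Q) +P (XnMinus1 M *P R)))

CycDiv : (M s : ℕ) → Subset M → Set
CycDiv M s A = DividesMask M (Φ s) A

Tiles : (M : ℕ) → Subset M → Subset M → Set
Tiles M A B =
  ∀ (x : Fin M) →
    (∃[ a ] ∃[ b ] (a ∈ A × b ∈ B × (toℕ a ℕ.+ toℕ b) ≡ toℕ x [mod M ]))
  × (∀ a b a' b' → a ∈ A → b ∈ B → a' ∈ A → b' ∈ B →
       (toℕ a ℕ.+ toℕ b) ≡ toℕ x [mod M ] →
       (toℕ a' ℕ.+ toℕ b') ≡ toℕ x [mod M ] →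
       (a ≡ a') × (b ≡ b'))

T2 : (M : ℕ) → Subset M → Set
T2 M A = ∀ (L : List (ℕ × ℕ)) → L ≢ [] →
  All (λ pa → Prime (proj₁ pa) × 1 ≤ proj₂ pa × (proj₁ pa ^ proj₂ pa) ND.∣ M
              × CycDiv M (proj₁ pa ^ proj₂ pa) A) L →
  AllPairs _≢_ (map proj₁ L) →
  CycDiv M (product (map (λ pa → proj₁ pa ^ proj₂ pa) L)) A

T2Equivalent : (M : ℕ) → Subset M → Subset M → Subset M → Set
T2Equivalent M A Λ B = Tiles M A B × Tiles M Λ B × (T2 M A ⇔ T2 M Λ)

Λ : (M D : ℕ) → Fin M → Subset M
Λ M D x = tabulate (λ y → does (D ∣? ((toℕ y ℕ.+ M) ℕ.∸ toℕ x)))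

-- fibers. A direction is given by a prime p ∣ M together with the step
-- c = M / p, so that F = {0, c, 2c, ..., (p-1)c}.

InFiber : (M p c : ℕ) → Fin M → Fin M → Set
InFiber M p c x y = ∃[ t ] (t < p × toℕ y ≡ (toℕ x ℕ.+ t ℕ.* c) [mod M ])

FiberIn : (M p c : ℕ) → Fin M → Subset M → Set
FiberIn M p c x S = ∀ y → InFiber M p c x y → y ∈ S

Fibered : (M p c : ℕ) → Subset M → Set
Fibered M p c S = ∃[ S' ] (S' ⊆ S × (∀ y → (y ∈ S ⇔ (∃[ s ] (s ∈ S' × InFiber M p c s y)))))

Λ₀ : (M D : ℕ) → Subset M
Λ₀ M D = tabulate (λ y → does (D ∣? toℕ y))

DirSet : (M p c : ℕ) → Subset M → Fin M → Set
DirSet M p c A a = a ∈ A × FiberIn M p c a A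

data Perm3 : ℕ × ℕ × ℕ → ℕ × ℕ × ℕ → Set where
  σ123 : ∀ {a b c} → Perm3 (a , b , c) (a , b , c)
  σ132 : ∀ {a b c} → Perm3 (a , c , b) (a , b , c)
  σ213 : ∀ {a b c} → Perm3 (b , a , c) (a , b , c)
  σ231 : ∀ {a b c} → Perm3 (b , c , a) (a , b , c)
  σ312 : ∀ {a b c} → Perm3 (c , a , b) (a , b , c)
  σ321 : ∀ {a b c} → Perm3 (c , b , a) (a , b , c)

-- steps M / q for the three directions, with M = q1² q2² q3²
step₁ step₂ step₃ : ℕ → ℕ → ℕ → ℕ
step₁ q1 q2 q3 = q1 ℕ.* q2 ^ 2 ℕ.* q3 ^ 2
step₂ q1 q2 q3 = q1 ^ 2 ℕ.* q2 ℕ.* q3 ^ 2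
step₃ q1 q2 q3 = q1 ^ 2 ℕ.* q2 ^ 2 ℕ.* q3

-- conclusion (IIb) for the direction (q, c) of the set A, with partner B:
-- A fibered in direction q, Φ_{q²} ∣ A, and for every d = q² e with d ∣ M,
-- Φ_d ∣ A or Φ_{d/q} Φ_{d/q²} ∣ B; both A and B satisfy (T2)
ConclIIb : (M q c : ℕ) → Subset M → Subset M → Set
ConclIIb M q c A B =
  Fibered M q c A × CycDiv M (q ^ 2) A
  × (∀ e → (q ^ 2 ℕ.* e) ND.∣ M →
       CycDiv M (q ^ 2 ℕ.* e) A ⊎ DividesMask M (Φ (q ℕ.* e) *P Φ e) B)
  × T2 M A × T2 M B

ConclII : (M : ℕ) → Subset M → Subset M → ℕ → ℕ → ℕ → Set
ConclII M A B q1 q2 q3 =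
  let 𝓘 = DirSet M q1 (step₁ q1 q2 q3) A
      𝓙 = DirSet M q2 (step₂ q1 q2 q3) A
      𝓚 = DirSet M q3 (step₃ q1 q2 q3) A
  in
  ((∀ a → ¬ 𝓘 a) × (∀ a → a ∈ A → 𝓙 a ⊎ 𝓚 a))
  × ((∀ a → a ∈ A → 𝓙 a) → ConclIIb M q2 (step₂ q1 q2 q3) A B)
  × ((∀ a → a ∈ A → 𝓚 a) → ConclIIb M q3 (step₃ q1 q2 q3) A B)
  × ((∀ a → ¬ 𝓘 a) → (∃[ a ] (𝓙 a × ¬ 𝓚 a)) → (∃[ a ] (𝓚 a × ¬ 𝓙 a)) →
       (CycDiv M q1 A →
          CycDiv M (q1 ^ 2) B
          × (∀ e → (q1 ^ 2 ℕ.* e) ND.∣ M →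
               CycDiv M (q1 ^ 2 ℕ.* e) B ⊎ DividesMask M (Φ (q1 ℕ.* e) *P Φ e) A)
          × T2 M A × T2 M B)
       × (CycDiv M (q1 ^ 2) A →
          (∀ a → a ∈ A → ∀ y → y ∈ A → toℕ y ≡ toℕ a [mod q1 ])
          × T2 M A × T2 M B))

{-# OPTIONS --safe #-}
-- Divisibility by Φ_s is read off from the alternating sums of the counting function of a set over cuboids in
-- ℤ_{p²} × ℤ_{q²} × ℤ_{r²}. Averaging over dilations (Tijdeman) shows that each Φ_s with 1 ≠ s ∣ M divides A or B,
-- without the irreducibility of Φ_s. The hypothesis partitions A into fibres, and counting modulo p, q and r shows
-- that a partition never uses all three directions; since planes spanned by two fibres can be retyped, this gives
-- (IIa) and shows that in (I) the set A is fibered in one direction. If A is fibered in the p direction, or lies in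
-- one class mod p, then a dilation that is 0 mod p² and 1 mod q²r² yields tilings of ℤ_{q²r²}, for which (T2) comes
-- down to 0/1 matrices without cross differences. Otherwise Φ_p ∣ A, every class of A mod p is a union of q-fibres
-- or a union of r-fibres, and for q < r the divisors are found one after the other by counting in A and B.
module Submission where

open import Defs
open import Data.Nat using (ℕ; _*_; _^_)
open import Data.Nat.Divisibility using (_∣_)
open import Data.Nat.Primality using (Prime)
open import Data.Fin.Subset using (Subset; _∈_; _∩_; ∣_∣)
open import Data.Product using (_×_; _,_; ∃-syntax)
open import Data.Sum using (_⊎_)
open import Relation.Nullary using (¬_)
open import Relation.Binary.PropositionalEquality using (_≡_; _≢_)

open import Data.Nat.Properties using (*-assoc; *-cancelʳ-≡; *-cancelˡ-<; *-cancelˡ-≡; *-cancelˡ-≤; *-comm; *-distribˡ-+; *-identityʳ; *-identityˡ; *-mono-≤; *-monoʳ-≤; *-zeroʳ; +-assoc; +-cancelʳ-≡; +-cancelʳ-≤; +-cancelˡ-≡; +-cancelˡ-≤; +-comm; +-identityʳ; +-mono-≤; +-monoʳ-≤; +-monoˡ-≤; +-∸-assoc; 0∸n≡0; <-asym; <-cmp; <-irrefl; <-trans; <-≤-trans; <⇒≢; <⇒≤; <⇒≱; ^-distribˡ-+-*; _!≢0; m*n≡0⇒m≡0∨n≡0; m*n≢0; m+[n∸m]≡n; m+n≡0⇒m≡0; m^n≢0; m∸n+n≡m; m∸n≤m; m≤m+n; m≤n+m; m≤n⇒m∸n≡0; m≤n⇒m≤1+n; n<1+n; n∸n≡0; n≢0⇒n>0;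 n≤0⇒n≡0; n≤1+n; suc-injective; suc-pred; ∸-monoʳ-<; ≤-<-trans; ≤-antisym; ≤-pred; ≤-refl; ≤-reflexive; ≤-total; ≤-trans; ≤∧≢⇒<; ≮⇒≥; ≰⇒>)
open import Data.Integer.Properties as ℤₚ using (*-distribʳ-+; *-zeroˡ; +-identityˡ; +-injective; +-inverseʳ; +-inverseˡ; -1*i≡-i; 0≤i⇒+∣i∣≡i; abs-*; i*j≡0⇒i≡0∨j≡0; i-j≡0⇒i≡j; i≡j⇒i-j≡0; m-n≡m⊖n; neg-distribˡ-*; neg-involutive; pos-*; suc-*; ∣i∣≡0⇒i≡0; ∣⊖∣-≤; ⊖-≥) renaming (*-assoc to ·-assoc; *-cancelˡ-≡ to ·-cancelˡ-≡; *-comm to ·-comm; *-distribˡ-+ to ·-distribˡ-⊕; *-identityʳ to ·-identityʳ; *-identityˡ to ·-identityˡ; *-zeroʳ to ·-zeroʳ; +-assoc to ⊕-assoc; +-comm to ⊕-comm; +-identityʳ to ⊕-identityʳ; +-mono-≤ to ⊕-mono-≤; +-monoʳ-≤ to ⊕-monoʳ-≤; +-monoˡ-≤ to ⊕-monoˡ-≤)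
import Data.List.Properties as Lₚ
open import Relation.Binary.PropositionalEquality
import Tactic.RingSolver as Solver
import Tactic.RingSolver.Core.AlmostCommutativeRing as ACR
import Relation.Binary.Reasoning.Setoid as SetoidR
import Data.List.Relation.Unary.All as All
import Data.List.Relation.Unary.All.Properties as Allₚ
open All using (All; []; _∷_)
import Data.List.Relation.Unary.Unique.Propositional.Properties as Uniqueₚ
import Data.Nat as ℕ
import Data.Integer.Divisibility as ZD
open import Data.Integer.DivMod using (_%ℕ_; _/ℕ_; a≡a%ℕn+[a/ℕn]*n; n%ℕd<d)
open import Data.Fin.Properties as Finₚ using (all?; any?; toℕ-fromℕ<; toℕ-injective; toℕ-inject₁; toℕ<n)
import Data.Vec.Relation.Unary.Any as VAny
open import Data.Nat.Tactic.RingSolver using () renaming (solve-∀ to ringℕ)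
open import Data.Nat using (ℕ; zero; suc; _+_; _*_; _^_; _∸_; _≤_; _<_; z≤n; s≤s; NonZero; _≤?_; _≟_; _!; >-nonZero; >-nonZero⁻¹; nonTrivial⇒n>1; pred; ≢-nonZero; ≢-nonZero⁻¹)
open import Data.Integer as ℤ using (ℤ; +_; -_; _-_) renaming (_*_ to _·_; _+_ to _⊕_)
open import Data.Integer.Tactic.RingSolver using () renaming (solve-∀ to ring)
open import Data.List using (List; []; _∷_; map; _++_; length; reverse; replicate; filter; upTo; foldr; foldl; cartesianProductWith)
open import Data.Maybe using (Maybe; just; nothing)
open import Data.Product using (_×_; _,_; proj₁; proj₂)
open import Data.Sum using (_⊎_; inj₁; inj₂; [_,_]′)
open import Data.Empty using (⊥; ⊥-elim)
open import Function using (_∘_; mk⇔; module Equivalence)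
open import Level using (0ℓ)
open import Algebra.Bundles using (CommutativeRing)
open import Relation.Nullary using (¬_; Dec; yes; no; does)
open import Data.Nat.Divisibility using (_∣_; divides; _∣?_; ∣⇒≤; ∣-refl; ∣-trans; ∣-antisym; ∣m⇒∣m*n; ∣n⇒∣m*n; *-cancelˡ-∣; m∣m*n; n∣m*n; 1∣_; *-pres-∣; *-monoʳ-∣; *-monoˡ-∣; ∣1⇒≡1; ∣m+n∣m⇒∣n; ∣m∣n⇒∣m+n; ∣-reflexive)
open import Data.Nat.GCD using (gcd; gcd-GCD; gcd[m,n]∣m; gcd[m,n]∣n; module Bézout; gcd-greatest)
open import Data.List.Relation.Unary.AllPairs using (AllPairs; []; _∷_)
open import Data.List.Relation.Unary.Any using (here; there)
open import Data.List.Membership.Propositional using () renaming (_∈_ to _∈L_)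
open import Data.List.Membership.Propositional.Properties using (∈-filter⁻; ∈-filter⁺; ∈-upTo⁻; ∈-upTo⁺; ∈-map⁺; ∈-map⁻; ∈-cartesianProductWith⁻)
open import Data.Integer.Divisibility.Signed using (∣ᵤ⇒∣; ∣⇒∣ᵤ; ∣m+n∣n⇒∣m) renaming (_∣_ to _∣ℤ_; _∣?_ to _∣ℤ?_; divides to dividesℤ; ∣m∣n⇒∣m-n to sub∣; ∣m∣n⇒∣m+n to add∣; ∣n⇒∣m*n to mulˡ∣; ∣m⇒∣m*n to mulʳ∣; ∣m⇒∣-m to neg∣; ∣-trans to trans∣; ∣-refl to refl∣; *-cancelˡ-∣ to cancelˡ∣)
open import Data.Nat.Primality using (Prime; euclidsLemma; prime⇒nonZero; prime⇒nonTrivial; prime⇒irreducible)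
open import Data.Nat.Primality.Factorisation using (factorise; PrimeFactorisation)
open import Data.Nat.Coprimality as Cop′ using (Coprime; coprime-Bézout; coprime-divisor)
open import Data.Nat.Combinatorics using (_C_; nCk≡n!/k![n-k]!; k![n∸k]!∣n!; nCn≡1)
open import Data.Nat.DivMod using (m/n*n≡m)
open import Data.Nat.ListAction using (product)
open import Data.Bool using (Bool; true; false; if_then_else_)
open import Data.Fin as Fin using (Fin; toℕ; fromℕ<)
open import Data.Fin.Subset using (Subset; _∈_; _∩_; ∣_∣)
open import Data.Vec as Vec using (Vec; []; _∷_)
open import Relation.Nullary.Decidable using (dec-true; dec-false; ¬?; decidable-stable; _×-dec_; _→-dec_)
open import Data.Unit using (⊤; tt)
open import Relation.Binary.Definitions using (tri<; tri≈; tri>)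
open import Data.Fin.Subset.Properties using (_∈?_; x∈p∩q⁺; x∈p∩q⁻)
open import Data.Vec.Properties using (lookup∘tabulate; []=⇒lookup; lookup⇒[]=)

-- `Φ` is defined as the output of a long division, so even X^n - 1 = ∏ Φ_d is a theorem here; its
-- proof runs together with a weak coprimality: for d ≠ e a nonzero integer lies in the ideal
-- generated by Φ_d and Φ_e. Nothing more is known about a single Φ_s, so it need not visibly divide
-- a factor of a product it divides. What replaces this is multiplicativity: averaged over units,
-- the kernel that detects Φ_s splits into a value at A times a value at B, while its sum over every
-- dilated tiling is zero. After that only numbers of points in residue classes occur. By the
-- Chinese remainder theorem the three primes play equal parts, so each statement is proved for one
-- order of them and transported. Two facts carry the counting. For distinct primes q and r, qy + rz
-- = qr forces y = 0 or z = 0. A nonnegative matrix with vanishing cross differences is f(d) + g(ω),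
-- so if each row has a zero, all rows are equal and their number divides the total. Oddness enters,
-- for example, where two layers mod p² are occupied and a third one is wanted.

infixr 5 _∙_
_∙_ : ∀ {ℓ} {A : Set ℓ} {x y z : A} → x ≡ y → y ≡ z → x ≡ z
_∙_ = trans

-- Integer polynomials as a commutative ring

conv : (ℕ → ℤ) → (ℕ → ℤ) → ℕ → ℤ
conv f g zero    = f 0 · g 0
conv f g (suc n) = f 0 · g (suc n) ⊕ conv (f ∘ suc) g n

conv-cong : ∀ {f f' g g'} → (∀ n → f n ≡ f' n) → (∀ n → g n ≡ g' n) → ∀ n → conv f g n ≡ conv f' g' n
conv-cong ff gg zero = cong₂ _·_ (ff 0) (gg 0)
conv-cong ff gg (suc n) = cong₂ _⊕_ (cong₂ _·_ (ff 0) (gg (suc n))) (conv-cong (ff ∘ suc) gg n)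

conv-0ˡ : ∀ g n → conv (λ _ → + 0) g n ≡ + 0
conv-0ˡ g zero = refl
conv-0ˡ g (suc n) = +-identityˡ _ ∙ conv-0ˡ g n

conv-+ˡ : ∀ f f' g n → conv (λ m → f m ⊕ f' m) g n ≡ conv f g n ⊕ conv f' g n
conv-+ˡ f f' g zero = *-distribʳ-+ (g 0) (f 0) (f' 0)
conv-+ˡ f f' g (suc n) rewrite conv-+ˡ (f ∘ suc) (f' ∘ suc) g n = lem (f 0) (f' 0) (g (suc n)) _ _
  where
  lem : ∀ a b c x y → (a ⊕ b) · c ⊕ (x ⊕ y) ≡ (a · c ⊕ x) ⊕ (b · c ⊕ y); lem = ring

conv-*ˡ : ∀ c f g n → conv (λ m → c · f m) g n ≡ c · conv f g n
conv-*ˡ c f g zero = ·-assoc c (f 0) (g 0)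
conv-*ˡ c f g (suc n) rewrite conv-*ˡ c (f ∘ suc) g n = lem c (f 0) (g (suc n)) _
  where
  lem : ∀ c a b x → c · a · b ⊕ c · x ≡ c · (a · b ⊕ x); lem = ring

-- `conv` strips the first value of `f`. Stripping the last one instead shortens `g` at its front,
-- and the two recursions together give commutativity.
conv-sucʳ : ∀ f g n → conv f g (suc n) ≡ conv f (g ∘ suc) n ⊕ f (suc n) · g 0
conv-sucʳ f g zero = refl
conv-sucʳ f g (suc n) rewrite conv-sucʳ (f ∘ suc) g n = sym (⊕-assoc (f 0 · g (suc (suc n))) _ _)

conv-comm : ∀ f g n → conv f g n ≡ conv g f n
conv-comm f g zero = ·-comm (f 0) (g 0)
conv-comm f g (suc n) rewrite conv-sucʳ g f n | conv-comm (f ∘ suc) g n | ·-comm (f 0) (g (suc n)) =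
  ⊕-comm (g (suc n) · f 0) _

conv-assoc : ∀ f g h n → conv (conv f g) h n ≡ conv f (conv g h) n
conv-assoc f g h zero = ·-assoc (f 0) (g 0) (h 0)
conv-assoc f g h (suc n)
  rewrite conv-+ˡ (λ m → f 0 · g (suc m)) (conv (f ∘ suc) g) h n
        | conv-*ˡ (f 0) (g ∘ suc) h n
        | conv-assoc (f ∘ suc) g h n = lem (f 0) (g 0) (h (suc n)) _ _
  where
  lem : ∀ a b c x y → a · b · c ⊕ (a · x ⊕ y) ≡ a · (b · c ⊕ x) ⊕ y; lem = ring

coeff-+ : ∀ p q n → coeff (p +P q) n ≡ coeff p n ⊕ coeff q n
coeff-+ [] q n = sym (+-identityˡ _)
coeff-+ (a ∷ p) [] n = sym (⊕-identityʳ _)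
coeff-+ (a ∷ p) (b ∷ q) zero = refl
coeff-+ (a ∷ p) (b ∷ q) (suc n) = coeff-+ p q n

coeff-map : ∀ a q n → coeff (map (a ·_) q) n ≡ a · coeff q n
coeff-map a [] n = sym (·-zeroʳ a)
coeff-map a (b ∷ q) zero = refl
coeff-map a (b ∷ q) (suc n) = coeff-map a q n

coeff-* : ∀ p q n → coeff (p *P q) n ≡ conv (coeff p) (coeff q) n
coeff-* [] q n = sym (conv-0ˡ (coeff q) n)
coeff-* (a ∷ p) q zero = coeff-+ (map (a ·_) q) _ 0 ∙ ⊕-identityʳ _ ∙ coeff-map a q 0
coeff-* (a ∷ p) q (suc n) = coeff-+ (map (a ·_) q) _ (suc n) ∙ cong₂ _⊕_ (coeff-map a q (suc n)) (coeff-* p q n)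

negP : Poly → Poly
negP = map (λ c → - c)

coeff-neg : ∀ q n → coeff (negP q) n ≡ - coeff q n
coeff-neg [] n = refl
coeff-neg (b ∷ q) zero = refl
coeff-neg (b ∷ q) (suc n) = coeff-neg q n

1P : Poly
1P = + 1 ∷ []

infix 4 _≋_
-- A record, so that the two polynomials are recovered by unification.
record _≋_ (P Q : Poly) : Set where
  constructor eq
  field at : P ≈P Q
open _≋_ public

+P-cong : ∀ {p p' q q'} → p ≋ p' → q ≋ q' → p +P q ≋ p' +P q'
+P-cong {p} {p'} {q} {q'} (eq a) (eq b) = eq λ n → coeff-+ p q n ∙ cong₂ _⊕_ (a n) (b n) ∙ sym (coeff-+ p' q' n)

*P-cong : ∀ {p p' q q'} → p ≋ p' → q ≋ q' → p *P q ≋ p' *P q'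
*P-cong {p} {p'} {q} {q'} (eq a) (eq b) = eq λ n → coeff-* p q n ∙ conv-cong a b n ∙ sym (coeff-* p' q' n)

negP-cong : ∀ {p p'} → p ≋ p' → negP p ≋ negP p'
negP-cong {p} {p'} (eq a) = eq λ n → coeff-neg p n ∙ cong -_ (a n) ∙ sym (coeff-neg p' n)

conv-1ˡ : ∀ q n → conv (coeff 1P) (coeff q) n ≡ coeff q n
conv-1ˡ q zero = ·-identityˡ _
conv-1ˡ q (suc n) = cong₂ _⊕_ (·-identityˡ (coeff q (suc n))) (conv-0ˡ (coeff q) n) ∙ ⊕-identityʳ _

*P-comm : ∀ p q → p *P q ≋ q *P p
*P-comm p q = eq λ n → coeff-* p q n ∙ conv-comm (coeff p) (coeff q) n ∙ sym (coeff-* q p n)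

*P-assoc : ∀ p q r → (p *P q) *P r ≋ p *P (q *P r)
*P-assoc p q r = eq λ n → coeff-* (p *P q) r n ∙
  conv-cong (coeff-* p q) (λ _ → refl) n ∙
  conv-assoc (coeff p) (coeff q) (coeff r) n ∙
  conv-cong {coeff p} (λ _ → refl) (λ m → sym (coeff-* q r m)) n ∙ sym (coeff-* p (q *P r) n)

*P-distribʳ : ∀ r p q → (p +P q) *P r ≋ (p *P r) +P (q *P r)
*P-distribʳ r p q = eq λ n → coeff-* (p +P q) r n ∙
  conv-cong (coeff-+ p q) (λ _ → refl) n ∙
  conv-+ˡ (coeff p) (coeff q) (coeff r) n ∙
  sym (cong₂ _⊕_ (coeff-* p r n) (coeff-* q r n)) ∙ sym (coeff-+ (p *P r) (q *P r) n)

≋-sym : ∀ {p q} → p ≋ q → q ≋ p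
≋-sym (eq a) = eq λ n → sym (a n)

≋-trans : ∀ {p q r} → p ≋ q → q ≋ r → p ≋ r
≋-trans (eq a) (eq b) = eq λ n → a n ∙ b n

infixr 5 _⨾_
_⨾_ : ∀ {p q r} → p ≋ q → q ≋ r → p ≋ r
_⨾_ = ≋-trans

≋-refl : ∀ {p} → p ≋ p
≋-refl = eq λ _ → refl

polyRing : CommutativeRing 0ℓ 0ℓ
polyRing = record
  { Carrier = Poly ; _≈_ = _≋_ ; _+_ = _+P_ ; _*_ = _*P_ ; -_ = negP ; 0# = [] ; 1# = 1P
  ; isCommutativeRing = record
    { isRing = record
      { +-isAbelianGroup = record
        { isGroup = record
          { isMonoid = record
            { isSemigroup = record
              { isMagma = record
                { isEquivalence = record { refl = ≋-refl ; sym = ≋-sym ; trans = ≋-trans }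
                ; ∙-cong = +P-cong }
              ; assoc = λ p q r → eq λ n → coeff-+ (p +P q) r n ∙ cong (λ z → z ⊕ coeff r n) (coeff-+ p q n) ∙
                  ⊕-assoc (coeff p n) _ _ ∙ sym (coeff-+ p (q +P r) n ∙ cong (λ z → coeff p n ⊕ z) (coeff-+ q r n)) }
            ; identity = (λ p → ≋-refl) , (λ p → eq λ n → coeff-+ p [] n ∙ ⊕-identityʳ _) }
          ; inverse = (λ p → eq λ n → coeff-+ (negP p) p n ∙ cong (λ z → z ⊕ coeff p n) (coeff-neg p n) ∙ +-inverseˡ (coeff p n))
                    , (λ p → eq λ n → coeff-+ p (negP p) n ∙ cong (λ z → coeff p n ⊕ z) (coeff-neg p n) ∙ +-inverseʳ (coeff p n))
          ; ⁻¹-cong = negP-cong }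
        ; comm = λ p q → eq λ n → coeff-+ p q n ∙ ⊕-comm (coeff p n) _ ∙ sym (coeff-+ q p n) }
      ; *-cong = *P-cong
      ; *-assoc = *P-assoc
      ; *-identity = (λ p → eq λ n → coeff-* 1P p n ∙ conv-1ˡ p n)
                   , (λ p → *P-comm p 1P ⨾ eq λ n → coeff-* 1P p n ∙ conv-1ˡ p n)
      ; distrib = (λ r p q → *P-comm r (p +P q) ⨾ *P-distribʳ r p q ⨾ +P-cong (*P-comm p r) (*P-comm q r)) , *P-distribʳ }
    ; *-comm = *P-comm } }

module PR = CommutativeRing polyRing

+ˡ : ∀ p {q q'} → q ≋ q' → p +P q ≋ p +P q'
+ˡ p = +P-cong (≋-refl {p})

+ʳ : ∀ q {p p'} → p ≋ p' → p +P q ≋ p' +P q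
+ʳ q e = +P-cong e (≋-refl {q})

*ˡ : ∀ p {q q'} → q ≋ q' → p *P q ≋ p *P q'
*ˡ p = *P-cong (≋-refl {p})

*ʳ : ∀ q {p p'} → p ≋ p' → p *P q ≋ p' *P q
*ʳ q e = *P-cong e (≋-refl {q})

polyACR : ACR.AlmostCommutativeRing 0ℓ 0ℓ
polyACR = ACR.fromCommutativeRing polyRing zero?
  where
  zero? : ∀ p → Maybe ([] ≋ p)
  zero? [] = just ≋-refl
  zero? (+ 0 ∷ p) with zero? p
  ... | just (eq f) = just (eq λ { zero → refl ; (suc n) → f n })
  ... | nothing = nothing
  zero? (_ ∷ p) = nothing

open import Algebra.Properties.Semiring.Exp (CommutativeRing.semiring polyRing) using () renaming (_^_ to _^P_)
open import Algebra.Properties.Semiring.Mult (CommutativeRing.semiring polyRing) using () renaming (_×_ to _×P_)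
import Algebra.Properties.Monoid.Sum (CommutativeRing.+-monoid polyRing) as PSum
open import Algebra.Properties.CommutativeSemiring.Binomial (CommutativeRing.commutativeSemiring polyRing) using (binomialTerm) renaming (theorem to binomial-theorem; binomial to binomialMonomial)

module ≋R = SetoidR (CommutativeRing.setoid polyRing)

-- Monic polynomials and division with remainder

mono : ℕ → ℤ → Poly
mono zero c = c ∷ []
mono (suc n) c = + 0 ∷ mono n c

coeff-≥ : ∀ p n → length p ≤ n → coeff p n ≡ + 0
coeff-≥ [] n _ = refl
coeff-≥ (_ ∷ p) (suc n) (s≤s le) = coeff-≥ p n le

snoc≋ : ∀ p c → p ++ c ∷ [] ≋ p +P mono (length p) c
snoc≋ [] c = ≋-refl
snoc≋ (a ∷ p) c = eq λ { zero → sym (⊕-identityʳ a) ; (suc n) → at (snoc≋ p c) n }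

shift* : ∀ p q → (+ 0 ∷ p) *P q ≋ + 0 ∷ (p *P q)
shift* p q = eq λ n → coeff-+ (map (+ 0 ·_) q) (+ 0 ∷ (p *P q)) n ∙
  cong (λ z → z ⊕ coeff (+ 0 ∷ (p *P q)) n) (coeff-map (+ 0) q n ∙ *-zeroˡ (coeff q n)) ∙ +-identityˡ _

∷-cong : ∀ {a p q} → p ≋ q → a ∷ p ≋ a ∷ q
∷-cong (eq f) = eq λ { zero → refl ; (suc n) → f n }

const* : ∀ c d → (c ∷ []) *P (d ∷ []) ≋ (c · d) ∷ []
const* c d = eq λ { zero → ⊕-identityʳ _ ; (suc zero) → refl ; (suc (suc n)) → refl }

shift*ʳ : ∀ p q → p *P (+ 0 ∷ q) ≋ + 0 ∷ (p *P q)
shift*ʳ p q = *P-comm p (+ 0 ∷ q) ⨾ shift* q p ⨾ ∷-cong (*P-comm q p)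

mono* : ∀ a b c d → mono a c *P mono b d ≋ mono (a + b) (c · d)
mono* zero zero c d = const* c d
mono* zero (suc b) c d = shift*ʳ (c ∷ []) (mono b d) ⨾ ∷-cong (mono* zero b c d)
mono* (suc a) b c d = shift* (mono a c) (mono b d) ⨾ ∷-cong (mono* a b c d)

mono-+ : ∀ n c d → mono n (c ⊕ d) ≋ mono n c +P mono n d
mono-+ zero c d = ≋-refl
mono-+ (suc n) c d = ∷-cong (mono-+ n c d)

mono-neg : ∀ n c → mono n (- c) ≋ negP (mono n c)
mono-neg zero c = ≋-refl
mono-neg (suc n) c = ∷-cong (mono-neg n c)

Vanish≥ : ℕ → Poly → Set
Vanish≥ m P = ∀ n → m ≤ n → coeff P n ≡ + 0

-- Monicity is a property of the list and not of its class under `_≋_`: the long division reverses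
-- the list and takes its head for the leading coefficient, so a trailing zero would spoil it.
record Mon (P : Poly) : Set where
  constructor mon
  field
    low : List ℤ
    lit : P ≡ low ++ + 1 ∷ []
  deg : ℕ
  deg = length low

coeff-snoc-≡ : ∀ xs c → coeff (xs ++ c ∷ []) (length xs) ≡ c
coeff-snoc-≡ [] c = refl
coeff-snoc-≡ (x ∷ xs) c = coeff-snoc-≡ xs c

length-snoc : ∀ (xs : List ℤ) c → length (xs ++ c ∷ []) ≡ suc (length xs)
length-snoc xs c = Lₚ.length-++ xs ∙ +-comm (length xs) 1

mon-top : ∀ {P} (m : Mon P) → coeff P (Mon.deg m) ≡ + 1
mon-top (mon low refl) = coeff-snoc-≡ low (+ 1)

mon-above : ∀ {P} (m : Mon P) → Vanish≥ (suc (Mon.deg m)) P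
mon-above (mon low refl) n le = coeff-≥ (low ++ + 1 ∷ []) n (subst (_≤ n) (sym (length-snoc low (+ 1))) le)

-- The top coefficient of a nonzero q would survive in the product, as that of D is 1. The recursion
-- first kills everything above the constant term of q; the coefficient at `deg` then kills the
-- constant term.
mon-zero : ∀ {D} (m : Mon D) q → Vanish≥ (Mon.deg m) (q *P D) → q ≋ []
mon-zero {D} m [] v = ≋-refl
mon-zero {D} m (a ∷ q) v = eq λ { zero → a≡0 ; (suc n) → at q≋0 n }
  where
  q≋0 : q ≋ []
  q≋0 = mon-zero m q λ n le → sym (+-identityˡ _) ∙ cong (λ z → z ⊕ coeff (q *P D) n)
      (sym (coeff-map a D (suc n) ∙ cong (a ·_) (mon-above m (suc n) (s≤s le)) ∙ ·-zeroʳ a)) ∙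
      sym (coeff-+ (map (a ·_) D) (+ 0 ∷ (q *P D)) (suc n)) ∙ v (suc n) (m≤n⇒m≤1+n le)
  k = Mon.deg m
  sh : ∀ n → coeff (+ 0 ∷ (q *P D)) n ≡ + 0
  sh zero = refl
  sh (suc n) = at (PR.trans (*P-cong q≋0 (≋-refl {D})) (≋-refl {[]})) n
  a≡0 : a ≡ + 0
  a≡0 = sym (·-identityʳ a) ∙ cong (a ·_) (sym (mon-top m)) ∙ sym (coeff-map a D k) ∙
     sym (⊕-identityʳ _) ∙ cong (λ z → coeff (map (a ·_) D) k ⊕ z) (sym (sh k)) ∙
       sym (coeff-+ (map (a ·_) D) (+ 0 ∷ (q *P D)) k) ∙ v k ≤-refl

record DivMod (F D : Poly) (m : ℕ) : Set where
  constructor dm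
  field
    quo rem : Poly
    split : F ≋ (quo *P D) +P rem
    small : Vanish≥ m rem

-- Horner's scheme: a + Xr has degree at most `deg`, and subtracting t times D, with t its
-- coefficient there, makes it a remainder again.
divMod : ∀ {D} (m : Mon D) F → DivMod F D (Mon.deg m)
divMod m [] = dm [] [] ≋-refl (λ _ _ → refl)
divMod {D} m (a ∷ F) with divMod m F
... | dm q r sp sm = dm (t ∷ q) (r' +P negP (map (t ·_) D)) split' small'
  where
  r' = a ∷ r
  k = Mon.deg m
  t = coeff r' k
  split' : a ∷ F ≋ ((t ∷ q) *P D) +P (r' +P negP (map (t ·_) D))
  split' = ∷-cong sp ⨾ step ⨾ lem (map (t ·_) D) (+ 0 ∷ (q *P D)) r'
    where
    step : a ∷ ((q *P D) +P r) ≋ (+ 0 ∷ (q *P D)) +P (a ∷ r); step = eq λ { zero → sym (+-identityˡ a) ; (suc n) → refl }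
    lem : ∀ x y z → y +P z ≋ (x +P y) +P (z +P negP x); lem = Solver.solve-∀ polyACR
  co : ∀ n → coeff (r' +P negP (map (t ·_) D)) n ≡ coeff r' n ⊕ - (t · coeff D n)
  co n = coeff-+ r' (negP (map (t ·_) D)) n ∙ cong (λ z → coeff r' n ⊕ z) (coeff-neg (map (t ·_) D) n ∙ cong -_ (coeff-map t D n))
  small' : Vanish≥ k (r' +P negP (map (t ·_) D))
  small' n le with k ≟ n
  ... | yes refl = co k ∙ cong (λ z → t ⊕ - (t · z)) (mon-top m) ∙ cong (λ z → t ⊕ - z) (·-identityʳ t) ∙ +-inverseʳ t
  ... | no k≢n with ≤∧≢⇒< le k≢n
  ...   | s≤s {n = n'} le' = co n ∙ cong₂ (λ x y → x ⊕ - (t · y)) (sm n' le') (mon-above m n (s≤s le')) ∙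
            cong (λ z → + 0 ⊕ - z) (·-zeroʳ t)

infix 4 _∣P_
_∣P_ : Poly → Poly → Set
D ∣P F = ∃[ Q ] F ≋ Q *P D

constP : ℤ → Poly
constP c = c ∷ []

coeff-const* : ∀ c p n → coeff (constP c *P p) n ≡ c · coeff p n
coeff-const* c p n = coeff-+ (map (c ·_) p) (+ 0 ∷ []) n ∙
  cong₂ _⊕_ (coeff-map c p n) (z n) ∙ ⊕-identityʳ _
  where z : ∀ n → coeff (+ 0 ∷ []) n ≡ + 0
        z zero = refl
        z (suc n) = refl

vanish-const* : ∀ c p {m} → Vanish≥ m p → Vanish≥ m (constP c *P p)
vanish-const* c p v n le = coeff-const* c p n ∙ cong (c ·_) (v n le) ∙ ·-zeroʳ c

-- The remainder r of F satisfies D ∣ c r, whose degree is too small, so r = 0. This removes the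
-- integer constants that Bézout identities over ℚ bring in.
mon-div-const : ∀ {D} → Mon D → ∀ c → c ≢ + 0 → ∀ F → D ∣P (constP c *P F) → D ∣P F
mon-div-const {D} m c c≢0 F (Q , e) with divMod m F
... | dm q r sp sm = q , sp ⨾ +ˡ (q *P D) r≋0 ⨾ PR.+-identityʳ (q *P D)
  where
  cr : (Q +P negP (constP c *P q)) *P D ≋ constP c *P r
  cr = lem Q (constP c) q D ⨾ +ʳ (negP (constP c *P (q *P D))) (≋-sym e ⨾ *ˡ (constP c) sp) ⨾ lem2 (constP c) q D r
    where
    lem : ∀ Q c q D → (Q +P negP (c *P q)) *P D ≋ (Q *P D) +P negP (c *P (q *P D)); lem = Solver.solve-∀ polyACR
    lem2 : ∀ c q D r → (c *P ((q *P D) +P r)) +P negP (c *P (q *P D)) ≋ c *P r; lem2 = Solver.solve-∀ polyACR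
  z : Q +P negP (constP c *P q) ≋ []
  z = mon-zero m _ λ n le → at cr n ∙ vanish-const* c r sm n le
  r≋0 : r ≋ []
  r≋0 = eq λ n → ·-cancelˡ-≡ c _ _ {{ℤ.≢-nonZero c≢0}} (sym (coeff-const* c r n) ∙ sym (at cr n) ∙
          at (*P-cong z (≋-refl {D})) n ∙ sym (·-zeroʳ c))

-- Correctness of the long division that computes Φ

mutual
  -- The division loop is private to the definitions and cannot be named. The underscore stands for
  -- it: `quotMonic-unfold` mentions the unknown, and checking its proof against the unfolded
  -- `quotMonic` solves it. `subtractMultiple` is obtained in the same way.
  longDivision : ℕ → List ℤ → List ℤ → List ℤ
  longDivision = _
  quotMonic-unfold : ∀ N D → quotMonic N D ≡ reverse (longDivision (length N) (reverse N) (reverse D))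
  quotMonic-unfold N D with length N | reverse N | reverse D
  -- With the length, both reversed lists and the outer reversal abstracted to variables, the
  -- unknown is applied to variables only, and unification finds the loop.
  ... | f | n | d with foldl {A = List ℤ} {B = ℤ} (λ y x → x ∷ y) []
  ... | g = refl

mutual
  subtractMultiple : ℤ → List ℤ → List ℤ → List ℤ
  subtractMultiple = _
  longDivision-step : ∀ f c ns ds → length ds ≤ length ns →
    longDivision (suc f) (c ∷ ns) (+ 1 ∷ ds) ≡ c ∷ longDivision f (subtractMultiple c ns ds) (+ 1 ∷ ds)
  longDivision-step f c ns ds le with suc (length ds) ≤? suc (length ns)
  ... | yes _ = refl
  ... | no n = ⊥-elim (n (s≤s le))

longDivision-stop : ∀ f c ns ds → ¬ (length ds ≤ length ns) → longDivision (suc f) (c ∷ ns) (+ 1 ∷ ds) ≡ []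
longDivision-stop f c ns ds nle with suc (length ds) ≤? suc (length ns)
... | yes (s≤s le) = ⊥-elim (nle le)
... | no n = refl

subtractMultiple-[] : ∀ c ns → subtractMultiple c ns [] ≡ ns
subtractMultiple-[] c [] = refl
subtractMultiple-[] c (x ∷ ns) = refl

length-subtract : ∀ c ns ds → length ds ≤ length ns → length (subtractMultiple c ns ds) ≡ length ns
length-subtract c ns [] _ = cong length (subtractMultiple-[] c ns)
length-subtract c (n ∷ ns) (d ∷ ds) (s≤s le) = cong suc (length-subtract c ns ds le)

reverse-∷ : ∀ c ns → reverse (c ∷ ns) ≋ reverse ns +P mono (length ns) c
reverse-∷ c ns = subst₂ (λ a b → a ≋ reverse ns +P mono b c) (sym (Lₚ.unfold-reverse c ns)) (Lₚ.length-reverse ns) (snoc≋ (reverse ns) c)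

reverse-subtract : ∀ c ns ds → length ds ≤ length ns →
  reverse (subtractMultiple c ns ds) ≋ reverse ns +P negP (mono (length ns ∸ length ds) c *P reverse ds)
reverse-subtract c ns [] _ rewrite subtractMultiple-[] c ns =
  ≋-sym (+ˡ (reverse ns) (negP-cong (*P-comm (mono (length ns) c) [])) ⨾ PR.+-identityʳ (reverse ns))
reverse-subtract c (n ∷ ns) (d ∷ ds) (s≤s le) = begin
  reverse ((n - c · d) ∷ subtractMultiple c ns ds)   ≈⟨ reverse-∷ _ (subtractMultiple c ns ds) ⟩
  reverse (subtractMultiple c ns ds) +P mono (length (subtractMultiple c ns ds)) (n - c · d)
     ≈⟨ +P-cong (reverse-subtract c ns ds le) (subst (λ k → mono k _ ≋ mono (length ns) _) (sym (length-subtract c ns ds le)) ≋-refl) ⟩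
  (reverse ns +P negP (mono k c *P reverse ds)) +P mono (length ns) (n - c · d)
     ≈⟨ +ˡ (reverse ns +P negP (mono k c *P reverse ds)) (mono-+ (length ns) n (- (c · d)) ⨾ +ˡ (mono (length ns) n) (mono-neg (length ns) (c · d) ⨾
           negP-cong (subst (λ j → mono j (c · d) ≋ mono k c *P mono (length ds) d) (m∸n+n≡m le) (≋-sym (mono* k (length ds) c d))))) ⟩
  (reverse ns +P negP (mono k c *P reverse ds)) +P (mono (length ns) n +P negP (mono k c *P mono (length ds) d))
     ≈⟨ lem (reverse ns) (mono k c) (reverse ds) (mono (length ns) n) (mono (length ds) d) ⟩
  (reverse ns +P mono (length ns) n) +P negP (mono k c *P (reverse ds +P mono (length ds) d))
     ≈⟨ +P-cong (≋-sym (reverse-∷ n ns)) (negP-cong (*ˡ (mono k c) (≋-sym (reverse-∷ d ds)))) ⟩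
  reverse (n ∷ ns) +P negP (mono k c *P reverse (d ∷ ds)) ∎
  where
  open ≋R
  k = length ns ∸ length ds
  lem : ∀ a x b y z → (a +P negP (x *P b)) +P (y +P negP (x *P z)) ≋ (a +P y) +P negP (x *P (b +P z))
  lem = Solver.solve-∀ polyACR

-- The length of `q` belongs to the invariant because the quotient is built from its leading end: a
-- digit put in front of `q` has weight X^(length q).
record LongDivision (ns ds q : List ℤ) : Set where
  field
    rem : Poly
    split : reverse ns ≋ (reverse q *P reverse (+ 1 ∷ ds)) +P rem
    small : Vanish≥ (length ds) rem
    len : length q ≡ suc (length ns) ∸ suc (length ds)

longDivision-correct : ∀ f ns ds → length ns ≤ f → LongDivision ns ds (longDivision f ns (+ 1 ∷ ds))
longDivision-correct zero [] ds _ = record { rem = [] ; split = ≋-refl ; small = λ _ _ → refl ; len = sym (0∸n≡0 (length ds)) }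
longDivision-correct (suc f) [] ds _ = record { rem = [] ; split = ≋-refl ; small = λ _ _ → refl ; len = sym (0∸n≡0 (length ds)) }
longDivision-correct (suc f) (c ∷ ns) ds (s≤s le) with length ds ≤? length ns
... | no nle = subst (LongDivision (c ∷ ns) ds) (sym (longDivision-stop f c ns ds nle))
      (record { rem = reverse (c ∷ ns) ; split = ≋-refl
              ; small = λ n l → coeff-≥ (reverse (c ∷ ns)) n (subst (_≤ n) (sym (Lₚ.length-reverse (c ∷ ns))) (≤-trans (≰⇒> nle) l))
              ; len = sym (m≤n⇒m∸n≡0 (≰⇒> nle)) })
... | yes dl = subst (LongDivision (c ∷ ns) ds) (sym (longDivision-step f c ns ds dl))
      (record { rem = IH.rem ; split = split' ; small = IH.small ; len = cong suc len' ∙ sym (+-∸-assoc 1 dl) })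
  where
  q' = longDivision f (subtractMultiple c ns ds) (+ 1 ∷ ds)
  ih : LongDivision (subtractMultiple c ns ds) ds q'
  ih = longDivision-correct f (subtractMultiple c ns ds) ds (subst (_≤ f) (sym (length-subtract c ns ds dl)) le)
  module IH = LongDivision ih
  k = length ns ∸ length ds
  len' : length q' ≡ k
  len' = IH.len ∙ cong (_∸ length ds) (length-subtract c ns ds dl)
  open ≋R
  lem1 : ∀ a x b y → a +P y ≋ ((a +P negP (x *P b)) +P (x *P b)) +P y
  lem1 = Solver.solve-∀ polyACR
  lem2 : ∀ q D r x b y → (((q *P D) +P r) +P (x *P b)) +P (x *P y) ≋ ((q *P D) +P (x *P (b +P y))) +P r
  lem2 = Solver.solve-∀ polyACR
  split' : reverse (c ∷ ns) ≋ (reverse (c ∷ q') *P reverse (+ 1 ∷ ds)) +P IH.rem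
  split' = begin
    reverse (c ∷ ns) ≈⟨ reverse-∷ c ns ⟩
    reverse ns +P mono (length ns) c ≈⟨ lem1 (reverse ns) (mono k c) (reverse ds) _ ⟩
    ((reverse ns +P negP (mono k c *P reverse ds)) +P (mono k c *P reverse ds)) +P mono (length ns) c
      ≈⟨ +P-cong (+ʳ (mono k c *P reverse ds) (≋-sym (reverse-subtract c ns ds dl) ⨾ IH.split))
           (≋-sym (mono* k (length ds) c (+ 1) ⨾ subst₂ (λ j e → mono (k + length ds) (c · + 1) ≋ mono j e) (m∸n+n≡m dl) (·-identityʳ c) ≋-refl)) ⟩
    (((reverse q' *P reverse (+ 1 ∷ ds)) +P IH.rem) +P (mono k c *P reverse ds)) +P (mono k c *P mono (length ds) (+ 1))
      ≈⟨ lem2 (reverse q') (reverse (+ 1 ∷ ds)) IH.rem (mono k c) (reverse ds) (mono (length ds) (+ 1)) ⟩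
    ((reverse q' *P reverse (+ 1 ∷ ds)) +P (mono k c *P (reverse ds +P mono (length ds) (+ 1)))) +P IH.rem
      ≈⟨ +ʳ IH.rem (+ˡ (reverse q' *P reverse (+ 1 ∷ ds)) (*P-cong (subst (λ j → mono k c ≋ mono j c) (sym len') ≋-refl) (≋-sym (reverse-∷ (+ 1) ds)))) ⟩
    ((reverse q' *P reverse (+ 1 ∷ ds)) +P (mono (length q') c *P reverse (+ 1 ∷ ds))) +P IH.rem
      ≈⟨ +ʳ IH.rem (≋-sym (*P-distribʳ (reverse (+ 1 ∷ ds)) (reverse q') (mono (length q') c))) ⟩
    ((reverse q' +P mono (length q') c) *P reverse (+ 1 ∷ ds)) +P IH.rem
      ≈⟨ +ʳ IH.rem (*ʳ (reverse (+ 1 ∷ ds)) (≋-sym (reverse-∷ c q'))) ⟩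
    (reverse (c ∷ q') *P reverse (+ 1 ∷ ds)) +P IH.rem ∎

+P-longer : ∀ p zs → length p ≤ length zs → ∃[ ws ] (p +P (zs ++ + 1 ∷ []) ≡ ws ++ + 1 ∷ []) × (length ws ≡ length zs)
+P-longer [] zs _ = zs , refl , refl
+P-longer (a ∷ p) (z ∷ zs) (s≤s le) with +P-longer p zs le
... | ws , e , l = (a ⊕ z) ∷ ws , cong ((a ⊕ z) ∷_) e , cong suc l

+P-0 : ∀ x (q : List ℤ) → (x ∷ q) +P (+ 0 ∷ []) ≡ x ∷ q
+P-0 x [] = cong (_∷ []) (⊕-identityʳ x)
+P-0 x (y ∷ q) = cong (_∷ y ∷ q) (⊕-identityʳ x)

1*-snoc : ∀ ys → map (+ 1 ·_) (ys ++ + 1 ∷ []) +P (+ 0 ∷ []) ≡ ys ++ + 1 ∷ []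
1*-snoc [] = refl
1*-snoc (y ∷ ys) = +P-0 (+ 1 · y) _ ∙ cong₂ _∷_ (·-identityˡ y) (Lₚ.map-cong ·-identityˡ (ys ++ + 1 ∷ []) ∙ Lₚ.map-id _)

-- An equality of lists and not only of coefficients, so that a product of Φ's is again an
-- admissible divisor for `quotMonic`.
*P-lit : ∀ xs ys → ∃[ zs ] ((xs ++ + 1 ∷ []) *P (ys ++ + 1 ∷ []) ≡ zs ++ + 1 ∷ []) × (length zs ≡ length xs + length ys)
*P-lit [] ys = ys , 1*-snoc ys , refl
*P-lit (x ∷ xs) ys with *P-lit xs ys
... | zs , e , l with +P-longer (map (x ·_) (ys ++ + 1 ∷ [])) (+ 0 ∷ zs) (subst₂ _≤_ (sym (Lₚ.length-map (x ·_) (ys ++ + 1 ∷ []) ∙ length-snoc ys (+ 1))) (cong suc (sym l)) (s≤s (m≤n+m (length ys) (length xs))))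
...   | ws , e' , l' = ws , cong (λ z → map (x ·_) (ys ++ + 1 ∷ []) +P (+ 0 ∷ z)) e ∙ e' , l' ∙ cong suc l

Mon-* : ∀ {P Q} → Mon P → Mon Q → Mon (P *P Q)
Mon-* (mon xs refl) (mon ys refl) with *P-lit xs ys
... | zs , e , _ = mon zs e

Mon-1 : Mon 1P
Mon-1 = mon [] refl

Mon-Xn : ∀ n → 1 ≤ n → Mon (XnMinus1 n)
Mon-Xn (suc n) _ = mon (- (+ 1) ∷ replicate n (+ 0)) refl

-- The polynomials X^n - 1 and coprimality over ℚ

Xpow : ℕ → Poly
Xpow n = mono n (+ 1)

replicate-mono : ∀ n → replicate n (+ 0) ++ + 1 ∷ [] ≡ mono n (+ 1)
replicate-mono zero = refl
replicate-mono (suc n) = cong (+ 0 ∷_) (replicate-mono n)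

Xn≋ : ∀ n → XnMinus1 n ≋ Xpow n +P negP 1P
Xn≋ zero = eq λ { zero → refl ; (suc n) → refl }
Xn≋ (suc n) = eq λ { zero → refl ; (suc m) → cong (λ z → coeff z m) (replicate-mono n) ∙ sym (coeff-+ (mono n (+ 1)) [] m ∙ ⊕-identityʳ _) }

Xpow-+ : ∀ a b → Xpow (a + b) ≋ (Xpow a) *P (Xpow b)
Xpow-+ a b = ≋-sym (mono* a b (+ 1) (+ 1))

geo : ℕ → ℕ → Poly
geo g zero = []
geo g (suc k) = 1P +P ((Xpow g) *P geo g k)

geo-Xn : ∀ g k → geo g k *P XnMinus1 g ≋ XnMinus1 (k * g)
geo-Xn g zero = ≋-refl
geo-Xn g (suc k) = begin
  (1P +P ((Xpow g) *P geo g k)) *P XnMinus1 g            ≈⟨ lem (Xpow g) (geo g k) (XnMinus1 g) ⟩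
  XnMinus1 g +P ((Xpow g) *P (geo g k *P XnMinus1 g))    ≈⟨ +P-cong (Xn≋ g) (*ˡ (Xpow g) (geo-Xn g k ⨾ Xn≋ (k * g))) ⟩
  (Xpow g +P negP 1P) +P ((Xpow g) *P (Xpow (k * g) +P negP 1P)) ≈⟨ lem2 (Xpow g) (Xpow (k * g)) ⟩
  ((Xpow g) *P (Xpow (k * g))) +P negP 1P                  ≈⟨ +ʳ (negP 1P) (≋-sym (Xpow-+ g (k * g))) ⟩
  Xpow (g + k * g) +P negP 1P                            ≈⟨ ≋-sym (Xn≋ (g + k * g)) ⟩
  XnMinus1 (g + k * g) ∎
  where
  open ≋R
  lem : ∀ x y z → (1P +P (x *P y)) *P z ≋ z +P (x *P (y *P z))
  lem = Solver.solve-∀ polyACR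
  lem2 : ∀ x y → (x +P negP 1P) +P (x *P (y +P negP 1P)) ≋ (x *P y) +P negP 1P
  lem2 = Solver.solve-∀ polyACR

-- Each of the k powers of X^g in the geometric sum is 1 modulo X^g - 1.
geo-const : ∀ g k → ∃[ W ] geo g k ≋ constP (+ k) +P (W *P XnMinus1 g)
geo-const g zero = [] , eq λ { zero → refl ; (suc n) → refl }
geo-const g (suc k) with geo-const g k
... | W , e = ((Xpow g) *P W) +P constP (+ k) , (begin
  1P +P ((Xpow g) *P geo g k) ≈⟨ +ˡ 1P (*ˡ (Xpow g) e) ⟩
  1P +P ((Xpow g) *P (constP (+ k) +P (W *P XnMinus1 g))) ≈⟨ lem (Xpow g) (constP (+ k)) W (XnMinus1 g) ⟩
  ((1P +P constP (+ k)) +P (((Xpow g) *P W) *P XnMinus1 g)) +P (constP (+ k) *P (Xpow g +P negP 1P))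
    ≈⟨ +ˡ ((1P +P constP (+ k)) +P (((Xpow g) *P W) *P XnMinus1 g)) (*ˡ (constP (+ k)) (≋-sym (Xn≋ g))) ⟩
  ((1P +P constP (+ k)) +P (((Xpow g) *P W) *P XnMinus1 g)) +P (constP (+ k) *P XnMinus1 g)
    ≈⟨ lem2 (1P +P constP (+ k)) ((Xpow g) *P W) (XnMinus1 g) (constP (+ k)) ⟩
  constP (+ suc k) +P ((((Xpow g) *P W) +P constP (+ k)) *P XnMinus1 g) ∎)
  where
  open ≋R
  lem : ∀ x k w z → 1P +P (x *P (k +P (w *P z))) ≋ ((1P +P k) +P ((x *P w) *P z)) +P (k *P (x +P negP 1P))
  lem = Solver.solve-∀ polyACR
  lem2 : ∀ a w z k → (a +P (w *P z)) +P (k *P z) ≋ a +P ((w +P k) *P z)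
  lem2 = Solver.solve-∀ polyACR

∣P-refl : ∀ {D} → D ∣P D
∣P-refl {D} = 1P , ≋-sym (PR.*-identityˡ D)

∣P-trans : ∀ {D E F} → D ∣P E → E ∣P F → D ∣P F
∣P-trans {D} (Q , e) (R , f) = R *P Q , f ⨾ *ˡ R e ⨾ ≋-sym (*P-assoc R Q D)

∣P-*ˡ : ∀ {D F} G → D ∣P F → D ∣P (G *P F)
∣P-*ˡ {D} G (Q , e) = G *P Q , *ˡ G e ⨾ ≋-sym (*P-assoc G Q D)

∣P-*ʳ : ∀ {D F} G → D ∣P F → D ∣P (F *P G)
∣P-*ʳ {D} {F} G d with ∣P-*ˡ G d
... | R , e = R , *P-comm F G ⨾ e

∣P-+ : ∀ {D F G} → D ∣P F → D ∣P G → D ∣P (F +P G)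
∣P-+ {D} (Q , e) (R , f) = Q +P R , +P-cong e f ⨾ ≋-sym (*P-distribʳ D Q R)

∣P-cong : ∀ {D F G} → F ≋ G → D ∣P F → D ∣P G
∣P-cong e (Q , f) = Q , ≋-sym e ⨾ f

∣P-congˡ : ∀ {D E F} → D ≋ E → D ∣P F → E ∣P F
∣P-congˡ e (Q , f) = Q , f ⨾ *ˡ Q e

Xn-∣ : ∀ {g e} → g ∣ e → XnMinus1 g ∣P XnMinus1 e
Xn-∣ {g} (divides k refl) = geo g k , ≋-sym (geo-Xn g k)

-- If g + yb = xa, then X^g - 1 = (X^(xa) - 1) - X^g (X^(yb) - 1), and the brackets are multiples of
-- X^a - 1 and X^b - 1. The other sign in Bézout's identity is symmetric.
Xn-gcd : ∀ a b → ∃[ u ] ∃[ v ] XnMinus1 (gcd a b) ≋ (u *P XnMinus1 a) +P (v *P XnMinus1 b)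
Xn-gcd a b with Bézout.identity (gcd-GCD a b)
... | Bézout.Identity.+- x y e = geo a x , negP ((Xpow g) *P geo b y) , (begin
  XnMinus1 g ≈⟨ Xn≋ g ⟩
  Xpow g +P negP 1P ≈⟨ lem (Xpow g) (Xpow (y * b)) ⟩
  (((Xpow g) *P (Xpow (y * b))) +P negP 1P) +P negP ((Xpow g) *P (Xpow (y * b) +P negP 1P))
    ≈⟨ +P-cong (+ʳ (negP 1P) (≋-sym (Xpow-+ g (y * b))) ⨾ ≋-sym (Xn≋ (g + y * b))) (negP-cong (*ˡ (Xpow g) (≋-sym (Xn≋ (y * b)) ⨾ ≋-sym (geo-Xn b y)))) ⟩
  XnMinus1 (g + y * b) +P negP ((Xpow g) *P (geo b y *P XnMinus1 b))
    ≈⟨ +P-cong (subst (λ j → XnMinus1 j ≋ geo a x *P XnMinus1 a) (sym e) (≋-sym (geo-Xn a x))) (lem2 (Xpow g) (geo b y) (XnMinus1 b)) ⟩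
  (geo a x *P XnMinus1 a) +P (negP ((Xpow g) *P geo b y) *P XnMinus1 b) ∎)
  where
  open ≋R
  g = gcd a b
  lem : ∀ x y → x +P negP 1P ≋ ((x *P y) +P negP 1P) +P negP (x *P (y +P negP 1P))
  lem = Solver.solve-∀ polyACR
  lem2 : ∀ x y z → negP (x *P (y *P z)) ≋ negP (x *P y) *P z
  lem2 = Solver.solve-∀ polyACR
... | Bézout.Identity.-+ x y e = negP ((Xpow g) *P geo a x) , geo b y , (begin
  XnMinus1 g ≈⟨ Xn≋ g ⟩
  Xpow g +P negP 1P ≈⟨ lem (Xpow g) (Xpow (x * a)) ⟩
  negP ((Xpow g) *P (Xpow (x * a) +P negP 1P)) +P (((Xpow g) *P (Xpow (x * a))) +P negP 1P)
    ≈⟨ +P-cong (negP-cong (*ˡ (Xpow g) (≋-sym (Xn≋ (x * a)) ⨾ ≋-sym (geo-Xn a x)))) (+ʳ (negP 1P) (≋-sym (Xpow-+ g (x * a))) ⨾ ≋-sym (Xn≋ (g + x * a))) ⟩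
  negP ((Xpow g) *P (geo a x *P XnMinus1 a)) +P XnMinus1 (g + x * a)
    ≈⟨ +P-cong (lem2 (Xpow g) (geo a x) (XnMinus1 a)) (subst (λ j → XnMinus1 j ≋ geo b y *P XnMinus1 b) (sym e) (≋-sym (geo-Xn b y))) ⟩
  (negP ((Xpow g) *P geo a x) *P XnMinus1 a) +P (geo b y *P XnMinus1 b) ∎)
  where
  open ≋R
  g = gcd a b
  lem : ∀ x y → x +P negP 1P ≋ negP (x *P (y +P negP 1P)) +P ((x *P y) +P negP 1P)
  lem = Solver.solve-∀ polyACR
  lem2 : ∀ x y z → negP (x *P (y *P z)) ≋ negP (x *P y) *P z
  lem2 = Solver.solve-∀ polyACR

-- Comaximality over ℚ: a nonzero integer lies in the ideal generated by F and G.
record Cop (F G : Poly) : Set where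
  constructor cop
  field
    u v : Poly
    c : ℤ
    c≢0 : c ≢ + 0
    bezout : (u *P F) +P (v *P G) ≋ constP c

cop-sym : ∀ {F G} → Cop F G → Cop G F
cop-sym {F} {G} (cop u v c nz e) = cop v u c nz (PR.+-comm (v *P G) (u *P F) ⨾ e)

cop-1 : ∀ F → Cop F 1P
cop-1 F = cop [] 1P (+ 1) (λ ()) ≋-refl

cop-∣ : ∀ {F G H} → Cop F G → H ∣P G → Cop F H
cop-∣ {F} {G} {H} (cop u v c nz e) (Q , f) = cop u (v *P Q) c nz (+ˡ (u *P F) (*P-assoc v Q H ⨾ *ˡ v (≋-sym f)) ⨾ e)

-- In the product of the two Bézout identities every term except v v' G H contains F.
cop-* : ∀ {F G H} → Cop F G → Cop F H → Cop F (G *P H)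
cop-* {F} {G} {H} (cop u v c nz e) (cop u' v' c' nz' e') = cop ((u *P ((u' *P F) +P (v' *P H))) +P ((v *P G) *P u')) (v *P v') (c · c')
  (λ z → [ nz , nz' ]′ (i*j≡0⇒i≡0∨j≡0 c z))
  (lem u v F G u' v' H ⨾ *P-cong e e' ⨾ const* c c')
  where
  lem : ∀ u v F G u' v' H → (((u *P ((u' *P F) +P (v' *P H))) +P ((v *P G) *P u')) *P F) +P ((v *P v') *P (G *P H))
        ≋ ((u *P F) +P (v *P G)) *P ((u' *P F) +P (v' *P H))
  lem = Solver.solve-∀ polyACR

-- Multiplied by N, the Bézout identity exhibits c N as a multiple of F G; since F G is monic, c can
-- be cancelled.
cop-divides : ∀ {F G N} → Mon F → Mon G → Cop F G → F ∣P N → G ∣P N → (F *P G) ∣P N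
cop-divides {F} {G} {N} mF mG (cop u v c nz e) (P , p) (Q , q) = mon-div-const (Mon-* mF mG) c nz N
  ((u *P Q) +P (v *P P) , (begin
    constP c *P N ≈⟨ *ʳ N (≋-sym e) ⟩
    ((u *P F) +P (v *P G)) *P N ≈⟨ *P-distribʳ N (u *P F) (v *P G) ⟩
    ((u *P F) *P N) +P ((v *P G) *P N) ≈⟨ +P-cong (*ˡ (u *P F) q) (*ˡ (v *P G) p) ⟩
    ((u *P F) *P (Q *P G)) +P ((v *P G) *P (P *P F)) ≈⟨ lem u F Q G v P ⟩
    ((u *P Q) +P (v *P P)) *P (F *P G) ∎))
  where
  open ≋R
  lem : ∀ u F Q G v P → ((u *P F) *P (Q *P G)) +P ((v *P G) *P (P *P F)) ≋ ((u *P Q) +P (v *P P)) *P (F *P G)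
  lem = Solver.solve-∀ polyACR

Πd : (ℕ → Poly) → List ℕ → Poly
Πd f = foldr (λ d acc → f d *P acc) 1P

Πd-mon : ∀ f L → All (λ d → Mon (f d)) L → Mon (Πd f L)
Πd-mon f [] [] = Mon-1
Πd-mon f (d ∷ L) (m ∷ ms) = Mon-* m (Πd-mon f L ms)

Πd-cop : ∀ f {F} L → All (λ d → Cop F (f d)) L → Cop F (Πd f L)
Πd-cop f {F} [] [] = cop-1 F
Πd-cop f (d ∷ L) (m ∷ ms) = cop-* m (Πd-cop f L ms)

Πd-divides : ∀ f {N} L → All (λ d → Mon (f d)) L → AllPairs (λ d e → Cop (f d) (f e)) L → All (λ d → f d ∣P N) L → Πd f L ∣P N
Πd-divides f {N} [] _ _ _ = N , ≋-sym (PR.*-identityʳ N)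
Πd-divides f (d ∷ L) (m ∷ ms) (c ∷ cs) (v ∷ vs) = cop-divides m (Πd-mon f L ms) (Πd-cop f L c) v (Πd-divides f L ms cs vs)

∈⇒∣Πd : ∀ f {d} L → d ∈L L → f d ∣P Πd f L
∈⇒∣Πd f (d ∷ L) (here refl) = ∣P-*ʳ (Πd f L) ∣P-refl
∈⇒∣Πd f (x ∷ L) (there m) = ∣P-*ˡ (f x) (∈⇒∣Πd f L m)

∈-pd⁻ : ∀ {n d} → 1 ≤ n → d ∈L properDivisors n → (1 ≤ d) × (d < n) × (d ∣ n)
∈-pd⁻ {suc n} {d} _ m with ∈-filter⁻ (λ d → d ∣? suc n) {xs = Data.List.drop 1 (upTo (suc n))} m
... | m' , dv = pos d dv , ∈-upTo⁻ {suc n} (there m') , dv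
  where
  pos : ∀ d → d ∣ suc n → 1 ≤ d
  pos zero (divides q e) with trans e (*-zeroʳ q)
  ... | ()
  pos (suc d) _ = s≤s z≤n

∈-pd⁺ : ∀ {n d} → 1 ≤ d → d < n → d ∣ n → d ∈L properDivisors n
∈-pd⁺ {suc n} {suc d} _ lt dv with ∈-upTo⁺ lt
... | there m = ∈-filter⁺ (λ d → d ∣? suc n) m dv

pd-unique : ∀ n → AllPairs _≢_ (properDivisors n)
pd-unique n = Uniqueₚ.filter⁺ (λ d → d ∣? n) (Uniqueₚ.drop⁺ 1 (Uniqueₚ.upTo⁺ n))

foldr-cong-∈ : ∀ {f g : ℕ → Poly} L → (∀ d → d ∈L L → f d ≡ g d) → Πd f L ≡ Πd g L
foldr-cong-∈ [] h = refl
foldr-cong-∈ (d ∷ L) h = cong₂ _*P_ (h d (here refl)) (foldr-cong-∈ L (λ e m → h e (there m)))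

-- Inside Φ_n the smaller Φ_d are computed with fuel n - 1; they have to be identified with `Φ d`,
-- whose fuel is d.
cycF-fuel : ∀ K f n → f ≤ K → n ≤ f → 1 ≤ n → cycF f n ≡ Φ n
cycF-fuel (suc K) (suc f) (suc n) (s≤s f≤K) (s≤s n≤f) _ = cong (quotMonic (XnMinus1 (suc n)))
  (foldr-cong-∈ (properDivisors (suc n)) λ d m → let (1≤d , d<n , _) = ∈-pd⁻ (s≤s z≤n) m ; d≤n = ≤-pred d<n in
    cycF-fuel K f d f≤K (≤-trans d≤n n≤f) 1≤d ∙ sym (cycF-fuel K n d (≤-trans n≤f f≤K) d≤n 1≤d))

Φ-quot : ∀ n → 1 ≤ n → Φ n ≡ quotMonic (XnMinus1 n) (Πd Φ (properDivisors n))
Φ-quot (suc n) _ = cong (quotMonic (XnMinus1 (suc n)))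
  (foldr-cong-∈ (properDivisors (suc n)) λ d m → let (1≤d , d<n , _) = ∈-pd⁻ (s≤s z≤n) m ; d≤n = ≤-pred d<n in cycF-fuel n n d ≤-refl d≤n 1≤d)

mon-deg-≤ : ∀ {D N} (mD : Mon D) (mN : Mon N) → D ∣P N → Mon.deg mD ≤ Mon.deg mN
mon-deg-≤ {D} {N} mD mN (Q , e) with Mon.deg mD ≤? Mon.deg mN
... | yes le = le
... | no nle = ⊥-elim (1≢0 (sym (mon-top mN) ∙ at e (Mon.deg mN) ∙ at (*ʳ D Q≋0) (Mon.deg mN)))
  where
  1≢0 : + 1 ≢ + 0
  1≢0 ()
  Q≋0 : Q ≋ []
  Q≋0 = mon-zero mD Q λ n le → sym (at e n) ∙ mon-above mN n (≤-trans (≰⇒> nle) le)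

-- The remainder equals (Q - quotient) D and has degree below that of D, so `mon-zero` makes it
-- vanish.
quotMonic-exact : ∀ {N D} → Mon N → Mon D → D ∣P N → Mon (quotMonic N D) × (N ≋ quotMonic N D *P D)
quotMonic-exact {N} {D} mN@(mon nl refl) mD@(mon dl refl) (Q , e) = monQ , N≋
  where
  ns = reverse nl ; ds = reverse dl
  revN : reverse N ≡ + 1 ∷ ns
  revN = Lₚ.reverse-++ nl (+ 1 ∷ [])
  revD : reverse D ≡ + 1 ∷ ds
  revD = Lₚ.reverse-++ dl (+ 1 ∷ [])
  f = length N
  f≡ : f ≡ suc (length ns)
  f≡ = length-snoc nl (+ 1) ∙ cong suc (sym (Lₚ.length-reverse nl))
  q = longDivision (suc (length ns)) (+ 1 ∷ ns) (+ 1 ∷ ds)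
  quot≡ : quotMonic N D ≡ reverse q
  quot≡ = quotMonic-unfold N D ∙ cong reverse (cong₂ (longDivision f) revN revD ∙ cong (λ k → longDivision k (+ 1 ∷ ns) (+ 1 ∷ ds)) f≡)
  le : length ds ≤ length ns
  le = subst₂ _≤_ (sym (Lₚ.length-reverse dl)) (sym (Lₚ.length-reverse nl)) (mon-deg-≤ mD mN (Q , e))
  monQ : Mon (quotMonic N D)
  monQ = mon (reverse (longDivision (length ns) (subtractMultiple (+ 1) ns ds) (+ 1 ∷ ds)))
         (quot≡ ∙ cong reverse (longDivision-step (length ns) (+ 1) ns ds le) ∙ Lₚ.unfold-reverse (+ 1) (longDivision (length ns) (subtractMultiple (+ 1) ns ds) (+ 1 ∷ ds)))
  ld : LongDivision (+ 1 ∷ ns) ds q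
  ld = longDivision-correct (suc (length ns)) (+ 1 ∷ ns) ds ≤-refl
  module L = LongDivision ld
  open ≋R
  split' : N ≋ (quotMonic N D *P D) +P L.rem
  split' = subst₂ (λ a b → a ≋ b +P L.rem) (cong reverse (sym revN) ∙ Lₚ.reverse-involutive N)
     (cong₂ _*P_ (sym quot≡) (cong reverse (sym revD) ∙ Lₚ.reverse-involutive D)) L.split
  diff : (Q +P negP (quotMonic N D)) *P D ≋ L.rem
  diff = begin
    (Q +P negP (quotMonic N D)) *P D ≈⟨ lem Q (quotMonic N D) D ⟩
    (Q *P D) +P negP (quotMonic N D *P D) ≈⟨ +ʳ (negP (quotMonic N D *P D)) (≋-sym e ⨾ split') ⟩
    ((quotMonic N D *P D) +P L.rem) +P negP (quotMonic N D *P D) ≈⟨ lem2 (quotMonic N D *P D) L.rem ⟩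
    L.rem ∎
    where
    lem : ∀ a b d → (a +P negP b) *P d ≋ (a *P d) +P negP (b *P d); lem = Solver.solve-∀ polyACR
    lem2 : ∀ a b → (a +P b) +P negP a ≋ b; lem2 = Solver.solve-∀ polyACR
  zero' : Q +P negP (quotMonic N D) ≋ []
  zero' = mon-zero mD _ λ n l → at diff n ∙ L.small n (subst (_≤ n) (sym (Lₚ.length-reverse dl)) l)
  N≋ : N ≋ quotMonic N D *P D
  N≋ = e ⨾ *ʳ D (lem Q (quotMonic N D) ⨾ +ʳ (quotMonic N D) zero' ⨾ ≋-refl)
    where
    lem : ∀ a b → a ≋ (a +P negP b) +P b; lem = Solver.solve-∀ polyACR

-- The cyclotomic factorisation of X^n - 1

Exact : ℕ → Set
Exact n = Mon (Φ n) × (XnMinus1 n ≋ Φ n *P Πd Φ (properDivisors n))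

PairwiseCop : ℕ → Set
PairwiseCop N = ∀ e f → 1 ≤ e → 1 ≤ f → e ≤ N → f ≤ N → e ≢ f → Cop (Φ e) (Φ f)

allPairs-∈ : ∀ {R S : ℕ → ℕ → Set} L → AllPairs R L → (∀ {x y} → x ∈L L → y ∈L L → R x y → S x y) → AllPairs S L
allPairs-∈ [] [] h = []
allPairs-∈ (x ∷ L) (a ∷ as) h = All.tabulate (λ m → h (here refl) (there m) (All.lookup a m)) ∷ allPairs-∈ L as (λ m n → h (there m) (there n))

pos-∣ : ∀ {g e} → 1 ≤ e → g ∣ e → 1 ≤ g
pos-∣ {zero} (s≤s _) (divides q e) with trans e (*-zeroʳ q)
... | ()
pos-∣ {suc g} _ _ = s≤s z≤n

Φ∣Xn : ∀ {n} → Exact n → Φ n ∣P XnMinus1 n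
Φ∣Xn {n} (_ , e) = Πd Φ (properDivisors n) , e ⨾ *P-comm (Φ n) (Πd Φ (properDivisors n))

-- Let g = gcd(e, t), a proper divisor of e = kg. All Φ_h with h ∣ g divide Ψ, the product of the
-- Φ_d over the proper divisors d of e. So X^g - 1 ∣ Ψ, and Φ_e divides (X^e - 1)/(X^g - 1) =
-- `geo g k`, which is k modulo X^g - 1. As X^g - 1 lies in the ideal generated by Φ_e and X^t - 1,
-- so does k.
Φ-Xn-coprime : ∀ N → (∀ n → 1 ≤ n → n ≤ N → Exact n) → PairwiseCop N →
  ∀ e t → 1 ≤ e → e ≤ suc N → Exact e → ¬ (e ∣ t) → Cop (Φ e) (XnMinus1 t)
Φ-Xn-coprime N ex pc e t 1≤e e≤ (mon-e , exact-e) e∤t with Xn-gcd e t | gcd[m,n]∣m e t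
... | a , b , g∈ | g∣e@(divides k e≡kg) = result (geo-const g k) W-exists
  where
  g = gcd e t
  1≤g : 1 ≤ g
  1≤g = pos-∣ 1≤e g∣e
  g<e : g < e
  g<e = ≤∧≢⇒< (∣⇒≤ {{>-nonZero 1≤e}} g∣e) (λ g≡e → e∤t (subst (_∣ t) g≡e (gcd[m,n]∣n e t)))
  g≤N : g ≤ N
  g≤N = ≤-pred (≤-trans g<e e≤)
  Ψ = Πd Φ (properDivisors e)
  bd : ∀ {h} → h ∈L g ∷ properDivisors g → (1 ≤ h) × (h ≤ g) × (h ∣ g)
  bd (here refl) = 1≤g , ≤-refl , ∣-refl
  bd (there m) = let (x , y , z) = ∈-pd⁻ 1≤g m in x , <⇒≤ y , z
  Xg∣Ψ : XnMinus1 g ∣P Ψ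
  Xg∣Ψ = ∣P-congˡ (≋-sym (proj₂ (ex g 1≤g g≤N))) (Πd-divides Φ (g ∷ properDivisors g)
    (All.tabulate λ m → let (x , y , _) = bd m in proj₁ (ex _ x (≤-trans y g≤N)))
    (allPairs-∈ (g ∷ properDivisors g) (All.tabulate (λ m g≡h → <⇒≢ (proj₁ (proj₂ (∈-pd⁻ 1≤g m))) (sym g≡h)) ∷ pd-unique g)
      (λ m n → let (x , y , _) = bd m ; (x' , y' , _) = bd n in pc _ _ x x' (≤-trans y g≤N) (≤-trans y' g≤N)))
    (All.tabulate λ m → let (x , y , z) = bd m in ∈⇒∣Πd Φ (properDivisors e) (∈-pd⁺ x (≤-trans (s≤s y) g<e) (∣-trans z g∣e))))
  W-exists : Φ e ∣P geo g k
  W-exists = Q , lem (geo g k) (Q *P Φ e) ⨾ +ʳ (Q *P Φ e) zero' ⨾ ≋-refl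
    where
    open ≋R
    Q = proj₁ Xg∣Ψ
    diff : (geo g k +P negP (Q *P Φ e)) *P XnMinus1 g ≋ []
    diff = begin
      (geo g k +P negP (Q *P Φ e)) *P XnMinus1 g ≈⟨ lem2 (geo g k) Q (Φ e) (XnMinus1 g) ⟩
      (geo g k *P XnMinus1 g) +P negP (Φ e *P (Q *P XnMinus1 g))
        ≈⟨ +P-cong (geo-Xn g k) (negP-cong (*ˡ (Φ e) (≋-sym (proj₂ Xg∣Ψ)) ⨾ ≋-sym exact-e)) ⟩
      XnMinus1 (k * g) +P negP (XnMinus1 e) ≈⟨ subst (λ j → XnMinus1 j +P negP (XnMinus1 e) ≋ []) e≡kg (PR.-‿inverseʳ (XnMinus1 e)) ⟩
      [] ∎
      where
      lem2 : ∀ s q f x → (s +P negP (q *P f)) *P x ≋ (s *P x) +P negP (f *P (q *P x)); lem2 = Solver.solve-∀ polyACR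
    zero' : geo g k +P negP (Q *P Φ e) ≋ []; zero' = mon-zero (Mon-Xn g 1≤g) _ (λ n _ → at diff n)
    lem : ∀ a b → a ≋ (a +P negP b) +P b; lem = Solver.solve-∀ polyACR
  k≢0 : + k ≢ + 0
  k≢0 z with +-injective z
  ... | refl = <⇒≢ 1≤e (sym e≡kg)
  result : ∃[ W ] geo g k ≋ constP (+ k) +P (W *P XnMinus1 g) → Φ e ∣P geo g k → Cop (Φ e) (XnMinus1 t)
  result (V , v) (W , w) = cop (W +P negP (V *P (a *P Ψ))) (negP (V *P b)) (+ k) k≢0 (begin
    ((W +P negP (V *P (a *P Ψ))) *P Φ e) +P (negP (V *P b) *P XnMinus1 t) ≈⟨ lem W V a Ψ (Φ e) b (XnMinus1 t) ⟩
    (W *P Φ e) +P negP (V *P ((a *P (Φ e *P Ψ)) +P (b *P XnMinus1 t)))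
      ≈⟨ +P-cong (≋-sym w) (negP-cong (*ˡ V (+ʳ (b *P XnMinus1 t) (*ˡ a (≋-sym exact-e)) ⨾ ≋-sym g∈))) ⟩
    geo g k +P negP (V *P XnMinus1 g) ≈⟨ +ʳ (negP (V *P XnMinus1 g)) v ⟩
    (constP (+ k) +P (V *P XnMinus1 g)) +P negP (V *P XnMinus1 g) ≈⟨ lem2 (constP (+ k)) (V *P XnMinus1 g) ⟩
    constP (+ k) ∎)
    where
    open ≋R
    lem : ∀ w v a p f b x → ((w +P negP (v *P (a *P p))) *P f) +P (negP (v *P b) *P x) ≋ (w *P f) +P negP (v *P ((a *P (f *P p)) +P (b *P x)))
    lem = Solver.solve-∀ polyACR
    lem2 : ∀ a b → (a +P b) +P negP b ≋ a; lem2 = Solver.solve-∀ polyACR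

-- Exactness at N + 1 needs the coprimality of the smaller Φ_d, for their product to divide X^(N+1)
-- - 1; coprimality up to N + 1 needs that exactness. Of two different indices at least one does not
-- divide the other, and `Φ-Xn-coprime` applies to it.
cyclotomic : ∀ N → (∀ n → 1 ≤ n → n ≤ N → Exact n) × PairwiseCop N
cyclotomic zero = (λ { _ (s≤s _) () }) , (λ { _ _ (s≤s _) _ () })
cyclotomic (suc N) = ex' , pc'
  where
  ex = proj₁ (cyclotomic N)
  pc = proj₂ (cyclotomic N)
  new : Exact (suc N)
  new = subst Mon (sym φ≡) (proj₁ qe) , subst (λ z → XnMinus1 (suc N) ≋ z *P Πd Φ L) (sym φ≡) (proj₂ qe)
    where
    L = properDivisors (suc N)
    φ≡ = Φ-quot (suc N) (s≤s z≤n)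
    exL : ∀ {d} → d ∈L L → Exact d × (d ∣ suc N)
    exL m = let (x , y , z) = ∈-pd⁻ (s≤s z≤n) m in ex _ x (≤-pred y) , z
    monL : All (λ d → Mon (Φ d)) L; monL = All.tabulate λ m → proj₁ (proj₁ (exL m))
    qe = quotMonic-exact (Mon-Xn (suc N) (s≤s z≤n)) (Πd-mon Φ L monL)
      (Πd-divides Φ L monL
        (allPairs-∈ L (pd-unique (suc N)) λ m n → let (x , y , _) = ∈-pd⁻ (s≤s z≤n) m ; (x' , y' , _) = ∈-pd⁻ (s≤s z≤n) n in pc _ _ x x' (≤-pred y) (≤-pred y'))
        (All.tabulate λ m → let (e , z) = exL m in ∣P-trans (Φ∣Xn e) (Xn-∣ z)))
  ex' : ∀ n → 1 ≤ n → n ≤ suc N → Exact n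
  ex' n 1≤n n≤ with n ≟ suc N
  ... | yes refl = new
  ... | no n≢ = ex n 1≤n (≤-pred (≤∧≢⇒< n≤ n≢))
  pc' : PairwiseCop (suc N)
  pc' e f 1≤e 1≤f e≤ f≤ e≢f with e ∣? f
  ... | no e∤f = cop-∣ (Φ-Xn-coprime N ex pc e f 1≤e e≤ (ex' e 1≤e e≤) e∤f) (Φ∣Xn (ex' f 1≤f f≤))
  ... | yes e∣f = cop-sym (cop-∣ (Φ-Xn-coprime N ex pc f e 1≤f f≤ (ex' f 1≤f f≤)
           (λ f∣e → e≢f (∣-antisym e∣f f∣e))) (Φ∣Xn (ex' e 1≤e e≤)))

Φ-exact : ∀ n → 1 ≤ n → Exact n
Φ-exact n 1≤n = proj₁ (cyclotomic n) n 1≤n ≤-refl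

Φ-mon : ∀ n → 1 ≤ n → Mon (Φ n)
Φ-mon n 1≤n = proj₁ (Φ-exact n 1≤n)

Φ-cop : ∀ e f → 1 ≤ e → 1 ≤ f → e ≢ f → Cop (Φ e) (Φ f)
Φ-cop e f 1≤e 1≤f = proj₂ (cyclotomic (e + f)) e f 1≤e 1≤f (m≤m+n e f) (m≤n+m f e)

Φ-cop-Xn : ∀ e t → 1 ≤ e → ¬ (e ∣ t) → Cop (Φ e) (XnMinus1 t)
Φ-cop-Xn e t 1≤e = Φ-Xn-coprime e (proj₁ (cyclotomic e)) (proj₂ (cyclotomic e)) e t 1≤e (n≤1+n e) (Φ-exact e 1≤e)

-- Sums over lists and the action of polynomials on functions on ℤ

module _ {A : Set} where
  sumL : List A → (A → ℤ) → ℤ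
  sumL [] f = + 0
  sumL (x ∷ L) f = f x ⊕ sumL L f

  sumL-cong-∈ : ∀ L {f g} → (∀ x → x ∈L L → f x ≡ g x) → sumL L f ≡ sumL L g
  sumL-cong-∈ [] h = refl
  sumL-cong-∈ (x ∷ L) h = cong₂ _⊕_ (h x (here refl)) (sumL-cong-∈ L λ y m → h y (there m))

  sumL-cong : ∀ L {f g} → (∀ x → f x ≡ g x) → sumL L f ≡ sumL L g
  sumL-cong L h = sumL-cong-∈ L (λ x _ → h x)

  sumL-0 : ∀ L → sumL L (λ _ → + 0) ≡ + 0
  sumL-0 [] = refl
  sumL-0 (x ∷ L) = +-identityˡ _ ∙ sumL-0 L

  sumL-+ : ∀ L f g → sumL L (λ x → f x ⊕ g x) ≡ sumL L f ⊕ sumL L g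
  sumL-+ [] f g = refl
  sumL-+ (x ∷ L) f g rewrite sumL-+ L f g = lem (f x) (g x) (sumL L f) (sumL L g)
    where lem : ∀ a b c d → (a ⊕ b) ⊕ (c ⊕ d) ≡ (a ⊕ c) ⊕ (b ⊕ d); lem = ring

  sumL-* : ∀ L c f → sumL L (λ x → c · f x) ≡ c · sumL L f
  sumL-* [] c f = sym (·-zeroʳ c)
  sumL-* (x ∷ L) c f rewrite sumL-* L c f = sym (·-distribˡ-⊕ c (f x) (sumL L f))

  sumL-const : ∀ L c → sumL L (λ _ → c) ≡ + length L · c
  sumL-const [] c = sym (*-zeroˡ c)
  sumL-const (x ∷ L) c = cong (λ z → c ⊕ z) (sumL-const L c) ∙ sym (suc-* (+ length L) c)

  sumL-++ : ∀ L L' f → sumL (L ++ L') f ≡ sumL L f ⊕ sumL L' f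
  sumL-++ [] L' f = sym (+-identityˡ _)
  sumL-++ (x ∷ L) L' f = cong (λ z → f x ⊕ z) (sumL-++ L L' f) ∙ sym (⊕-assoc (f x) _ _)

  sumL-nonneg : ∀ L {f} → (∀ x → + 0 ℤ.≤ f x) → + 0 ℤ.≤ sumL L f
  sumL-nonneg [] h = ℤₚ.≤-refl
  sumL-nonneg (x ∷ L) h = ⊕-mono-≤ (h x) (sumL-nonneg L h)

  sumL-zero-∈ : ∀ L {f} → (∀ x → + 0 ℤ.≤ f x) → sumL L f ≡ + 0 → ∀ {x} → x ∈L L → f x ≡ + 0
  sumL-zero-∈ (y ∷ L) {f} h e (here refl) = ℤₚ.≤-antisym (subst (f y ℤ.≤_) e (subst (ℤ._≤ f y ⊕ sumL L f) (⊕-identityʳ (f y)) (⊕-monoʳ-≤ (f y) (sumL-nonneg L h)))) (h y)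
  sumL-zero-∈ (y ∷ L) {f} h e (there m) = sumL-zero-∈ L h (ℤₚ.≤-antisym (subst (sumL L f ℤ.≤_) e (subst (ℤ._≤ f y ⊕ sumL L f) (+-identityˡ _) (⊕-monoˡ-≤ (sumL L f) (h y)))) (sumL-nonneg L h)) m

  sumL-single : ∀ L {f} → AllPairs _≢_ L → ∀ {x} → x ∈L L → (∀ y → y ∈L L → y ≢ x → f y ≡ + 0) → sumL L f ≡ f x
  sumL-single (x ∷ L) {f} (u ∷ us) (here refl) h = cong (λ z → f x ⊕ z) ((sumL-cong-∈ L λ y m → h y (there m) (λ y≡x → All.lookup u m (sym y≡x))) ∙ sumL-0 L) ∙ ⊕-identityʳ (f x)
  sumL-single (y ∷ L) {f} (u ∷ us) {x} (there m) h = cong₂ _⊕_ (h y (here refl) (All.lookup u m)) (sumL-single L us m (λ z n → h z (there n))) ∙ +-identityˡ (f x)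

sumL-swap : ∀ {A B : Set} (L : List A) (L' : List B) (f : A → B → ℤ) → sumL L (λ x → sumL L' (f x)) ≡ sumL L' (λ y → sumL L (λ x → f x y))
sumL-swap [] L' f = sym (sumL-0 L')
sumL-swap (x ∷ L) L' f = cong (λ z → sumL L' (f x) ⊕ z) (sumL-swap L L' f) ∙ sym (sumL-+ L' (f x) (λ y → sumL L (λ x → f x y)))

sumL-map : ∀ {A B : Set} (h : A → B) L f → sumL (map h L) f ≡ sumL L (f ∘ h)
sumL-map h [] f = refl
sumL-map h (x ∷ L) f = cong (λ z → f (h x) ⊕ z) (sumL-map h L f)

abstract
  -- Abstract, so that these indicators are handled by the lemmas on them and the divisibility test
  -- is never evaluated during type checking.
  δ : ℕ → ℤ → ℤ
  δ N z = if does (+ N ∣ℤ? z) then + 1 else + 0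

  δ-yes : ∀ {N z} → + N ∣ℤ z → δ N z ≡ + 1
  δ-yes {N} {z} d rewrite dec-true (+ N ∣ℤ? z) d = refl

  δ-no : ∀ {N z} → ¬ (+ N ∣ℤ z) → δ N z ≡ + 0
  δ-no {N} {z} d rewrite dec-false (+ N ∣ℤ? z) d = refl

δ-⇔ : ∀ {N N' z z'} → (+ N ∣ℤ z → + N' ∣ℤ z') → (+ N' ∣ℤ z' → + N ∣ℤ z) → δ N z ≡ δ N' z'
δ-⇔ {N} {z = z} f g = go (+ N ∣ℤ? z)
  where
  go : Dec _ → _
  go (yes a) = δ-yes a ∙ sym (δ-yes (f a))
  go (no a) = δ-no a ∙ sym (δ-no (a ∘ g))

δ-nonneg : ∀ N z → + 0 ℤ.≤ δ N z
δ-nonneg N z = go (+ N ∣ℤ? z)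
  where
  go : Dec _ → _
  go (yes a) = subst (+ 0 ℤ.≤_) (sym (δ-yes a)) (ℤ.+≤+ z≤n)
  go (no a) = subst (+ 0 ℤ.≤_) (sym (δ-no a)) (ℤ.+≤+ z≤n)

δ-shift : ∀ {N} z k → + N ∣ℤ k → δ N (z ⊕ k) ≡ δ N z
δ-shift {N} z k d = δ-⇔ (λ e → ∣m+n∣n⇒∣m e d) (λ e → add∣ e d)

δ-≡ : ∀ {N} z z' → + N ∣ℤ (z - z') → δ N z ≡ δ N z'
δ-≡ {N} z z' d = cong (δ N) (lem z z') ∙ δ-shift z' _ d
  where lem : ∀ z z' → z ≡ z' ⊕ (z - z'); lem = ring

-- X acts as the translation by 1. So `act (mask A) K` is the convolution of A with K, and X^N - 1
-- annihilates exactly the N-periodic functions.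
act : Poly → (ℤ → ℤ) → ℤ → ℤ
act [] K y = + 0
act (c ∷ cs) K y = c · K y ⊕ act cs K (y - + 1)

act-congᴷ : ∀ p {K K'} → (∀ y → K y ≡ K' y) → ∀ y → act p K y ≡ act p K' y
act-congᴷ [] h y = refl
act-congᴷ (c ∷ p) h y = cong₂ _⊕_ (cong (c ·_) (h y)) (act-congᴷ p h _)

act-+ : ∀ p q K y → act (p +P q) K y ≡ act p K y ⊕ act q K y
act-+ [] q K y = sym (+-identityˡ _)
act-+ (a ∷ p) [] K y = sym (⊕-identityʳ _)
act-+ (a ∷ p) (b ∷ q) K y rewrite act-+ p q K (y - + 1) = lem a b (K y) _ _
  where lem : ∀ a b k x z → (a ⊕ b) · k ⊕ (x ⊕ z) ≡ (a · k ⊕ x) ⊕ (b · k ⊕ z); lem = ring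

act-scale : ∀ c p K y → act (map (c ·_) p) K y ≡ c · act p K y
act-scale c [] K y = sym (·-zeroʳ c)
act-scale c (a ∷ p) K y rewrite act-scale c p K (y - + 1) = lem c a (K y) _
  where lem : ∀ c a k x → c · a · k ⊕ c · x ≡ c · (a · k ⊕ x); lem = ring

act-* : ∀ p q K y → act (p *P q) K y ≡ act p (act q K) y
act-* [] q K y = refl
act-* (a ∷ p) q K y rewrite act-+ (map (a ·_) q) (+ 0 ∷ (p *P q)) K y | act-scale a q K y | act-* p q K (y - + 1) =
  cong (λ z → a · act q K y ⊕ z) (cong (λ z → z ⊕ act p (act q K) (y - + 1)) (*-zeroˡ (K y)) ∙ +-identityˡ _)

act-zero-terms : ∀ p K z → (∀ n → coeff p n · K (z - + n) ≡ + 0) → act p K z ≡ + 0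
act-zero-terms [] K z h = refl
act-zero-terms (a ∷ p) K z h = cong₂ _⊕_ (cong (λ w → a · K w) (sym (⊕-identityʳ z)) ∙ h 0)
  (act-zero-terms p K (z - + 1) λ n → cong (λ w → coeff p n · K w) (lem z (+ n)) ∙ h (suc n))
  where lem : ∀ z n → (z - + 1) - n ≡ z - (+ 1 ⊕ n); lem = ring

-- The recursion sees trailing zeros, which `_≋_` ignores; hence the detour through the difference
-- of the two lists, all of whose terms vanish.
act-≋ : ∀ {p q} → p ≋ q → ∀ K y → act p K y ≡ act q K y
act-≋ {p} {q} e K y = lem (act p K y) (act q K y) ∙ cong (λ z → act q K y ⊕ z) diff0 ∙ ⊕-identityʳ _
  where
  lem : ∀ a b → a ≡ b ⊕ (a ⊕ - b); lem = ring
  neg : act (negP q) K y ≡ - act q K y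
  neg = go q y
    where
    go : ∀ q y → act (negP q) K y ≡ - act q K y
    go [] y = refl
    go (a ∷ q) y rewrite go q (y - + 1) = l a (K y) _
      where l : ∀ a k x → - a · k ⊕ - x ≡ - (a · k ⊕ x); l = ring
  diff0 : act p K y ⊕ - act q K y ≡ + 0
  diff0 = cong (λ z → act p K y ⊕ z) (sym neg) ∙ sym (act-+ p (negP q) K y) ∙
    act-zero-terms (p +P negP q) K y λ n → cong (_· K (y - + n)) (at (+ʳ (negP q) e) n ∙ at (PR.-‿inverseʳ q) n) ∙ *-zeroˡ (K (y - + n))

act-mono : ∀ n c K y → act (mono n c) K y ≡ c · K (y - + n)
act-mono zero c K y = ⊕-identityʳ _ ∙ cong (λ z → c · K z) (sym (⊕-identityʳ y))
act-mono (suc n) c K y = cong₂ _⊕_ (*-zeroˡ (K y)) (act-mono n c K (y - + 1)) ∙ +-identityˡ _ ∙ cong (λ z → c · K z) (lem y (+ n))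
  where lem : ∀ y n → (y - + 1) - n ≡ y - (+ 1 ⊕ n); lem = ring

act-Xn : ∀ n K y → act (XnMinus1 n) K y ≡ K (y - + n) - K y
act-Xn n K y = act-≋ (Xn≋ n) K y ∙ act-+ (Xpow n) (negP 1P) K y ∙ cong (λ z → z ⊕ act (negP 1P) K y) (act-mono n (+ 1) K y) ∙ lem (K (y - + n)) (K y)
  where lem : ∀ a b → + 1 · a ⊕ ((- + 1) · b ⊕ + 0) ≡ a ⊕ - b; lem = ring

act-const : ∀ c p K y → act (constP c *P p) K y ≡ c · act p K y
act-const c p K y = act-* (constP c) p K y ∙ ⊕-identityʳ _

act-0 : ∀ p y → act p (λ _ → + 0) y ≡ + 0
act-0 p y = act-zero-terms p (λ _ → + 0) y λ n → ·-zeroʳ (coeff p n)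

act-vanish : ∀ p {K} → (∀ y → K y ≡ + 0) → ∀ y → act p K y ≡ + 0
act-vanish p h y = act-congᴷ p h y ∙ act-0 p y

Xn-δ : ∀ d y → act (XnMinus1 d) (δ d) y ≡ + 0
Xn-δ d y = act-Xn d (δ d) y ∙ cong (λ z → z - δ d y) (δ-shift y (- + d) (neg∣ refl∣)) ∙ +-inverseʳ (δ d y)

act-single : ∀ p K z y → (∀ n → n ≢ y → coeff p n · K (z - + n) ≡ + 0) → K (z - + y) ≡ + 1 → act p K z ≡ coeff p y
act-single [] K z y h e = refl
act-single (a ∷ p) K z zero h e = cong₂ _⊕_ (cong (λ w → a · w) (cong K (sym (⊕-identityʳ z)) ∙ e) ∙ ·-identityʳ a)
    (act-zero-terms p K (z - + 1) λ n → cong (λ w → coeff p n · K w) (lem z (+ n)) ∙ h (suc n) (λ ())) ∙ ⊕-identityʳ a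
  where lem : ∀ z n → (z - + 1) - n ≡ z - (+ 1 ⊕ n); lem = ring
act-single (a ∷ p) K z (suc y) h e = cong₂ _⊕_ (cong (λ w → a · K w) (sym (⊕-identityʳ z)) ∙ h 0 (λ ()))
    (act-single p K (z - + 1) y (λ n n≢ → cong (λ w → coeff p n · K w) (lem z (+ n)) ∙ h (suc n) (λ e → n≢ (suc-injective e))) (cong K (lem z (+ y)) ∙ e)) ∙ +-identityˡ _
  where lem : ∀ z n → (z - + 1) - n ≡ z - (+ 1 ⊕ n); lem = ring

small-∣ : ∀ {d a b} → a < d → b < d → + d ∣ℤ (+ a - + b) → a ≡ b
small-∣ {d} {a} {b} a<d b<d dv = +-injective (i-j≡0⇒i≡j (+ a) (+ b) (∣i∣≡0⇒i≡0 (∣<⇒0 (<-≤-trans (abs< a b a<d b<d) ≤-refl) (∣⇒∣ᵤ dv))))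
  where
  ∣<⇒0 : ∀ {m n} → m < n → n ∣ m → m ≡ 0
  ∣<⇒0 {zero} _ _ = refl
  ∣<⇒0 {suc m} lt dv = ⊥-elim (<⇒≱ lt (∣⇒≤ dv))
  abs< : ∀ a b → a < d → b < d → ℤ.∣ + a - + b ∣ < d
  abs< a b a<d b<d rewrite m-n≡m⊖n a b with ≤-total a b
  ... | inj₁ a≤b = ≤-<-trans (≤-reflexive (∣⊖∣-≤ a≤b)) (≤-<-trans (m∸n≤m b a) b<d)
  ... | inj₂ b≤a = ≤-<-trans (≤-reflexive (cong ℤ.∣_∣ (⊖-≥ b≤a))) (≤-<-trans (m∸n≤m a b) a<d)

-- X^d − 1 divides P exactly when all sums of coefficients over residue classes mod d vanish.
δ⇒Xn∣ : ∀ d → 1 ≤ d → ∀ P → (∀ y → act P (δ d) y ≡ + 0) → XnMinus1 d ∣P P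
δ⇒Xn∣ (suc d') 1≤d P h with divMod (Mon-Xn (suc d') 1≤d) P
... | dm q r sp sm = q , sp ⨾ +ˡ (q *P XnMinus1 d) r≋0 ⨾ PR.+-identityʳ _
  where
  d = suc d'
  sm' : Vanish≥ d r
  sm' n le = sm n (subst (_≤ n) (cong suc (sym (Lₚ.length-replicate d'))) le)
  act-r : ∀ y → act r (δ d) y ≡ + 0
  act-r y = sym (+-identityˡ _) ∙ cong (λ z → z ⊕ act r (δ d) y) (sym (act-* q (XnMinus1 d) (δ d) y ∙ act-vanish q (Xn-δ d) y)) ∙
    sym (act-+ (q *P XnMinus1 d) r (δ d) y) ∙ sym (act-≋ sp (δ d) y) ∙ h y
  r≋0 : r ≋ []
  r≋0 = eq go
    where
    go : ∀ n → coeff r n ≡ + 0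
    -- A remainder has at most one coefficient in each residue class mod d, so its sum over the
    -- class of n is the n-th coefficient.
    go n with d ≤? n
    ... | yes le = sm' n le
    ... | no nle = sym (act-single r (δ d) (+ n) n others (δ-yes (subst (+ d ∣ℤ_) (sym (+-inverseʳ (+ n))) (dividesℤ (+ 0) (sym (*-zeroˡ (+ d))))))) ∙ act-r (+ n)
      where
      others : ∀ m → m ≢ n → coeff r m · δ d (+ n - + m) ≡ + 0
      others m m≢n with d ≤? m
      ... | yes le = cong (_· δ d (+ n - + m)) (sm' m le) ∙ *-zeroˡ (δ d (+ n - + m))
      ... | no m< = cong (coeff r m ·_) (δ-no (λ dv → m≢n (sym (small-∣ (≰⇒> nle) (≰⇒> m<) dv)))) ∙ ·-zeroʳ (coeff r m)

listP : List ℕ → Poly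
listP [] = []
listP (a ∷ L) = Xpow a +P listP L

act-listP : ∀ L K y → act (listP L) K y ≡ sumL L (λ a → K (y - + a))
act-listP [] K y = refl
act-listP (a ∷ L) K y = act-+ (Xpow a) (listP L) K y ∙ cong₂ _⊕_ (act-mono a (+ 1) K y ∙ ·-identityˡ _) (act-listP L K y)

els : ∀ {n} → Vec Bool n → List ℕ
els [] = []
els (true ∷ v) = 0 ∷ map suc (els v)
els (false ∷ v) = map suc (els v)

act-mask : ∀ {M} (A : Subset M) K y → act (mask A) K y ≡ sumL (els A) (λ a → K (y - + a))
act-mask A = go A
  where
  tail : ∀ {n} (v : Vec Bool n) K y → act (mask v) K (y - + 1) ≡ sumL (map suc (els v)) (λ a → K (y - + a))
  go : ∀ {n} (v : Vec Bool n) K y → act (mask v) K y ≡ sumL (els v) (λ a → K (y - + a))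
  tail v K y = go v K (y - + 1) ∙ sumL-cong (els v) (λ a → cong K (lem y (+ a))) ∙ sym (sumL-map suc (els v) _)
    where lem : ∀ y n → (y - + 1) - n ≡ y - (+ 1 ⊕ n); lem = ring
  go [] K y = refl
  go (true ∷ v) K y = cong₂ _⊕_ (·-identityˡ _ ∙ cong K (sym (⊕-identityʳ y))) (tail v K y)
  go (false ∷ v) K y = cong (λ z → z ⊕ act (mask v) K (y - + 1)) (*-zeroˡ (K y)) ∙ +-identityˡ _ ∙ tail v K y

els-unique : ∀ {n} (v : Vec Bool n) → AllPairs _≢_ (els v)
els-unique [] = []
els-unique (true ∷ v) = All.tabulate (λ m → λ e → nz e (proj₂ (proj₂ (∈-map⁻ suc m)))) ∷ Uniqueₚ.map⁺ suc-injective (els-unique v)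
  where nz : ∀ {x y} → 0 ≡ x → x ≡ suc y → ⊥
        nz refl ()
els-unique (false ∷ v) = Uniqueₚ.map⁺ suc-injective (els-unique v)

∈-els⁺ : ∀ {n} {v : Vec Bool n} {x} → x ∈ v → toℕ x ∈L els v
∈-els⁺ {v = true ∷ v} {Fin.zero} Vec.here = here refl
∈-els⁺ {v = true ∷ v} {Fin.suc x} (Vec.there m) = there (∈-map⁺ suc (∈-els⁺ m))
∈-els⁺ {v = false ∷ v} {Fin.suc x} (Vec.there m) = ∈-map⁺ suc (∈-els⁺ m)

∈-els⁻ : ∀ {n} {v : Vec Bool n} {a} → a ∈L els v → ∃[ x ] (x ∈ v) × (toℕ x ≡ a)
∈-els⁻ {v = true ∷ v} (here refl) = Fin.zero , Vec.here , refl
∈-els⁻ {v = true ∷ v} (there m) with ∈-map⁻ suc m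
... | b , m' , e with ∈-els⁻ m'
...   | x , x∈ , e' = Fin.suc x , Vec.there x∈ , cong suc e' ∙ sym e
∈-els⁻ {v = false ∷ v} m with ∈-map⁻ suc m
... | b , m' , e with ∈-els⁻ m'
...   | x , x∈ , e' = Fin.suc x , Vec.there x∈ , cong suc e' ∙ sym e

length-els : ∀ {n} (v : Subset n) → length (els v) ≡ ∣ v ∣
length-els [] = refl
length-els (true ∷ v) = cong suc (Lₚ.length-map suc (els v) ∙ length-els v)
length-els (false ∷ v) = Lₚ.length-map suc (els v) ∙ length-els v

-- Dilations of a tile

×-const : ∀ m x → m ×P x ≋ constP (+ m) *P x
×-const zero x = ≋-sym (eq λ n → coeff-const* (+ 0) x n ∙ *-zeroˡ (coeff x n))
×-const (suc m) x = +ˡ x (×-const m x) ⨾ lem x (constP (+ m)) ⨾ *ʳ x (≋-refl {constP (+ suc m)})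
  where lem : ∀ x k → x +P (k *P x) ≋ (1P +P k) *P x
        lem = Solver.solve-∀ polyACR

prime∤! : ∀ {p} → Prime p → ∀ k → k < p → ¬ (p ∣ k !)
prime∤! pr zero _ d = <⇒≱ (nonTrivial⇒n>1 _ {{prime⇒nonTrivial pr}}) (∣⇒≤ d)
prime∤! pr (suc k) lt d with euclidsLemma (suc k) (k !) pr d
... | inj₁ e = <⇒≱ lt (∣⇒≤ e)
... | inj₂ e = prime∤! pr k (<-trans (n<1+n k) lt) e

prime∣C : ∀ {p} → Prime p → ∀ k → 0 < k → k < p → p ∣ (p C k)
prime∣C {p} pr k 0<k k<p with euclidsLemma (p C k) (k ! * (p ∸ k) !) pr (subst (p ∣_) (sym p!≡) (p∣p! p pr))
  where
  instance nz = _!≢0 k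
           nz' = _!≢0 (p ∸ k)
  p!≡ : (p C k) * (k ! * (p ∸ k) !) ≡ p !
  p!≡ = cong (_* (k ! * (p ∸ k) !)) (nCk≡n!/k![n-k]! (<⇒≤ k<p)) ∙ m/n*n≡m {{m*n≢0 (k !) ((p ∸ k) !)}} (k![n∸k]!∣n! (<⇒≤ k<p))
  p∣p! : ∀ p → Prime p → p ∣ p !
  p∣p! zero pr = ⊥-elim (≢-nonZero⁻¹ 0 {{prime⇒nonZero pr}} refl)
  p∣p! (suc p) _ = divides (p !) (*-comm (suc p) (p !))
... | inj₁ d = d
... | inj₂ d with euclidsLemma (k !) ((p ∸ k) !) pr d
...   | inj₁ e = ⊥-elim (prime∤! pr k k<p e)
...   | inj₂ e = ⊥-elim (prime∤! pr (p ∸ k) (∸-monoʳ-< 0<k (<⇒≤ k<p)) e)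

sum-multiples : ∀ c n (t : Fin n → Poly) → (∀ i → ∃[ T ] t i ≋ constP c *P T) → ∃[ T ] PSum.sum t ≋ constP c *P T
sum-multiples c zero t h = [] , ≋-sym (*P-comm (constP c) [])
sum-multiples c (suc n) t h with h Fin.zero | sum-multiples c n (t ∘ Fin.suc) (h ∘ Fin.suc)
... | T , e | T' , e' = T +P T' , +P-cong e e' ⨾ ≋-sym (PR.distribˡ (constP c) T T')

freshman : ∀ {p} → Prime p → ∀ x y → ∃[ T ] ((x +P y) ^P p ≋ ((x ^P p) +P (y ^P p)) +P (constP (+ p) *P T))
freshman {zero} pr x y = ⊥-elim (≢-nonZero⁻¹ 0 {{prime⇒nonZero pr}} refl)
freshman {p@(suc m)} pr x y = proj₁ mid , (begin
    (x +P y) ^P p ≈⟨ binomial-theorem p x y ⟩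
    PSum.sum t ≈⟨ PSum.sum-init-last t ⟩
    (t Fin.zero +P PSum.sum t') +P t (Fin.fromℕ p) ≈⟨ +P-cong (+P-cong first (proj₂ mid)) last ⟩
    ((y ^P p) +P (constP (+ p) *P proj₁ mid)) +P (x ^P p) ≈⟨ lem (y ^P p) (constP (+ p) *P proj₁ mid) (x ^P p) ⟩
    ((x ^P p) +P (y ^P p)) +P (constP (+ p) *P proj₁ mid) ∎)
  where
  open ≋R
  t = binomialTerm x y p
  t' : Fin m → Poly
  t' j = t (Fin.inject₁ (Fin.suc j))
  first : t Fin.zero ≋ y ^P p
  first = PR.+-identityʳ _ ⨾ PR.*-identityˡ (y ^P p)
  last : t (Fin.fromℕ p) ≋ x ^P p
  last = lastTerm _ (Finₚ.toℕ-fromℕ p)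
    where
    lastTerm : ∀ j → j ≡ p → (p C j) ×P ((x ^P j) *P (y ^P (p ∸ j))) ≋ x ^P p
    lastTerm _ refl = subst₂ (λ c k → c ×P ((x ^P p) *P (y ^P k)) ≋ x ^P p) (sym (nCn≡1 p)) (sym (n∸n≡0 p))
      (PR.+-identityʳ ((x ^P p) *P 1P) ⨾ PR.*-identityʳ (x ^P p))
  middle : ∀ j → ∃[ T ] t' j ≋ constP (+ p) *P T
  middle j with prime∣C pr (suc (toℕ (Fin.inject₁ j))) (s≤s z≤n) (s≤s (subst (_< m) (sym (toℕ-inject₁ j)) (toℕ<n j)))
  ... | divides k e = constP (+ k) *P b , ×-const (p C suc (toℕ (Fin.inject₁ j))) b ⨾
        subst (λ z → constP (+ z) *P b ≋ constP (+ p) *P (constP (+ k) *P b)) (sym e)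
          (*ʳ b (subst (λ z → constP z ≋ (+ p · + k) ∷ []) (sym (pos-* p k) ∙ cong +_ (*-comm p k)) ≋-refl ⨾ ≋-sym (const* (+ p) (+ k))) ⨾ *P-assoc (constP (+ p)) (constP (+ k)) b)
    where b = binomialMonomial x y p (Fin.inject₁ (Fin.suc j))
  mid = sum-multiples (+ p) m t' middle
  lem : ∀ a b c → (a +P b) +P c ≋ (c +P a) +P b
  lem = Solver.solve-∀ polyACR

Xpow-^ : ∀ a k → (Xpow a) ^P k ≋ Xpow (k * a)
Xpow-^ a zero = ≋-refl
Xpow-^ a (suc k) = *ˡ (Xpow a) (Xpow-^ a k) ⨾ ≋-sym (Xpow-+ a (k * a))

^P-cong : ∀ k {x y} → x ≋ y → x ^P k ≋ y ^P k
^P-cong zero e = ≋-refl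
^P-cong (suc k) e = *P-cong e (^P-cong k e)

frobenius : ∀ {p} → Prime p → ∀ X → ∃[ T ] (listP X ^P p ≋ listP (map (p *_) X) +P (constP (+ p) *P T))
frobenius {p} pr [] = [] , nil-^ p pr ⨾ ≋-sym (*P-comm (constP (+ p)) [])
  where
  nil-^ : ∀ p → Prime p → [] ^P p ≋ []
  nil-^ zero pr = ⊥-elim (≢-nonZero⁻¹ 0 {{prime⇒nonZero pr}} refl)
  nil-^ (suc m) pr = ≋-refl
frobenius {p} pr (a ∷ X) with freshman pr (Xpow a) (listP X) | frobenius pr X
... | T , e | T' , e' = T +P T' , (begin
    (Xpow a +P listP X) ^P p ≈⟨ e ⟩
    (((Xpow a) ^P p) +P (listP X ^P p)) +P (constP (+ p) *P T) ≈⟨ +ʳ (constP (+ p) *P T) (+P-cong (Xpow-^ a p) e') ⟩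
    (Xpow (p * a) +P (listP (map (p *_) X) +P (constP (+ p) *P T'))) +P (constP (+ p) *P T)
      ≈⟨ lem (Xpow (p * a)) (listP (map (p *_) X)) (constP (+ p)) T' T ⟩
    (Xpow (p * a) +P listP (map (p *_) X)) +P (constP (+ p) *P (T +P T')) ∎)
  where
  open ≋R
  lem : ∀ a b c t t' → (a +P (b +P (c *P t))) +P (c *P t') ≋ (a +P b) +P (c *P (t' +P t))
  lem = Solver.solve-∀ polyACR

pos∣ : ∀ {m n} → m ∣ n → + m ∣ℤ + n
pos∣ {m} {n} = ∣ᵤ⇒∣ {+ m} {+ n}

pos∣⁻¹ : ∀ {m n} → + m ∣ℤ + n → m ∣ n
pos∣⁻¹ = ∣⇒∣ᵤ

^P-pred : ∀ P {p} → Prime p → P ^P p ≡ P *P (P ^P pred p)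
^P-pred P {zero} pr = ⊥-elim (≢-nonZero⁻¹ 0 {{prime⇒nonZero pr}} refl)
^P-pred P {suc m} pr = refl

count : ℕ → List ℕ → List ℕ → ℤ → ℤ
count N X Y y = sumL X (λ a → sumL Y (λ b → δ N (y - + a - + b)))

-- X ⊕ Y = ℤ_N, for lists of representatives.
TileL : ℕ → List ℕ → List ℕ → Set
TileL N X Y = ∀ y → count N X Y y ≡ + 1

count-act : ∀ N X Y y → act (listP X *P listP Y) (δ N) y ≡ count N X Y y
count-act N X Y y = act-* (listP X) (listP Y) (δ N) y ∙ act-listP X (act (listP Y) (δ N)) y ∙ sumL-cong X λ a → act-listP Y (δ N) (y - + a)

residue-sum : ∀ N → .{{_ : NonZero N}} → ∀ s → sumL (upTo N) (λ y → δ N (+ y - s)) ≡ + 1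
residue-sum N s = sumL-single (upTo N) (Uniqueₚ.upTo⁺ N) (∈-upTo⁺ (n%ℕd<d s N)) others ∙
    δ-yes rs
  where
  r = s %ℕ N
  rs : + N ∣ℤ (+ r - s)
  rs = dividesℤ (- (s /ℕ N)) (cong (λ z → + r - z) (a≡a%ℕn+[a/ℕn]*n s N) ∙ lem (+ r) (s /ℕ N) (+ N))
    where lem : ∀ r q n → r - (r ⊕ q · n) ≡ (- q) · n; lem = ring
  others : ∀ y → y ∈L upTo N → y ≢ r → δ N (+ y - s) ≡ + 0
  others y m y≢ = δ-no λ d → y≢ (small-∣ (∈-upTo⁻ m) (n%ℕd<d s N) (subst (+ N ∣ℤ_) (lem (+ y) s (+ r)) (sub∣ d rs)))
    where lem : ∀ y s r → (y - s) - (r - s) ≡ y - r; lem = ring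

count-total : ∀ N → .{{_ : NonZero N}} → ∀ X Y → sumL (upTo N) (λ y → count N X Y (+ y)) ≡ + length X · + length Y
count-total N X Y = sumL-swap (upTo N) X _ ∙ (sumL-cong X λ a → sumL-swap (upTo N) Y _ ∙
   (sumL-cong Y λ b → (sumL-cong (upTo N) λ y → cong (δ N) (lem (+ y) (+ a) (+ b))) ∙ residue-sum N (+ a ⊕ + b)) ∙ sumL-const Y (+ 1) ∙ ·-identityʳ _) ∙
   sumL-const X (+ length Y)
  where lem : ∀ y a b → y - a - b ≡ y - (a ⊕ b); lem = ring

count-mod : ∀ N → .{{_ : NonZero N}} → ∀ X Y y → count N X Y y ≡ count N X Y (+ (y %ℕ N))
count-mod N X Y y = sumL-cong X λ a → sumL-cong Y λ b → δ-≡ _ _ (dividesℤ (y /ℕ N)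
    (lem y (+ (y %ℕ N)) (+ a) (+ b) ∙ cong (_- + (y %ℕ N)) (a≡a%ℕn+[a/ℕn]*n y N) ∙ lem2 (+ (y %ℕ N)) _))
  where lem : ∀ y r a b → (y - a - b) - (r - a - b) ≡ y - r; lem = ring
        lem2 : ∀ r q → (r ⊕ q) - r ≡ q; lem2 = ring

act-power-1 : ∀ X k y → act (listP X ^P k) (λ _ → + 1) y ≡ + (length X ^ k)
act-power-1 X zero y = refl
act-power-1 X (suc k) y = act-* (listP X) (listP X ^P k) _ y ∙ act-congᴷ (listP X) (act-power-1 X k) y ∙
   act-listP X _ y ∙ sumL-const X _ ∙ sym (pos-* (length X) (length X ^ k))

prime∣^ : ∀ {p} → Prime p → ∀ n k → p ∣ n ^ k → p ∣ n
prime∣^ pr n zero d = ⊥-elim (<⇒≱ (nonTrivial⇒n>1 _ {{prime⇒nonTrivial pr}}) (∣⇒≤ d))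
prime∣^ pr n (suc k) d with euclidsLemma n (n ^ k) pr d
... | inj₁ e = e
... | inj₂ e = prime∣^ pr n k e

count-nonneg : ∀ N X Y y → + 0 ℤ.≤ count N X Y y
count-nonneg N X Y y = sumL-nonneg X λ a → sumL-nonneg Y λ b → δ-nonneg N _

1≤-nonneg : ∀ {z} → + 0 ℤ.≤ z → z ≢ + 0 → + 0 ℤ.≤ z - + 1
1≤-nonneg {+ zero} _ ne = ⊥-elim (ne refl)
1≤-nonneg {+ suc n} _ _ = ℤ.+≤+ z≤n
1≤-nonneg {ℤ.-[1+ n ]} () _

-- Modulo ℓ the counting function of ℓX ⊕ Y agrees with that of X ⊕ … ⊕ X ⊕ Y, which is the constant |X|^(ℓ-1);
-- so ℓX ⊕ Y covers everything, and there is no room for multiplicity.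
tijdeman-prime : ∀ N → .{{_ : NonZero N}} → ∀ X Y → TileL N X Y → ∀ {ℓ} → Prime ℓ → ¬ (ℓ ∣ length X) → TileL N (map (ℓ *_) X) Y
tijdeman-prime N X Y tile {ℓ} pr ℓ∤ y = count-mod N X' Y y ∙ i-j≡0⇒i≡j (c (y %ℕ N)) (+ 1) (sumL-zero-∈ (upTo N) {λ y → c y - + 1} (λ z → 1≤-nonneg (count-nonneg N X' Y (+ z)) (nonzero (+ z))) total (∈-upTo⁺ (n%ℕd<d y N)))
  where
  m = pred ℓ
  X' = map (ℓ *_) X
  c : ℕ → ℤ
  c y = count N X' Y (+ y)
  T = proj₁ (frobenius pr X)
  power : ∀ y → act ((listP X ^P ℓ) *P listP Y) (δ N) y ≡ + (length X ^ m)
  power y = act-≋ (subst (λ z → z *P listP Y ≋ (listP X ^P m) *P (listP X *P listP Y)) (sym (^P-pred (listP X) pr)) (lem (listP X) (listP X ^P m) (listP Y))) (δ N) y ∙ act-* (listP X ^P m) (listP X *P listP Y) (δ N) y ∙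
     act-congᴷ (listP X ^P m) (λ z → count-act N X Y z ∙ tile z) y ∙ act-power-1 X m y
    where lem : ∀ x p q → (x *P p) *P q ≋ p *P (x *P q); lem = Solver.solve-∀ polyACR
  split : ∀ y → + (length X ^ m) ≡ count N X' Y y ⊕ + ℓ · act (T *P listP Y) (δ N) y
  split y = sym (power y) ∙ act-≋ (*ʳ (listP Y) (proj₂ (frobenius pr X)) ⨾ lem (listP X') (constP (+ ℓ)) T (listP Y)) (δ N) y ∙
     act-+ (listP X' *P listP Y) (constP (+ ℓ) *P (T *P listP Y)) (δ N) y ∙ cong₂ _⊕_ (count-act N X' Y y) (act-const (+ ℓ) (T *P listP Y) (δ N) y)
    where lem : ∀ x k t y → (x +P (k *P t)) *P y ≋ (x *P y) +P (k *P (t *P y)); lem = Solver.solve-∀ polyACR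
  nonzero : ∀ y → count N X' Y y ≢ + 0
  nonzero y z = ℓ∤ (prime∣^ pr (length X) m (pos∣⁻¹ (dividesℤ t (split y ∙ cong (λ w → w ⊕ + ℓ · t) z ∙ +-identityˡ (+ ℓ · t) ∙ ·-comm (+ ℓ) t))))
    where t = act (T *P listP Y) (δ N) y
  -- The numbers of representations add up to |X||Y| before and after the dilation. So the excesses
  -- over 1, which are nonnegative, add up to zero.
  total : sumL (upTo N) (λ y → c y - + 1) ≡ + 0
  total = sumL-+ (upTo N) c (λ _ → - + 1) ∙ cong₂ _⊕_ (count-total N X' Y ∙ cong (λ k → + k · + length Y) (Lₚ.length-map (ℓ *_) X) ∙
     sym (count-total N X Y) ∙ sumL-cong (upTo N) (λ y → tile (+ y)) ∙ sumL-const (upTo N) (+ 1)) (sumL-const (upTo N) (- + 1)) ∙ lem (+ length (upTo N))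
    where lem : ∀ n → n · + 1 ⊕ n · (- + 1) ≡ + 0; lem = ring

-- A dilation keeps the length of the list, so the prime case can be repeated along the prime
-- factors of k.
tijdeman : ∀ N → .{{_ : NonZero N}} → ∀ X Y → TileL N X Y → ∀ k → .{{_ : NonZero k}} →
  (∀ {π} → Prime π → π ∣ k → ¬ (π ∣ length X)) → TileL N (map (k *_) X) Y
tijdeman N X Y tile k free = subst (λ j → TileL N (map (j *_) X) Y) (sym PF.isFactorisation)
    (go PF.factors PF.factorsPrime (λ {π} pr d → free pr (subst (π ∣_) (sym PF.isFactorisation) d)))
  where
  module PF = PrimeFactorisation (factorise k)
  go : ∀ ps → All Prime ps → (∀ {π} → Prime π → π ∣ product ps → ¬ (π ∣ length X)) → TileL N (map (product ps *_) X) Y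
  go [] [] _ = subst (λ L → TileL N L Y) (sym (Lₚ.map-cong *-identityˡ X ∙ Lₚ.map-id X)) tile
  go (p ∷ ps) (pr ∷ prs) c = subst (λ L → TileL N L Y) (sym (Lₚ.map-∘ X) ∙ Lₚ.map-cong (λ x → sym (*-assoc p (product ps) x)) X)
     (tijdeman-prime N (map (product ps *_) X) Y (go ps prs (λ pr' d → c pr' (∣-trans d (divides p refl)))) pr
       (λ d → c pr (divides (product ps) (*-comm p (product ps))) (subst (p ∣_) (Lₚ.length-map (product ps *_) X) d)))

sumL-cartesian : ∀ {A B C : Set} (h : A → B → C) L L' f → sumL (cartesianProductWith h L L') f ≡ sumL L (λ a → sumL L' (λ b → f (h a b)))
sumL-cartesian h [] L' f = refl
sumL-cartesian h (a ∷ L) L' f = sumL-++ (map (h a) L') _ f ∙ cong₂ _⊕_ (sumL-map (h a) L' f) (sumL-cartesian h L L' f)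

sumL-*-sumL : ∀ {A B : Set} (L : List A) (L' : List B) f g → sumL L (λ a → sumL L' (λ b → f a · g b)) ≡ sumL L f · sumL L' g
sumL-*-sumL L L' f g = (sumL-cong L λ a → sumL-* L' (f a) g ∙ ·-comm (f a) _) ∙ sumL-* L (sumL L' g) f ∙ ·-comm _ (sumL L f)

sumL-upTo-suc : ∀ n (f : ℕ → ℤ) → sumL (upTo (suc n)) f ≡ f 0 ⊕ sumL (upTo n) (f ∘ suc)
sumL-upTo-suc n f = cong (λ z → f 0 ⊕ z) (cong (λ L → sumL L f) (sym (Lₚ.map-upTo suc n)) ∙ sumL-map suc (upTo n) f)

-- Averaging kernels and the dichotomy

Periodic : ℕ → (ℤ → ℤ) → Set
Periodic N K = ∀ z z' → + N ∣ℤ (z - z') → K z ≡ K z'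

Even : (ℤ → ℤ) → Set
Even K = ∀ z → K (- z) ≡ K z

-- K is, up to a factor, a primitive idempotent of ℚ[ℤ_N]: the average of its dilations by units is multiplicative.
record Kernel (N : ℕ) (K : ℤ → ℤ) : Set where
  field
    units : List ℕ
    units-coprime : ∀ {u} → u ∈L units → ∀ {π} → Prime π → π ∣ N → ¬ (π ∣ u)
    scale : ℤ
    scale≢0 : scale ≢ + 0
    periodic : Periodic N K
    even : Even K
    unit-average : ∀ x y → sumL units (λ u → K (y - + u · x)) ≡ scale · (K x · K y)
    prime-factor : ∃[ π ] Prime π × (π ∣ N)

-- K has mean zero along an arithmetic progression. The unit m is there for products of kernels: the
-- Chinese remainder theorem multiplies the step by the other modulus, which is prime to N.
Balanced : ℕ → (ℤ → ℤ) → Set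
Balanced N K = ∃[ n ] NonZero n × ∃[ t ] (∀ m → (∀ {π} → Prime π → π ∣ N → ¬ (+ π ∣ℤ m)) → ∀ y → sumL (upTo n) (λ τ → K (y ⊕ + τ · (m · t))) ≡ + 0)

periodic-expand : ∀ {N K} → .{{_ : NonZero N}} → Periodic N K → ∀ z s → sumL (upTo N) (λ y → δ N (+ y - s) · K (z - + y)) ≡ K (z - s)
periodic-expand {N} {K} per z s = sumL-cong (upTo N) pointwise ∙ sumL-* (upTo N) (K (z - s)) _ ∙
    cong (K (z - s) ·_) (residue-sum N s) ∙ ·-identityʳ _
  where
  pointwise : ∀ y → δ N (+ y - s) · K (z - + y) ≡ K (z - s) · δ N (+ y - s)
  pointwise y = go (+ N ∣ℤ? (+ y - s))
    where
    go : Dec _ → _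
    go (yes d) = cong (δ N (+ y - s) ·_) (per _ _ (subst (+ N ∣ℤ_) (lem z (+ y) s) (neg∣ d))) ∙ ·-comm (δ N (+ y - s)) _
      where lem : ∀ z y s → - (y - s) ≡ (z - y) - (z - s); lem = ring
    go (no d) = cong (_· K (z - + y)) (δ-no d) ∙ *-zeroˡ (K (z - + y)) ∙ sym (cong (K (z - s) ·_) (δ-no d) ∙ ·-zeroʳ (K (z - s)))

pairSum : List ℕ → List ℕ → (ℤ → ℤ) → ℤ → ℤ
pairSum X Y K z = sumL X (λ a → sumL Y (λ b → K (z - + a - + b)))

pairSum-tile : ∀ {N K X Y} → .{{_ : NonZero N}} → Periodic N K → TileL N X Y → ∀ z → pairSum X Y K z ≡ sumL (upTo N) (λ y → K (z - + y))
pairSum-tile {N} {K} {X} {Y} per tile z = begin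
  pairSum X Y K z
    ≡⟨ sumL-cong X (λ a → sumL-cong Y λ b → cong K (lem z (+ a) (+ b)) ∙ sym (periodic-expand per z (+ a ⊕ + b))) ⟩
  sumL X (λ a → sumL Y (λ b → sumL (upTo N) (λ y → δ N (+ y - (+ a ⊕ + b)) · K (z - + y))))
    ≡⟨ sumL-cong X (λ a → sumL-swap Y (upTo N) _) ⟩
  sumL X (λ a → sumL (upTo N) (λ y → sumL Y (λ b → δ N (+ y - (+ a ⊕ + b)) · K (z - + y))))
    ≡⟨ sumL-swap X (upTo N) _ ⟩
  sumL (upTo N) (λ y → sumL X (λ a → sumL Y (λ b → δ N (+ y - (+ a ⊕ + b)) · K (z - + y))))
    ≡⟨ sumL-cong (upTo N) (λ y → (sumL-cong X λ a → (sumL-cong Y λ b → ·-comm (δ N _) _ ∙ cong (λ w → K (z - + y) · δ N w) (lem' (+ y) (+ a) (+ b))) ∙ sumL-* Y (K (z - + y)) _) ∙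
          sumL-* X (K (z - + y)) _ ∙ cong (K (z - + y) ·_) (tile (+ y)) ∙ ·-identityʳ _) ⟩
  sumL (upTo N) (λ y → K (z - + y)) ∎
  where
  open ≡-Reasoning
  lem : ∀ z a b → z - a - b ≡ z - (a ⊕ b); lem = ring
  lem' : ∀ z a b → z - (a ⊕ b) ≡ z - a - b; lem' = ring

residue-shift : ∀ {N K} → .{{_ : NonZero N}} → Periodic N K → ∀ z t → sumL (upTo N) (λ y → K ((z ⊕ t) - + y)) ≡ sumL (upTo N) (λ y → K (z - + y))
residue-shift {N} {K} per z t = begin
  sumL (upTo N) (λ y → K ((z ⊕ t) - + y))
    ≡⟨ sumL-cong (upTo N) (λ y → cong K (lem z t (+ y)) ∙ sym (periodic-expand per z (+ y - t))) ⟩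
  sumL (upTo N) (λ y → sumL (upTo N) (λ x → δ N (+ x - (+ y - t)) · K (z - + x)))
    ≡⟨ sumL-swap (upTo N) (upTo N) _ ⟩
  sumL (upTo N) (λ x → sumL (upTo N) (λ y → δ N (+ x - (+ y - t)) · K (z - + x)))
    ≡⟨ sumL-cong (upTo N) (λ x → (sumL-cong (upTo N) λ y → ·-comm (δ N _) _ ∙ cong (K (z - + x) ·_) (flip x y)) ∙
         sumL-* (upTo N) (K (z - + x)) _ ∙ cong (K (z - + x) ·_) (residue-sum N (+ x ⊕ t)) ∙ ·-identityʳ _) ⟩
  sumL (upTo N) (λ x → K (z - + x)) ∎
  where
  open ≡-Reasoning
  lem : ∀ z t y → (z ⊕ t) - y ≡ z - (y - t); lem = ring
  lem2 : ∀ x y t → - (x - (y - t)) ≡ y - (x ⊕ t); lem2 = ring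
  lem3 : ∀ x y t → x - (y - t) ≡ - (y - (x ⊕ t)); lem3 = ring
  flip : ∀ x y → δ N (+ x - (+ y - t)) ≡ δ N (+ y - (+ x ⊕ t))
  flip x y = δ-⇔ (λ d → subst (+ N ∣ℤ_) (lem2 (+ x) (+ y) t) (neg∣ d)) (λ d → subst (+ N ∣ℤ_) (sym (lem3 (+ x) (+ y) t)) (neg∣ d))

-- In a tiling a + b runs once through ℤ_N, so the pair sum is the sum of K over all residues and
-- does not depend on z; its mean over the progression of `Balanced` is zero.
pairSum-zero : ∀ {N K X Y} → .{{_ : NonZero N}} → Periodic N K → Balanced N K → TileL N X Y → ∀ z → pairSum X Y K z ≡ + 0
pairSum-zero {N} {K} {X} {Y} per (n , nz , t , bal) tile z = ·-cancelˡ-≡ (+ n) _ _ {{nz}} (begin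
  + n · pairSum X Y K z
    ≡⟨ sym (sumL-const (upTo n) (pairSum X Y K z) ∙ cong (λ k → + k · pairSum X Y K z) (Lₚ.length-upTo n)) ⟩
  sumL (upTo n) (λ τ → pairSum X Y K z)
    ≡⟨ sumL-cong (upTo n) (λ τ → pairSum-tile {X = X} {Y = Y} per tile z ∙ sym (residue-shift per z (+ τ · (+ 1 · t))) ∙ sym (pairSum-tile {X = X} {Y = Y} per tile (z ⊕ + τ · (+ 1 · t)))) ⟩
  sumL (upTo n) (λ τ → pairSum X Y K (z ⊕ + τ · (+ 1 · t)))
    ≡⟨ sumL-swap (upTo n) X _ ∙ (sumL-cong X λ a → sumL-swap (upTo n) Y _) ⟩
  sumL X (λ a → sumL Y (λ b → sumL (upTo n) (λ τ → K ((z ⊕ + τ · (+ 1 · t)) - + a - + b))))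
    ≡⟨ (sumL-cong X λ a → (sumL-cong Y λ b → (sumL-cong (upTo n) λ τ → cong K (lem z (+ τ · (+ 1 · t)) (+ a) (+ b))) ∙ bal (+ 1) unit1 (z - + a - + b)) ∙ sumL-0 Y) ∙ sumL-0 X ⟩
  + 0 ≡⟨ sym (·-zeroʳ (+ n)) ⟩
  + n · + 0 ∎)
  where
  open ≡-Reasoning
  lem : ∀ z t a b → (z ⊕ t) - a - b ≡ (z - a - b) ⊕ t; lem = ring
  unit1 : ∀ {π} → Prime π → π ∣ N → ¬ (+ π ∣ℤ + 1)
  unit1 pr _ d = <⇒≱ (nonTrivial⇒n>1 _ {{prime⇒nonTrivial pr}}) (∣⇒≤ (pos∣⁻¹ d))

conv-vanishes : List ℕ → (ℤ → ℤ) → Set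
conv-vanishes X K = ∀ z → sumL X (λ a → K (z - + a)) ≡ + 0

-- By `unit-average` the product is, up to the scale, a sum over units u of pair sums of K for uX
-- and Y. The units are prime to N, hence to |X|, so each uX ⊕ Y is again a tiling and its pair sum
-- vanishes.
dilate-product : ∀ {N K X Y} → .{{_ : NonZero N}} → (k : Kernel N K) → Balanced N K → TileL N X Y → (∀ {π} → Prime π → π ∣ length X → π ∣ N) →
  ∀ x y → sumL X (λ a → K (x - + a)) · sumL Y (λ b → K (y - + b)) ≡ + 0
dilate-product {N} {K} {X} {Y} k bal tile prX x y = ·-cancelˡ-≡ scale _ _ {{ℤ.≢-nonZero scale≢0}} (begin
  scale · (sumL X (λ a → K (x - + a)) · sumL Y (λ b → K (y - + b)))
    ≡⟨ cong (scale ·_) (sym (sumL-*-sumL X Y _ _)) ⟩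
  scale · sumL X (λ a → sumL Y (λ b → K (x - + a) · K (y - + b)))
    ≡⟨ sym ((sumL-cong X λ a → sumL-* Y scale _) ∙ sumL-* X scale _) ⟩
  sumL X (λ a → sumL Y (λ b → scale · (K (x - + a) · K (y - + b))))
    ≡⟨ sumL-cong X (λ a → sumL-cong Y λ b → cong (λ w → scale · (w · K (y - + b))) (sym (even (x - + a)) ∙ cong K (lem1 x (+ a))) ∙ sym (unit-average (+ a - x) (y - + b))) ⟩
  sumL X (λ a → sumL Y (λ b → sumL units (λ u → K ((y - + b) - + u · (+ a - x)))))
    ≡⟨ (sumL-cong X λ a → sumL-swap Y units _) ∙ sumL-swap X units _ ⟩
  sumL units (λ u → sumL X (λ a → sumL Y (λ b → K ((y - + b) - + u · (+ a - x)))))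
    ≡⟨ sumL-cong-∈ units each ∙ sumL-0 units ⟩
  + 0 ≡⟨ sym (·-zeroʳ scale) ⟩
  scale · + 0 ∎)
  where
  open ≡-Reasoning
  open Kernel k
  lem1 : ∀ x a → - (x - a) ≡ a - x; lem1 = ring
  lem2 : ∀ y b u a x → (y - b) - u · (a - x) ≡ (y ⊕ u · x) - u · a - b; lem2 = ring
  each : ∀ u → u ∈L units → sumL X (λ a → sumL Y (λ b → K ((y - + b) - + u · (+ a - x)))) ≡ + 0
  each u m = (sumL-cong X λ a → sumL-cong Y λ b → cong K (lem2 y (+ b) (+ u) (+ a) x ∙ cong (λ w → (y ⊕ + u · x) - w - + b) (sym (pos-* u a)))) ∙
    sym (sumL-map (u *_) X (λ a → sumL Y (λ b → K ((y ⊕ + u · x) - + a - + b)))) ∙ pairSum-zero {X = map (u *_) X} {Y = Y} periodic bal (tijdeman N X Y tile u {{unz}} (λ pr d e → units-coprime m pr (prX pr e) d)) (y ⊕ + u · x)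
    where
    unz : NonZero u; unz = ≢-nonZero λ { refl → units-coprime m (proj₁ (proj₂ prime-factor)) (proj₂ (proj₂ prime-factor)) (divides 0 refl) }

conv-periodic : ∀ {N K} X → Periodic N K → Periodic N (λ z → sumL X (λ a → K (z - + a)))
conv-periodic X per z z' d = sumL-cong X λ a → per _ _ (subst (+ _ ∣ℤ_) (lem z z' (+ a)) d)
  where lem : ∀ z z' a → z - z' ≡ (z - a) - (z' - a); lem = ring

mod-reduce : ∀ N → .{{_ : NonZero N}} → ∀ z → + N ∣ℤ (z - + (z %ℕ N))
mod-reduce N z = dividesℤ (z /ℕ N) (cong (_- + (z %ℕ N)) (a≡a%ℕn+[a/ℕn]*n z N) ∙ lem (+ (z %ℕ N)) _)
  where lem : ∀ r q → (r ⊕ q) - r ≡ q; lem = ring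

dichotomy : ∀ {N K X Y} → .{{_ : NonZero N}} → Kernel N K → Balanced N K → TileL N X Y → (∀ {π} → Prime π → π ∣ length X → π ∣ N) →
  conv-vanishes X K ⊎ conv-vanishes Y K
dichotomy {N} {K} {X} {Y} k bal tile prX with any? {n = N} (λ i → ¬? (sumL X (λ a → K (+ toℕ i - + a)) ℤₚ.≟ + 0))
... | yes (i , ne) = inj₂ λ y → [ (λ e → ⊥-elim (ne e)) , (λ e → e) ]′ (i*j≡0⇒i≡0∨j≡0 _ (dilate-product {X = X} {Y = Y} k bal tile prX (+ toℕ i) y))
... | no none = inj₁ λ z → conv-periodic X (Kernel.periodic k) z (+ (z %ℕ N)) (mod-reduce N z) ∙ zero-at z
  where
  zero-at : ∀ z → sumL X (λ a → K (+ (z %ℕ N) - + a)) ≡ + 0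
  zero-at z with sumL X (λ a → K (+ (z %ℕ N) - + a)) ℤₚ.≟ + 0
  ... | yes e = e
  ... | no ne = ⊥-elim (none (fromℕ< (n%ℕd<d z N) , subst (λ j → sumL X (λ a → K (+ j - + a)) ≢ + 0) (sym (toℕ-fromℕ< (n%ℕd<d z N))) ne))

crt-unit : ∀ m n → .{{_ : NonZero m}} → Coprime m n → ∃[ e ] (+ m ∣ℤ (+ e - + 1)) × (+ n ∣ℤ + e)
crt-unit m@(suc m') n c with coprime-Bézout c
-- Here 1 + yn = xm, so yn is -1 mod m; the factor m - 1 corrects the sign.
... | Bézout.Identity.+- x y e = y * n * m' , dividesℤ (+ (y * n) - + x) eq1 , dividesℤ (+ (m' * y)) (cong +_ (*-comm (y * n) m' ∙ sym (*-assoc m' y n)) ∙ pos-* (m' * y) n)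
  where
  eq1 : + (y * n * m') - + 1 ≡ (+ (y * n) - + x) · + suc m'
  eq1 = cong (_- + 1) (pos-* (y * n) m') ∙ lem (+ (y * n)) (+ m') ∙ cong (λ w → + (y * n) · (+ 1 ⊕ + m') - w) (cong +_ e ∙ pos-* x m) ∙ lem2 (+ (y * n)) (+ suc m') (+ x)
    where lem : ∀ a b → a · b - + 1 ≡ a · (+ 1 ⊕ b) - (+ 1 ⊕ a); lem = ring
          lem2 : ∀ a m x → a · m - x · m ≡ (a - x) · m; lem2 = ring
... | Bézout.Identity.-+ x y e = y * n , dividesℤ (+ x) (cong (λ w → + w - + 1) (sym e) ∙ lem (+ (x * m)) ∙ pos-* x m) , dividesℤ (+ y) (pos-* y n)
    where lem : ∀ a → (+ 1 ⊕ a) - + 1 ≡ a; lem = ring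

∣ℤ-cong : ∀ {d a b} → a ≡ b → d ∣ℤ a → d ∣ℤ b
∣ℤ-cong refl x = x

-- A pair of units is lifted to one integer with these residues, so the average over pairs factors
-- into the two averages.
kernel-* : ∀ {N₁ N₂ K₁ K₂} → .{{_ : NonZero N₁}} → .{{_ : NonZero N₂}} → Coprime N₁ N₂ → Kernel N₁ K₁ → Kernel N₂ K₂ → Kernel (N₁ * N₂) (λ z → K₁ z · K₂ z)
kernel-* {N₁} {N₂} {K₁} {K₂} c k₁ k₂ = record
  { units = cartesianProductWith U k₁.units k₂.units
  ; units-coprime = λ m pr d e → coprime-U m pr d e
  ; scale = k₁.scale · k₂.scale
  ; scale≢0 = λ z → [ k₁.scale≢0 , k₂.scale≢0 ]′ (i*j≡0⇒i≡0∨j≡0 k₁.scale z)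
  ; periodic = λ z z' d → cong₂ _·_ (k₁.periodic z z' (trans∣ N₁∣ d)) (k₂.periodic z z' (trans∣ N₂∣ d))
  ; even = λ z → cong₂ _·_ (k₁.even z) (k₂.even z)
  ; unit-average = λ x y → sumL-cartesian U k₁.units k₂.units _ ∙ (sumL-cong k₁.units λ u → sumL-cong k₂.units λ v →
        cong₂ _·_ (k₁.periodic _ _ (close (+ U u v) (+ u) x y (U₁ u v))) (k₂.periodic _ _ (close (+ U u v) (+ v) x y (U₂ u v)))) ∙
      sumL-*-sumL k₁.units k₂.units _ _ ∙ cong₂ _·_ (k₁.unit-average x y) (k₂.unit-average x y) ∙ lem k₁.scale (K₁ x) (K₁ y) k₂.scale (K₂ x) (K₂ y)
  ; prime-factor = let (π , pr , d) = k₁.prime-factor in π , pr , ∣-trans d (divides N₂ (*-comm N₁ N₂)) }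
  where
  module k₁ = Kernel k₁
  module k₂ = Kernel k₂
  e₁ = proj₁ (crt-unit N₁ N₂ c)
  e₂ = proj₁ (crt-unit N₂ N₁ (Cop′.sym c))
  U : ℕ → ℕ → ℕ
  U u v = u * e₁ + v * e₂
  N₁∣ : + N₁ ∣ℤ + (N₁ * N₂)
  N₁∣ = dividesℤ (+ N₂) (pos-* N₁ N₂ ∙ ·-comm (+ N₁) (+ N₂))
  N₂∣ : + N₂ ∣ℤ + (N₁ * N₂)
  N₂∣ = dividesℤ (+ N₁) (pos-* N₁ N₂)
  U-ℤ : ∀ u v → + U u v ≡ + u · + e₁ ⊕ + v · + e₂
  U-ℤ u v = cong₂ _⊕_ (pos-* u e₁) (pos-* v e₂)
  U₁ : ∀ u v → + N₁ ∣ℤ (+ U u v - + u)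
  U₁ u v = ∣ℤ-cong (l (+ u) (+ e₁) (+ v) (+ e₂) ∙ cong (_- + u) (sym (U-ℤ u v))) (add∣ (mulˡ∣ (+ u) (proj₁ (proj₂ (crt-unit N₁ N₂ c)))) (mulˡ∣ (+ v) (proj₂ (proj₂ (crt-unit N₂ N₁ (Cop′.sym c))))))
    where l : ∀ u e v f → u · (e - + 1) ⊕ v · f ≡ (u · e ⊕ v · f) - u; l = ring
  U₂ : ∀ u v → + N₂ ∣ℤ (+ U u v - + v)
  U₂ u v = ∣ℤ-cong (l (+ u) (+ e₁) (+ v) (+ e₂) ∙ cong (_- + v) (sym (U-ℤ u v))) (add∣ (mulˡ∣ (+ v) (proj₁ (proj₂ (crt-unit N₂ N₁ (Cop′.sym c))))) (mulˡ∣ (+ u) (proj₂ (proj₂ (crt-unit N₁ N₂ c)))))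
    where l : ∀ u e v f → v · (f - + 1) ⊕ u · e ≡ (u · e ⊕ v · f) - v; l = ring
  close : ∀ {N} w u x y → + N ∣ℤ (w - u) → + N ∣ℤ ((y - w · x) - (y - u · x))
  close w u x y d = ∣ℤ-cong (l w u x y) (mulˡ∣ (- x) d)
    where l : ∀ w u x y → (- x) · (w - u) ≡ (y - w · x) - (y - u · x); l = ring
  lem : ∀ s a b t c d → s · (a · b) · (t · (c · d)) ≡ s · t · (a · c · (b · d)); lem = ring
  transfer : ∀ {π w u} → + π ∣ℤ (+ w - + u) → π ∣ w → π ∣ u
  transfer {π} {w} {u} d e = pos∣⁻¹ (∣ℤ-cong (l (+ w) (+ u)) (sub∣ (pos∣ e) d))
    where l : ∀ w u → w - (w - u) ≡ u; l = ring
  coprime-U : ∀ {w} → w ∈L cartesianProductWith U k₁.units k₂.units → ∀ {π} → Prime π → π ∣ N₁ * N₂ → ¬ (π ∣ w)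
  coprime-U {w} m {π} pr d e with ∈-cartesianProductWith⁻ U k₁.units k₂.units m | euclidsLemma N₁ N₂ pr d
  ... | u , v , mu , mv , refl | inj₁ d₁ = k₁.units-coprime mu pr d₁ (transfer {π} {w} {u} (trans∣ (pos∣ d₁) (U₁ u v)) e)
  ... | u , v , mu , mv , refl | inj₂ d₂ = k₂.units-coprime mv pr d₂ (transfer {π} {w} {v} (trans∣ (pos∣ d₂) (U₂ u v)) e)

prime-∣ℤ-* : ∀ {π} → Prime π → ∀ a b → + π ∣ℤ (a · b) → (+ π ∣ℤ a) ⊎ (+ π ∣ℤ b)
prime-∣ℤ-* {π} pr a b d with euclidsLemma ℤ.∣ a ∣ ℤ.∣ b ∣ pr (subst (π ∣_) (abs-* a b) (∣⇒∣ᵤ {+ π} {a · b} d))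
... | inj₁ e = inj₁ (∣ᵤ⇒∣ {+ π} {a} e)
... | inj₂ e = inj₂ (∣ᵤ⇒∣ {+ π} {b} e)

balanced-*ˡ : ∀ {N₁ N₂ K₁ K₂} → Coprime N₁ N₂ → Balanced N₁ K₁ → Periodic N₂ K₂ → Balanced (N₁ * N₂) (λ z → K₁ z · K₂ z)
balanced-*ˡ {N₁} {N₂} {K₁} {K₂} c (n , nz , t , bal) per = n , nz , + N₂ · t , λ m unit y →
  (sumL-cong (upTo n) λ τ → cong₂ _·_ (cong K₁ (l y (+ τ) m (+ N₂) t)) (per _ y (∣ℤ-cong (l2 y (+ τ) m (+ N₂) t) (mulʳ∣ (+ τ · (m · t)) refl∣))) ∙ ·-comm _ (K₂ y)) ∙
    sumL-* (upTo n) (K₂ y) _ ∙ cong (K₂ y ·_) (bal (m · + N₂) (λ pr d e → [ unit pr (∣-trans d (divides N₂ (*-comm N₁ N₂))) , (λ e' → <⇒≢ (nonTrivial⇒n>1 _ {{prime⇒nonTrivial pr}}) (sym (c (d , pos∣⁻¹ e')))) ]′ (prime-∣ℤ-* pr m (+ N₂) e)) y) ∙ ·-zeroʳ (K₂ y)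
  where
  l : ∀ y τ m n t → y ⊕ τ · (m · (n · t)) ≡ y ⊕ τ · ((m · n) · t)
  l = ring
  l2 : ∀ y τ m n t → n · (τ · (m · t)) ≡ (y ⊕ τ · (m · (n · t))) - y; l2 = ring

balanced-*ʳ : ∀ {N₁ N₂ K₁ K₂} → Coprime N₁ N₂ → Periodic N₁ K₁ → Balanced N₂ K₂ → Balanced (N₁ * N₂) (λ z → K₁ z · K₂ z)
balanced-*ʳ {N₁} {N₂} {K₁} {K₂} c per bal with balanced-*ˡ {K₁ = K₂} {K₂ = K₁} (Cop′.sym c) bal per
... | n , nz , t , b = n , nz , t , λ m unit y → (sumL-cong (upTo n) λ τ → ·-comm (K₁ (y ⊕ + τ · (m · t))) (K₂ (y ⊕ + τ · (m · t)))) ∙ b m (λ {π} pr d → unit pr (subst (π ∣_) (*-comm N₂ N₁) d)) y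

-- The kernels of prime powers

data Lv : Set where
  l0 l1 l2 : Lv

exponent : Lv → ℕ
exponent l0 = 0
exponent l1 = 1
exponent l2 = 2

-- Ramanujan sums, that is, sums over the primitive roots of unity of order p^l: c_p(z) at `l1`, and
-- c_{p²}(z) divided by p at `l2`.
kern : ℕ → Lv → ℤ → ℤ
kern p l0 z = + 1
kern p l1 z = + p · δ p z - + 1
kern p l2 z = + p · δ (p ^ 2) z - δ p z

p∣p^2 : ∀ p → + p ∣ℤ + (p ^ 2)
p∣p^2 p = pos∣ (divides p (cong (p *_) (*-identityʳ p)))

δ-periodic : ∀ {m N} → + m ∣ℤ + N → Periodic N (δ m)
δ-periodic d z z' e = δ-≡ z z' (trans∣ d e)

kern-periodic : ∀ p l → Periodic (p ^ 2) (kern p l)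
kern-periodic p l0 z z' d = refl
kern-periodic p l1 z z' d = cong (λ w → + p · w - + 1) (δ-periodic (p∣p^2 p) z z' d)
kern-periodic p l2 z z' d = cong₂ (λ w v → + p · w - v) (δ-periodic refl∣ z z' d) (δ-periodic (p∣p^2 p) z z' d)

δ-even : ∀ N → Even (δ N)
δ-even N z = δ-⇔ (λ d → subst (+ N ∣ℤ_) (neg-involutive z) (neg∣ d)) neg∣

kern-even : ∀ p l → Even (kern p l)
kern-even p l0 z = refl
kern-even p l1 z = cong (λ w → + p · w - + 1) (δ-even p z)
kern-even p l2 z = cong₂ (λ w v → + p · w - v) (δ-even (p ^ 2) z) (δ-even p z)

module PrimeKernel {p : ℕ} (pr : Prime p) where
  instance
    p≢0 : NonZero p; p≢0 = prime⇒nonZero pr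

  p≢0ℤ : + p ≢ + 0
  p≢0ℤ e = ≢-nonZero⁻¹ p (+-injective e)

  prime∤⇒coprime : ∀ x → ¬ (p ∣ x) → Coprime p x
  prime∤⇒coprime x p∤x {d} (d∣p , d∣x) with prime⇒irreducible pr d∣p
  ... | inj₁ e = e
  ... | inj₂ refl = ⊥-elim (p∤x d∣x)

  inverse : ∀ x → ¬ (+ p ∣ℤ x) → ∃[ u ] (+ p ∣ℤ (u · x - + 1))
  inverse x p∤x with crt-unit p r {{p≢0}} (prime∤⇒coprime r λ d → p∤x (∣ℤ-cong (lem x (+ r)) (add∣ (mod-reduce p x) (pos∣ d))))
    where
    r = x %ℕ p
    lem : ∀ x r → (x - r) ⊕ r ≡ x; lem = ring
  ... | e , d , dividesℤ q e≡ = q , ∣ℤ-cong (lem (+ e) q x (+ r) e≡) (add∣ d (mulˡ∣ q (mod-reduce p x)))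
    where
    r = x %ℕ p
    l : ∀ q x r → (q · r - + 1) ⊕ q · (x - r) ≡ q · x - + 1; l = ring
    lem : ∀ e q x r → e ≡ q · r → (e - + 1) ⊕ q · (x - r) ≡ q · x - + 1
    lem e q x r refl = l q x r

  solve-linear : ∀ w x u s t → s ≡ - (u · w) → + p ∣ℤ (u · x - + 1) → + p ∣ℤ (s - t) → + p ∣ℤ (w ⊕ t · x)
  solve-linear w x u s t e d f = ∣ℤ-cong (cong (λ k → (- w) · (u · x - + 1) - x · (k - t)) e ∙ cong (_- x · (- (u · w) - t)) (lem₁ w u x) ∙ lem₂ w (u · w) x t) (sub∣ (mulˡ∣ (- w) d) (mulˡ∣ x f))
    where lem₁ : ∀ w u x → (- w) · (u · x - + 1) ≡ w - (u · w) · x; lem₁ = ring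
          lem₂ : ∀ w k x t → (w - k · x) - x · (- k - t) ≡ w ⊕ t · x; lem₂ = ring

  linear-sum : ∀ x → ¬ (+ p ∣ℤ x) → ∀ w → sumL (upTo p) (λ τ → δ p (w ⊕ + τ · x)) ≡ + 1
  linear-sum x p∤x w with inverse x p∤x
  ... | u , ux = sumL-single (upTo p) (Uniqueₚ.upTo⁺ p) (∈-upTo⁺ (n%ℕd<d s p)) others ∙ δ-yes hit
    where
    s = - (u · w)
    τ₀ = s %ℕ p
    hit : + p ∣ℤ (w ⊕ + τ₀ · x); hit = solve-linear w x u s (+ τ₀) refl ux (mod-reduce p s)
    others : ∀ τ → τ ∈L upTo p → τ ≢ τ₀ → δ p (w ⊕ + τ · x) ≡ + 0
    others τ m ne = δ-no λ d → [ (λ e → ne (small-∣ (∈-upTo⁻ m) (n%ℕd<d s p) e)) , p∤x ]′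
       (prime-∣ℤ-* pr (+ τ - + τ₀) x (∣ℤ-cong (lem w (+ τ) (+ τ₀) x) (sub∣ d hit)))
      where lem : ∀ w a b x → (w ⊕ a · x) - (w ⊕ b · x) ≡ (a - b) · x; lem = ring

  k1-sum : ∀ x → ¬ (+ p ∣ℤ x) → ∀ w → sumL (upTo p) (λ τ → kern p l1 (w ⊕ + τ · x)) ≡ + 0
  k1-sum x p∤x w = sumL-+ (upTo p) _ (λ _ → - + 1) ∙ cong₂ _⊕_ (sumL-* (upTo p) (+ p) _ ∙ cong (+ p ·_) (linear-sum x p∤x w))
     (sumL-const (upTo p) (- + 1) ∙ cong (λ k → + k · (- + 1)) (Lₚ.length-upTo p)) ∙ lem (+ p)
    where lem : ∀ n → n · + 1 ⊕ n · (- + 1) ≡ + 0; lem = ring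

  p²∣p* : ∀ w → + (p ^ 2) ∣ℤ (+ p · w) → + p ∣ℤ w
  p²∣p* w d = cancelˡ∣ (+ p) {+ p} {w} (∣ℤ-congˡ (cong (λ z → + (p * z)) (*-identityʳ p) ∙ pos-* p p) d)
    where ∣ℤ-congˡ : ∀ {a b c} → a ≡ b → a ∣ℤ c → b ∣ℤ c
          ∣ℤ-congˡ refl x = x

  p*∣p² : ∀ w → + p ∣ℤ w → + (p ^ 2) ∣ℤ (+ p · w)
  p*∣p² w (dividesℤ q refl) = dividesℤ q (lem (+ p) q ∙ cong (q ·_) (sym (pos-* p p) ∙ cong (λ z → + (p * z)) (sym (*-identityʳ p))))
    where lem : ∀ p q → p · (q · p) ≡ q · (p · p); lem = ring

  k2-p* : ∀ w → kern p l2 (+ p · w) ≡ kern p l1 w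
  k2-p* w = cong₂ (λ a b → + p · a - b) (δ-⇔ (p²∣p* w) (p*∣p² w)) (δ-yes (mulʳ∣ w refl∣))

  k2-p∤ : ∀ w → ¬ (+ p ∣ℤ w) → kern p l2 w ≡ + 0
  k2-p∤ w p∤w = cong₂ (λ a b → + p · a - b) (δ-no (λ d → p∤w (trans∣ (p∣p^2 p) d))) (δ-no p∤w) ∙ cong (_- + 0) (·-zeroʳ (+ p))

  -- The two cases of kern p l2: it is supported on the multiples of p, where it is kern p l1 of the quotient.
  k2-sum : ∀ x → ¬ (+ p ∣ℤ x) → ∀ w → sumL (upTo p) (λ τ → kern p l2 (w ⊕ + τ · (+ p · x))) ≡ + 0
  k2-sum x p∤x w = go (+ p ∣ℤ? w)
    where
    lem : ∀ q p t x → q · p ⊕ t · (p · x) ≡ p · (q ⊕ t · x); lem = ring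
    lem2 : ∀ w p t x → (w ⊕ t · (p · x)) - t · x · p ≡ w; lem2 = ring
    go : Dec (+ p ∣ℤ w) → _
    go (yes (dividesℤ q refl)) = (sumL-cong (upTo p) λ τ → cong (kern p l2) (lem q (+ p) (+ τ) x) ∙ k2-p* _) ∙ k1-sum x p∤x q
    go (no p∤w) = (sumL-cong (upTo p) λ τ → k2-p∤ _ λ d → p∤w (∣ℤ-cong (lem2 w (+ p) (+ τ) x) (sub∣ d (dividesℤ (+ τ · x) refl)))) ∙ sumL-0 (upTo p)

  -- If p ∣ x, all p - 1 terms are the kernel at y. Otherwise the terms for the multipliers 0, ...,
  -- p - 1 add up to zero, and the one left out, for 0, is the kernel at y.
  k1-units : ∀ x y → sumL (upTo (pred p)) (λ u → kern p l1 (y - + suc u · x)) ≡ kern p l1 x · kern p l1 y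
  k1-units x y = go (+ p ∣ℤ? x)
    where
    pred-p : suc (pred p) ≡ p; pred-p = suc-pred p
    go : Dec (+ p ∣ℤ x) → _
    go (yes d) = (sumL-cong (upTo (pred p)) λ u → cong (λ w → + p · w - + 1) (δ-≡ _ y (∣ℤ-cong (l y (+ suc u) x) (mulˡ∣ (- + suc u) d)))) ∙
        sumL-const (upTo (pred p)) (kern p l1 y) ∙ cong (_· kern p l1 y) (cong +_ (Lₚ.length-upTo (pred p)) ∙
          l2' (+ pred p) ∙ cong (λ k → + k - + 1) pred-p ∙ sym (cong (λ w → + p · w - + 1) (δ-yes d) ∙ cong (_- + 1) (·-identityʳ (+ p))))
      where l : ∀ y u x → (- u) · x ≡ (y - u · x) - y; l = ring
            l2' : ∀ m → m ≡ (+ 1 ⊕ m) - + 1; l2' = ring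
    go (no nd) = l3 (kern p l1 y) _ (cong (λ z → kern p l1 z ⊕ rest) (l4 y x) ∙ sym (sumL-upTo-suc (pred p) (λ u → kern p l1 (y - + u · x))) ∙
        cong (λ k → sumL (upTo k) (λ u → kern p l1 (y - + u · x))) pred-p ∙
        (sumL-cong (upTo p) λ u → cong (kern p l1) (l5 y (+ u) x)) ∙ k1-sum (- x) (λ e → nd (subst (+ p ∣ℤ_) (neg-involutive x) (neg∣ e))) y) ∙
        sym (cong (λ w → (+ p · w - + 1) · kern p l1 y) (δ-no nd) ∙ cong (λ w → (w - + 1) · kern p l1 y) (·-zeroʳ (+ p)) ∙ -1*i≡-i (kern p l1 y))
      where
      rest = sumL (upTo (pred p)) (λ u → kern p l1 (y - + suc u · x))
      l3 : ∀ a b → a ⊕ b ≡ + 0 → b ≡ - a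
      l3 a b e = l6 a b ∙ cong (_- a) e ∙ +-identityˡ (- a)
        where l6 : ∀ a b → b ≡ (a ⊕ b) - a; l6 = ring
      l4 : ∀ y x → y ≡ y - + 0 · x; l4 = ring
      l5 : ∀ y u x → y - u · x ≡ y ⊕ u · (- x); l5 = ring

  -- Representatives of the units mod p²: a nonzero residue mod p plus a multiple of p.
  unit : ℕ → ℕ → ℕ
  unit u τ = suc u + τ * p

  unitsList : List ℕ
  unitsList = cartesianProductWith unit (upTo (pred p)) (upTo p)

  unit-ℤ : ∀ u τ → + unit u τ ≡ + suc u ⊕ + τ · + p
  unit-ℤ u τ = cong (λ z → + suc u ⊕ z) (pos-* τ p)

  units-ok : ∀ {w} → w ∈L unitsList → ∀ {π} → Prime π → π ∣ p ^ 2 → ¬ (π ∣ w)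
  units-ok {w} m {π} prπ d e with ∈-cartesianProductWith⁻ unit (upTo (pred p)) (upTo p) m
  ... | u , τ , mu , mτ , refl with prime⇒irreducible pr (prime∣^ prπ p 2 d)
  ...   | inj₁ refl = <-irrefl refl (nonTrivial⇒n>1 1 {{prime⇒nonTrivial prπ}})
  ...   | inj₂ refl = <⇒≱ (subst (suc u <_) (suc-pred p) (s≤s (∈-upTo⁻ mu))) (∣⇒≤ (pos∣⁻¹ (∣ℤ-cong (cong (_- + τ · + p) (unit-ℤ u τ) ∙ l (+ suc u) (+ τ · + p)) (sub∣ (pos∣ e) (dividesℤ (+ τ) refl)))))
    where l : ∀ a b → (a ⊕ b) - b ≡ a; l = ring

  scaleOf : Lv → ℤ
  scaleOf l0 = + length unitsList
  scaleOf _ = + p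

  scaleOf≢0 : ∀ l → scaleOf l ≢ + 0
  scaleOf≢0 l0 e = [ (λ z → <⇒≢ (nonTrivial⇒n>1 p {{prime⇒nonTrivial pr}}) (sym (sym (suc-pred p) ∙ cong suc (+-injective z)))) , p≢0ℤ ]′
      (i*j≡0⇒i≡0∨j≡0 (+ pred p) (sym size ∙ e))
    where
    size : + length unitsList ≡ + pred p · + p
    size = sym (sumL-const unitsList (+ 1) ∙ ·-identityʳ _) ∙ sumL-cartesian unit (upTo (pred p)) (upTo p) (λ _ → + 1) ∙
      (sumL-cong (upTo (pred p)) λ u → sumL-const (upTo p) (+ 1) ∙ ·-identityʳ _ ∙ cong +_ (Lₚ.length-upTo p)) ∙
        sumL-const (upTo (pred p)) (+ p) ∙ cong (λ k → + k · + p) (Lₚ.length-upTo (pred p))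
  scaleOf≢0 l1 = p≢0ℤ
  scaleOf≢0 l2 = p≢0ℤ

  arg : ∀ u τ x y → y - + unit u τ · x ≡ (y - + suc u · x) ⊕ + τ · (+ p · (- x))
  arg u τ x y = cong (λ w → y - w · x) (unit-ℤ u τ) ∙ l y (+ suc u) (+ τ) (+ p) x
    where l : ∀ y u t p x → y - (u ⊕ t · p) · x ≡ (y - u · x) ⊕ t · (p · (- x)); l = ring

  -- At `l2` with p ∤ x the sum over τ vanishes, and so does the right-hand side. With p ∣ x the
  -- terms do not depend on τ, and if p ∣ y too, dividing both arguments by p leads back to
  -- `k1-units`.
  average : ∀ l x y → sumL unitsList (λ u → kern p l (y - + u · x)) ≡ scaleOf l · (kern p l x · kern p l y)
  average l0 x y = sumL-const unitsList (+ 1) ∙ refl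
  average l1 x y = sumL-cartesian unit (upTo (pred p)) (upTo p) _ ∙ (sumL-cong (upTo (pred p)) λ u →
      (sumL-cong (upTo p) λ τ → cong (kern p l1) (arg u τ x y) ∙ cong (λ w → + p · w - + 1) (δ-shift (y - + suc u · x) _ (mulˡ∣ (+ τ) (mulʳ∣ (- x) refl∣)))) ∙
        sumL-const (upTo p) _ ∙ cong (λ k → + k · kern p l1 (y - + suc u · x)) (Lₚ.length-upTo p)) ∙
    sumL-* (upTo (pred p)) (+ p) _ ∙ cong (+ p ·_) (k1-units x y)
  average l2 x y = sumL-cartesian unit (upTo (pred p)) (upTo p) _ ∙ go (+ p ∣ℤ? x)
    where
    go : Dec (+ p ∣ℤ x) → _
    go (no nd) = (sumL-cong (upTo (pred p)) λ u → (sumL-cong (upTo p) λ τ → cong (kern p l2) (arg u τ x y)) ∙ k2-sum (- x) (λ e → nd (subst (+ p ∣ℤ_) (neg-involutive x) (neg∣ e))) (y - + suc u · x)) ∙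
         sumL-0 (upTo (pred p)) ∙ sym (cong (λ w → + p · (w · kern p l2 y)) (k2-p∤ x nd) ∙ cong (+ p ·_) (*-zeroˡ (kern p l2 y)) ∙ ·-zeroʳ (+ p))
    go (yes (dividesℤ x' refl)) = (sumL-cong (upTo (pred p)) λ u → (sumL-cong (upTo p) λ τ → kern-periodic p l2 _ (y - + suc u · (x' · + p))
            (∣ℤ-cong (l (y - + suc u · (x' · + p)) (+ p) (+ τ) x' ∙ cong (_- (y - + suc u · (x' · + p))) (sym (arg u τ (x' · + p) y))) (p*∣p² (+ p · (- (+ τ · x'))) (mulʳ∣ (- (+ τ · x')) refl∣)))) ∙
          sumL-const (upTo p) (kern p l2 (y - + suc u · (x' · + p))) ∙ cong (λ k → + k · kern p l2 (y - + suc u · (x' · + p))) (Lₚ.length-upTo p)) ∙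
       sumL-* (upTo (pred p)) (+ p) _ ∙ cong (+ p ·_) (inner (+ p ∣ℤ? y))
      where
      l : ∀ w p t x → p · (p · (- (t · x))) ≡ (w ⊕ t · (p · (- (x · p)))) - w; l = ring
      l3 : ∀ y' p u x → y' · p - u · (x · p) ≡ p · (y' - u · x); l3 = ring
      l4 : ∀ y u x p → (y - u · (x · p)) ⊕ u · x · p ≡ y; l4 = ring
      inner : Dec (+ p ∣ℤ y) → sumL (upTo (pred p)) (λ u → kern p l2 (y - + suc u · (x' · + p))) ≡ kern p l2 (x' · + p) · kern p l2 y
      inner (no nd) = (sumL-cong (upTo (pred p)) λ u → k2-p∤ _ λ d → nd (∣ℤ-cong (l4 y (+ suc u) x' (+ p)) (add∣ d (dividesℤ (+ suc u · x') refl)))) ∙ sumL-0 (upTo (pred p)) ∙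
         sym (cong (kern p l2 (x' · + p) ·_) (k2-p∤ y nd) ∙ ·-zeroʳ (kern p l2 (x' · + p)))
      inner (yes (dividesℤ y' refl)) = (sumL-cong (upTo (pred p)) λ u → cong (kern p l2) (l3 y' (+ p) (+ suc u) x') ∙ k2-p* _) ∙
         k1-units x' y' ∙ sym (cong₂ _·_ (cong (kern p l2) (·-comm x' (+ p)) ∙ k2-p* x') (cong (kern p l2) (·-comm y' (+ p)) ∙ k2-p* y'))

  prime-kernel : ∀ l → Kernel (p ^ 2) (kern p l)
  prime-kernel l = record
    { units = unitsList ; units-coprime = units-ok ; scale = scaleOf l ; scale≢0 = scaleOf≢0 l ; periodic = kern-periodic p l ; even = kern-even p l
    ; unit-average = average l ; prime-factor = p , pr , divides (p * 1) (*-comm p (p * 1)) }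

  prime-balanced : ∀ l → l ≢ l0 → Balanced (p ^ 2) (kern p l)
  prime-balanced l0 ne = ⊥-elim (ne refl)
  prime-balanced l1 _ = p , p≢0 , + 1 , λ m unit y → (sumL-cong (upTo p) λ τ → cong (λ w → kern p l1 (y ⊕ + τ · w)) (·-identityʳ m)) ∙ k1-sum m (unit pr (divides (p * 1) (*-comm p (p * 1)))) y
  prime-balanced l2 _ = p , p≢0 , + p , λ m unit y → (sumL-cong (upTo p) λ τ → cong (λ w → kern p l2 (y ⊕ + τ · w)) (·-comm m (+ p))) ∙ k2-sum m (unit pr (divides (p * 1) (*-comm p (p * 1)))) y

-- Divisibility by Φ as vanishing over cuboids

prime-divisor : ∀ n → n ≢ 0 → n ≢ 1 → ∃[ π ] Prime π × (π ∣ n)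
prime-divisor n n≢0 n≢1 = go (factorise n {{≢-nonZero n≢0}})
  where
  go : PrimeFactorisation n → _
  go record { factors = [] ; isFactorisation = e } = ⊥-elim (n≢1 e)
  go record { factors = π ∷ ps ; isFactorisation = refl ; factorsPrime = pr ∷ _ } = π , pr , m∣m*n (product ps)

primes-coprime : ∀ {m n} → m ≢ 0 → (∀ {π} → Prime π → π ∣ m → ¬ (π ∣ n)) → Coprime m n
primes-coprime {m} {n} m≢0 h {d} (d∣m , d∣n) with d ≟ 1
... | yes e = e
... | no d≢1 with prime-divisor d (λ { refl → m≢0 (0∣ d∣m) }) d≢1
  where 0∣ : ∀ {m} → 0 ∣ m → m ≡ 0
        0∣ (divides q e) = e ∙ *-zeroʳ q
...   | π , pr , π∣d = ⊥-elim (h pr (∣-trans π∣d d∣m) (∣-trans π∣d d∣n))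

prime-∣-prime : ∀ {π p} → Prime π → Prime p → π ∣ p → π ≡ p
prime-∣-prime prπ pr d with prime⇒irreducible pr d
... | inj₁ refl = ⊥-elim (<-irrefl refl (nonTrivial⇒n>1 1 {{prime⇒nonTrivial prπ}}))
... | inj₂ e = e

-- The two values of one coordinate that a cuboid compares. At `l2` they agree mod p, because Φ_{p²}
-- only relates those classes mod p² that lie in one class mod p.
TestZ : ℕ → Lv → Set
TestZ p l0 = ⊤
TestZ p l1 = ℤ × ℤ
TestZ p l2 = ∃[ x ] ∃[ x' ] (+ p ∣ℤ (x - x'))

dz : ∀ p l → TestZ p l → ℤ → ℤ
dz p l0 _ z = + 1
dz p l1 (x , x') z = δ p (x - z) - δ p (x' - z)
dz p l2 (x , x' , _) z = δ (p ^ 2) (x - z) - δ (p ^ 2) (x' - z)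

-- Φ_{p^l q^m r^n} ∣ X, as the vanishing of all alternating sums of the counting function over cuboids.
Vz : ∀ p q r (l m n : Lv) → List ℕ → Set
Vz p q r l m n X = ∀ t u s → sumL X (λ a → dz p l t (+ a) · (dz q m u (+ a) · dz r n s (+ a))) ≡ + 0

-- The kernels at x and x' differ by p times the difference of the indicators: the term -1 cancels
-- at `l1`, and -δ_p cancels at `l2` since x and x' agree mod p.
slot : ∀ {p} → Prime p → ∀ l X (G : ℕ → ℤ) → (∀ x → sumL X (λ a → kern p l (x - + a) · G a) ≡ + 0) →
  ∀ t → sumL X (λ a → dz p l t (+ a) · G a) ≡ + 0
slot {p} pr l X G h t = go l h t
  where
  difference : ∀ (f g : ℕ → ℤ) (k : ℤ → ℤ) x x' → (∀ a → k (x - + a) - k (x' - + a) ≡ + p · f a) →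
     (∀ x → sumL X (λ a → k (x - + a) · G a) ≡ + 0) → sumL X (λ a → f a · G a) ≡ + 0
  difference f _ k x x' e h = ·-cancelˡ-≡ (+ p) _ _ {{prime⇒nonZero pr}} (sym (sumL-* X (+ p) _) ∙
     (sumL-cong X λ a → sym (·-assoc (+ p) (f a) (G a)) ∙ cong (_· G a) (sym (e a)) ∙ lem (k (x - + a)) (k (x' - + a)) (G a)) ∙
     sumL-+ X _ _ ∙ cong₂ _⊕_ (h x) (sumL-* X (- + 1) _ ∙ cong ((- + 1) ·_) (h x')) ∙ sym (·-zeroʳ (+ p)))
    where lem : ∀ a b g → (a - b) · g ≡ a · g ⊕ (- + 1) · (b · g); lem = ring
  go : ∀ l → (∀ x → sumL X (λ a → kern p l (x - + a) · G a) ≡ + 0) → ∀ t → sumL X (λ a → dz p l t (+ a) · G a) ≡ + 0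
  go l0 h t = h (+ 0)
  go l1 h (x , x') = difference _ G (kern p l1) x x' (λ a → lem (+ p) (δ p (x - + a)) (δ p (x' - + a))) h
    where lem : ∀ p a b → (p · a - + 1) - (p · b - + 1) ≡ p · (a - b); lem = ring
  go l2 h (x , x' , d) = difference _ G (kern p l2) x x' (λ a → cong (λ w → (+ p · δ (p ^ 2) (x - + a) - w) - kern p l2 (x' - + a)) (δ-≡ _ _ (∣ℤ-cong (l3 x x' (+ a)) d)) ∙
       lem (+ p) (δ (p ^ 2) (x - + a)) (δ (p ^ 2) (x' - + a)) (δ p (x' - + a))) h
    where lem : ∀ p a b c → (p · a - c) - (p · b - c) ≡ p · (a - b); lem = ring
          l3 : ∀ x x' a → x - x' ≡ (x - a) - (x' - a); l3 = ring

shiftPoly : Lv → ℕ → Poly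
shiftPoly l0 T = 1P
shiftPoly _ T = XnMinus1 T

shiftDiff : Lv → ℕ → (ℤ → ℤ) → ℤ → ℤ
shiftDiff l0 T f z = f z
shiftDiff _ T f z = f (z - + T) - f z

Invariant : ℕ → (ℤ → ℤ) → Set
Invariant T g = ∀ z → g (z - + T) ≡ g z

act-shift : ∀ l T f g → Invariant T g → ∀ z → act (shiftPoly l T) (λ y → f y · g y) z ≡ shiftDiff l T f z · g z
act-shift l0 T f g inv z = ⊕-identityʳ _ ∙ ·-identityˡ _
act-shift l1 T f g inv z = act-Xn T _ z ∙ cong (λ w → f (z - + T) · w - f z · g z) (inv z) ∙ lem (f (z - + T)) (f z) (g z)
  where lem : ∀ a b g → a · g - b · g ≡ (a - b) · g; lem = ring
act-shift l2 T f g inv z = act-shift l1 T f g inv z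

shiftDiff-invariant : ∀ l T T' f → Invariant T' f → Invariant T' (shiftDiff l T f)
shiftDiff-invariant l0 T T' f inv z = inv z
shiftDiff-invariant l1 T T' f inv z = cong₂ _-_ (cong f (lem z (+ T) (+ T')) ∙ inv (z - + T)) (inv z)
  where lem : ∀ z t u → (z - u) - t ≡ (z - t) - u; lem = ring
shiftDiff-invariant l2 T T' f inv = shiftDiff-invariant l1 T T' f inv

δ-invariant : ∀ {m T} → m ∣ T → Invariant T (δ m)
δ-invariant {m} {T} d z = δ-shift z (- + T) (neg∣ (pos∣ d))

pow∣sq : ∀ p l → p ^ exponent l ∣ p ^ 2
pow∣sq p l0 = 1∣ _
pow∣sq p l1 = *-monoʳ-∣ p (1∣ _)
pow∣sq p l2 = ∣-refl

prime∣pow : ∀ {π} → Prime π → ∀ p → Prime p → ∀ k → π ∣ p ^ k → π ≡ p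
prime∣pow prπ p prp k d = prime-∣-prime prπ prp (prime∣^ prπ p k d)

record Distinct (p q r : ℕ) : Set where
  field
    p-prime : Prime p
    q-prime : Prime q
    r-prime : Prime r
    p≢q : p ≢ q
    p≢r : p ≢ r
    q≢r : q ≢ r

swap12 : ∀ {p q r} → Distinct p q r → Distinct q p r
swap12 D = record { p-prime = q-prime ; q-prime = p-prime ; r-prime = r-prime ; p≢q = p≢q ∘ sym ; p≢r = q≢r ; q≢r = p≢r }
  where open Distinct D

swap23 : ∀ {p q r} → Distinct p q r → Distinct p r q
swap23 D = record { p-prime = p-prime ; q-prime = r-prime ; r-prime = q-prime ; p≢q = p≢r ; p≢r = p≢q ; q≢r = q≢r ∘ sym }
  where open Distinct D

sq≢0 : ∀ {p} → Prime p → p ^ 2 ≢ 0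
sq≢0 {p} pr = ≢-nonZero⁻¹ (p ^ 2) {{m^n≢0 p 2 {{prime⇒nonZero pr}}}}

cofactor-coprime : ∀ {p q r} → Distinct p q r → Coprime (p ^ 2) (q ^ 2 * r ^ 2)
cofactor-coprime {p} {q} {r} D = primes-coprime (sq≢0 p-prime) λ {π} prπ d e →
   [ (λ e' → p≢q (sym (prime∣pow prπ p p-prime 2 d) ∙ prime∣pow prπ q q-prime 2 e'))
   , (λ e' → p≢r (sym (prime∣pow prπ p p-prime 2 d) ∙ prime∣pow prπ r r-prime 2 e')) ]′ (euclidsLemma (q ^ 2) (r ^ 2) prπ e)
  where open Distinct D

record CRT (p q r : ℕ) : Set where
  field
    E : ℕ
    E≡1 : + (p ^ 2) ∣ℤ (+ E - + 1)
    q∣E : q ^ 2 ∣ E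
    r∣E : r ^ 2 ∣ E

abstract
  crt₁ : ∀ {p q r} → Distinct p q r → CRT p q r
  crt₁ {p} {q} {r} D with crt-unit (p ^ 2) (q ^ 2 * r ^ 2) {{≢-nonZero (sq≢0 (Distinct.p-prime D))}} (cofactor-coprime D)
  ... | E , d , e = record { E = E ; E≡1 = d ; q∣E = ∣-trans (m∣m*n (r ^ 2)) (pos∣⁻¹ e) ; r∣E = ∣-trans (n∣m*n (q ^ 2)) (pos∣⁻¹ e) }

crt-term : ∀ {m} E x y → + m ∣ℤ (+ E - + 1) → + m ∣ℤ y → + m ∣ℤ ((x · + E ⊕ y) - x)
crt-term E x y d e = ∣ℤ-cong (lem x (+ E) y) (add∣ (mulˡ∣ x d) e)
  where lem : ∀ x E y → x · (E - + 1) ⊕ y ≡ (x · E ⊕ y) - x; lem = ring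

crt₃ : ∀ {p q r} → Distinct p q r → ∀ x y z → ∃[ w ] (+ (p ^ 2) ∣ℤ (w - x)) × (+ (q ^ 2) ∣ℤ (w - y)) × (+ (r ^ 2) ∣ℤ (w - z))
crt₃ {p} {q} {r} D x y z = w
  , crt-term P.E x _ P.E≡1 (add∣ (mulˡ∣ y (pos∣ Q.q∣E)) (mulˡ∣ z (pos∣ R.q∣E)))
  , ∣ℤ-cong (e1 x y z (+ P.E) (+ Q.E) (+ R.E)) (crt-term Q.E y (x · + P.E ⊕ z · + R.E) Q.E≡1 (add∣ (mulˡ∣ x (pos∣ P.q∣E)) (mulˡ∣ z (pos∣ R.r∣E))))
  , ∣ℤ-cong (e2 x y z (+ P.E) (+ Q.E) (+ R.E)) (crt-term R.E z (x · + P.E ⊕ y · + Q.E) R.E≡1 (add∣ (mulˡ∣ x (pos∣ P.r∣E)) (mulˡ∣ y (pos∣ Q.r∣E))))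
  where
  module P = CRT (crt₁ D)
  module Q = CRT (crt₁ (swap12 D))
  module R = CRT (crt₁ (swap12 (swap23 D)))
  w = x · + P.E ⊕ (y · + Q.E ⊕ z · + R.E)
  e1 : ∀ x y z a b c → (y · b ⊕ (x · a ⊕ z · c)) - y ≡ (x · a ⊕ (y · b ⊕ z · c)) - y; e1 = ring
  e2 : ∀ x y z a b c → (z · c ⊕ (x · a ⊕ y · b)) - z ≡ (x · a ⊕ (y · b ⊕ z · c)) - z; e2 = ring

-- A shift realising the test t in the first coordinate and trivial in the other two.
record Shift (p q r : ℕ) (l : Lv) (t : TestZ p l) : Set where
  field
    T : ℕ
    base : ℤ
    q∣T : q ^ 2 ∣ T
    r∣T : r ^ 2 ∣ T
    p∣T : l ≡ l2 → p ∣ T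
    value : ∀ w → + (p ^ 2) ∣ℤ (w - base) → ∀ a → shiftDiff l T (δ (p ^ exponent l)) (w - a) ≡ dz p l t a

δ-1-const : ∀ z → δ 1 z ≡ + 1
δ-1-const z = δ-yes (dividesℤ z (sym (·-identityʳ z)))

-- T is x' - x mod p² and 0 mod q² and r², so moving back by T leads from x' to x in the first
-- coordinate and leaves the others alone.
mkShift : ∀ {p q r} → Distinct p q r → ∀ l t → Shift p q r l t
mkShift {p} {q} {r} D l t = go l t
  where
  module P = CRT (crt₁ D)
  instance nz : NonZero (p ^ 2)
           nz = ≢-nonZero (sq≢0 (Distinct.p-prime D))
  T : ℤ → ℤ → ℕ
  T x x' = ((x' - x) %ℕ (p ^ 2)) * P.E
  T-≡ : ∀ x x' → + (p ^ 2) ∣ℤ (+ T x x' - (x' - x))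
  T-≡ x x' = ∣ℤ-cong (lem (+ s) (+ P.E) (x' - x) ∙ cong (_- (x' - x)) (sym (pos-* s P.E)))
     (sub∣ (mulˡ∣ (+ s) P.E≡1) (mod-reduce (p ^ 2) (x' - x)))
    where s = (x' - x) %ℕ (p ^ 2)
          lem : ∀ s E d → s · (E - + 1) - (d - s) ≡ s · E - d; lem = ring
  val : ∀ k (k∣ : k ∣ p ^ 2) x x' w → + (p ^ 2) ∣ℤ (w - x') → ∀ a → δ k ((w - a) - + T x x') - δ k (w - a) ≡ δ k (x - a) - δ k (x' - a)
  val k k∣ x x' w d a = cong₂ _-_ (δ-≡ _ _ (trans∣ (pos∣ k∣) (∣ℤ-cong (lem w a (+ T x x') x x') (sub∣ d (T-≡ x x')))))
       (δ-≡ _ _ (trans∣ (pos∣ k∣) (∣ℤ-cong (lem2 w a x') d)))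
    where lem : ∀ w a t x x' → (w - x') - (t - (x' - x)) ≡ ((w - a) - t) - (x - a); lem = ring
          lem2 : ∀ w a x' → w - x' ≡ (w - a) - (x' - a); lem2 = ring
  val1 : ∀ x x' w → + (p ^ 2) ∣ℤ (w - x') → ∀ a → δ (p ^ 1) ((w - a) - + T x x') - δ (p ^ 1) (w - a) ≡ δ p (x - a) - δ p (x' - a)
  val1 = subst (λ k → ∀ x x' w → + (p ^ 2) ∣ℤ (w - x') → ∀ a → δ k ((w - a) - + T x x') - δ k (w - a) ≡ δ p (x - a) - δ p (x' - a))
    (sym (*-identityʳ p)) (val p (∣m⇒∣m*n (p * 1) ∣-refl))
  go : ∀ l t → Shift p q r l t
  go l0 t = record { T = 0 ; base = + 0 ; q∣T = divides 0 refl ; r∣T = divides 0 refl ; p∣T = λ () ; value = λ w _ a → δ-1-const (w - a) }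
  go l1 (x , x') = record { T = T x x' ; base = x' ; q∣T = ∣n⇒∣m*n ((x' - x) %ℕ (p ^ 2)) P.q∣E ; r∣T = ∣n⇒∣m*n ((x' - x) %ℕ (p ^ 2)) P.r∣E ; p∣T = λ () ; value = val1 x x' }
  go l2 (x , x' , d) = record { T = T x x' ; base = x' ; q∣T = ∣n⇒∣m*n ((x' - x) %ℕ (p ^ 2)) P.q∣E ; r∣T = ∣n⇒∣m*n ((x' - x) %ℕ (p ^ 2)) P.r∣E
    ; p∣T = λ _ → pos∣⁻¹ (∣ℤ-cong (lem (+ T x x') x x') (sub∣ (trans∣ (p∣p^2 p) (T-≡ x x')) d)) ; value = val (p ^ 2) ∣-refl x x' }
    where lem : ∀ t x x' → (t - (x' - x)) - (x - x') ≡ t; lem = ring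

coprime-∣* : ∀ {a b n} → Coprime a b → a ∣ n → b ∣ n → a * b ∣ n
coprime-∣* {a} {b} {n} c a∣n (divides k refl) with coprime-divisor c (subst (a ∣_) (*-comm k b) a∣n)
... | divides j refl = divides j (*-assoc j a b)

δ-* : ∀ {a b} → Coprime a b → ∀ z → δ (a * b) z ≡ δ a z · δ b z
δ-* {a} {b} c z = go (+ a ∣ℤ? z) (+ b ∣ℤ? z)
  where
  go : Dec (+ a ∣ℤ z) → Dec (+ b ∣ℤ z) → _
  go (yes d) (yes e) = δ-yes (∣ᵤ⇒∣ {+ (a * b)} {z} (coprime-∣* c (∣⇒∣ᵤ d) (∣⇒∣ᵤ e))) ∙ sym (cong₂ _·_ (δ-yes d) (δ-yes e))
  go (no nd) _ = δ-no (λ d → nd (trans∣ (pos∣ (m∣m*n b)) d)) ∙ sym (cong (_· δ b z) (δ-no nd) ∙ *-zeroˡ (δ b z))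
  go _ (no nd) = δ-no (λ d → nd (trans∣ (pos∣ (n∣m*n a)) d)) ∙ sym (cong (δ a z ·_) (δ-no nd) ∙ ·-zeroʳ (δ a z))

modulus : ∀ (p q r : ℕ) (l m n : Lv) → ℕ
modulus p q r l m n = p ^ exponent l * q ^ exponent m * r ^ exponent n

pow≢0 : ∀ {p} → Prime p → ∀ k → p ^ k ≢ 0
pow≢0 {p} pr k = ≢-nonZero⁻¹ (p ^ k) {{m^n≢0 p k {{prime⇒nonZero pr}}}}

*≢0 : ∀ {a b} → a ≢ 0 → b ≢ 0 → a * b ≢ 0
*≢0 {a} a≢0 b≢0 e with m*n≡0⇒m≡0∨n≡0 a e
... | inj₁ z = a≢0 z
... | inj₂ z = b≢0 z

module _ {p q r : ℕ} (D : Distinct p q r) where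
  open Distinct D

  modulus≢0 : ∀ l m n → modulus p q r l m n ≢ 0
  modulus≢0 l m n = *≢0 (*≢0 (pow≢0 p-prime (exponent l)) (pow≢0 q-prime (exponent m))) (pow≢0 r-prime (exponent n))

  1≤modulus : ∀ l m n → 1 ≤ modulus p q r l m n
  1≤modulus l m n = n≢0⇒n>0 (modulus≢0 l m n)

  pow-coprime : ∀ {p q} → Prime p → Prime q → p ≢ q → ∀ a b → Coprime (p ^ a) (q ^ b)
  pow-coprime pp pq p≢q a b = primes-coprime (pow≢0 pp a) λ prπ d e → p≢q (sym (prime∣pow prπ _ pp a d) ∙ prime∣pow prπ _ pq b e)

  pow-coprime₂ : ∀ a b c → Coprime (p ^ a * q ^ b) (r ^ c)
  pow-coprime₂ a b c = primes-coprime (*≢0 (pow≢0 p-prime a) (pow≢0 q-prime b)) λ {π} prπ d e → [ (λ d' → p≢r (sym (prime∣pow prπ _ p-prime a d') ∙ prime∣pow prπ _ r-prime c e))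
     , (λ d' → q≢r (sym (prime∣pow prπ _ q-prime b d') ∙ prime∣pow prπ _ r-prime c e)) ]′ (euclidsLemma (p ^ a) (q ^ b) prπ d)

  δ-modulus : ∀ l m n z → δ (modulus p q r l m n) z ≡ δ (p ^ exponent l) z · (δ (q ^ exponent m) z · δ (r ^ exponent n) z)
  δ-modulus l m n z = δ-* (pow-coprime₂ (exponent l) (exponent m) (exponent n)) z ∙
    cong (_· δ (r ^ exponent n) z) (δ-* (pow-coprime p-prime q-prime p≢q (exponent l) (exponent m)) z) ∙ ·-assoc (δ (p ^ exponent l) z) _ _

act-three : ∀ l m n T₁ T₂ T₃ f₁ f₂ f₃ → Invariant T₁ f₂ → Invariant T₁ f₃ → Invariant T₂ f₁ → Invariant T₂ f₃ → Invariant T₃ f₁ → Invariant T₃ f₂ → ∀ z →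
  act (shiftPoly l T₁ *P (shiftPoly m T₂ *P shiftPoly n T₃)) (λ y → f₁ y · (f₂ y · f₃ y)) z ≡ shiftDiff l T₁ f₁ z · (shiftDiff m T₂ f₂ z · shiftDiff n T₃ f₃ z)
act-three l m n T₁ T₂ T₃ f₁ f₂ f₃ i12 i13 i21 i23 i31 i32 z =
  act-* (shiftPoly l T₁) _ _ z ∙ act-congᴷ (shiftPoly l T₁) (λ y → act-* (shiftPoly m T₂) (shiftPoly n T₃) _ y ∙ act-congᴷ (shiftPoly m T₂) step₃' y ∙ step₂' y) z ∙
    act-shift l T₁ f₁ (λ y → shiftDiff m T₂ f₂ y · shiftDiff n T₃ f₃ y) (λ y → cong₂ _·_ (shiftDiff-invariant m T₂ T₁ f₂ i12 y) (shiftDiff-invariant n T₃ T₁ f₃ i13 y)) z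
  where
  rot : ∀ a b c → a · (b · c) ≡ c · (a · b); rot = ring
  rot2 : ∀ a b c → c · (a · b) ≡ b · (a · c); rot2 = ring
  rot3 : ∀ a b c → b · (a · c) ≡ a · (b · c); rot3 = ring
  step₃' : ∀ y → act (shiftPoly n T₃) (λ y → f₁ y · (f₂ y · f₃ y)) y ≡ f₂ y · (f₁ y · shiftDiff n T₃ f₃ y)
  step₃' y = act-congᴷ (shiftPoly n T₃) (λ y → rot (f₁ y) (f₂ y) (f₃ y)) y ∙
    act-shift n T₃ f₃ (λ y → f₁ y · f₂ y) (λ y → cong₂ _·_ (i31 y) (i32 y)) y ∙ rot2 (f₁ y) (f₂ y) (shiftDiff n T₃ f₃ y)
  step₂' : ∀ y → act (shiftPoly m T₂) (λ y → f₂ y · (f₁ y · shiftDiff n T₃ f₃ y)) y ≡ f₁ y · (shiftDiff m T₂ f₂ y · shiftDiff n T₃ f₃ y)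
  step₂' y = act-shift m T₂ f₂ (λ y → f₁ y · shiftDiff n T₃ f₃ y) (λ y → cong₂ _·_ (i21 y) (shiftDiff-invariant n T₃ T₂ f₃ i23 y)) y ∙ rot3 (f₁ y) (shiftDiff m T₂ f₂ y) (shiftDiff n T₃ f₃ y)

record Admissible (p q r : ℕ) (l : Lv) (T : ℕ) : Set where
  constructor adm
  field
    q∣ : q ^ 2 ∣ T
    r∣ : r ^ 2 ∣ T
    p∣ : l ≡ l2 → p ∣ T

-- S is the product of the X^T - 1 over the nonzero levels and acts on `δ d` as the alternating sum
-- over a cuboid with sides T. Admissibility makes S a multiple of Φ_e for all proper divisors e of
-- d; sides that are not multiples of d keep S coprime to Φ_d. The two directions of the criterion
-- use one property each.
module Divisibility {p q r : ℕ} (D : Distinct p q r) (l m n : Lv) (T₁ T₂ T₃ : ℕ)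
  (a₁ : Admissible p q r l T₁) (a₂ : Admissible q p r m T₂) (a₃ : Admissible r p q n T₃) where
  open Distinct D
  module A₁ = Admissible a₁
  module A₂ = Admissible a₂
  module A₃ = Admissible a₃

  d : ℕ
  d = modulus p q r l m n

  S : Poly
  S = shiftPoly l T₁ *P (shiftPoly m T₂ *P shiftPoly n T₃)

  inv : ∀ {q T} m → q ^ 2 ∣ T → Invariant T (δ (q ^ exponent m))
  inv {q} m q∣ = δ-invariant (∣-trans (pow∣sq q m) q∣)

  act-S : ∀ z → act S (δ d) z ≡ shiftDiff l T₁ (δ (p ^ exponent l)) z · (shiftDiff m T₂ (δ (q ^ exponent m)) z · shiftDiff n T₃ (δ (r ^ exponent n)) z)
  act-S z = act-congᴷ S (δ-modulus D l m n) z ∙ act-three l m n T₁ T₂ T₃ _ _ _ (inv m A₁.q∣) (inv n A₁.r∣) (inv l A₂.q∣) (inv n A₂.r∣) (inv l A₃.q∣) (inv m A₃.r∣) z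

  slot∣S : ∀ l' → l' ≢ l0 → ∀ T {e} → e ∣ T → XnMinus1 e ∣P shiftPoly l' T
  slot∣S l0 ne T _ = ⊥-elim (ne refl)
  slot∣S l1 _ T e∣ = Xn-∣ e∣
  slot∣S l2 _ T e∣ = Xn-∣ e∣

  quotient∣T : ∀ {p q r} → Distinct p q r → ∀ l m n {T e k} → Admissible p q r l T → (p ^ exponent l) * (q ^ exponent m * r ^ exponent n) ≡ k * p * e → p ∣ p ^ exponent l → (l ≢ l0) × (e ∣ T)
  quotient∣T {p} {q} {r} D l m n {T} {e} {k} ad eq' dv = go l ad eq' dv
    where
    module D = Distinct D
    instance nzp = prime⇒nonZero D.p-prime
    qr∣T : q ^ 2 ∣ T → r ^ 2 ∣ T → q ^ exponent m * r ^ exponent n ∣ T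
    qr∣T a b = coprime-∣* (pow-coprime D D.q-prime D.r-prime D.q≢r (exponent m) (exponent n)) (∣-trans (pow∣sq q m) a) (∣-trans (pow∣sq r n) b)
    go : ∀ l → Admissible p q r l T → (p ^ exponent l) * (q ^ exponent m * r ^ exponent n) ≡ k * p * e → p ∣ p ^ exponent l → (l ≢ l0) × (e ∣ T)
    go l0 _ _ d = ⊥-elim (<⇒≱ (nonTrivial⇒n>1 p {{prime⇒nonTrivial D.p-prime}}) (∣⇒≤ d))
    go l1 ad' eq'' _ = (λ ()) , ∣-trans (divides k (*-cancelˡ-≡ _ _ p (cong (_* _) (sym (*-identityʳ p)) ∙ eq'' ∙ lem k p e))) (qr∣T (Admissible.q∣ ad') (Admissible.r∣ ad'))
      where lem : ∀ k p e → k * p * e ≡ p * (k * e)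
            lem k p e = cong (_* e) (*-comm k p) ∙ *-assoc p k e
    go l2 ad' eq'' _ = (λ ()) , ∣-trans (divides k (*-cancelˡ-≡ _ _ p (sym (*-assoc p p _) ∙ cong (λ z → p * z * _) (sym (*-identityʳ p)) ∙ eq'' ∙ lem k p e)))
        (coprime-∣* (primes-coprime (λ z → pow≢0 D.p-prime 1 (*-identityʳ p ∙ z)) λ prπ d' e' → [ (λ x → D.p≢q (sym (prime-∣-prime prπ D.p-prime d') ∙ prime∣pow prπ _ D.q-prime (exponent m) x))
             , (λ x → D.p≢r (sym (prime-∣-prime prπ D.p-prime d') ∙ prime∣pow prπ _ D.r-prime (exponent n) x)) ]′ (euclidsLemma (q ^ exponent m) (r ^ exponent n) prπ e'))
           (Admissible.p∣ ad' refl) (qr∣T (Admissible.q∣ ad') (Admissible.r∣ ad')))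
      where lem : ∀ k p e → k * p * e ≡ p * (k * e)
            lem k p e = cong (_* e) (*-comm k p) ∙ *-assoc p k e

  prime∣pow⇒ : ∀ {π p} → Prime π → Prime p → ∀ k → π ∣ p ^ k → (π ≡ p) × (p ∣ p ^ k)
  prime∣pow⇒ prπ prp k d with prime∣pow prπ _ prp k d
  ... | refl = refl , d

  -- A proper divisor of d divides d/π for some prime π, hence one of the shifts.
  proper∣S : ∀ e → e ∣ d → e ≢ d → XnMinus1 e ∣P S
  proper∣S e (divides k d≡ke) e≢d with prime-divisor k (λ { refl → modulus≢0 D l m n d≡ke }) (λ { refl → e≢d (sym (d≡ke ∙ *-identityˡ e)) })
  ... | π , prπ , divides j refl = [ (λ x → [ case₁ , case₂ ]′ (euclidsLemma (p ^ exponent l) (q ^ exponent m) prπ x)) , case₃ ]′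
        (euclidsLemma (p ^ exponent l * q ^ exponent m) (r ^ exponent n) prπ (divides (j * e) (d≡ke ∙ *-assoc j π e ∙ cong (j *_) (*-comm π e) ∙ sym (*-assoc j e π))))
    where
    P' = p ^ exponent l ; Q' = q ^ exponent m ; R' = r ^ exponent n
    case₁ : π ∣ P' → XnMinus1 e ∣P S
    case₁ x with prime∣pow⇒ prπ p-prime (exponent l) x
    ... | refl , y = let (ne , e∣) = quotient∣T D l m n {k = j} a₁ (sym (*-assoc P' Q' R') ∙ d≡ke) y in ∣P-*ʳ (shiftPoly m T₂ *P shiftPoly n T₃) (slot∣S l ne T₁ e∣)
    case₂ : π ∣ Q' → XnMinus1 e ∣P S
    case₂ x with prime∣pow⇒ prπ q-prime (exponent m) x
    ... | refl , y = let (ne , e∣) = quotient∣T (swap12 D) m l n {k = j} a₂ (sym (*-assoc Q' P' R') ∙ cong (_* R') (*-comm Q' P') ∙ d≡ke) y in ∣P-*ˡ (shiftPoly l T₁) (∣P-*ʳ (shiftPoly n T₃) (slot∣S m ne T₂ e∣))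
    case₃ : π ∣ R' → XnMinus1 e ∣P S
    case₃ x with prime∣pow⇒ prπ r-prime (exponent n) x
    ... | refl , y = let (ne , e∣) = quotient∣T (swap12 (swap23 D)) n l m {k = j} a₃ (*-comm R' (P' * Q') ∙ d≡ke) y in ∣P-*ˡ (shiftPoly l T₁) (∣P-*ˡ (shiftPoly m T₂) (slot∣S n ne T₃ e∣))

  1≤d : 1 ≤ d
  1≤d = 1≤modulus D l m n

  -- The Φ_e for proper divisors e of d are pairwise coprime and divide S. So their product divides
  -- S, and it is the cofactor of Φ_d in X^d - 1.
  Xd∣ΦS : XnMinus1 d ∣P (Φ d *P S)
  Xd∣ΦS = W , *ˡ (Φ d) (proj₂ Ψ∣S) ⨾ lem (Φ d) W Ψ ⨾ *ˡ W (≋-sym (proj₂ (Φ-exact d 1≤d)))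
    where
    Ψ = Πd Φ (properDivisors d)
    lem : ∀ f w ψ → f *P (w *P ψ) ≋ w *P (f *P ψ); lem = Solver.solve-∀ polyACR
    Ψ∣S : Ψ ∣P S
    Ψ∣S = Πd-divides Φ (properDivisors d) (All.tabulate λ m → Φ-mon _ (proj₁ (∈-pd⁻ 1≤d m)))
      (allPairs-∈ (properDivisors d) (pd-unique d) λ m n → Φ-cop _ _ (proj₁ (∈-pd⁻ 1≤d m)) (proj₁ (∈-pd⁻ 1≤d n)))
      (All.tabulate λ m → let (1≤e , e<d , e∣d) = ∈-pd⁻ 1≤d m in ∣P-trans (Φ∣Xn (Φ-exact _ 1≤e)) (proper∣S _ e∣d (<⇒≢ e<d)))
    W = proj₁ Ψ∣S

  Φ∣⇒vanish : ∀ A → Φ d ∣P A → ∀ z → act A (act S (δ d)) z ≡ + 0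
  Φ∣⇒vanish A (Q , e) z = sym (act-* A S (δ d) z) ∙ act-≋ poly (δ d) z ∙ act-* (Q *P W) (XnMinus1 d) (δ d) z ∙ act-vanish (Q *P W) (Xn-δ d) z
    where
    W = proj₁ Xd∣ΦS
    poly : A *P S ≋ (Q *P W) *P XnMinus1 d; poly = *ʳ S e ⨾ *P-assoc Q (Φ d) S ⨾ *ˡ Q (proj₂ Xd∣ΦS) ⨾ ≋-sym (*P-assoc Q W (XnMinus1 d))

  -- The vanishing means X^d - 1 ∣ A S, so Φ_d ∣ A S. The Bézout identity of Φ_d and S then gives
  -- Φ_d ∣ c A, and c cancels.
  vanish⇒Φ∣ : (l ≢ l0 → ¬ (d ∣ T₁)) → (m ≢ l0 → ¬ (d ∣ T₂)) → (n ≢ l0 → ¬ (d ∣ T₃)) → ∀ A → (∀ z → act A (act S (δ d)) z ≡ + 0) → Φ d ∣P A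
  vanish⇒Φ∣ n₁ n₂ n₃ A h = mon-div-const (Φ-mon d 1≤d) C.c C.c≢0 A (∣P-cong combine (∣P-+ (∣P-*ʳ A (∣P-*ˡ C.u ∣P-refl)) (∣P-*ˡ C.v Φ∣AS)))
    where
    slot-cop : ∀ l T → (l ≢ l0 → ¬ (d ∣ T)) → Cop (Φ d) (shiftPoly l T)
    slot-cop l0 T _ = cop-1 (Φ d)
    slot-cop l1 T h = Φ-cop-Xn d T 1≤d (h λ ())
    slot-cop l2 T h = Φ-cop-Xn d T 1≤d (h λ ())
    C : Cop (Φ d) S; C = cop-* (slot-cop l T₁ n₁) (cop-* (slot-cop m T₂ n₂) (slot-cop n T₃ n₃))
    module C = Cop C
    Φ∣AS : Φ d ∣P (A *P S); Φ∣AS = ∣P-trans (Φ∣Xn (Φ-exact d 1≤d)) (δ⇒Xn∣ d 1≤d (A *P S) λ z → act-* A S (δ d) z ∙ h z)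
    lem : ∀ u f a v s → ((u *P f) *P a) +P (v *P (a *P s)) ≋ ((u *P f) +P (v *P s)) *P a; lem = Solver.solve-∀ polyACR
    combine : ((C.u *P Φ d) *P A) +P (C.v *P (A *P S)) ≋ constP C.c *P A; combine = lem C.u (Φ d) A C.v S ⨾ *ʳ A C.bezout

DividesMask⇒∣P : ∀ {M P} (A : Subset M) → P ∣P XnMinus1 M → DividesMask M P A → P ∣P mask A
DividesMask⇒∣P {M} {P} A (W , w) (Q , R , e) = Q +P (R *P W) , eq e ⨾ +ˡ (P *P Q) (*ʳ R w) ⨾ lem P Q W R
  where lem : ∀ p q w r → (p *P q) +P ((w *P p) *P r) ≋ (q +P (r *P w)) *P p
        lem = Solver.solve-∀ polyACR

∣P⇒DividesMask : ∀ {M P} (A : Subset M) → P ∣P mask A → DividesMask M P A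
∣P⇒DividesMask {M} {P} A (Q , e) = Q , [] , at (e ⨾ *P-comm Q P ⨾ ≋-sym (+ˡ (P *P Q) (*P-comm (XnMinus1 M) []) ⨾ PR.+-identityʳ (P *P Q)))

modulus-square : ∀ p q r l m n → modulus p q r l m n ∣ p ^ 2 * q ^ 2 * r ^ 2
modulus-square p q r l m n = *-pres-∣ (*-pres-∣ (pow∣sq p l) (pow∣sq q m)) (pow∣sq r n)

1≤⇒cyc∣ : ∀ {d M} → 1 ≤ d → d ∣ M → Φ d ∣P XnMinus1 M
1≤⇒cyc∣ 1≤d d∣M = ∣P-trans (Φ∣Xn (Φ-exact _ 1≤d)) (Xn-∣ d∣M)

module _ {p q r : ℕ} (D : Distinct p q r) {M : ℕ} (M≡ : M ≡ p ^ 2 * q ^ 2 * r ^ 2) where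
  open Distinct D

  modulus∣M : ∀ l m n → modulus p q r l m n ∣ M
  modulus∣M l m n = subst (modulus p q r l m n ∣_) (sym M≡) (modulus-square p q r l m n)

  CycDiv⇒Φ∣ : ∀ l m n (A : Subset M) → CycDiv M (modulus p q r l m n) A → Φ (modulus p q r l m n) ∣P mask A
  CycDiv⇒Φ∣ l m n A = DividesMask⇒∣P A (1≤⇒cyc∣ (1≤modulus D l m n) (modulus∣M l m n))

  shift-adm : ∀ {p q r} {D : Distinct p q r} {l t} (s : Shift p q r l t) → Admissible p q r l (Shift.T s)
  shift-adm s = adm (Shift.q∣T s) (Shift.r∣T s) (Shift.p∣T s)

  -- Every cuboid arises from shifts that are trivial in two coordinates, based at a point whose
  -- residues are prescribed by the Chinese remainder theorem.
  Φ∣⇒Vz : ∀ l m n (A : Subset M) → Φ (modulus p q r l m n) ∣P mask A → Vz p q r l m n (els A)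
  Φ∣⇒Vz l m n A h t u s = sumL-cong (els A) pointwise ∙ sym (act-mask A (act Dv.S (δ Dv.d)) w) ∙ Dv.Φ∣⇒vanish (mask A) h w
    where
    s₁ = mkShift D l t
    s₂ = mkShift (swap12 D) m u
    s₃ = mkShift (swap12 (swap23 D)) n s
    module Dv = Divisibility D l m n (Shift.T s₁) (Shift.T s₂) (Shift.T s₃) (shift-adm {D = D} s₁) (shift-adm {D = swap12 D} s₂) (shift-adm {D = swap12 (swap23 D)} s₃)
    W = crt₃ D (Shift.base s₁) (Shift.base s₂) (Shift.base s₃)
    w = proj₁ W
    pointwise : ∀ a → dz p l t (+ a) · (dz q m u (+ a) · dz r n s (+ a)) ≡ act Dv.S (δ Dv.d) (w - + a)
    pointwise a = sym (Dv.act-S (w - + a) ∙ cong₂ _·_ (Shift.value s₁ w (proj₁ (proj₂ W)) (+ a)) (cong₂ _·_ (Shift.value s₂ w (proj₁ (proj₂ (proj₂ W))) (+ a)) (Shift.value s₃ w (proj₂ (proj₂ (proj₂ W))) (+ a))))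

  private
    unitShift : ∀ (p q r : ℕ) → Lv → ℕ
    unitShift p q r l2 = p * (q ^ 2 * r ^ 2)
    unitShift p q r _ = q ^ 2 * r ^ 2

    unitShift-adm : ∀ p q r l → Admissible p q r l (unitShift p q r l)
    unitShift-adm p q r l0 = adm (m∣m*n (r ^ 2)) (n∣m*n (q ^ 2)) (λ ())
    unitShift-adm p q r l1 = adm (m∣m*n (r ^ 2)) (n∣m*n (q ^ 2)) (λ ())
    unitShift-adm p q r l2 = adm (∣n⇒∣m*n p (m∣m*n (r ^ 2))) (∣n⇒∣m*n p (n∣m*n (q ^ 2))) (λ _ → m∣m*n (q ^ 2 * r ^ 2))

    unitShift-∤ : ∀ {p q r} → Distinct p q r → ∀ l → l ≢ l0 → ∀ {d} → p ^ exponent l ∣ d → ¬ (d ∣ unitShift p q r l)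
    unitShift-∤ D l0 ne = ⊥-elim (ne refl)
    unitShift-∤ {p} {q} {r} D l ne {d} pl∣d d∣ = no-p (go l ne (∣-trans pl∣d d∣))
      where
      module D = Distinct D
      no-p : ¬ (p ∣ q ^ 2 * r ^ 2)
      no-p x = [ (λ y → D.p≢q (prime∣pow D.p-prime q D.q-prime 2 y)) , (λ y → D.p≢r (prime∣pow D.p-prime r D.r-prime 2 y)) ]′ (euclidsLemma (q ^ 2) (r ^ 2) D.p-prime x)
      go : ∀ l → l ≢ l0 → p ^ exponent l ∣ unitShift p q r l → p ∣ q ^ 2 * r ^ 2
      go l0 ne _ = ⊥-elim (ne refl)
      go l1 _ x = ∣-trans (m∣m*n 1) x
      go l2 _ x = *-cancelˡ-∣ p {{prime⇒nonZero D.p-prime}} (∣-trans (*-monoʳ-∣ p (m∣m*n 1)) x)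

    unitTest : ∀ p q r l → ℤ → TestZ p l
    unitTest p q r l0 z = tt
    unitTest p q r l1 z = z - + unitShift p q r l1 , z
    unitTest p q r l2 z = z - + unitShift p q r l2 , z , ∣ℤ-cong (lem z (+ unitShift p q r l2)) (neg∣ (pos∣ (m∣m*n (q ^ 2 * r ^ 2))))
      where lem : ∀ z T → - T ≡ (z - T) - z; lem = ring

    unitTest-value : ∀ p q r l z a → shiftDiff l (unitShift p q r l) (δ (p ^ exponent l)) (z - a) ≡ dz p l (unitTest p q r l z) a
    unitTest-value p q r l0 z a = δ-1-const (z - a)
    unitTest-value p q r l1 z a rewrite *-identityʳ p = cong (λ w → δ p w - δ p (z - a)) (lem z a (+ (q ^ 2 * r ^ 2)))
      where lem : ∀ z a T → (z - a) - T ≡ (z - T) - a; lem = ring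
    unitTest-value p q r l2 z a = cong (λ w → δ (p ^ 2) w - δ (p ^ 2) (z - a)) (lem z a (+ unitShift p q r l2))
      where lem : ∀ z a T → (z - a) - T ≡ (z - T) - a; lem = ring

  -- The translates of one cuboid suffice. Its side for p is prime to p at `l1` and p times a number
  -- prime to p at `l2`, so that it is not a multiple of d.
  Vz⇒Φ∣ : ∀ l m n (A : Subset M) → Vz p q r l m n (els A) → Φ (modulus p q r l m n) ∣P mask A
  Vz⇒Φ∣ l m n A h = Dv.vanish⇒Φ∣ (λ ne → unitShift-∤ D l ne (∣-trans (m∣m*n Q') (m∣m*n R'))) (λ ne → unitShift-∤ (swap12 D) m ne (∣-trans (n∣m*n P') (m∣m*n R')))
      (λ ne → unitShift-∤ (swap12 (swap23 D)) n ne (n∣m*n (P' * Q'))) (mask A) zero-at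
    where
    P' = p ^ exponent l ; Q' = q ^ exponent m ; R' = r ^ exponent n
    module Dv = Divisibility D l m n (unitShift p q r l) (unitShift q p r m) (unitShift r p q n) (unitShift-adm p q r l) (unitShift-adm q p r m) (unitShift-adm r p q n)
    zero-at : ∀ z → act (mask A) (act Dv.S (δ Dv.d)) z ≡ + 0
    zero-at z = act-mask A (act Dv.S (δ Dv.d)) z ∙ (sumL-cong (els A) λ a → Dv.act-S (z - + a) ∙ cong₂ _·_ (unitTest-value p q r l z (+ a)) (cong₂ _·_ (unitTest-value q p r m z (+ a)) (unitTest-value r p q n z (+ a)))) ∙
       h (unitTest p q r l z) (unitTest q p r m z) (unitTest r p q n z)

  CycDiv⇒Vz : ∀ l m n (A : Subset M) → CycDiv M (modulus p q r l m n) A → Vz p q r l m n (els A)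
  CycDiv⇒Vz l m n A h = Φ∣⇒Vz l m n A (CycDiv⇒Φ∣ l m n A h)

  Vz⇒CycDiv : ∀ l m n (A : Subset M) → Vz p q r l m n (els A) → CycDiv M (modulus p q r l m n) A
  Vz⇒CycDiv l m n A h = ∣P⇒DividesMask A (Vz⇒Φ∣ l m n A h)

module _ {p q r : ℕ} (D : Distinct p q r) (X : List ℕ) where
  open Distinct D

  kernels⇒Vz : ∀ l m n → (∀ x y z → sumL X (λ a → kern p l (x - + a) · (kern q m (y - + a) · kern r n (z - + a))) ≡ + 0) → Vz p q r l m n X
  kernels⇒Vz l m n h t u s = slot p-prime l X _ (λ x → (sumL-cong X λ a → l₁ (kern p l (x - + a)) (dz q m u (+ a)) (dz r n s (+ a))) ∙
      slot q-prime m X _ (λ y → (sumL-cong X λ a → l₂ (kern q m (y - + a)) (kern p l (x - + a)) (dz r n s (+ a))) ∙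
        slot r-prime n X _ (λ z → (sumL-cong X λ a → l₃ (kern r n (z - + a)) (kern p l (x - + a)) (kern q m (y - + a))) ∙ h x y z) s) u) t
    where
    l₁ : ∀ a b c → a · (b · c) ≡ b · (a · c); l₁ = ring
    l₂ : ∀ b a c → b · (a · c) ≡ c · (a · b); l₂ = ring
    l₃ : ∀ c a b → c · (a · b) ≡ a · (b · c); l₃ = ring

  -- One argument w serves the three coordinates, as its residues mod p², q² and r² can be
  -- prescribed independently.
  vanish⇒Vz : ∀ l m n → conv-vanishes X (λ z → kern p l z · kern q m z · kern r n z) → Vz p q r l m n X
  vanish⇒Vz l m n h = kernels⇒Vz l m n λ x y z → let (w , wx , wy , wz) = crt₃ D x y z in
    (sumL-cong X λ a → cong₂ _·_ (kern-periodic p l _ _ (cl w x wx a)) (cong₂ _·_ (kern-periodic q m _ _ (cl w y wy a)) (kern-periodic r n _ _ (cl w z wz a))) ∙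
        sym (·-assoc (kern p l (w - + a)) (kern q m (w - + a)) (kern r n (w - + a)))) ∙ h w
    where
    cl : ∀ {N} w x → + N ∣ℤ (w - x) → ∀ a → + N ∣ℤ ((x - + a) - (w - + a))
    cl w x d a = ∣ℤ-cong (lem w x (+ a)) (neg∣ d)
      where lem : ∀ w x a → - (w - x) ≡ (x - a) - (w - a); lem = ring

sqnz : ∀ {p} → Prime p → NonZero (p ^ 2)
sqnz pr = ≢-nonZero (sq≢0 pr)

-- The kernel is the product of the three prime kernels; it is balanced as soon as one level is
-- nonzero, which is where s = 1 is excluded.
Vz-dichotomy : ∀ {p q r} → Distinct p q r → ∀ X Y → TileL (p ^ 2 * q ^ 2 * r ^ 2) X Y → (∀ {π} → Prime π → π ∣ length X → π ∣ p ^ 2 * q ^ 2 * r ^ 2) →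
  ∀ l m n → ¬ (l ≡ l0 × m ≡ l0 × n ≡ l0) → Vz p q r l m n X ⊎ Vz p q r l m n Y
Vz-dichotomy {p} {q} {r} D X Y tile prX l m n ne = [ (λ h → inj₁ (vanish⇒Vz D X l m n h)) , (λ h → inj₂ (vanish⇒Vz D Y l m n h)) ]′ (dichotomy {X = X} {Y = Y} ker (bal l m n ne) tile prX)
  where
  open Distinct D
  instance
    n₁ = sqnz p-prime
    n₂ = sqnz q-prime
    n₃ = sqnz r-prime
    n₄ = m*n≢0 (p ^ 2) (q ^ 2)
    n₅ = m*n≢0 (p ^ 2 * q ^ 2) (r ^ 2)
  module P = PrimeKernel p-prime
  module Q = PrimeKernel q-prime
  module R = PrimeKernel r-prime
  c₁ : Coprime (p ^ 2) (q ^ 2)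
  c₁ = pow-coprime D p-prime q-prime p≢q 2 2
  c₂ : Coprime (p ^ 2 * q ^ 2) (r ^ 2)
  c₂ = pow-coprime₂ D 2 2 2
  kpq : Kernel (p ^ 2 * q ^ 2) (λ z → kern p l z · kern q m z)
  kpq = kernel-* c₁ (P.prime-kernel l) (Q.prime-kernel m)
  ker : Kernel (p ^ 2 * q ^ 2 * r ^ 2) (λ z → kern p l z · kern q m z · kern r n z)
  ker = kernel-* c₂ kpq (R.prime-kernel n)
  bal₁ : ∀ l m → ¬ (l ≡ l0 × m ≡ l0) → Balanced (p ^ 2 * q ^ 2) (λ z → kern p l z · kern q m z)
  bal₁ l0 l0 ne = ⊥-elim (ne (refl , refl))
  bal₁ l0 l1 ne = balanced-*ʳ {K₁ = kern p l0} {K₂ = kern q l1} c₁ (kern-periodic p l0) (Q.prime-balanced l1 λ ())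
  bal₁ l0 l2 ne = balanced-*ʳ {K₁ = kern p l0} {K₂ = kern q l2} c₁ (kern-periodic p l0) (Q.prime-balanced l2 λ ())
  bal₁ l1 m ne = balanced-*ˡ {K₁ = kern p l1} {K₂ = kern q m} c₁ (P.prime-balanced l1 λ ()) (kern-periodic q m)
  bal₁ l2 m ne = balanced-*ˡ {K₁ = kern p l2} {K₂ = kern q m} c₁ (P.prime-balanced l2 λ ()) (kern-periodic q m)
  bal : ∀ l m n → ¬ (l ≡ l0 × m ≡ l0 × n ≡ l0) → Balanced (p ^ 2 * q ^ 2 * r ^ 2) (λ z → kern p l z · kern q m z · kern r n z)
  bal l m l0 ne = balanced-*ˡ {K₁ = λ z → kern p l z · kern q m z} {K₂ = kern r l0} c₂ (bal₁ l m λ (a , b) → ne (a , b , refl)) (kern-periodic r l0)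
  bal l m l1 ne = balanced-*ʳ {K₁ = λ z → kern p l z · kern q m z} {K₂ = kern r l1} c₂ (Kernel.periodic (kernel-* c₁ (P.prime-kernel l) (Q.prime-kernel m))) (R.prime-balanced l1 λ ())
  bal l m l2 ne = balanced-*ʳ {K₁ = λ z → kern p l z · kern q m z} {K₂ = kern r l2} c₂ (Kernel.periodic (kernel-* c₁ (P.prime-kernel l) (Q.prime-kernel m))) (R.prime-balanced l2 λ ())

Vz-dichotomy₂ : ∀ {p q r} → Distinct p q r → ∀ X Y → TileL (q ^ 2 * r ^ 2) X Y → (∀ {π} → Prime π → π ∣ length X → π ∣ q ^ 2 * r ^ 2) →
  ∀ m n → ¬ (m ≡ l0 × n ≡ l0) → Vz p q r l0 m n X ⊎ Vz p q r l0 m n Y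
Vz-dichotomy₂ {p} {q} {r} D X Y tile prX m n ne = [ (λ h → inj₁ (fromQR X h)) , (λ h → inj₂ (fromQR Y h)) ]′ (dichotomy {X = X} {Y = Y} ker (bal m n ne) tile prX)
  where
  open Distinct D
  instance
    n₂ = sqnz q-prime
    n₃ = sqnz r-prime
    n₄ = m*n≢0 (q ^ 2) (r ^ 2)
  module Q = PrimeKernel q-prime
  module R = PrimeKernel r-prime
  c : Coprime (q ^ 2) (r ^ 2)
  c = pow-coprime D q-prime r-prime q≢r 2 2
  ker : Kernel (q ^ 2 * r ^ 2) (λ z → kern q m z · kern r n z)
  ker = kernel-* c (Q.prime-kernel m) (R.prime-kernel n)
  bal : ∀ m n → ¬ (m ≡ l0 × n ≡ l0) → Balanced (q ^ 2 * r ^ 2) (λ z → kern q m z · kern r n z)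
  bal l0 l0 ne = ⊥-elim (ne (refl , refl))
  bal l0 l1 ne = balanced-*ʳ {K₁ = kern q l0} {K₂ = kern r l1} c (kern-periodic q l0) (R.prime-balanced l1 λ ())
  bal l0 l2 ne = balanced-*ʳ {K₁ = kern q l0} {K₂ = kern r l2} c (kern-periodic q l0) (R.prime-balanced l2 λ ())
  bal l1 n ne = balanced-*ˡ {K₁ = kern q l1} {K₂ = kern r n} c (Q.prime-balanced l1 λ ()) (kern-periodic r n)
  bal l2 n ne = balanced-*ˡ {K₁ = kern q l2} {K₂ = kern r n} c (Q.prime-balanced l2 λ ()) (kern-periodic r n)
  fromQR : ∀ X → conv-vanishes X (λ z → kern q m z · kern r n z) → Vz p q r l0 m n X
  fromQR X h = vanish⇒Vz D X l0 m n λ z → (sumL-cong X λ a → cong (_· kern r n (z - + a)) (·-identityˡ (kern q m (z - + a)))) ∙ h z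

-- Finite sums

∑ : ∀ {n} → (Fin n → ℕ) → ℕ
∑ {zero} f = 0
∑ {suc n} f = f Fin.zero + ∑ (f ∘ Fin.suc)

∑-cong : ∀ {n} {f g : Fin n → ℕ} → (∀ i → f i ≡ g i) → ∑ f ≡ ∑ g
∑-cong {zero} h = refl
∑-cong {suc n} h = cong₂ _+_ (h Fin.zero) (∑-cong (h ∘ Fin.suc))

∑-+ : ∀ {n} (f g : Fin n → ℕ) → ∑ (λ i → f i + g i) ≡ ∑ f + ∑ g
∑-+ {zero} f g = refl
∑-+ {suc n} f g = cong (λ z → f Fin.zero + g Fin.zero + z) (∑-+ (f ∘ Fin.suc) (g ∘ Fin.suc)) ∙ lem (f Fin.zero) (g Fin.zero) _ _
  where lem : ∀ a b c d → a + b + (c + d) ≡ a + c + (b + d); lem = ringℕ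

∑-* : ∀ {n} k (f : Fin n → ℕ) → ∑ (λ i → k * f i) ≡ k * ∑ f
∑-* {zero} k f = sym (*-zeroʳ k)
∑-* {suc n} k f = cong (λ z → k * f Fin.zero + z) (∑-* k (f ∘ Fin.suc)) ∙ sym (*-distribˡ-+ k (f Fin.zero) _)

∑∑-* : ∀ {m n} k (f : Fin m → Fin n → ℕ) → ∑ (λ i → ∑ (λ j → k * f i j)) ≡ k * ∑ (λ i → ∑ (f i))
∑∑-* k f = (∑-cong λ i → ∑-* k (f i)) ∙ ∑-* k (λ i → ∑ (f i))

∑-const : ∀ n k → ∑ {n} (λ _ → k) ≡ n * k
∑-const zero k = refl
∑-const (suc n) k = cong (λ z → k + z) (∑-const n k)

∑-swap : ∀ {m n} (f : Fin m → Fin n → ℕ) → ∑ (λ i → ∑ (f i)) ≡ ∑ (λ j → ∑ (λ i → f i j))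
∑-swap {zero} {n} f = sym (∑-const n 0 ∙ *-zeroʳ n)
∑-swap {suc m} f = cong (λ z → ∑ (f Fin.zero) + z) (∑-swap (f ∘ Fin.suc)) ∙ sym (∑-+ (f Fin.zero) _)

∑-≥ : ∀ {n} (f : Fin n → ℕ) i → f i ≤ ∑ f
∑-≥ f Fin.zero = m≤m+n _ _
∑-≥ f (Fin.suc i) = ≤-trans (∑-≥ (f ∘ Fin.suc) i) (m≤n+m _ (f Fin.zero))

∑-≥₂ : ∀ {n} (f : Fin n → ℕ) {i j} → i ≢ j → f i + f j ≤ ∑ f
∑-≥₂ f {Fin.zero} {Fin.zero} ne = ⊥-elim (ne refl)
∑-≥₂ f {Fin.zero} {Fin.suc j} ne = +-monoʳ-≤ (f Fin.zero) (∑-≥ (f ∘ Fin.suc) j)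
∑-≥₂ f {Fin.suc i} {Fin.zero} ne = subst (_≤ ∑ f) (+-comm (f Fin.zero) _) (+-monoʳ-≤ (f Fin.zero) (∑-≥ (f ∘ Fin.suc) i))
∑-≥₂ f {Fin.suc i} {Fin.suc j} ne = ≤-trans (∑-≥₂ (f ∘ Fin.suc) (ne ∘ cong Fin.suc)) (m≤n+m _ (f Fin.zero))

∑-mono : ∀ {n} {f g : Fin n → ℕ} → (∀ i → f i ≤ g i) → ∑ f ≤ ∑ g
∑-mono {zero} h = z≤n
∑-mono {suc n} h = +-mono-≤ (h Fin.zero) (∑-mono (h ∘ Fin.suc))

∑-all-pos : ∀ {n} (f : Fin n → ℕ) → (∀ i → 1 ≤ f i) → n ≤ ∑ f
∑-all-pos {n} f h = subst (_≤ ∑ f) (∑-const n 1 ∙ *-identityʳ n) (∑-mono h)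

∑-strict : ∀ {n} (g : Fin n → ℕ) → (∀ i → 1 ≤ g i) → ∀ i → 1 < g i → n < ∑ g
∑-strict {suc n} g h Fin.zero lt = +-mono-≤ lt (∑-all-pos (g ∘ Fin.suc) (h ∘ Fin.suc))
∑-strict {suc n} g h (Fin.suc i) lt = +-mono-≤ (h Fin.zero) (∑-strict (g ∘ Fin.suc) (h ∘ Fin.suc) i lt)

∑-zero : ∀ {n} (f : Fin n → ℕ) → ∑ f ≡ 0 → ∀ i → f i ≡ 0
∑-zero f e i = n≤0⇒n≡0 (subst (f i ≤_) e (∑-≥ f i))

∑-0 : ∀ {n} {f : Fin n → ℕ} → (∀ i → f i ≡ 0) → ∑ f ≡ 0
∑-0 {n} h = ∑-cong h ∙ ∑-const n 0 ∙ *-zeroʳ n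

∑-pos : ∀ {n} (f : Fin n → ℕ) → 1 ≤ ∑ f → ∃[ i ] 1 ≤ f i
∑-pos {suc n} f h with f Fin.zero in e
... | suc k = Fin.zero , subst (1 ≤_) (sym e) (s≤s z≤n)
... | zero with ∑-pos (f ∘ Fin.suc) h
...   | i , p = Fin.suc i , p

∑-dominated : ∀ {n} (f : Fin n → ℕ) i → ∑ f ≤ f i → ∀ j → j ≢ i → f j ≡ 0
∑-dominated f i h j ne = n≤0⇒n≡0 (+-cancelˡ-≤ (f i) _ _ (subst (f i + f j ≤_) (sym (+-identityʳ (f i))) (≤-trans (∑-≥₂ f (ne ∘ sym)) h)))

∑-single : ∀ {n} (f : Fin n → ℕ) i → (∀ j → j ≢ i → f j ≡ 0) → ∑ f ≡ f i
∑-single {suc n} f Fin.zero h = cong (λ z → f Fin.zero + z) (∑-0 (λ j → h (Fin.suc j) λ ())) ∙ +-identityʳ _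
∑-single {suc n} f (Fin.suc i) h = cong₂ _+_ (h Fin.zero λ ()) (∑-single (f ∘ Fin.suc) i λ j ne → h (Fin.suc j) (ne ∘ Finₚ.suc-injective))

∑-const-≡ : ∀ {n} (f : Fin n → ℕ) i → (∀ j → f j ≡ f i) → ∑ f ≡ n * f i
∑-const-≡ {n} f i h = ∑-cong h ∙ ∑-const n (f i)

∑ℤ : ∀ {n} → (Fin n → ℤ) → ℤ
∑ℤ {zero} f = + 0
∑ℤ {suc n} f = f Fin.zero ⊕ ∑ℤ (f ∘ Fin.suc)

+∑ : ∀ {n} (f : Fin n → ℕ) → + ∑ f ≡ ∑ℤ (λ i → + f i)
+∑ {zero} f = refl
+∑ {suc n} f = cong (λ z → + f Fin.zero ⊕ z) (+∑ (f ∘ Fin.suc))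

∑ℤ-cong : ∀ {n} {f g : Fin n → ℤ} → (∀ i → f i ≡ g i) → ∑ℤ f ≡ ∑ℤ g
∑ℤ-cong {zero} h = refl
∑ℤ-cong {suc n} h = cong₂ _⊕_ (h Fin.zero) (∑ℤ-cong (h ∘ Fin.suc))

∑ℤ-sub : ∀ {n} (f g : Fin n → ℤ) → ∑ℤ (λ i → f i - g i) ≡ ∑ℤ f - ∑ℤ g
∑ℤ-sub {zero} f g = refl
∑ℤ-sub {suc n} f g = cong (λ z → (f Fin.zero - g Fin.zero) ⊕ z) (∑ℤ-sub (f ∘ Fin.suc) (g ∘ Fin.suc)) ∙ lem (f Fin.zero) (g Fin.zero) _ _
  where lem : ∀ a b c d → (a - b) ⊕ (c - d) ≡ (a ⊕ c) - (b ⊕ d); lem = ring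

∑ℤ-const : ∀ n k → ∑ℤ {n} (λ _ → k) ≡ + n · k
∑ℤ-const zero k = sym (*-zeroˡ k)
∑ℤ-const (suc n) k = cong (λ z → k ⊕ z) (∑ℤ-const n k) ∙ sym (suc-* (+ n) k)

constant-zero : ∀ {n} (f : Fin n → ℤ) → (∀ i j → f i ≡ f j) → ∑ℤ f ≡ + 0 → ∀ i → f i ≡ + 0
constant-zero {suc n} f h e i with i*j≡0⇒i≡0∨j≡0 (+ suc n) (sym (∑ℤ-const (suc n) (f i)) ∙ ∑ℤ-cong (λ j → h i j) ∙ e)
... | inj₂ z = z

-- Profiles: numbers of points in residue classes

Pos : ℕ → Lv → Set
Pos p l0 = ⊤
Pos p l1 = Fin p
Pos p l2 = Fin p × Fin p

Test : ℕ → Lv → Set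
Test p l0 = ⊤
Test p l1 = Fin p × Fin p
Test p l2 = Fin p × Fin p × Fin p

alt : ∀ {p} l → Test p l → (Pos p l → ℤ) → ℤ
alt l0 _ f = f tt
alt l1 (c , c') f = f c - f c'
alt l2 (c , σ , σ') f = f (c , σ) - f (c , σ')

alt-cong : ∀ {p} l t {f g : Pos p l → ℤ} → (∀ x → f x ≡ g x) → alt l t f ≡ alt l t g
alt-cong l0 t h = h tt
alt-cong l1 (c , c') h = cong₂ _-_ (h c) (h c')
alt-cong l2 (c , σ , σ') h = cong₂ _-_ (h (c , σ)) (h (c , σ'))

alt-sub : ∀ {p} l t (f g : Pos p l → ℤ) → alt l t (λ x → f x - g x) ≡ alt l t f - alt l t g
alt-sub l0 t f g = refl
alt-sub l1 (c , c') f g = lem (f c) (g c) (f c') (g c')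
  where lem : ∀ a b c d → (a - b) - (c - d) ≡ (a - c) - (b - d); lem = ring
alt-sub l2 (c , σ , σ') f g = alt-sub l1 (σ , σ') (λ x → f (c , x)) (λ x → g (c , x))

alt-+ : ∀ {p} l t (f g : Pos p l → ℤ) → alt l t (λ x → f x ⊕ g x) ≡ alt l t f ⊕ alt l t g
alt-+ l0 t f g = refl
alt-+ l1 (c , c') f g = lem (f c) (g c) (f c') (g c')
  where lem : ∀ a b c d → (a ⊕ b) - (c ⊕ d) ≡ (a - c) ⊕ (b - d); lem = ring
alt-+ l2 (c , σ , σ') f g = alt-+ l1 (σ , σ') (λ x → f (c , x)) (λ x → g (c , x))

alt-0 : ∀ {p} l t → alt {p} l t (λ _ → + 0) ≡ + 0
alt-0 l0 t = refl
alt-0 l1 t = refl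
alt-0 l2 t = refl

alt-swap : ∀ {p q} l m t u (f : Pos p l → Pos q m → ℤ) → alt l t (λ x → alt m u (f x)) ≡ alt m u (λ y → alt l t (λ x → f x y))
alt-swap l l0 t u f = refl
alt-swap l l1 t (v , v') f = alt-sub l t (λ x → f x v) (λ x → f x v')
alt-swap l l2 t (v , ψ , ψ') f = alt-sub l t (λ x → f x (v , ψ)) (λ x → f x (v , ψ'))

alt-∑ : ∀ {p n} l t (f : Pos p l → Fin n → ℤ) → alt l t (λ x → ∑ℤ (f x)) ≡ ∑ℤ (λ i → alt l t (λ x → f x i))
alt-∑ {n = zero} l t f = alt-0 l t
alt-∑ {n = suc n} l t f = alt-+ l t (λ x → f x Fin.zero) (λ x → ∑ℤ (f x ∘ Fin.suc)) ∙ cong (λ z → alt l t (λ x → f x Fin.zero) ⊕ z) (alt-∑ l t (λ x i → f x (Fin.suc i)))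

-- The numbers of points in the residue classes mod p^l, q^m, r^n; the pair (c , σ) stands for c + σ p mod p².
record Profile (p q r : ℕ) : Set where
  field
    N : ∀ l m n → Pos p l → Pos q m → Pos r n → ℕ
    p₀ : ∀ {m n y z} → N l0 m n tt y z ≡ ∑ (λ c → N l1 m n c y z)
    p₁ : ∀ {m n c y z} → N l1 m n c y z ≡ ∑ (λ σ → N l2 m n (c , σ) y z)
    q₀ : ∀ {l n x z} → N l l0 n x tt z ≡ ∑ (λ v → N l l1 n x v z)
    q₁ : ∀ {l n x v z} → N l l1 n x v z ≡ ∑ (λ ψ → N l l2 n x (v , ψ) z)
    r₀ : ∀ {l m x y} → N l m l0 x y tt ≡ ∑ (λ w → N l m l1 x y w)
    r₁ : ∀ {l m x y w} → N l m l1 x y w ≡ ∑ (λ ω → N l m l2 x y (w , ω))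

  total : ℕ
  total = N l0 l0 l0 tt tt tt

sw12 : ∀ {p q r} → Profile p q r → Profile q p r
sw12 P = record { N = λ m l n y x z → N l m n x y z ; p₀ = q₀ ; p₁ = q₁ ; q₀ = p₀ ; q₁ = p₁ ; r₀ = r₀ ; r₁ = r₁ }
  where open Profile P

sw23 : ∀ {p q r} → Profile p q r → Profile p r q
sw23 P = record { N = λ l n m x z y → N l m n x y z ; p₀ = p₀ ; p₁ = p₁ ; q₀ = r₀ ; q₁ = r₁ ; r₀ = q₀ ; r₁ = q₁ }
  where open Profile P

-- For the profile of a set: Φ with the exponents l, m, n divides its mask.
V : ∀ {p q r} → Profile p q r → Lv → Lv → Lv → Set
V P l m n = ∀ t u s → alt l t (λ x → alt m u (λ y → alt n s (λ z → + Profile.N P l m n x y z))) ≡ + 0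

V-sw12 : ∀ {p q r} (P : Profile p q r) l m n → V P l m n → V (sw12 P) m l n
V-sw12 P l m n h u t s = sym (alt-swap l m t u (λ x y → alt n s (λ z → + Profile.N P l m n x y z))) ∙ h t u s

V-sw23 : ∀ {p q r} (P : Profile p q r) l m n → V P l m n → V (sw23 P) l n m
V-sw23 P l m n h t s u = (alt-cong l t λ x → sym (alt-swap m n u s (λ y z → + Profile.N P l m n x y z))) ∙ h t u s

module _ {p q r : ℕ} (P : Profile p q r) (m n : Lv) (u : Test q m) (s : Test r n) where
  open Profile P

  slice : ∀ l → Pos p l → ℤ
  slice l x = alt m u (λ y → alt n s (λ z → + N l m n x y z))

  slice-∑ : ∀ {k l l'} (x : Pos p l) (x' : Fin k → Pos p l') → (∀ {y z} → N l m n x y z ≡ ∑ (λ i → N l' m n (x' i) y z)) → slice l x ≡ ∑ℤ (λ i → slice l' (x' i))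
  slice-∑ {l' = l'} x x' e = (alt-cong m u λ y → (alt-cong n s λ z → cong +_ (e {y} {z}) ∙ +∑ (λ i → N l' m n (x' i) y z)) ∙ alt-∑ n s (λ z i → + N l' m n (x' i) y z)) ∙ alt-∑ m u (λ y i → alt n s (λ z → + N l' m n (x' i) y z))

  slice₁-const : V P l1 m n → ∀ c c' → slice l1 c ≡ slice l1 c'
  slice₁-const h c c' = i-j≡0⇒i≡j _ _ (h (c , c') u s)

  slice₂-const : V P l2 m n → ∀ c σ σ' → slice l2 (c , σ) ≡ slice l2 (c , σ')
  slice₂-const h c σ σ' = i-j≡0⇒i≡j _ _ (h (c , σ , σ') u s)

  -- Exponent 1 makes the slice the same for all c, and exponent 0 makes its sum over c vanish.
  slice₁-zero : V P l0 m n → V P l1 m n → ∀ c → slice l1 c ≡ + 0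
  slice₁-zero h₀ h₁ = constant-zero (slice l1) (slice₁-const h₁) (sym (slice-∑ tt (λ c → c) p₀) ∙ h₀ tt u s)

  slice₂-zero : V P l0 m n → V P l1 m n → V P l2 m n → ∀ c σ → slice l2 (c , σ) ≡ + 0
  slice₂-zero h₀ h₁ h₂ c = constant-zero (λ σ → slice l2 (c , σ)) (slice₂-const h₂ c) (sym (slice-∑ c (λ σ → c , σ) p₁) ∙ slice₁-zero h₀ h₁ c)

  slice₁-sum : (∀ c σ → slice l2 (c , σ) ≡ + 0) → ∀ c → slice l1 c ≡ + 0
  slice₁-sum h c = slice-∑ c (λ σ → c , σ) p₁ ∙ ∑ℤ-cong (h c) ∙ ∑ℤ-const p (+ 0) ∙ ·-zeroʳ (+ p)

  slice₀-sum : (∀ c → slice l1 c ≡ + 0) → slice l0 tt ≡ + 0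
  slice₀-sum h = slice-∑ tt (λ c → c) p₀ ∙ ∑ℤ-cong h ∙ ∑ℤ-const p (+ 0) ∙ ·-zeroʳ (+ p)

cross : ∀ a b c d → (+ a - + b) - (+ c - + d) ≡ + 0 → a + d ≡ b + c
cross a b c d e = +-injective (lem (+ a) (+ b) (+ c) (+ d) ∙ cong (λ z → (+ b ⊕ + c) ⊕ z) e ∙ ⊕-identityʳ (+ (b + c)))
  where lem : ∀ a b c d → a ⊕ d ≡ (b ⊕ c) ⊕ ((a - b) - (c - d)); lem = ring

cross-at : ∀ {X Y : Set} (f : X → Y → ℕ) x x' y y' → (+ f x y - + f x y') - (+ f x' y - + f x' y') ≡ + 0 → f x y + f x' y' ≡ f x y' + f x' y
cross-at f x x' y y' = cross (f x y) (f x y') (f x' y) (f x' y')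

uncross : ∀ a b c d → a + d ≡ b + c → (+ a - + b) - (+ c - + d) ≡ + 0
uncross a b c d e = lem (+ a) (+ b) (+ c) (+ d) ∙ cong (λ z → + z - + (b + c)) e ∙ +-inverseʳ (+ (b + c))
  where lem : ∀ a b c d → (a - b) - (c - d) ≡ (a ⊕ d) - (b ⊕ c); lem = ring

level : ∀ {a b} → + a - + b ≡ + 0 → a ≡ b
level e = +-injective (i-j≡0⇒i≡j _ _ e)

unlevel : ∀ {a b} → a ≡ b → + a - + b ≡ + 0
unlevel {a} refl = +-inverseʳ (+ a)

-- κ has the form f d + g ω; if every row contains a zero then f is constant.
rows-equal : ∀ {p r} (κ : Fin p → Fin r → ℕ) → (∀ d d' ω ω' → κ d ω + κ d' ω' ≡ κ d ω' + κ d' ω) →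
  (∀ d → ∃[ ω ] κ d ω ≡ 0) → ∀ d d' ω → κ d ω ≡ κ d' ω
rows-equal κ cr z d d' ω = ≤-antisym (below d d' ω) (below d' d ω)
  where
  below : ∀ d d' ω → κ d ω ≤ κ d' ω
  below d d' ω = let (ω₀ , e) = z d in ≤-trans (m≤m+n (κ d ω) (κ d' ω₀)) (≤-reflexive (cr d d' ω ω₀ ∙ cong (λ z → z + κ d' ω) e))

zero-or-pos : ∀ {n} (f : Fin n → ℕ) → (∃[ i ] f i ≡ 0) ⊎ (∀ i → 1 ≤ f i)
zero-or-pos f with any? (λ i → f i ≟ 0)
... | yes z = inj₁ z
... | no nz = inj₂ λ i → n≢0⇒n>0 λ e → nz (i , e)

-- A row without a zero would have sum at least r > q. So every row has a zero, all p rows are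
-- equal, and p divides the total q.
matrix-bound : ∀ {p q r} (κ : Fin p → Fin r → ℕ) → (∀ d d' ω ω' → κ d ω + κ d' ω' ≡ κ d ω' + κ d' ω) →
  ∑ (λ d → ∑ (κ d)) ≡ q → q < r → ¬ (p ∣ q) → ⊥
matrix-bound {p} {q} {r} κ cr tot q<r p∤q = p∤q (subst (p ∣_) tot (divides-all p κ eqs))
  where
  row-zero : ∀ d → ∃[ ω ] κ d ω ≡ 0
  row-zero d = [ (λ z → z) , (λ pos → ⊥-elim (<⇒≱ q<r (≤-trans (∑-all-pos (κ d) pos) (subst (∑ (κ d) ≤_) tot (∑-≥ (λ d → ∑ (κ d)) d))))) ]′ (zero-or-pos (κ d))
  eqs : ∀ d d' → ∑ (κ d) ≡ ∑ (κ d')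
  eqs d d' = ∑-cong (rows-equal κ cr row-zero d d')
  divides-all : ∀ p (κ : Fin p → Fin r → ℕ) → (∀ d d' → ∑ (κ d) ≡ ∑ (κ d')) → p ∣ ∑ (λ d → ∑ (κ d))
  divides-all zero κ h = divides 0 refl
  divides-all (suc p) κ h = divides (∑ (κ Fin.zero)) (∑-const-≡ (λ d → ∑ (κ d)) Fin.zero (λ j → h j Fin.zero) ∙ *-comm (suc p) _)

record FullRow {p k r : ℕ} (κ : Fin p → Fin k → Fin r → ℕ) : Set where
  field
    σ₀ : Fin p
    w₀ : Fin k
    full : ∀ ω → κ σ₀ w₀ ω ≡ 1
    empty-σ : ∀ σ w ω → σ ≢ σ₀ → κ σ w ω ≡ 0
    empty-w : ∀ σ w ω → w ≢ w₀ → κ σ w ω ≡ 0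

-- A row without a zero already has sum r, the total, so it consists of ones and all else is empty.
-- If every row has a zero, then nothing depends on σ and p divides r.
full-row : ∀ {p k r} (κ : Fin p → Fin k → Fin r → ℕ) → (∀ w d d' ω ω' → κ d w ω + κ d' w ω' ≡ κ d w ω' + κ d' w ω) →
  ∑ (λ σ → ∑ (λ w → ∑ (κ σ w))) ≡ r → ¬ (p ∣ r) → FullRow κ
full-row {p} {k} {r} κ cr tot p∤r with any? (λ σ → any? (λ w → all? (λ ω → 1 ≤? κ σ w ω)))
... | yes (σ₀ , w₀ , pos) = record { σ₀ = σ₀ ; w₀ = w₀ ; full = full ; empty-σ = λ σ w ω ne → ∑-zero (κ σ w) (∑-zero (λ w → ∑ (κ σ w)) (∑-dominated f σ₀ dom-σ σ ne) w) ω ; empty-w = ew }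
  where
  f : Fin p → ℕ
  f σ = ∑ (λ w → ∑ (κ σ w))
  row = ∑ (κ σ₀ w₀)
  r≤row : r ≤ row
  r≤row = ∑-all-pos (κ σ₀ w₀) pos
  row≤ : row ≤ f σ₀
  row≤ = ∑-≥ (λ w → ∑ (κ σ₀ w)) w₀
  f≤ : f σ₀ ≤ r
  f≤ = subst (f σ₀ ≤_) tot (∑-≥ f σ₀)
  dom-σ : ∑ f ≤ f σ₀
  dom-σ = subst (_≤ f σ₀) (sym tot) (≤-trans r≤row row≤)
  ew : ∀ σ w ω → w ≢ w₀ → κ σ w ω ≡ 0
  ew σ w ω ne with σ Finₚ.≟ σ₀
  ... | yes refl = ∑-zero (κ σ w) (∑-dominated (λ w → ∑ (κ σ w)) w₀ (≤-trans f≤ r≤row) w ne) ω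
  ... | no ne' = ∑-zero (κ σ w) (∑-zero (λ w → ∑ (κ σ w)) (∑-dominated f σ₀ dom-σ σ ne') w) ω
  full : ∀ ω → κ σ₀ w₀ ω ≡ 1
  full ω = ≤-antisym (≮⇒≥ λ two → <⇒≱ (∑-strict (κ σ₀ w₀) pos ω two) (≤-trans row≤ f≤)) (pos ω)
... | no none = ⊥-elim (p∤r (subst (p ∣_) tot (divides-all p f eqs)))
  where
  f : Fin p → ℕ
  f σ = ∑ (λ w → ∑ (κ σ w))
  row-zero : ∀ w σ → ∃[ ω ] κ σ w ω ≡ 0
  row-zero w σ = [ (λ z → z) , (λ pos → ⊥-elim (none (σ , w , pos))) ]′ (zero-or-pos (κ σ w))
  eqs : ∀ d d' → f d ≡ f d'
  eqs d d' = ∑-cong λ w → ∑-cong (rows-equal (λ σ → κ σ w) (cr w) (row-zero w) d d')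
  divides-all : ∀ p (f : Fin p → ℕ) → (∀ d d' → f d ≡ f d') → p ∣ ∑ f
  divides-all zero f h = divides 0 refl
  divides-all (suc p) f h = divides (f Fin.zero) (∑-const-≡ f Fin.zero (λ j → h j Fin.zero) ∙ *-comm (suc p) _)

module _ {p q r : ℕ} where
  open Profile

  -- The points of a p-fibre differ only in σ, so this is how the profile of a union of p-fibres
  -- looks.
  Indep₁ : Profile p q r → Set
  Indep₁ P = ∀ m n c σ σ' y z → N P l2 m n (c , σ) y z ≡ N P l2 m n (c , σ') y z

  Indep₂ : Profile p q r → Set
  Indep₂ P = ∀ l n x v ψ ψ' z → N P l l2 n x (v , ψ) z ≡ N P l l2 n x (v , ψ') z

  Indep₃ : Profile p q r → Set
  Indep₃ P = ∀ l m x y w ω ω' → N P l m l2 x y (w , ω) ≡ N P l m l2 x y (w , ω')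

  indep₁-* : ∀ {P} → Indep₁ P → ∀ {m n} c σ y z → N P l1 m n c y z ≡ p * N P l2 m n (c , σ) y z
  indep₁-* {P} h c σ y z = p₁ P ∙ ∑-const-≡ (λ σ → N P l2 _ _ (c , σ) y z) σ (λ σ' → h _ _ c σ' σ y z)

  indep₂-* : ∀ {P} → Indep₂ P → ∀ {l n} x v ψ z → N P l l1 n x v z ≡ q * N P l l2 n x (v , ψ) z
  indep₂-* {P} h x v ψ z = q₁ P ∙ ∑-const-≡ (λ ψ → N P _ l2 _ x (v , ψ) z) ψ (λ ψ' → h _ _ x v ψ' ψ z)

  indep₃-* : ∀ {P} → Indep₃ P → ∀ {l m} x y w ω → N P l m l1 x y w ≡ r * N P l m l2 x y (w , ω)
  indep₃-* {P} h x y w ω = r₁ P ∙ ∑-const-≡ (λ ω → N P _ _ l2 x y (w , ω)) ω (λ ω' → h _ _ x y w ω' ω)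

  -- Each q-fibre has exactly one point with the given ψ, so under `Indep₂` this is a number of
  -- fibres.
  fibres₂ : Profile p q r → Fin q → ∀ l n → Pos p l → Pos r n → ℕ
  fibres₂ P ψ l n x z = ∑ (λ v → N P l l2 n x (v , ψ) z)

  fibres₃ : Profile p q r → Fin r → ∀ l m → Pos p l → Pos q m → ℕ
  fibres₃ P ω l m x y = ∑ (λ w → N P l m l2 x y (w , ω))

  fibres₂-* : ∀ {P} → Indep₂ P → ∀ {l n} x z ψ → N P l l0 n x tt z ≡ q * fibres₂ P ψ l n x z
  fibres₂-* {P} h x z ψ = q₀ P ∙ (∑-cong λ v → indep₂-* {P} h x v ψ z) ∙ ∑-* q (λ v → N P _ l2 _ x (v , ψ) z)

  fibres₃-* : ∀ {P} → Indep₃ P → ∀ {l m} x y ω → N P l m l0 x y tt ≡ r * fibres₃ P ω l m x y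
  fibres₃-* {P} h x y ω = r₀ P ∙ (∑-cong λ w → indep₃-* {P} h x y w ω) ∙ ∑-* r (λ w → N P _ _ l2 x y (w , ω))

  Split : (A A₁ A₂ A₃ : Profile p q r) → Set
  Split A A₁ A₂ A₃ = ∀ l m n x y z → N A l m n x y z ≡ N A₁ l m n x y z + N A₂ l m n x y z + N A₃ l m n x y z

  ≤-p₁ : ∀ (P : Profile p q r) {m n} c σ y z → N P l2 m n (c , σ) y z ≤ N P l1 m n c y z
  ≤-p₁ P c σ y z = subst (N P l2 _ _ (c , σ) y z ≤_) (sym (p₁ P)) (∑-≥ (λ σ → N P l2 _ _ (c , σ) y z) σ)

  ≤-p₀ : ∀ (P : Profile p q r) {m n} c y z → N P l1 m n c y z ≤ N P l0 m n tt y z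
  ≤-p₀ P c y z = subst (N P l1 _ _ c y z ≤_) (sym (p₀ P)) (∑-≥ (λ c → N P l1 _ _ c y z) c)

  ≤-q₁ : ∀ (P : Profile p q r) {l n} x v ψ z → N P l l2 n x (v , ψ) z ≤ N P l l1 n x v z
  ≤-q₁ P x v ψ z = subst (N P _ l2 _ x (v , ψ) z ≤_) (sym (q₁ P)) (∑-≥ (λ ψ → N P _ l2 _ x (v , ψ) z) ψ)

  ≤-q₀ : ∀ (P : Profile p q r) {l n} x v z → N P l l1 n x v z ≤ N P l l0 n x tt z
  ≤-q₀ P x v z = subst (N P _ l1 _ x v z ≤_) (sym (q₀ P)) (∑-≥ (λ v → N P _ l1 _ x v z) v)

  ≤-r₁ : ∀ (P : Profile p q r) {l m} x y w ω → N P l m l2 x y (w , ω) ≤ N P l m l1 x y w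
  ≤-r₁ P x y w ω = subst (N P _ _ l2 x y (w , ω) ≤_) (sym (r₁ P)) (∑-≥ (λ ω → N P _ _ l2 x y (w , ω)) ω)

  ≤-r₀ : ∀ (P : Profile p q r) {l m} x y w → N P l m l1 x y w ≤ N P l m l0 x y tt
  ≤-r₀ P x y w = subst (N P _ _ l1 x y w ≤_) (sym (r₀ P)) (∑-≥ (λ w → N P _ _ l1 x y w) w)

  coarsen-q : ∀ (P : Profile p q r) {l n} x m (y : Pos q m) z → N P l m n x y z ≤ N P l l0 n x tt z
  coarsen-q P x l0 y z = ≤-refl
  coarsen-q P x l1 y z = ≤-q₀ P x y z
  coarsen-q P x l2 (v , ψ) z = ≤-trans (≤-q₁ P x v ψ z) (≤-q₀ P x v z)

  coarsen-r : ∀ (P : Profile p q r) {l m} x y n (z : Pos r n) → N P l m n x y z ≤ N P l m l0 x y tt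
  coarsen-r P x y l0 z = ≤-refl
  coarsen-r P x y l1 z = ≤-r₀ P x y z
  coarsen-r P x y l2 (w , ω) = ≤-trans (≤-r₁ P x y w ω) (≤-r₀ P x y w)

  coarsen-qr : ∀ (P : Profile p q r) {l} x m n (y : Pos q m) (z : Pos r n) → N P l m n x y z ≤ N P l l0 l0 x tt tt
  coarsen-qr P x m n y z = ≤-trans (coarsen-q P x m y z) (coarsen-r P x tt n z)

  class-zero : ∀ (P : Profile p q r) {l} x → N P l l0 l0 x tt tt ≡ 0 → ∀ m n y z → N P l m n x y z ≡ 0
  class-zero P x e m n y z = n≤0⇒n≡0 (subst (N P _ m n x y z ≤_) e (coarsen-qr P x m n y z))

  layer-zero : ∀ (P : Profile p q r) c → N P l1 l0 l0 c tt tt ≡ 0 → ∀ σ → N P l2 l0 l0 (c , σ) tt tt ≡ 0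
  layer-zero P c e σ = n≤0⇒n≡0 (subst (N P l2 l0 l0 (c , σ) tt tt ≤_) e (≤-p₁ P c σ tt tt))

rev : ∀ {p q r} → Profile p q r → Profile r q p
rev P = sw12 (sw23 (sw12 P))

V-rev : ∀ {p q r} (P : Profile p q r) l m n → V P l m n → V (rev P) n m l
V-rev P l m n h = V-sw12 (sw23 (sw12 P)) m n l (V-sw23 (sw12 P) m l n (V-sw12 P l m n h))

-- Pairs of profiles with complementary divisors

record Pair (p q r : ℕ) : Set where
  field
    distinct : Distinct p q r
    A B : Profile p q r
    alternative : ∀ l m n → ¬ (l ≡ l0 × m ≡ l0 × n ≡ l0) → V A l m n ⊎ V B l m n
    total-A : Profile.total A ≡ p * q * r
    total-B : Profile.total B ≡ p * q * r

*-swap12 : ∀ p q r → p * q * r ≡ q * p * r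
*-swap12 = ringℕ

*-swap23 : ∀ p q r → p * q * r ≡ p * r * q
*-swap23 = ringℕ

pair12 : ∀ {p q r} → Pair p q r → Pair q p r
pair12 {p} {q} {r} T = record { distinct = swap12 distinct ; A = sw12 A ; B = sw12 B
  ; alternative = λ m l n ne → [ (λ h → inj₁ (V-sw12 A l m n h)) , (λ h → inj₂ (V-sw12 B l m n h)) ]′ (alternative l m n λ (a , b , c) → ne (b , a , c))
  ; total-A = total-A ∙ *-swap12 p q r ; total-B = total-B ∙ *-swap12 p q r }
  where open Pair T

pair23 : ∀ {p q r} → Pair p q r → Pair p r q
pair23 {p} {q} {r} T = record { distinct = swap23 distinct ; A = sw23 A ; B = sw23 B
  ; alternative = λ l n m ne → [ (λ h → inj₁ (V-sw23 A l m n h)) , (λ h → inj₂ (V-sw23 B l m n h)) ]′ (alternative l m n λ (a , b , c) → ne (a , c , b))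
  ; total-A = total-A ∙ *-swap23 p q r ; total-B = total-B ∙ *-swap23 p q r }
  where open Pair T

pairAB : ∀ {p q r} → Pair p q r → Pair p q r
pairAB T = record { distinct = distinct ; A = B ; B = A
  ; alternative = λ l m n ne → [ inj₂ , inj₁ ]′ (alternative l m n ne) ; total-A = total-B ; total-B = total-A }
  where open Pair T

origin : ∀ {p} → Prime p → Fin p
origin pr = fromℕ< (>-nonZero⁻¹ _ {{prime⇒nonZero pr}})

prime∤prime : ∀ {p q} → Prime p → Prime q → p ≢ q → ¬ (p ∣ q)
prime∤prime pp pq ne d = ne (prime-∣-prime pp pq d)

prime∤* : ∀ {p q r} → Distinct p q r → ¬ (p ∣ q * r)
prime∤* {p} {q} {r} D d = [ prime∤prime p-prime q-prime p≢q , prime∤prime p-prime r-prime p≢r ]′ (euclidsLemma q r p-prime d)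
  where open Distinct D

-- r divides q(y - y'), hence y - y', and both numbers are below r.
coin : ∀ {q r} → Prime q → Prime r → q ≢ r → ∀ {y z y' z'} → q * y + r * z ≡ q * y' + r * z' → q * y < q * r → q * y' < q * r → y ≡ y'
coin {q} {r} pq pr q≢r {y} {z} {y'} {z'} e lt lt' = small-∣ (*-cancelˡ-< q y r lt) (*-cancelˡ-< q y' r lt')
  ([ (λ d → ⊥-elim (prime∤prime pr pq (q≢r ∘ sym) (pos∣⁻¹ d))) , (λ d → d) ]′ (prime-∣ℤ-* pr (+ q) (+ y - + y') (dividesℤ (+ z' - + z) eqn)))
  where
  e' : + q · + y ⊕ + r · + z ≡ + q · + y' ⊕ + r · + z'
  e' = sym (cong₂ _⊕_ (pos-* q y) (pos-* r z)) ∙ cong +_ e ∙ cong₂ _⊕_ (pos-* q y') (pos-* r z')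
  eqn : + q · (+ y - + y') ≡ (+ z' - + z) · + r
  eqn = lem (+ q) (+ y) (+ y') (+ r) (+ z) (+ z') ∙ cong (λ w → w - (+ q · + y' ⊕ + r · + z) ) e' ∙ lem2 (+ q) (+ y') (+ r) (+ z) (+ z')
    where lem : ∀ q y y' r z z' → q · (y - y') ≡ (q · y ⊕ r · z) - (q · y' ⊕ r · z); lem = ring
          lem2 : ∀ q y' r z z' → (q · y' ⊕ r · z') - (q · y' ⊕ r · z) ≡ (z' - z) · r; lem2 = ring

module NonZeros {p q r : ℕ} (D : Distinct p q r) where
  open Distinct D
  instance
    nzp = prime⇒nonZero p-prime
    nzq = prime⇒nonZero q-prime
    nzr = prime⇒nonZero r-prime

module Basics {p q r : ℕ} (D : Distinct p q r) (P : Profile p q r) (tot : Profile.total P ≡ p * q * r) where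
  open Distinct D
  open Profile P
  instance
    nzp = prime⇒nonZero p-prime
    nzq = prime⇒nonZero q-prime
    nzr = prime⇒nonZero r-prime

  level₁ : V P l1 l0 l0 → ∀ c → N l1 l0 l0 c tt tt ≡ q * r
  level₁ h c = *-cancelˡ-≡ _ _ p (sym (∑-const-≡ (λ c → N l1 l0 l0 c tt tt) c (λ c' → level (h (c' , c) tt tt))) ∙ sym p₀ ∙ tot ∙ *-assoc p q r)

  level₂ : V P l2 l0 l0 → ∀ σ → ∑ (λ c → N l2 l0 l0 (c , σ) tt tt) ≡ q * r
  level₂ h σ = *-cancelˡ-≡ _ _ p (sym (∑-* p (λ c → N l2 l0 l0 (c , σ) tt tt)) ∙ (∑-cong λ c → sym (p₁ ∙ ∑-const-≡ (λ σ → N l2 l0 l0 (c , σ) tt tt) σ (λ σ' → level (h (c , σ' , σ) tt tt)))) ∙ sym p₀ ∙ tot ∙ *-assoc p q r)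

  level₃ : V P l0 l0 l1 → ∀ w → N l0 l0 l1 tt tt w ≡ p * q
  level₃ h w = *-cancelˡ-≡ _ _ r (sym (∑-const-≡ (λ w → N l0 l0 l1 tt tt w) w (λ w' → level (h tt tt (w' , w)))) ∙ sym r₀ ∙ tot ∙ *-comm (p * q) r)

  -- Φ_p puts qr points into each class mod p, and Φ_{p²} would spread them evenly over its p
  -- layers; but p ∤ qr.
  exclusive₁ : V P l1 l0 l0 → ¬ V P l2 l0 l0
  exclusive₁ h₁ h₂ = prime∤* D (divides (N l2 l0 l0 (o , o) tt tt) (sym (level₁ h₁ o) ∙ p₁ ∙ ∑-const-≡ (λ σ → N l2 l0 l0 (o , σ) tt tt) o (λ σ → level (h₂ (o , σ , o) tt tt)) ∙ *-comm p _))
    where o = origin p-prime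

record Exponent₁ {p q r} (T : Pair p q r) (a b : Lv) : Set where
  field
    in-A : V (Pair.A T) a l0 l0
    in-B : V (Pair.B T) b l0 l0
    out-A : ¬ V (Pair.A T) b l0 l0
    out-B : ¬ V (Pair.B T) a l0 l0

-- Φ_p and Φ_{p²} each divide one of the two sets, and neither set can have both.
exponent₁ : ∀ {p q r} (T : Pair p q r) → Exponent₁ T l1 l2 ⊎ Exponent₁ T l2 l1
exponent₁ {p} {q} {r} T = go (alternative l1 l0 l0 λ ()) (alternative l2 l0 l0 λ ())
  where
  open Pair T
  module BA = Basics distinct A total-A
  module BB = Basics distinct B total-B
  go : V A l1 l0 l0 ⊎ V B l1 l0 l0 → V A l2 l0 l0 ⊎ V B l2 l0 l0 → _
  go (inj₁ a) (inj₁ b) = ⊥-elim (BA.exclusive₁ a b)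
  go (inj₁ a) (inj₂ b) = inj₁ (record { in-A = a ; in-B = b ; out-A = BA.exclusive₁ a ; out-B = λ c → BB.exclusive₁ c b })
  go (inj₂ a) (inj₁ b) = inj₂ (record { in-A = b ; in-B = a ; out-A = λ c → BA.exclusive₁ c b ; out-B = BB.exclusive₁ a })
  go (inj₂ a) (inj₂ b) = ⊥-elim (BB.exclusive₁ a b)

module _ {p q r : ℕ} (T : Pair p q r) (q<r : q < r) where
  open Pair T
  open Distinct distinct
  open Profile B
  private
    module BB = Basics distinct B total-B
    o = origin p-prime

  independent-of-σ : V B l2 l0 l0 → V B l2 l0 l1 → V B l2 l0 l2 → ∀ c σ σ' w ω → N l2 l0 l2 (c , σ) tt (w , ω) ≡ N l2 l0 l2 (c , σ') tt (w , ω)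
  independent-of-σ h₀ h₁ h₂ c σ σ' w ω = level (slice₂-zero (rev B) l0 l2 tt (c , σ , σ') (V-rev B l2 l0 l0 h₀) (V-rev B l2 l0 l1 h₁) (V-rev B l2 l0 l2 h₂) w ω)

  -- Then B would have, in each class mod r or in total, q points arranged in a p × r matrix without cross differences.
  no-cyclotomic-pattern : V B l2 l0 l0 → V B l2 l0 l1 → V B l2 l0 l2 → V B l1 l0 l2 → V B l0 l0 l1 ⊎ (V B l0 l0 l2 × V B l1 l0 l1) → ⊥
  no-cyclotomic-pattern h₀ h₁ h₂ h12 = [ caseʳ₁ , caseʳ₂ ]′
    where
    open BB
    p∤q : ¬ (p ∣ q); p∤q = prime∤prime p-prime q-prime p≢q
    κ : Fin p → Fin r → Fin r → ℕ
    κ d w ω = N l2 l0 l2 (d , o) tt (w , ω)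
    N₁ : ∀ d w ω → N l1 l0 l2 d tt (w , ω) ≡ p * κ d w ω
    N₁ d w ω = p₁ ∙ ∑-const-≡ (λ σ → N l2 l0 l2 (d , σ) tt (w , ω)) o (λ σ → independent-of-σ h₀ h₁ h₂ d σ o w ω)
    κ-cross : ∀ w d d' ω ω' → κ d w ω + κ d' w ω' ≡ κ d w ω' + κ d' w ω
    κ-cross w d d' ω ω' = *-cancelˡ-≡ _ _ p (*-distribˡ-+ p (κ d w ω) _ ∙ cong₂ _+_ (sym (N₁ d w ω)) (sym (N₁ d' w ω')) ∙
       cross-at (λ i j → N l1 l0 l2 i tt (w , j)) d d' ω ω' (h12 (d , d') tt (w , ω , ω')) ∙ cong₂ _+_ (N₁ d w ω') (N₁ d' w ω) ∙ sym (*-distribˡ-+ p (κ d w ω') _))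
    caseʳ₁ : V B l0 l0 l1 → ⊥
    caseʳ₁ h = matrix-bound (λ d ω → κ d w ω) (κ-cross w) tot q<r p∤q
      where
      w = origin r-prime
      tot : ∑ (λ d → ∑ (κ d w)) ≡ q
      tot = *-cancelˡ-≡ _ _ p (sym (∑∑-* p (λ d → κ d w)) ∙ (∑-cong λ d → (∑-cong λ ω → sym (N₁ d w ω)) ∙ sym r₁) ∙ sym p₀ ∙ level₃ h w)
    caseʳ₂ : V B l0 l0 l2 × V B l1 l0 l1 → ⊥
    caseʳ₂ (h , h') = matrix-bound (λ d w → κ d w oʳ) cr' tot q<r p∤q
      where
      oʳ = origin r-prime
      const-ω : ∀ d w ω → N l1 l0 l2 d tt (w , ω) ≡ N l1 l0 l2 d tt (w , oʳ)
      const-ω d w ω = level (slice₁-zero B l0 l2 tt (w , ω , oʳ) (λ _ _ s → h tt tt s) h12' d)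
        where h12' = h12
      N₁' : ∀ d w → N l1 l0 l1 d tt w ≡ r * (p * κ d w oʳ)
      N₁' d w = r₁ ∙ ∑-const-≡ (λ ω → N l1 l0 l2 d tt (w , ω)) oʳ (const-ω d w) ∙ cong (r *_) (N₁ d w oʳ)
      cr' : ∀ d d' w w' → κ d w oʳ + κ d' w' oʳ ≡ κ d w' oʳ + κ d' w oʳ
      cr' d d' w w' = *-cancelˡ-≡ _ _ p (*-cancelˡ-≡ _ _ r (dist _ _ ∙ cong₂ _+_ (sym (N₁' d w)) (sym (N₁' d' w')) ∙
         cross-at (λ i j → N l1 l0 l1 i tt j) d d' w w' (h' (d , d') tt (w , w')) ∙ cong₂ _+_ (N₁' d w') (N₁' d' w) ∙ sym (dist _ _)))
        where dist : ∀ a b → r * (p * (a + b)) ≡ r * (p * a) + r * (p * b)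
              dist a b = lem r p a b
                where lem : ∀ r p a b → r * (p * (a + b)) ≡ r * (p * a) + r * (p * b); lem = ringℕ
      tot : ∑ (λ d → ∑ (λ w → κ d w oʳ)) ≡ q
      tot = *-cancelˡ-≡ _ _ p (*-cancelˡ-≡ _ _ r (cong (r *_) (sym (∑∑-* p (λ d w → κ d w oʳ))) ∙ sym (∑∑-* r (λ d w → p * κ d w oʳ)) ∙
        (∑-cong λ d → (∑-cong λ w → sym (N₁' d w)) ∙ sym r₀) ∙ sym p₀ ∙ total-B ∙ *-comm (p * q) r))

-- A decomposition into fibres cannot use three directions

record Decomposition {p q r : ℕ} (A : Profile p q r) : Set where
  field
    A₁ A₂ A₃ : Profile p q r
    split : Split A A₁ A₂ A₃
    i₁ : Indep₁ A₁
    i₂ : Indep₂ A₂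
    i₃ : Indep₃ A₃

dec12 : ∀ {p q r} {A : Profile p q r} → Decomposition A → Decomposition (sw12 A)
dec12 d = record { A₁ = sw12 A₂ ; A₂ = sw12 A₁ ; A₃ = sw12 A₃
  ; split = λ l m n x y z → split m l n y x z ∙ cong (_+ Profile.N A₃ m l n y x z) (+-comm (Profile.N A₁ m l n y x z) _)
  ; i₁ = λ m n c σ σ' y z → i₂ m n y c σ σ' z ; i₂ = λ l n x v ψ ψ' z → i₁ l n v ψ ψ' x z ; i₃ = λ l m x y → i₃ m l y x }
  where open Decomposition d

dec23 : ∀ {p q r} {A : Profile p q r} → Decomposition A → Decomposition (sw23 A)
dec23 d = record { A₁ = sw23 A₁ ; A₂ = sw23 A₃ ; A₃ = sw23 A₂
  ; split = λ l m n x y z → split l n m x z y ∙ lem (Profile.N A₁ l n m x z y) _ _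
  ; i₁ = λ m n c σ σ' y z → i₁ n m c σ σ' z y ; i₂ = λ l n x v ψ ψ' z → i₃ l n x z v ψ ψ' ; i₃ = λ l m x y w ω ω' → i₂ l m x w ω ω' y }
  where open Decomposition d
        lem : ∀ a b c → a + b + c ≡ a + c + b; lem = ringℕ

dec-rev : ∀ {p q r} {A : Profile p q r} → Decomposition A → Decomposition (rev A)
dec-rev d = dec12 (dec23 (dec12 d))

pair-rev : ∀ {p q r} → Pair p q r → Pair r q p
pair-rev T = pair12 (pair23 (pair12 T))

const-sum-div : ∀ {n} (f : Fin n → ℤ) → (∀ i j → f i ≡ f j) → + n ∣ℤ ∑ℤ f
const-sum-div {zero} f h = dividesℤ (+ 0) refl
const-sum-div {suc n} f h = dividesℤ (f Fin.zero) (∑ℤ-cong (λ i → h i Fin.zero) ∙ ∑ℤ-const (suc n) (f Fin.zero) ∙ ·-comm (+ suc n) _)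

∑ℤ-div : ∀ {n k} (f : Fin n → ℤ) → (∀ i → + k ∣ℤ f i) → + k ∣ℤ ∑ℤ f
∑ℤ-div {zero} {k} f h = dividesℤ (+ 0) (sym (*-zeroˡ (+ k)))
∑ℤ-div {suc n} f h = add∣ (h Fin.zero) (∑ℤ-div (f ∘ Fin.suc) (h ∘ Fin.suc))

-- The full slice is a sum of p equal terms at `l1`, and a sum over classes of p equal terms each at
-- `l2`.
slice-div : ∀ {p q r} (P : Profile p q r) m n u s l → l ≢ l0 → V P l m n → + p ∣ℤ slice P m n u s l0 tt
slice-div P m n u s l0 ne h = ⊥-elim (ne refl)
slice-div {p} P m n u s l1 ne h = subst (+ p ∣ℤ_) (sym (slice-∑ P m n u s tt (λ c → c) (Profile.p₀ P))) (const-sum-div _ (slice₁-const P m n u s h))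
slice-div {p} P m n u s l2 ne h = subst (+ p ∣ℤ_) (sym (slice-∑ P m n u s tt (λ c → c) (Profile.p₀ P))) (∑ℤ-div _ λ c →
  subst (+ p ∣ℤ_) (sym (slice-∑ P m n u s c (λ σ → c , σ) (Profile.p₁ P))) (const-sum-div _ (slice₂-const P m n u s h c)))

≤-split₁ : ∀ a b c → a ≤ a + b + c
≤-split₁ a b c = ≤-trans (m≤m+n a b) (m≤m+n (a + b) c)

≤-split₂ : ∀ a b c → b ≤ a + b + c
≤-split₂ a b c = ≤-trans (m≤n+m b a) (m≤m+n (a + b) c)

r-coprime : ∀ {p q r n} → Distinct p q r → r ∣ n → p * q ∣ n → r * (p * q) ∣ n
r-coprime {p} {q} {r} D = coprime-∣* (primes-coprime (≢-nonZero⁻¹ r {{prime⇒nonZero r-prime}}) λ prπ d e → [ (λ e' → p≢r (sym (prime-∣-prime prπ p-prime e') ∙ prime-∣-prime prπ r-prime d))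
  , (λ e' → q≢r (sym (prime-∣-prime prπ q-prime e') ∙ prime-∣-prime prπ r-prime d)) ]′ (euclidsLemma p q prπ e))
  where open Distinct D

module WithDecomposition {p q r : ℕ} (T : Pair p q r) (dec : Decomposition (Pair.A T)) where
  open Pair T
  open Distinct distinct
  open Decomposition dec
  open Profile
  module BA = Basics distinct A total-A
  open BA using (nzp; nzq; nzr)
  op = origin p-prime
  oq = origin q-prime
  or = origin r-prime

  y : Fin p → Fin p → ℕ
  y c σ = fibres₂ A₂ oq l2 l0 (c , σ) tt
  z : Fin p → Fin p → ℕ
  z c σ = fibres₃ A₃ or l2 l0 (c , σ) tt

  y-≡ : ∀ c σ → N A₂ l2 l0 l0 (c , σ) tt tt ≡ q * y c σ
  y-≡ c σ = fibres₂-* {P = A₂} i₂ (c , σ) tt oq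

  z-≡ : ∀ c σ → N A₃ l2 l0 l0 (c , σ) tt tt ≡ r * z c σ
  z-≡ c σ = fibres₃-* {P = A₃} i₃ (c , σ) tt or

  h : Fin p → Fin p → ℕ
  h c σ = N A l2 l0 l0 (c , σ) tt tt

  h-≡ : ∀ c σ → h c σ ≡ N A₁ l2 l0 l0 (c , σ) tt tt + q * y c σ + r * z c σ
  h-≡ c σ = split l2 l0 l0 (c , σ) tt tt ∙ cong₂ _+_ (cong (λ w → N A₁ l2 l0 l0 (c , σ) tt tt + w) (y-≡ c σ)) (z-≡ c σ)

  total-layers : ∀ (P : Profile p q r) → total P ≡ ∑ (λ c → ∑ (λ σ → N P l2 l0 l0 (c , σ) tt tt))
  total-layers P = p₀ P {l0} {l0} {tt} {tt} ∙ ∑-cong λ c → p₁ P {l0} {l0} {c} {tt} {tt}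

  module _ (v : V A l2 l0 l0) where
    h-const : ∀ c σ σ' → h c σ ≡ h c σ'
    h-const c σ σ' = level (v (c , σ , σ') tt tt)

    -- Φ_{p²} makes the size of a layer independent of σ, and the part of A₁ in it is independent of
    -- σ anyway. So q y + r z does not change with σ, and by `coin` neither do y and z: A₂ and A₃
    -- consist of p equal layers in each class.
    layers-divide : (∀ c σ → q * y c σ < q * r) → (p * q ∣ total A₂) × (p * r ∣ total A₃)
    layers-divide lt = divides (∑ (λ c → y c op)) (total-layers A₂ ∙ (∑-cong λ c → (∑-cong λ σ → y-≡ c σ ∙ cong (q *_) (y-const c σ)) ∙ ∑-const p (q * y c op)) ∙ ∑∑-lem p q y ∙ *-comm (p * q) _)
        , divides (∑ (λ c → z c op)) (total-layers A₃ ∙ (∑-cong λ c → (∑-cong λ σ → z-≡ c σ ∙ cong (r *_) (z-const c σ)) ∙ ∑-const p (r * z c op)) ∙ ∑∑-lem p r z ∙ *-comm (p * r) _)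
      where
      ∑∑-lem : ∀ a b (f : Fin p → Fin p → ℕ) → ∑ (λ c → a * (b * f c op)) ≡ a * b * ∑ (λ c → f c op)
      ∑∑-lem a b f = (∑-cong λ c → sym (*-assoc a b (f c op))) ∙ ∑-* (a * b) (λ c → f c op)
      eqs : ∀ c σ → q * y c σ + r * z c σ ≡ q * y c op + r * z c op
      eqs c σ = +-cancelˡ-≡ (N A₁ l2 l0 l0 (c , op) tt tt) _ _ (cong (_+ (q * y c σ + r * z c σ)) (i₁ l0 l0 c op σ tt tt) ∙
         sym (+-assoc (N A₁ l2 l0 l0 (c , σ) tt tt) _ _) ∙ sym (h-≡ c σ) ∙ h-const c σ op ∙ h-≡ c op ∙ +-assoc (N A₁ l2 l0 l0 (c , op) tt tt) _ _)
      y-const : ∀ c σ → y c σ ≡ y c op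
      y-const c σ = coin q-prime r-prime q≢r (eqs c σ) (lt c σ) (lt c op)
      z-const : ∀ c σ → z c σ ≡ z c op
      z-const c σ = *-cancelˡ-≡ _ _ r (+-cancelˡ-≡ (q * y c op) _ _ (cong (λ w → q * w + r * z c σ) (sym (y-const c σ)) ∙ eqs c σ))

    h≤ : ∀ c σ → h c σ ≤ q * r
    h≤ c σ = subst (h c σ ≤_) (BA.level₂ v σ) (∑-≥ (λ c → h c σ) c)

    -- The strict bound for `coin` comes from a class c₁ that meets A₁: all its layers are nonempty.
    -- They take away from q y in the class c₁ itself, and from the total qr of the layers with the
    -- same σ in any other class.
    square-divides : 1 ≤ total A₁ → (p * q ∣ total A₂) × (p * r ∣ total A₃)
    square-divides U≥1 = layers-divide λ c σ → strict c σ (c Finₚ.≟ c₁)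
      where
      c₁σ₁ : ∃[ c ] ∃[ σ ] 1 ≤ N A₁ l2 l0 l0 (c , σ) tt tt
      c₁σ₁ = let (c , e) = ∑-pos (λ c → ∑ (λ σ → N A₁ l2 l0 l0 (c , σ) tt tt)) (subst (1 ≤_) (total-layers A₁) U≥1) in c , ∑-pos (λ σ → N A₁ l2 l0 l0 (c , σ) tt tt) e
      c₁ = proj₁ c₁σ₁
      U₁ : ∀ σ → 1 ≤ N A₁ l2 l0 l0 (c₁ , σ) tt tt
      U₁ σ = subst (1 ≤_) (i₁ l0 l0 c₁ (proj₁ (proj₂ c₁σ₁)) σ tt tt) (proj₂ (proj₂ c₁σ₁))
      strict : ∀ c σ → Dec (c ≡ c₁) → q * y c σ < q * r
      strict c σ (yes refl) = ≤-trans (+-mono-≤ (U₁ σ) ≤-refl) (≤-trans (subst (N A₁ l2 l0 l0 (c , σ) tt tt + q * y c σ ≤_) (sym (h-≡ c σ)) (m≤m+n _ _)) (h≤ c σ))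
      strict c σ (no ne) = ≤-trans (s≤s (subst (q * y c σ ≤_) (sym (h-≡ c σ)) (≤-split₂ (N A₁ l2 l0 l0 (c , σ) tt tt) (q * y c σ) (r * z c σ))))
        (≤-trans (subst (_≤ h c σ + h c₁ σ) (+-comm (h c σ) 1) (+-monoʳ-≤ (h c σ) (≤-trans (U₁ σ) (subst (N A₁ l2 l0 l0 (c₁ , σ) tt tt ≤_) (sym (h-≡ c₁ σ)) (≤-split₁ (N A₁ l2 l0 l0 (c₁ , σ) tt tt) (q * y c₁ σ) (r * z c₁ σ))))))
          (subst (h c σ + h c₁ σ ≤_) (BA.level₂ v σ) (∑-≥₂ (λ c → h c σ) ne)))

    -- If no layer has all the qr points, `coin` applies and gives pq ∣ |A₂| and pr ∣ |A₃|. As |A₂|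
    -- + |A₃| = pqr, also pr ∣ |A₂|; so pqr ∣ |A₂| and A₃ would be empty.
    single-class : total A₁ ≡ 0 → 1 ≤ total A₂ → 1 ≤ total A₃ → ∃[ c₀ ] (∀ c → c ≢ c₀ → N A l1 l0 l0 c tt tt ≡ 0)
    single-class U≡0 W≥1 R≥1 with any? (λ c → q * r ≤? h c op)
    ... | yes (c₀ , full) = c₀ , λ c ne → p₁ A ∙ ∑-0 λ σ → h-const c σ op ∙ ∑-dominated (λ c → h c op) c₀ (subst (_≤ h c₀ op) (sym (BA.level₂ v op)) full) c ne
    ... | no none = ⊥-elim (<⇒≢ R≥1 (sym R≡0))
      where
      divs = layers-divide λ c σ → ≤-trans (s≤s (subst (q * y c σ ≤_) (sym (h-const c op σ ∙ h-≡ c σ)) (≤-split₂ (N A₁ l2 l0 l0 (c , σ) tt tt) (q * y c σ) (r * z c σ)))) (≰⇒> λ x → none (c , x))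
      tot : total A₂ + total A₃ ≡ p * q * r; tot = cong (λ w → w + total A₂ + total A₃) (sym U≡0) ∙ sym (split l0 l0 l0 tt tt tt) ∙ total-A
      pr∣W : p * r ∣ total A₂
      pr∣W = ∣m+n∣m⇒∣n (subst (p * r ∣_) (sym tot ∙ +-comm (total A₂) _) (divides q (lem p q r))) (proj₂ divs)
        where lem : ∀ p q r → p * q * r ≡ q * (p * r); lem = ringℕ
      pqr∣W : p * q * r ∣ total A₂; pqr∣W = subst (_∣ total A₂) (*-comm r (p * q)) (r-coprime distinct (∣-trans (n∣m*n p) pr∣W) (proj₁ divs))
      R≡0 : total A₃ ≡ 0
      R≡0 = n≤0⇒n≡0 (+-cancelˡ-≤ (total A₂) _ _ (≤-trans (≤-reflexive tot) (≤-trans (∣⇒≤ {{>-nonZero W≥1}} pqr∣W) (≤-reflexive (sym (+-identityʳ _))))))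

  module _ (v : V A l1 l0 l0) (U≥1 : 1 ≤ total A₁) where
    private
      c₁ : Fin p; c₁ = proj₁ (∑-pos (λ c → N A₁ l1 l0 l0 c tt tt) (subst (1 ≤_) (p₀ A₁) U≥1))
      Uc≥1 : 1 ≤ N A₁ l1 l0 l0 c₁ tt tt; Uc≥1 = proj₂ (∑-pos (λ c → N A₁ l1 l0 l0 c tt tt) (subst (1 ≤_) (p₀ A₁) U≥1))
      X : ℕ; X = N A₁ l2 l0 l0 (c₁ , op) tt tt
      X≥1 : 1 ≤ X; X≥1 = n≢0⇒n>0 λ e → <⇒≢ Uc≥1 (sym (indep₁-* {P = A₁} i₁ c₁ op tt tt ∙ cong (p *_) e ∙ *-zeroʳ p))
      h-≡' : ∀ σ → h c₁ σ ≡ X + q * y c₁ σ + r * z c₁ σ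
      h-≡' σ = h-≡ c₁ σ ∙ cong (λ w → w + q * y c₁ σ + r * z c₁ σ) (i₁ l0 l0 c₁ σ op tt tt)
      sum : p * X + q * ∑ (y c₁) + r * ∑ (z c₁) ≡ q * r
      sum = cong₂ _+_ (cong₂ _+_ (sym (∑-const p X)) (sym (∑-* q (y c₁)))) (sym (∑-* r (z c₁))) ∙
        cong (_+ ∑ (λ σ → r * z c₁ σ)) (sym (∑-+ (λ _ → X) (λ σ → q * y c₁ σ))) ∙ sym (∑-+ (λ σ → X + q * y c₁ σ) (λ σ → r * z c₁ σ)) ∙ (∑-cong λ σ → sym (h-≡' σ)) ∙ sym (p₁ A) ∙ BA.level₁ v c₁

    -- Otherwise the layer sizes in c₁ are congruent mod r, so y is the same in all layers, and
    -- counting the class gives p(X + q y) = r k with k ≤ q < p. Then p ∣ k, so k = 0 and c₁ would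
    -- have no point of A₁.
    not-V₂ : q < p → ∀ n → n ≢ l0 → ¬ V A l2 l0 n
    not-V₂ q<p n ne vn = <⇒≢ X≥1 (sym X≡0)
      where
      y< : ∀ σ → y c₁ σ < r
      y< σ = ≤-<-trans (∑-≥ (y c₁) σ) (*-cancelˡ-< q _ r (≤-trans (+-monoˡ-≤ (q * ∑ (y c₁)) (*-mono-≤ (>-nonZero⁻¹ p) X≥1)) (subst (p * X + q * ∑ (y c₁) ≤_) sum (m≤m+n _ _))))
      r∣h : ∀ σ σ' → + r ∣ℤ (+ h c₁ σ - + h c₁ σ')
      r∣h σ σ' = slice-div (rev A) l0 l2 tt (c₁ , σ , σ') n ne (V-rev A l2 l0 n vn)
      ℤ-h : ∀ σ → + h c₁ σ ≡ + X ⊕ + q · + y c₁ σ ⊕ + r · + z c₁ σ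
      ℤ-h σ = cong +_ (h-≡' σ) ∙ cong₂ _⊕_ (cong (λ w → + X ⊕ w) (pos-* q _)) (pos-* r _)
      y-const : ∀ σ → y c₁ σ ≡ y c₁ op
      y-const σ = small-∣ (y< σ) (y< op) ([ (λ d → ⊥-elim (prime∤prime r-prime q-prime (q≢r ∘ sym) (pos∣⁻¹ d))) , (λ d → d) ]′
         (prime-∣ℤ-* r-prime (+ q) (+ y c₁ σ - + y c₁ op) (∣ℤ-cong (cong₂ (λ a b → a - b - + r · (+ z c₁ σ - + z c₁ op)) (ℤ-h σ) (ℤ-h op) ∙ lem (+ X) (+ q) (+ y c₁ σ) (+ r) (+ z c₁ σ) (+ y c₁ op) (+ z c₁ op))
            (sub∣ (r∣h σ op) (mulʳ∣ (+ z c₁ σ - + z c₁ op) refl∣)))))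
        where lem : ∀ X q y r z y' z' → (X ⊕ q · y ⊕ r · z) - (X ⊕ q · y' ⊕ r · z') - r · (z - z') ≡ q · (y - y'); lem = ring
      Z = ∑ (z c₁)
      sum' : p * (X + q * y c₁ op) + r * Z ≡ q * r
      sum' = cong (_+ r * Z) (lem p X q (y c₁ op) ∙ cong (λ w → p * X + q * w) (sym (∑-cong y-const ∙ ∑-const p (y c₁ op)))) ∙ sum
        where lem : ∀ p X q y → p * (X + q * y) ≡ p * X + q * (p * y); lem = ringℕ
      Z≤q : Z ≤ q; Z≤q = *-cancelˡ-≤ r (subst (r * Z ≤_) (sum' ∙ *-comm q r) (m≤n+m (r * Z) _))
      k = q ∸ Z
      rk : p * (X + q * y c₁ op) ≡ r * k; rk = +-cancelʳ-≡ (r * Z) _ _ (sum' ∙ *-comm q r ∙ cong (r *_) (sym (m∸n+n≡m Z≤q)) ∙ *-distribˡ-+ r k Z)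
      p∣k : p ∣ k
      p∣k = [ (λ d → ⊥-elim (prime∤prime p-prime r-prime p≢r d)) , (λ d → d) ]′ (euclidsLemma r k p-prime (divides (X + q * y c₁ op) (sym rk ∙ *-comm p _)))
      k≡0 : k ≡ 0
      k≡0 with k in e
      ... | zero = refl
      ... | suc k' = ⊥-elim (<⇒≱ q<p (≤-trans (∣⇒≤ (subst (p ∣_) e p∣k)) (subst (_≤ q) e (m∸n≤m q Z))))
      X≡0 : X ≡ 0; X≡0 = m+n≡0⇒m≡0 X ([ (λ e → ⊥-elim (≢-nonZero⁻¹ p e)) , (λ e → e) ]′ (m*n≡0⇒m≡0∨n≡0 p (rk ∙ cong (r *_) k≡0 ∙ *-zeroʳ r)))

    p≤N : ∀ {n} (zz : Pos r n) → 1 ≤ N A₁ l1 l0 n c₁ tt zz → p ≤ N A l1 l0 n c₁ tt zz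
    p≤N {n} zz ge = ≤-trans (∣⇒≤ {{>-nonZero ge}} (divides (N A₁ l2 l0 n (c₁ , op) tt zz) (indep₁-* {P = A₁} i₁ c₁ op tt zz ∙ *-comm p _)))
      (subst (N A₁ l1 l0 n c₁ tt zz ≤_) (sym (split l1 l0 n c₁ tt zz)) (≤-split₁ (N A₁ l1 l0 n c₁ tt zz) (N A₂ l1 l0 n c₁ tt zz) (N A₃ l1 l0 n c₁ tt zz)))

    w₁ : ∃[ w ] 1 ≤ N A₁ l1 l0 l1 c₁ tt w; w₁ = ∑-pos (λ w → N A₁ l1 l0 l1 c₁ tt w) (subst (1 ≤_) (r₀ A₁) Uc≥1)

    -- The two divisors spread the points of the class c₁ evenly over ω, which leaves at most q
    -- points to each class mod r². A p-fibre puts p > q points into one of them.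
    not-V12 : q < p → V A l0 l0 l2 → ¬ V A l1 l0 l2
    not-V12 q<p v₀ v₁ = <⇒≱ q<p (≤-trans (p≤N (w , ω) (proj₂ w₂)) (subst (_≤ q) (sym (const-ω w ω)) (subst (N A l1 l0 l2 c₁ tt (w , or) ≤_) sum-a (∑-≥ (λ w → N A l1 l0 l2 c₁ tt (w , or)) w))))
      where
      w = proj₁ w₁
      w₂ : ∃[ ω ] 1 ≤ N A₁ l1 l0 l2 c₁ tt (w , ω); w₂ = ∑-pos (λ ω → N A₁ l1 l0 l2 c₁ tt (w , ω)) (subst (1 ≤_) (r₁ A₁) (proj₂ w₁))
      ω = proj₁ w₂
      const-ω : ∀ w ω → N A l1 l0 l2 c₁ tt (w , ω) ≡ N A l1 l0 l2 c₁ tt (w , or)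
      const-ω w ω = level (slice₁-zero A l0 l2 tt (w , ω , or) v₀ v₁ c₁)
      sum-a : ∑ (λ w → N A l1 l0 l2 c₁ tt (w , or)) ≡ q
      sum-a = *-cancelˡ-≡ _ _ r (sym (∑-* r (λ w → N A l1 l0 l2 c₁ tt (w , or))) ∙ (∑-cong λ w → sym (r₁ A ∙ ∑-const-≡ (λ ω → N A l1 l0 l2 c₁ tt (w , ω)) or (const-ω w))) ∙
         sym (r₀ A) ∙ BA.level₁ v c₁ ∙ *-comm q r)

    not-V11 : q < p → V A l0 l0 l1 → ¬ V A l1 l0 l1
    not-V11 q<p v₀ v₁ = <⇒≱ q<p (≤-trans (p≤N w (proj₂ w₁)) (≤-reflexive a≡q))
      where
      w = proj₁ w₁
      a≡q : N A l1 l0 l1 c₁ tt w ≡ q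
      a≡q = *-cancelˡ-≡ _ _ r (sym (r₀ A ∙ ∑-const-≡ (λ w → N A l1 l0 l1 c₁ tt w) w (λ w' → level (slice₁-zero A l0 l1 tt (w' , w) v₀ v₁ c₁))) ∙ BA.level₁ v c₁ ∙ *-comm q r)

-- Here q is the smallest prime. If Φ_{p²} and Φ_{r²} divide A, then pq and qr divide |A₂|, which
-- leaves nothing for A₁. If Φ_p or Φ_r divides A, the longer p-fibres or r-fibres keep the mixed
-- divisors away from A. So B has all of them, which `no-cyclotomic-pattern` forbids.
three-directions-smallest : ∀ {p q r} (T : Pair p q r) (dec : Decomposition (Pair.A T)) → q < p → q < r →
  1 ≤ Profile.total (Decomposition.A₁ dec) → 1 ≤ Profile.total (Decomposition.A₂ dec) → 1 ≤ Profile.total (Decomposition.A₃ dec) → ⊥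
three-directions-smallest {p} {q} {r} T dec q<p q<r U W R = go (exponent₁ T) (exponent₁ T')
  where
  T' = pair-rev T
  dec' = dec-rev dec
  open Pair T
  open Distinct distinct
  open Decomposition dec
  module F = WithDecomposition T dec
  module G = WithDecomposition T' dec'
  force-B : ∀ l m n → ¬ (l ≡ l0 × m ≡ l0 × n ≡ l0) → ¬ V A l m n → V B l m n
  force-B l m n ne nv = [ (λ a → ⊥-elim (nv a)) , (λ b → b) ]′ (alternative l m n ne)
  go : Exponent₁ T l1 l2 ⊎ Exponent₁ T l2 l1 → Exponent₁ T' l1 l2 ⊎ Exponent₁ T' l2 l1 → ⊥
  go (inj₂ a) (inj₂ b) = <⇒≢ U (sym U≡0)
    where
    pq∣W : p * q ∣ Profile.total A₂; pq∣W = proj₁ (F.square-divides (Exponent₁.in-A a) U)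
    rq∣W : r * q ∣ Profile.total A₂; rq∣W = proj₁ (G.square-divides (Exponent₁.in-A b) R)
    pqr∣W : p * q * r ∣ Profile.total A₂; pqr∣W = subst (_∣ Profile.total A₂) (*-comm r (p * q)) (r-coprime distinct (∣-trans (m∣m*n q) rq∣W) pq∣W)
    U≡0 : Profile.total A₁ ≡ 0
    U≡0 = n≤0⇒n≡0 (+-cancelʳ-≤ (Profile.total A₂) _ _ (≤-trans (m≤m+n _ (Profile.total A₃)) (≤-trans (≤-reflexive (sym (split l0 l0 l0 tt tt tt) ∙ total-A)) (∣⇒≤ {{>-nonZero W}} pqr∣W))))
  go (inj₁ a) (inj₁ b) = no-cyclotomic-pattern T q<r (Exponent₁.in-B a) (force-B l2 l0 l1 (λ ()) (F.not-V₂ va U q<p l1 λ ())) (force-B l2 l0 l2 (λ ()) (F.not-V₂ va U q<p l2 λ ()))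
      (force-B l1 l0 l2 (λ ()) λ x → G.not-V₂ vb R q<r l1 (λ ()) (V-rev A l1 l0 l2 x))
      (inj₂ (V-rev (rev B) l2 l0 l0 (Exponent₁.in-B b) , force-B l1 l0 l1 (λ ()) (F.not-V11 va U q<p (V-rev (rev A) l1 l0 l0 vb))))
    where va = Exponent₁.in-A a
          vb = Exponent₁.in-A b
  go (inj₁ a) (inj₂ b) = no-cyclotomic-pattern T q<r (Exponent₁.in-B a) (force-B l2 l0 l1 (λ ()) (F.not-V₂ va U q<p l1 λ ())) (force-B l2 l0 l2 (λ ()) (F.not-V₂ va U q<p l2 λ ()))
      (force-B l1 l0 l2 (λ ()) (F.not-V12 va U q<p (V-rev (rev A) l2 l0 l0 (Exponent₁.in-A b)))) (inj₁ (V-rev (rev B) l1 l0 l0 (Exponent₁.in-B b)))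
    where va = Exponent₁.in-A a
  go (inj₂ a) (inj₁ b) = no-cyclotomic-pattern T' q<p (Exponent₁.in-B b) (force-B' l2 l0 l1 (λ ()) (G.not-V₂ vb R q<r l1 λ ())) (force-B' l2 l0 l2 (λ ()) (G.not-V₂ vb R q<r l2 λ ()))
      (force-B' l1 l0 l2 (λ ()) (G.not-V12 vb R q<r (V-rev A l2 l0 l0 (Exponent₁.in-A a)))) (inj₁ (V-rev B l1 l0 l0 (Exponent₁.in-B a)))
    where
    vb = Exponent₁.in-A b
    force-B' : ∀ l m n → ¬ (l ≡ l0 × m ≡ l0 × n ≡ l0) → ¬ V (rev A) l m n → V (rev B) l m n
    force-B' l m n ne nv = [ (λ a → ⊥-elim (nv a)) , (λ b → b) ]′ (Pair.alternative T' l m n ne)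

three-directions : ∀ {p q r} (T : Pair p q r) (dec : Decomposition (Pair.A T)) →
  1 ≤ Profile.total (Decomposition.A₁ dec) → 1 ≤ Profile.total (Decomposition.A₂ dec) → 1 ≤ Profile.total (Decomposition.A₃ dec) → ⊥
three-directions {p} {q} {r} T dec U W R with <-cmp p q | <-cmp q r | <-cmp p r
... | tri≈ _ e _ | _ | _ = Distinct.p≢q (Pair.distinct T) e
... | _ | tri≈ _ e _ | _ = Distinct.q≢r (Pair.distinct T) e
... | _ | _ | tri≈ _ e _ = Distinct.p≢r (Pair.distinct T) e
... | tri> _ _ q<p | tri< q<r _ _ | _ = three-directions-smallest T dec q<p q<r U W R
... | tri< p<q _ _ | _ | tri< p<r _ _ = three-directions-smallest (pair12 T) (dec12 dec) p<q p<r W U R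
... | _ | tri> _ _ r<q | tri> _ _ r<p = three-directions-smallest (pair23 T) (dec23 dec) r<p r<q U R W
... | tri< p<q _ _ | tri< q<r _ _ | tri> _ _ r<p = <-asym r<p (<-trans p<q q<r)
... | tri> _ _ q<p | tri> _ _ r<q | tri< p<r _ _ = <-asym p<r (<-trans r<q q<p)

-- Classes mod p that are unions of q-fibres

lonely₂ : ∀ a {b c d} → (+ a - + b) - (+ c - + d) ≡ + 0 → b ≡ 0 → c ≡ 0 → d ≡ 0 → a ≡ 0
lonely₂ a {b} {c} {d} e refl refl refl = sym (+-identityʳ a) ∙ cross a 0 0 0 e

half : ∀ {x y} → x - y ≡ + 0 → y ≡ + 0 → x ≡ + 0
half e refl = i-j≡0⇒i≡j _ _ e

another : ∀ {n} → 2 ≤ n → (i : Fin n) → ∃[ j ] j ≢ i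
another (s≤s (s≤s _)) Fin.zero = Fin.suc Fin.zero , λ ()
another (s≤s (s≤s _)) (Fin.suc i) = Fin.zero , λ ()

third : ∀ {n} → 3 ≤ n → (i j : Fin n) → ∃[ k ] (k ≢ i × k ≢ j)
third (s≤s (s≤s (s≤s _))) Fin.zero Fin.zero = Fin.suc Fin.zero , (λ ()) , (λ ())
third (s≤s (s≤s (s≤s _))) Fin.zero (Fin.suc Fin.zero) = Fin.suc (Fin.suc Fin.zero) , (λ ()) , (λ ())
third (s≤s (s≤s (s≤s _))) Fin.zero (Fin.suc (Fin.suc j)) = Fin.suc Fin.zero , (λ ()) , (λ ())
third (s≤s (s≤s (s≤s _))) (Fin.suc Fin.zero) Fin.zero = Fin.suc (Fin.suc Fin.zero) , (λ ()) , (λ ())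
third (s≤s (s≤s (s≤s _))) (Fin.suc (Fin.suc i)) Fin.zero = Fin.suc Fin.zero , (λ ()) , (λ ())
third (s≤s (s≤s (s≤s _))) (Fin.suc i) (Fin.suc j) = Fin.zero , (λ ()) , (λ ())

prime≥2 : ∀ {p} → Prime p → 2 ≤ p
prime≥2 {p} pr = nonTrivial⇒n>1 p {{prime⇒nonTrivial pr}}

differs-or-constant : ∀ {n k} (f : Fin n → Fin k) i → (∃[ ω ] f ω ≢ i) ⊎ (∀ ω → f ω ≡ i)
differs-or-constant f i with any? (λ ω → ¬? (f ω Finₚ.≟ i))
... | yes j = inj₁ j
... | no none = inj₂ λ ω → decidable-stable (f ω Finₚ.≟ i) λ ne → none (ω , ne)

scale-cross : ∀ k .{{_ : NonZero k}} {a b c d a' b' c' d'} → a ≡ k * a' → b ≡ k * b' → c ≡ k * c' → d ≡ k * d' → a + d ≡ b + c → a' + d' ≡ b' + c'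
scale-cross k {a' = a'} {b'} {c'} {d'} refl refl refl refl e = *-cancelˡ-≡ _ _ k (*-distribˡ-+ k a' d' ∙ e ∙ sym (*-distribˡ-+ k b' c'))

full-row-const : ∀ {p k r} {κ : Fin p → Fin k → Fin r → ℕ} → FullRow κ → ∀ σ w ω ω' → κ σ w ω ≡ κ σ w ω'
full-row-const F σ w ω ω' with σ Finₚ.≟ FullRow.σ₀ F | w Finₚ.≟ FullRow.w₀ F
... | no ne | _ = FullRow.empty-σ F σ w ω ne ∙ sym (FullRow.empty-σ F σ w ω' ne)
... | yes _ | no ne = FullRow.empty-w F σ w ω ne ∙ sym (FullRow.empty-w F σ w ω' ne)
... | yes refl | yes refl = FullRow.full F ω ∙ sym (FullRow.full F ω')

multiple-≥ : ∀ {a k} → k ∣ a → 1 ≤ a → k ≤ a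
multiple-≥ d h = ∣⇒≤ {{>-nonZero h}} d

-- Vanishing class by class gives the divisors with exponents 0 and 1 of p at once; most of the
-- divisors of A found below arise so.
from-classes : ∀ {p q r} (P : Profile p q r) m n → (∀ c u s → slice P m n u s l1 c ≡ + 0) → V P l0 m n × V P l1 m n
from-classes P m n h = (λ _ u s → slice₀-sum P m n u s (λ c → h c u s)) , (λ (c , c') u s → cong₂ _-_ (h c u s) (h c' u s))

from-layers : ∀ {p q r} (P : Profile p q r) m n → (∀ c σ σ' y z → Profile.N P l2 m n (c , σ) y z ≡ Profile.N P l2 m n (c , σ') y z) → V P l2 m n
from-layers P m n h (c , σ , σ') u s = i≡j⇒i-j≡0 (alt-cong m u λ y → alt-cong n s λ z → cong +_ (h c σ σ' y z))

-- The points of A in the class c mod p form a union of q-fibres.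
record FibredClass {p q r : ℕ} (A : Profile p q r) (c : Fin p) : Set where
  open Profile
  field
    A₂ : Profile p q r
    i₂ : Indep₂ A₂
    e₁ : ∀ m n y z → N A l1 m n c y z ≡ N A₂ l1 m n c y z
    e₂ : ∀ m n σ y z → N A l2 m n (c , σ) y z ≡ N A₂ l2 m n (c , σ) y z
    size : N A l1 l0 l0 c tt tt ≡ q * r

module OnFibred {p q r : ℕ} (D : Distinct p q r) {A : Profile p q r} {c : Fin p} (F : FibredClass A c) where
  open Distinct D
  open FibredClass F
  open Profile
  open NonZeros D
  private
    oq = origin q-prime
    or = origin r-prime

  ψ-indep₁ : ∀ n v ψ ψ' z → N A l1 l2 n c (v , ψ) z ≡ N A l1 l2 n c (v , ψ') z
  ψ-indep₁ n v ψ ψ' z = e₁ l2 n (v , ψ) z ∙ i₂ l1 n c v ψ ψ' z ∙ sym (e₁ l2 n (v , ψ') z)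

  mult11 : ∀ n v z → N A l1 l1 n c v z ≡ q * N A₂ l1 l2 n c (v , oq) z
  mult11 n v z = e₁ l1 n v z ∙ indep₂-* {P = A₂} i₂ c v oq z

  mult10 : ∀ n z → N A l1 l0 n c tt z ≡ q * fibres₂ A₂ oq l1 n c z
  mult10 n z = e₁ l0 n tt z ∙ fibres₂-* {P = A₂} i₂ c z oq

  mult21 : ∀ n σ v z → N A l2 l1 n (c , σ) v z ≡ q * N A₂ l2 l2 n (c , σ) (v , oq) z
  mult21 n σ v z = e₂ l1 n σ v z ∙ indep₂-* {P = A₂} i₂ (c , σ) v oq z

  mult20 : ∀ n σ z → N A l2 l0 n (c , σ) tt z ≡ q * fibres₂ A₂ oq l2 n (c , σ) z
  mult20 n σ z = e₂ l0 n σ tt z ∙ fibres₂-* {P = A₂} i₂ (c , σ) z oq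

  q∣21 : ∀ n σ v z → q ∣ N A l2 l1 n (c , σ) v z
  q∣21 n σ v z = subst (q ∣_) (sym (mult21 n σ v z)) (m∣m*n _)

  q∣20 : ∀ n σ z → q ∣ N A l2 l0 n (c , σ) tt z
  q∣20 n σ z = subst (q ∣_) (sym (mult20 n σ z)) (m∣m*n _)

  -- Evenly spread, the qr points of the class would put r of them over each v; but over v there are
  -- whole q-fibres, so q ∣ r.
  not-v-constant : ¬ (∀ v v' → N A l1 l1 l0 c v tt ≡ N A l1 l1 l0 c v' tt)
  not-v-constant h = prime∤prime q-prime r-prime q≢r (divides (N A₂ l1 l2 l0 c (oq , oq) tt) (sym N≡r ∙ mult11 l0 oq tt ∙ *-comm q _))
    where
    N≡r : N A l1 l1 l0 c oq tt ≡ r; N≡r = *-cancelˡ-≡ _ _ q (sym (∑-const-≡ (λ v → N A l1 l1 l0 c v tt) oq (λ v → h v oq)) ∙ sym (q₀ A) ∙ size)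

  -- The class has r fibres, and Φ_{p²r²} removes the cross differences of their numbers in σ and ω.
  -- As p ∤ r, `full-row` puts one fibre over each ω of a single w and σ.
  ω-constant : V A l2 l0 l2 → ∀ w ω ω' → N A l1 l0 l2 c tt (w , ω) ≡ N A l1 l0 l2 c tt (w , ω')
  ω-constant h w ω ω' = N₁ ω ∙ (∑-cong λ σ → cong (q *_) (full-row-const row σ w ω ω')) ∙ sym (N₁ ω')
    where
    κ : Fin p → Fin r → Fin r → ℕ
    κ σ w ω = fibres₂ A₂ oq l2 l2 (c , σ) (w , ω)
    N₁ : ∀ {w} ω → N A l1 l0 l2 c tt (w , ω) ≡ ∑ (λ σ → q * κ σ w ω)
    N₁ {w} ω = p₁ A ∙ ∑-cong λ σ → mult20 l2 σ (w , ω)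
    tot : ∑ (λ σ → ∑ (λ w → ∑ (κ σ w))) ≡ r
    tot = *-cancelˡ-≡ _ _ q (sym ((∑-cong λ σ → ∑∑-* q (κ σ)) ∙ ∑-* q (λ σ → ∑ (λ w → ∑ (κ σ w)))) ∙
      (∑-cong λ σ → (∑-cong λ w → (∑-cong λ ω → sym (mult20 l2 σ (w , ω))) ∙ sym (r₁ A)) ∙ sym (r₀ A)) ∙ sym (p₁ A) ∙ size)
    row : FullRow κ
    row = full-row κ (λ w d d' ω ω' → scale-cross q (mult20 l2 d (w , ω)) (mult20 l2 d (w , ω')) (mult20 l2 d' (w , ω)) (mult20 l2 d' (w , ω'))
            (cross-at (λ i j → N A l2 l0 l2 (c , i) tt (w , j)) d d' ω ω' (h (c , d , d') tt (w , ω , ω')))) tot (prime∤prime p-prime r-prime p≢r)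

  -- Constancy in ω makes the number of points over each w a multiple of qr, the size of the class.
  -- So the class lies over a single `w₀`, with q points over each ω.
  module WithConstant (hω : ∀ w ω ω' → N A l1 l0 l2 c tt (w , ω) ≡ N A l1 l0 l2 c tt (w , ω')) where
    private
      u : Fin r → ℕ
      u w = fibres₂ A₂ oq l1 l2 c (w , or)
      N-u : ∀ w ω → N A l1 l0 l2 c tt (w , ω) ≡ q * u w
      N-u w ω = hω w ω or ∙ mult10 l2 (w , or)
      N-u' : ∀ w → N A l1 l0 l1 c tt w ≡ (q * r) * u w
      N-u' w = r₁ A ∙ (∑-cong λ ω → N-u w ω) ∙ ∑-const r (q * u w) ∙ lem r q (u w)
        where lem : ∀ r q u → r * (q * u) ≡ q * r * u; lem = ringℕ
      ∑u : ∑ u ≡ 1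
      ∑u = *-cancelˡ-≡ _ _ (q * r) {{m*n≢0 q r}} (sym (∑-* (q * r) u) ∙ (∑-cong λ w → sym (N-u' w)) ∙ sym (r₀ A) ∙ size ∙ sym (*-identityʳ (q * r)))
      w₀∃ : ∃[ w ] 1 ≤ u w; w₀∃ = ∑-pos u (≤-reflexive (sym ∑u))

    w₀ : Fin r; w₀ = proj₁ w₀∃

    off-w₀ : ∀ w → w ≢ w₀ → N A l1 l0 l1 c tt w ≡ 0
    off-w₀ w ne = N-u' w ∙ cong (q * r *_) (∑-dominated u w₀ (≤-trans (≤-reflexive ∑u) (proj₂ w₀∃)) w ne) ∙ *-zeroʳ (q * r)

    at-w₀ : ∀ ω → N A l1 l0 l2 c tt (w₀ , ω) ≡ q
    at-w₀ ω = N-u w₀ ω ∙ cong (q *_) (≤-antisym (subst (u w₀ ≤_) ∑u (∑-≥ u w₀)) (proj₂ w₀∃)) ∙ *-identityʳ q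

    collapse-w : ∀ v → N A l1 l1 l0 c v tt ≡ N A l1 l1 l1 c v w₀
    collapse-w v = r₀ A ∙ ∑-single (λ w → N A l1 l1 l1 c v w) w₀ λ w ne → n≤0⇒n≡0 (subst (N A l1 l1 l1 c v w ≤_) (off-w₀ w ne) (≤-q₀ A c v w))

    -- Over a w' other than `w₀` there is nothing, so balance between `w₀` and w' would be constancy
    -- in v.
    not-vw-balanced : ¬ (∀ v v' w w' → N A l1 l1 l1 c v w + N A l1 l1 l1 c v' w' ≡ N A l1 l1 l1 c v w' + N A l1 l1 l1 c v' w)
    not-vw-balanced h = not-v-constant λ v v' → collapse-w v ∙ sym (+-identityʳ _) ∙ subst₂ (λ a b → N A l1 l1 l1 c v w₀ + a ≡ b + N A l1 l1 l1 c v' w₀) (z v') (z v) (h v v' w₀ w') ∙ sym (collapse-w v')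
      where
      w' = proj₁ (another (prime≥2 r-prime) w₀)
      z : ∀ v → N A l1 l1 l1 c v w' ≡ 0
      z v = n≤0⇒n≡0 (subst (N A l1 l1 l1 c v w' ≤_) (off-w₀ w' (proj₂ (another (prime≥2 r-prime) w₀))) (≤-q₀ A c v w'))

    SingleLayer : Set; SingleLayer = ∃[ σ₀ ] (∀ σ → σ ≢ σ₀ → N A l2 l0 l0 (c , σ) tt tt ≡ 0)

    private
      abstract
        -- The q points over (w₀, ω) come in multiples of q in each layer, so one layer has them
        -- all.
        σ-of : ∀ ω → ∃[ σ ] q ≤ N A l2 l0 l2 (c , σ) tt (w₀ , ω)
        σ-of ω = let (σ , h) = ∑-pos (λ σ → N A l2 l0 l2 (c , σ) tt (w₀ , ω)) (subst (1 ≤_) (sym (at-w₀ ω) ∙ p₁ A) (>-nonZero⁻¹ q)) in σ , multiple-≥ (q∣20 l2 σ (w₀ , ω)) h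
      off-σ : ∀ ω σ → σ ≢ proj₁ (σ-of ω) → N A l2 l0 l2 (c , σ) tt (w₀ , ω) ≡ 0
      off-σ ω = ∑-dominated (λ σ → N A l2 l0 l2 (c , σ) tt (w₀ , ω)) (proj₁ (σ-of ω)) (≤-trans (≤-reflexive (sym (p₁ A) ∙ at-w₀ ω)) (proj₂ (σ-of ω)))
      off-σ₁ : ∀ ω σ v → σ ≢ proj₁ (σ-of ω) → N A l2 l1 l2 (c , σ) v (w₀ , ω) ≡ 0
      off-σ₁ ω σ v ne = n≤0⇒n≡0 (subst (N A l2 l1 l2 (c , σ) v (w₀ , ω) ≤_) (off-σ ω σ ne) (≤-q₀ A (c , σ) v (w₀ , ω)))
      s₀ : Fin p; s₀ = proj₁ (σ-of or)

    single-or-jump : SingleLayer ⊎ ∃[ ω ] proj₁ (σ-of ω) ≢ s₀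
    single-or-jump = [ inj₂ , (λ same → inj₁ (s₀ , λ σ ne → r₀ A ∙ ∑-0 λ w → r₁ A ∙ ∑-0 λ ω → go same σ ne w ω (w Finₚ.≟ w₀))) ]′ (differs-or-constant (λ ω → proj₁ (σ-of ω)) s₀)
      where
      go : (∀ ω → proj₁ (σ-of ω) ≡ s₀) → ∀ σ → σ ≢ s₀ → ∀ w ω → Dec (w ≡ w₀) → N A l2 l0 l2 (c , σ) tt (w , ω) ≡ 0
      go same σ ne w ω (yes refl) = off-σ ω σ λ e → ne (e ∙ same ω)
      go same σ ne w ω (no ne') = n≤0⇒n≡0 (subst (N A l2 l0 l2 (c , σ) tt (w , ω) ≤_) (off-w₀ w ne') (≤-trans (≤-p₁ A c σ tt (w , ω)) (≤-r₁ A c tt w ω)))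

    module _ (2<p : 2 < p) where
      -- If two values of ω had their points in different layers, a third layer would complete a
      -- rectangle with only one nonzero corner. This is where p > 2 is used.
      single-layer₀ : V A l2 l0 l2 → SingleLayer
      single-layer₀ h = [ (λ s → s) , jump ]′ single-or-jump
        where
        jump : ∃[ ω ] proj₁ (σ-of ω) ≢ s₀ → SingleLayer
        jump (ω' , ne) = let (σ' , n₁ , n₂) = third 2<p s₀ (proj₁ (σ-of ω')) in
          ⊥-elim (<⇒≢ (≤-trans (>-nonZero⁻¹ q) (proj₂ (σ-of or)))
          (sym (lonely₂ (N A l2 l0 l2 (c , s₀) tt (w₀ , or)) (h (c , s₀ , σ') tt (w₀ , or , ω')) (off-σ ω' s₀ (ne ∘ sym)) (off-σ or σ' n₁) (off-σ ω' σ' n₂))))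

      -- As before, with a cuboid: in the layer `s₀` the points over (w₀, `or`) form one q-fibre, so
      -- they have one v₀, and any other v gives an empty side.
      single-layer₁ : V A l2 l1 l2 → SingleLayer
      single-layer₁ h = [ (λ s → s) , jump ]′ single-or-jump
        where
        f : Fin q → ℕ
        f v = N A l2 l1 l2 (c , s₀) v (w₀ , or)
        ∑f : ∑ f ≡ N A l2 l0 l2 (c , s₀) tt (w₀ , or); ∑f = sym (q₀ A)
        ∑f≤q : ∑ f ≤ q; ∑f≤q = ≤-trans (≤-reflexive ∑f) (subst (N A l2 l0 l2 (c , s₀) tt (w₀ , or) ≤_) (at-w₀ or) (≤-p₁ A c s₀ tt (w₀ , or)))
        v₀∃ : ∃[ v ] 1 ≤ f v; v₀∃ = ∑-pos f (subst (1 ≤_) (sym ∑f) (≤-trans (>-nonZero⁻¹ q) (proj₂ (σ-of or))))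
        v₀ = proj₁ v₀∃
        v' = proj₁ (another (prime≥2 q-prime) v₀)
        off-v : f v' ≡ 0
        off-v = ∑-dominated f v₀ (≤-trans ∑f≤q (multiple-≥ (q∣21 l2 s₀ v₀ (w₀ , or)) (proj₂ v₀∃))) v' (proj₂ (another (prime≥2 q-prime) v₀))
        four : ∀ {a b c d} → a ≡ 0 → b ≡ 0 → c ≡ 0 → d ≡ 0 → (+ a - + b) - (+ c - + d) ≡ + 0
        four refl refl refl refl = refl
        jump : ∃[ ω ] proj₁ (σ-of ω) ≢ s₀ → SingleLayer
        jump (ω' , ne) = let (σ' , n₁ , n₂) = third 2<p s₀ (proj₁ (σ-of ω')) in
          ⊥-elim (<⇒≢ (proj₂ v₀∃)
          (sym (lonely₂ (f v₀) (half (h (c , s₀ , σ') (v₀ , v') (w₀ , or , ω')) (four (off-σ₁ or σ' v₀ n₁) (off-σ₁ ω' σ' v₀ n₂) (off-σ₁ or σ' v' n₁) (off-σ₁ ω' σ' v' n₂)))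
            (off-σ₁ ω' s₀ v₀ (ne ∘ sym)) off-v (off-σ₁ ω' s₀ v' (ne ∘ sym)))))

    module _ (single : SingleLayer) where
      private
        σ₀ = proj₁ single
        σ' = proj₁ (another (prime≥2 p-prime) σ₀)
        layer-0 : ∀ σ → σ ≢ σ₀ → ∀ m n y z → N A l2 m n (c , σ) y z ≡ 0
        layer-0 σ ne m n y z = class-zero A (c , σ) (proj₂ single σ ne) m n y z

      -- An empty layer turns vanishing in the second p-level into vanishing on the class.
      class-vanishes : ∀ m n → V A l2 m n → ∀ u s → slice A m n u s l1 c ≡ + 0
      class-vanishes m n h u s = (alt-cong m u λ y → alt-cong n s λ z → cong +_ (p₁ A ∙ ∑-single (λ σ → N A l2 m n (c , σ) y z) σ₀ λ σ ne → layer-0 σ ne m n y z)) ∙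
        half (h (c , σ₀ , σ') u s) ((alt-cong m u λ y → (alt-cong n s λ z → cong +_ (layer-0 σ' (proj₂ (another (prime≥2 p-prime) σ₀)) m n y z)) ∙ alt-0 n s) ∙ alt-0 m u)

      not-V210 : ¬ V A l2 l1 l0
      not-V210 h = not-v-constant λ v v' → level (class-vanishes l1 l0 h (v , v') tt)

      not-V211 : ¬ V A l2 l1 l1
      not-V211 h = not-vw-balanced λ v v' w w' → cross-at (N A l1 l1 l1 c) v v' w w' (class-vanishes l1 l1 h (v , v') (w , w'))

-- The divisors when Φ_p divides A and both other directions occur

record LevelOneDivisors {p q r : ℕ} (T : Pair p q r) : Set where
  open Pair T
  field
    -- The letter names the set and the three digits are the exponents of p, q and r.
    a020 : V A l0 l2 l0
    a120 : V A l1 l2 l0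
    a002 : V A l0 l0 l2
    a102 : V A l1 l0 l2
    b200 : V B l2 l0 l0
    b210 : V B l2 l1 l0
    b201 : V B l2 l0 l1
    b211 : V B l2 l1 l1
    b011 : V B l0 l1 l1
    slab12 : V B l2 l1 l2 ⊎ (V A l0 l1 l2 × V A l1 l1 l2)
    slab21 : V B l2 l2 l1 ⊎ (V A l0 l2 l1 × V A l1 l2 l1)

record LevelOneSetting {p q r : ℕ} (T : Pair p q r) : Set where
  open Pair T
  field
    2<p : 2 < p
    a100 : V A l1 l0 l0
    fibred : ∀ c → FibredClass A c ⊎ FibredClass (sw23 A) c
    c₂ c₃ : Fin p
    fibred₂ : FibredClass A c₂
    fibred₃ : FibredClass (sw23 A) c₃

module LevelOneBasics {p q r : ℕ} (T : Pair p q r) (S : LevelOneSetting T) where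
  open Pair T public
  open LevelOneSetting S public
  open Distinct distinct public
  open Profile
  instance
    nzp = prime⇒nonZero p-prime
    nzq = prime⇒nonZero q-prime
    nzr = prime⇒nonZero r-prime
  op = origin p-prime
  oq = origin q-prime
  or = origin r-prime
  NA = N A
  NB = N B
  module J {c} (F : FibredClass A c) = OnFibred distinct F
  module K {c} (F : FibredClass (sw23 A) c) = OnFibred (swap23 distinct) F

  b200 : V B l2 l0 l0
  b200 = [ (λ e → Exponent₁.in-B e) , (λ e → ⊥-elim (Exponent₁.out-A e a100)) ]′ (exponent₁ T)

  size₁ : ∀ c → NA l1 l0 l0 c tt tt ≡ q * r
  size₁ = Basics.level₁ distinct A total-A a100

  OmegaConstant : Set
  OmegaConstant = ∀ c w ω ω' → NA l1 l0 l2 c tt (w , ω) ≡ NA l1 l0 l2 c tt (w , ω')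

  -- If Φ_{p²qr²} divides A, then a q-fibred class lies in one layer and the alternating sum in q
  -- and r² vanishes on it already; on an r-fibred class nothing depends on ω.
  slab : OmegaConstant → V B l2 l1 l2 ⊎ (V A l0 l1 l2 × V A l1 l1 l2)
  slab hω = [ (λ a → inj₂ (from-classes A l1 l2 (on-class a))) , inj₁ ]′ (alternative l2 l1 l2 λ ())
    where
    on-class : V A l2 l1 l2 → ∀ c u s → slice A l1 l2 u s l1 c ≡ + 0
    on-class a c u s@(w , ω , ω') with fibred c
    ... | inj₁ F = let module W = J.WithConstant F (hω c) in W.class-vanishes (W.single-layer₁ 2<p a) l1 l2 a u s
    ... | inj₂ F = (alt-cong l1 u λ y → unlevel (K.ψ-indep₁ F l1 w ω ω' y)) ∙ alt-0 l1 u

  ω-constant-divisors : OmegaConstant → V A l0 l0 l2 × V A l1 l0 l2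
  ω-constant-divisors hω = from-classes A l0 l2 λ c u (w , ω , ω') → unlevel (hω c w ω ω')

-- The smaller exponents for q < r

module Ordered {p q r : ℕ} (T : Pair p q r) (S : LevelOneSetting T) (q<r : q < r) where
  open LevelOneBasics T S
  open Profile
  module K₃ = K fibred₃
  module J₂ = J fibred₂

  size-tot : ∀ c → ∑ (λ σ → ∑ (λ w → NA l2 l0 l1 (c , σ) tt w)) ≡ r * q
  size-tot c = (∑-cong λ σ → sym (r₀ A {l2} {l0} {c , σ} {tt})) ∙ sym (p₁ A) ∙ size₁ c ∙ *-comm q r

  -- Otherwise the q fibres in the r-fibred class c₃ would form a p × r matrix in (σ, w) without
  -- cross differences, contrary to `matrix-bound`.
  b201 : V B l2 l0 l1
  b201 = [ (λ a → ⊥-elim (bad a)) , (λ b → b) ]′ (alternative l2 l0 l1 λ ())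
    where
    p∤q = prime∤prime p-prime q-prime p≢q
    κ : Fin p → Fin r → ℕ
    κ σ w = N (FibredClass.A₂ fibred₃) l2 l2 l0 (c₃ , σ) (w , or) tt
    bad : V A l2 l0 l1 → ⊥
    bad a = matrix-bound κ
      (λ σ σ' w w' → scale-cross r (K₃.mult21 l0 σ w tt) (K₃.mult21 l0 σ w' tt) (K₃.mult21 l0 σ' w tt) (K₃.mult21 l0 σ' w' tt)
         (cross-at (λ i j → NA l2 l0 l1 (c₃ , i) tt j) σ σ' w w' (a (c₃ , σ , σ') tt (w , w'))))
      (*-cancelˡ-≡ _ _ r (sym (∑∑-* r κ) ∙ (∑-cong λ σ → ∑-cong λ w → sym (K₃.mult21 l0 σ w tt)) ∙ size-tot c₃)) q<r p∤q

  -- If A has Φ_{p²r²}, `ω-constant` settles the q-fibred classes. If A has Φ_{pr²}, any class is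
  -- compared with c₃, where there is no dependence on ω. Otherwise B has both, and then it has the
  -- whole pattern of `no-cyclotomic-pattern`.
  hω : OmegaConstant
  hω = go (alternative l2 l0 l2 λ ())
    where
    not-a101 : V A l0 l0 l1 → ¬ V A l1 l0 l1
    not-a101 a₀ a₁ = K₃.not-v-constant λ w w' → level (slice₁-zero A l0 l1 tt (w , w') a₀ a₁ c₃)
    go : V A l2 l0 l2 ⊎ V B l2 l0 l2 → OmegaConstant
    go (inj₁ a) c w ω ω' with fibred c
    ... | inj₁ F = J.ω-constant F a w ω ω'
    ... | inj₂ F = K.ψ-indep₁ F l0 w ω ω' tt
    go (inj₂ b) = go' (alternative l1 l0 l2 λ ())
      where
      pattern-⊥ = no-cyclotomic-pattern T q<r b200 b201 b
      go' : V A l1 l0 l2 ⊎ V B l1 l0 l2 → OmegaConstant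
      go' (inj₁ a) c w ω ω' = +-cancelʳ-≡ (NA l1 l0 l2 c₃ tt (w , ω')) _ _
        (cross-at (λ i j → NA l1 l0 l2 i tt (w , j)) c c₃ ω ω' (a (c , c₃) tt (w , ω , ω')) ∙
          cong (λ k → NA l1 l0 l2 c tt (w , ω') + k) (K₃.ψ-indep₁ l0 w ω ω' tt))
      go' (inj₂ b') = ⊥-elim (pattern-⊥ b' (go'' (exponent₁ (pair-rev T))))
        where
        go'' : Exponent₁ (pair-rev T) l1 l2 ⊎ Exponent₁ (pair-rev T) l2 l1 → V B l0 l0 l1 ⊎ (V B l0 l0 l2 × V B l1 l0 l1)
        go'' (inj₂ e) = inj₁ (V-rev (rev B) l1 l0 l0 (Exponent₁.in-B e))
        go'' (inj₁ e) = inj₂ (V-rev (rev B) l2 l0 l0 (Exponent₁.in-B e)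
          , [ (λ a → ⊥-elim (not-a101 (V-rev (rev A) l1 l0 l0 (Exponent₁.in-A e)) a)) , (λ b → b) ]′ (alternative l1 l0 l1 λ ()))

  a002 : V A l0 l0 l2
  a002 = proj₁ (ω-constant-divisors hω)

  b001 : V B l0 l0 l1
  b001 = [ (λ e → ⊥-elim (Exponent₁.out-A e (V-rev A l0 l0 l2 a002))) , (λ e → V-rev (rev B) l1 l0 l0 (Exponent₁.in-B e)) ]′ (exponent₁ (pair-rev T))

  module W₂ = J₂.WithConstant (hω c₂)

  -- If Φ_{p²qr²} or Φ_{p²r²} divides A, the class c₂ lies in one layer, and then A has neither of
  -- the two. If both divide B, the layers of B have equal counts over v and w.
  b21 : V B l2 l1 l0 × V B l2 l1 l1
  b21 = go (alternative l2 l1 l2 λ ()) (alternative l2 l0 l2 λ ())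
    where
    not-A : ∀ n → ¬ V A l2 l1 n → V A l2 l1 n ⊎ V B l2 l1 n → V B l2 l1 n
    not-A n na = [ (λ a → ⊥-elim (na a)) , (λ b → b) ]′
    from-single : W₂.SingleLayer → V B l2 l1 l0 × V B l2 l1 l1
    from-single s = not-A l0 (W₂.not-V210 s) (alternative l2 l1 l0 λ ()) , not-A l1 (W₂.not-V211 s) (alternative l2 l1 l1 λ ())
    go : V A l2 l1 l2 ⊎ V B l2 l1 l2 → V A l2 l0 l2 ⊎ V B l2 l0 l2 → V B l2 l1 l0 × V B l2 l1 l1
    go (inj₁ a) _ = from-single (W₂.single-layer₁ 2<p a)
    go (inj₂ _) (inj₁ a) = from-single (W₂.single-layer₀ 2<p a)
    go (inj₂ b212) (inj₂ b202) = from-layers B l1 l0 (λ d σ σ' v _ → r₀ B ∙ (∑-cong λ w → N₁ d σ σ' v w) ∙ sym (r₀ B)) , from-layers B l1 l1 (λ d σ σ' v w → N₁ d σ σ' v w)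
      where
      κ-indep = independent-of-σ T q<r b200 b201 b202
      κ : ∀ d w ω → ℕ
      κ d w ω = NB l2 l0 l2 (d , op) tt (w , ω)
      -- The layers agree, and over w there are pq points in all, so at most q < r in one layer:
      -- some ω is empty. Comparison with it turns equal differences into equal counts.
      ω₀ : ∀ d w → ∃[ ω ] κ d w ω ≡ 0
      ω₀ d w = [ (λ z → z) , (λ pos → ⊥-elim (<⇒≱ q<r (*-cancelˡ-≤ p (≤-trans (*-monoʳ-≤ p (≤-trans (∑-all-pos (κ d w) pos) (≤-reflexive (sym (r₁ B)))))
          (≤-trans (≤-reflexive (sym (p₁ B ∙ ∑-const-≡ (λ σ → NB l2 l0 l1 (d , σ) tt w) op (λ σ → r₁ B ∙ (∑-cong λ ω → κ-indep d σ op w ω) ∙ sym (r₁ B)))))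
            (subst (NB l1 l0 l1 d tt w ≤_) (Basics.level₃ distinct B total-B b001 w) (≤-p₀ B d tt w))))))) ]′ (zero-or-pos (κ d w))
      N₂ : ∀ d σ σ' v w ω → NB l2 l1 l2 (d , σ) v (w , ω) ≡ NB l2 l1 l2 (d , σ') v (w , ω)
      N₂ d σ σ' v w ω = +-cancelʳ-≡ (NB l2 l1 l2 (d , σ') v (w , ω')) _ _ (c' ∙ cong (λ k → k + NB l2 l1 l2 (d , σ') v (w , ω)) (z σ ∙ sym (z σ')) ∙ +-comm (NB l2 l1 l2 (d , σ') v (w , ω')) _)
        where
        ω' = proj₁ (ω₀ d w)
        z : ∀ σ → NB l2 l1 l2 (d , σ) v (w , ω') ≡ 0
        z σ = n≤0⇒n≡0 (subst (NB l2 l1 l2 (d , σ) v (w , ω') ≤_) (κ-indep d σ op w ω' ∙ proj₂ (ω₀ d w)) (≤-q₀ B (d , σ) v (w , ω')))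
        c' : NB l2 l1 l2 (d , σ) v (w , ω) + NB l2 l1 l2 (d , σ') v (w , ω') ≡ NB l2 l1 l2 (d , σ) v (w , ω') + NB l2 l1 l2 (d , σ') v (w , ω)
        c' = cross-at (λ i j → NB l2 l1 l2 (d , i) v (w , j)) σ σ' ω ω'
          (slice₁-zero (sw12 B) l2 l2 (d , σ , σ') (w , ω , ω') (V-sw12 B l2 l0 l2 b202) (V-sw12 B l2 l1 l2 b212) v)
      N₁ : ∀ d σ σ' v w → NB l2 l1 l1 (d , σ) v w ≡ NB l2 l1 l1 (d , σ') v w
      N₁ d σ σ' v w = r₁ B ∙ (∑-cong λ ω → N₂ d σ σ' v w ω) ∙ sym (r₁ B)

  b210 = proj₁ b21
  b211 = proj₂ b21

  m : Fin p → Fin q → Fin r → ℕ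
  m d v w = NB l2 l1 l1 (d , op) v w

  -- The difference of two layers of B is constant in v because of Φ_{p²q} and Φ_{p²qr}, and its sum
  -- over v is zero because of Φ_{p²} and Φ_{p²r}.
  m-≡ : ∀ d v w → NB l1 l1 l1 d v w ≡ p * m d v w
  m-≡ d v w = p₁ B ∙ ∑-const-≡ (λ σ → NB l2 l1 l1 (d , σ) v w) op λ σ → level (flat σ op)
    where
    flat : ∀ σ σ' → + NB l2 l1 l1 (d , σ) v w - + NB l2 l1 l1 (d , σ') v w ≡ + 0
    flat σ σ' = constant-zero f f-const f-sum v
      where
      f : Fin q → ℤ
      f v = + NB l2 l1 l1 (d , σ) v w - + NB l2 l1 l1 (d , σ') v w
      f-const : ∀ v v' → f v ≡ f v'
      f-const v v' = i-j≡0⇒i≡j _ _ (slice₁-zero (rev B) l1 l2 (v , v') (d , σ , σ') (V-rev B l2 l1 l0 b210) (V-rev B l2 l1 l1 b211) w)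
      f-sum : ∑ℤ f ≡ + 0
      f-sum = ∑ℤ-sub (λ v → + NB l2 l1 l1 (d , σ) v w) (λ v → + NB l2 l1 l1 (d , σ') v w) ∙ cong₂ _-_ (sym (cong +_ (q₀ B) ∙ +∑ (λ v → NB l2 l1 l1 (d , σ) v w))) (sym (cong +_ (q₀ B) ∙ +∑ (λ v → NB l2 l1 l1 (d , σ') v w))) ∙
        slice₁-zero (rev B) l0 l2 tt (d , σ , σ') (V-rev B l2 l0 l0 b200) (V-rev B l2 l0 l1 b201) w

  sum-m : ∀ w → ∑ (λ d → ∑ (λ v → m d v w)) ≡ q
  sum-m w = *-cancelˡ-≡ _ _ p (sym (∑∑-* p (λ d v → m d v w)) ∙ (∑-cong λ d → (∑-cong λ v → sym (m-≡ d v w)) ∙ sym (q₀ B)) ∙ sym (p₀ B) ∙ Basics.level₃ distinct B total-B b001 w)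

module OrderedLevels {p q r : ℕ} (T : Pair p q r) (S : LevelOneSetting T) (q<r : q < r) where
  open LevelOneBasics T S
  open Ordered T S q<r
  open Profile

  PsiConstant : Set
  PsiConstant = ∀ c v ψ ψ' → NA l1 l2 l0 c (v , ψ) tt ≡ NA l1 l2 l0 c (v , ψ') tt

  module ψ-Constancy where
    first-case : V A l1 l2 l0 → PsiConstant
    first-case a c v ψ ψ' = +-cancelʳ-≡ (NA l1 l2 l0 c₂ (v , ψ') tt) _ _
      (cross-at (λ i j → NA l1 l2 l0 i (v , j) tt) c c₂ ψ ψ' (a (c , c₂) (v , ψ , ψ') tt) ∙
        cong (λ k → NA l1 l2 l0 c (v , ψ') tt + k) (J₂.ψ-indep₁ l0 v ψ ψ' tt))

    -- In an r-fibred class the numbers of fibres over (w, v, ψ) have no cross differences in w and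
    -- ψ, as seen by comparison with the q-fibred class c₂. Their total is q and r ∤ q, so
    -- `full-row` applies with the roles changed.
    second-case : V A l1 l2 l1 → PsiConstant
    second-case a c v ψ ψ' with fibred c
    ... | inj₁ F = J.ψ-indep₁ F l0 v ψ ψ' tt
    ... | inj₂ F = r₀ A ∙ (∑-cong λ w → κ-≡ w v ψ ∙ cong (r *_) (full-row-const row w v ψ ψ') ∙ sym (κ-≡ w v ψ')) ∙ sym (r₀ A)
      where
      κ : Fin r → Fin q → Fin q → ℕ
      κ w v ψ = N (FibredClass.A₂ F) l1 l2 l2 c (w , or) (v , ψ)
      κ-≡ : ∀ w v ψ → NA l1 l2 l1 c (v , ψ) w ≡ r * κ w v ψ
      κ-≡ w v ψ = K.mult11 F l2 w (v , ψ)
      tot : ∑ (λ w → ∑ (λ v → ∑ (κ w v))) ≡ q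
      tot = *-cancelˡ-≡ _ _ r (sym ((∑-cong λ w → ∑∑-* r (κ w)) ∙ ∑-* r (λ w → ∑ (λ v → ∑ (κ w v)))) ∙
        (∑-cong λ w → (∑-cong λ v → (∑-cong λ ψ → sym (κ-≡ w v ψ)) ∙ sym (q₁ A)) ∙ sym (q₀ A)) ∙ sym (r₀ A) ∙ size₁ c ∙ *-comm q r)
      x : Fin q → Fin q → Fin r → ℕ
      x v ψ w = NA l1 l2 l1 c (v , ψ) w
      cr : ∀ v ψ ψ' w w' → x v ψ w + x v ψ' w' ≡ x v ψ w' + x v ψ' w
      cr v ψ ψ' w w' = cross-at (x v) ψ ψ' w w' (half (a (c , c₂) (v , ψ , ψ') (w , w')) (i≡j⇒i-j≡0 (cong₂ (λ a b → + a - + b) (J₂.ψ-indep₁ l1 v ψ ψ' w) (J₂.ψ-indep₁ l1 v ψ ψ' w'))))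
      row : FullRow κ
      row = full-row κ (λ v w w' ψ ψ' → scale-cross r (κ-≡ w v ψ) (κ-≡ w' v ψ) (κ-≡ w v ψ') (κ-≡ w' v ψ') (cr v ψ ψ' w w') ∙ +-comm (κ w' v ψ) _)
        tot (prime∤prime r-prime q-prime (q≢r ∘ sym))

    -- For different d the numbers m d v w are now congruent mod q. As they add up to q for each w,
    -- all the weight sits at one place (d₀ w, v₀ w), and pq divides the number of points of B over
    -- each (d, v). Both possibilities for Φ_{pr} contradict this.
    module Impossible (b120 : V B l1 l2 l0) (b121 : V B l1 l2 l1) where
      q∣m-m : ∀ d d' v w → + q ∣ℤ (+ m d v w - + m d' v w)
      q∣m-m d d' v w = [ (λ e → ⊥-elim (prime∤prime q-prime p-prime (p≢q ∘ sym) (pos∣⁻¹ e))) , (λ e → e) ]′ (prime-∣ℤ-* q-prime (+ p) (+ m d v w - + m d' v w) (∣ℤ-cong sum (const-sum-div f f-const)))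
        where
        f : Fin q → ℤ
        f ψ = + NB l1 l2 l1 d (v , ψ) w - + NB l1 l2 l1 d' (v , ψ) w
        f-const : ∀ ψ ψ' → f ψ ≡ f ψ'
        f-const ψ ψ' = i-j≡0⇒i≡j _ _ (slice₁-zero (rev B) l2 l1 (v , ψ , ψ') (d , d') (V-rev B l1 l2 l0 b120) (V-rev B l1 l2 l1 b121) w)
        total-b : ∀ d → ∑ℤ (λ ψ → + NB l1 l2 l1 d (v , ψ) w) ≡ + p · + m d v w
        total-b d = sym (+∑ (λ ψ → NB l1 l2 l1 d (v , ψ) w)) ∙ cong +_ (sym (q₁ B) ∙ m-≡ d v w) ∙ pos-* p (m d v w)
        sum : ∑ℤ f ≡ + p · (+ m d v w - + m d' v w)
        sum = ∑ℤ-sub (λ ψ → + NB l1 l2 l1 d (v , ψ) w) (λ ψ → + NB l1 l2 l1 d' (v , ψ) w) ∙ cong₂ _-_ (total-b d) (total-b d') ∙ lem (+ p) (+ m d v w) (+ m d' v w)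
          where lem : ∀ p a b → p · a - p · b ≡ p · (a - b); lem = ring

      -- If all these numbers were below q, the congruences would be equalities, and p equal sums
      -- would add up to q.
      heavy : ∀ w → ∃[ d ] ∃[ v ] q ≤ m d v w
      heavy w with any? (λ d → any? (λ v → q ≤? m d v w))
      ... | yes h = h
      ... | no none = ⊥-elim (prime∤prime p-prime q-prime p≢q (divides (∑ (λ v → m op v w)) (sym (sum-m w) ∙ (∑-const-≡ (λ d → ∑ (λ v → m d v w)) op λ d → ∑-cong λ v → small-∣ (small d v) (small op v) (q∣m-m d op v w)) ∙ *-comm p _)))
        where
        small : ∀ d v → m d v w < q
        small d v = ≰⇒> λ h → none (d , v , h)

      d₀ : Fin r → Fin p
      d₀ w = proj₁ (heavy w)
      v₀ : Fin r → Fin q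
      v₀ w = proj₁ (proj₂ (heavy w))
      m≥q : ∀ w → q ≤ m (d₀ w) (v₀ w) w
      m≥q w = proj₂ (proj₂ (heavy w))

      row≤ : ∀ d w → ∑ (λ v → m d v w) ≤ q
      row≤ d w = subst (∑ (λ v → m d v w) ≤_) (sum-m w) (∑-≥ (λ d → ∑ (λ v → m d v w)) d)

      off-d : ∀ w d v → d ≢ d₀ w → m d v w ≡ 0
      off-d w d v ne = ∑-zero (λ v → m d v w) (∑-dominated (λ d → ∑ (λ v → m d v w)) (d₀ w) (≤-trans (≤-reflexive (sum-m w)) (≤-trans (m≥q w) (∑-≥ (λ v → m (d₀ w) v w) (v₀ w)))) d ne) v

      off-v : ∀ w d v → v ≢ v₀ w → m d v w ≡ 0
      off-v w d v ne with d Finₚ.≟ d₀ w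
      ... | no ne' = off-d w d v ne'
      ... | yes refl = ∑-dominated (λ v → m d v w) (v₀ w) (≤-trans (row≤ d w) (m≥q w)) v ne

      q∣m : ∀ w d v → q ∣ m d v w
      q∣m w d v with d Finₚ.≟ d₀ w | v Finₚ.≟ v₀ w
      ... | no ne | _ = subst (q ∣_) (sym (off-d w d v ne)) (divides 0 refl)
      ... | yes _ | no ne = subst (q ∣_) (sym (off-v w d v ne)) (divides 0 refl)
      ... | yes refl | yes refl = subst (q ∣_) (≤-antisym (m≥q w) (≤-trans (∑-≥ (λ v → m d v w) v) (row≤ d w))) ∣-refl

      pq∣₁ : ∀ d v → p * q ∣ NB l1 l1 l0 d v tt
      pq∣₁ d v = subst (p * q ∣_) (sym (r₀ B)) (∑-divides (λ w → NB l1 l1 l1 d v w) λ w → subst (p * q ∣_) (sym (m-≡ d v w)) (*-monoʳ-∣ p (q∣m w d v)))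
        where
        ∑-divides : ∀ {n k} (f : Fin n → ℕ) → (∀ i → k ∣ f i) → k ∣ ∑ f
        ∑-divides {zero} f h = divides 0 refl
        ∑-divides {suc n} f h = ∣m∣n⇒∣m+n (h Fin.zero) (∑-divides (f ∘ Fin.suc) (h ∘ Fin.suc))

      not-pr : ∀ d v → NB l1 l1 l0 d v tt ≢ p * r
      not-pr d v e = prime∤prime q-prime r-prime q≢r (*-cancelˡ-∣ p (subst (p * q ∣_) e (pq∣₁ d v)))

      not-b010 : ¬ V B l0 l1 l0
      not-b010 b = prime∤prime q-prime r-prime q≢r (*-cancelˡ-∣ p (subst (p * q ∣_) (sym (q₀-sum oq) ∙ Basics.level₁ (swap12 distinct) (sw12 B) (total-B ∙ *-swap12 p q r) (V-sw12 B l0 l1 l0 b) oq) (∑-div' λ d → pq∣₁ d oq)))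
        where
        q₀-sum : ∀ v → NB l0 l1 l0 tt v tt ≡ ∑ (λ d → NB l1 l1 l0 d v tt)
        q₀-sum v = p₀ B
        ∑-div' : ∀ {n k} {f : Fin n → ℕ} → (∀ i → k ∣ f i) → k ∣ ∑ f
        ∑-div' {zero} h = divides 0 refl
        ∑-div' {suc n} h = ∣m∣n⇒∣m+n (h Fin.zero) (∑-div' (h ∘ Fin.suc))

      a010 : V A l0 l1 l0; a010 = [ (λ a → a) , (λ b → ⊥-elim (not-b010 b)) ]′ (alternative l0 l1 l0 λ ())

      not-a110 : ¬ V A l1 l1 l0
      not-a110 a = J₂.not-v-constant λ v v' → level (slice₁-zero A l1 l0 (v , v') tt a010 a c₂)

      b110 : V B l1 l1 l0; b110 = [ (λ a → ⊥-elim (not-a110 a)) , (λ b → b) ]′ (alternative l1 l1 l0 λ ())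

      -- With Φ_r and Φ_{pr} the counts in B do not depend on w, so B lies in one class d* mod p.
      -- Next to an empty class Φ_{pq} spreads it evenly over v, with pr points each, which is not a
      -- multiple of pq.
      case-b : ¬ V B l1 l0 l1
      case-b b101 = not-pr d* oq (*-cancelˡ-≡ _ _ q (sym (∑-const-≡ (λ v → NB l1 l1 l0 d* v tt) oq (λ v → v-const v oq)) ∙ sym (q₀ B) ∙ sym (p₀ B ∙ ∑-single (λ d → NB l1 l0 l0 d tt tt) d* off-class) ∙ total-B ∙ lem p q r))
        where
        lem : ∀ p q r → p * q * r ≡ q * (p * r); lem = ringℕ
        d* = d₀ or
        w-const : ∀ d w → NB l1 l0 l1 d tt w ≡ NB l1 l0 l1 d tt or
        w-const d w = level (slice₁-zero B l0 l1 tt (w , or) (λ _ → b001 tt) b101 d)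
        off-class : ∀ d → d ≢ d* → NB l1 l0 l0 d tt tt ≡ 0
        off-class d ne = r₀ B ∙ ∑-0 λ w → w-const d w ∙ q₀ B ∙ ∑-0 λ v → m-≡ d v or ∙ cong (p *_) (off-d or d v ne) ∙ *-zeroʳ p
        d' = proj₁ (another (prime≥2 p-prime) d*)
        z : ∀ v → NB l1 l1 l0 d' v tt ≡ 0
        z v = class-zero B d' (off-class d' (proj₂ (another (prime≥2 p-prime) d*))) l1 l0 v tt
        v-const : ∀ v v' → NB l1 l1 l0 d* v tt ≡ NB l1 l1 l0 d* v' tt
        v-const v v' = level (half (b110 (d* , d') (v , v') tt) (unlevel (z v ∙ sym (z v'))))

      -- Φ_{pr} gives all classes mod p of A the same distribution mod r, and c₂ is concentrated at
      -- w₀; so A lies over w₀. If A has Φ_{pqr}, it now has Φ_{pq} as well, which is excluded; if B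
      -- has it, a rectangle with a single nonzero corner results.
      a-case : ¬ V A l1 l0 l1
      a-case a101 = contra (alternative l1 l1 l1 λ ())
        where
        off-w : ∀ c w → w ≢ W₂.w₀ → NA l1 l0 l1 c tt w ≡ 0
        off-w c w ne = level (constant-zero f f-const f-sum w) ∙ W₂.off-w₀ w ne
          where
          f : Fin r → ℤ
          f w = + NA l1 l0 l1 c tt w - + NA l1 l0 l1 c₂ tt w
          f-const : ∀ w w' → f w ≡ f w'
          f-const w w' = i-j≡0⇒i≡j _ _ (V-rev A l1 l0 l1 a101 (w , w') tt (c , c₂))
          f-sum : ∑ℤ f ≡ + 0
          f-sum = ∑ℤ-sub (λ w → + NA l1 l0 l1 c tt w) (λ w → + NA l1 l0 l1 c₂ tt w) ∙ cong₂ _-_ (t c) (t c₂) ∙ unlevel {q * r} refl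
            where
            t : ∀ c → ∑ℤ (λ w → + NA l1 l0 l1 c tt w) ≡ + (q * r)
            t c = sym (+∑ (λ w → NA l1 l0 l1 c tt w)) ∙ cong +_ (sym (r₀ A) ∙ size₁ c)
        w' = proj₁ (another (prime≥2 r-prime) W₂.w₀)
        z : ∀ c v → NA l1 l1 l1 c v w' ≡ 0
        z c v = n≤0⇒n≡0 (subst (NA l1 l1 l1 c v w' ≤_) (off-w c w' (proj₂ (another (prime≥2 r-prime) W₂.w₀))) (≤-q₀ A c v w'))
        to-w₀ : ∀ c v → NA l1 l1 l0 c v tt ≡ NA l1 l1 l1 c v W₂.w₀
        to-w₀ c v = r₀ A ∙ ∑-single (λ w → NA l1 l1 l1 c v w) W₂.w₀ λ w ne → n≤0⇒n≡0 (subst (NA l1 l1 l1 c v w ≤_) (off-w c w ne) (≤-q₀ A c v w))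
        a110 : V A l1 l1 l1 → V A l1 l1 l0
        a110 a (c , c') (v , v') _ = uncross (x c v) (x c v') (x c' v) (x c' v') (subst₂ _≡_ (cong₂ _+_ (sym (to-w₀ c v)) (sym (to-w₀ c' v'))) (cong₂ _+_ (sym (to-w₀ c v')) (sym (to-w₀ c' v)))
           (cross-at y c c' v v' (drop (y c v) (y c v') (y c' v) (y c' v') (z c v) (z c v') (z c' v) (z c' v') (a (c , c') (v , v') (W₂.w₀ , w')))))
          where
          x y : Fin p → Fin q → ℕ
          x c v = NA l1 l1 l0 c v tt
          y c v = NA l1 l1 l1 c v W₂.w₀
          drop : ∀ a b c d {a' b' c' d'} → a' ≡ 0 → b' ≡ 0 → c' ≡ 0 → d' ≡ 0 →
            ((+ a - + a') - (+ b - + b')) - ((+ c - + c') - (+ d - + d')) ≡ + 0 → (+ a - + b) - (+ c - + d) ≡ + 0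
          drop a b c d refl refl refl refl e = lem (+ a) (+ b) (+ c) (+ d) ∙ e
            where lem : ∀ a b c d → (a - b) - (c - d) ≡ ((a - + 0) - (b - + 0)) - ((c - + 0) - (d - + 0)); lem = ring
        contra : V A l1 l1 l1 ⊎ V B l1 l1 l1 → ⊥
        contra (inj₁ a) = not-a110 (a110 a)
        contra (inj₂ b) = <⇒≢ (*-mono-≤ (>-nonZero⁻¹ p) (≤-trans (>-nonZero⁻¹ q) (m≥q or))) (sym (sym (m-≡ (d₀ or) (v₀ or) or) ∙
           lonely₂ (NB l1 l1 l1 (d₀ or) (v₀ or) or) (slice₁-zero (rev B) l1 l1 (v₀ or , v₁) (d₀ or , d₁) (V-rev B l1 l1 l0 b110) (V-rev B l1 l1 l1 b) or) (nul d₁ (v₀ or) (off-d or d₁ (v₀ or) d₁≢)) (nul (d₀ or) v₁ (off-v or (d₀ or) v₁ v₁≢)) (nul d₁ v₁ (off-v or d₁ v₁ v₁≢))))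
          where
          d₁ = proj₁ (another (prime≥2 p-prime) (d₀ or))
          d₁≢ = proj₂ (another (prime≥2 p-prime) (d₀ or))
          v₁ = proj₁ (another (prime≥2 q-prime) (v₀ or))
          v₁≢ = proj₂ (another (prime≥2 q-prime) (v₀ or))
          nul : ∀ d v → m d v or ≡ 0 → NB l1 l1 l1 d v or ≡ 0
          nul d v e = m-≡ d v or ∙ cong (p *_) e ∙ *-zeroʳ p

      impossible : ⊥; impossible = [ a-case , case-b ]′ (alternative l1 l0 l1 λ ())

  hψ : PsiConstant
  hψ = go (alternative l1 l2 l0 λ ()) (alternative l1 l2 l1 λ ())
    where
    open ψ-Constancy
    go : V A l1 l2 l0 ⊎ V B l1 l2 l0 → V A l1 l2 l1 ⊎ V B l1 l2 l1 → PsiConstant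
    go (inj₁ a) _ = first-case a
    go (inj₂ _) (inj₁ a) = second-case a
    go (inj₂ b) (inj₂ b') = ⊥-elim (Impossible.impossible b b')

  a020 : V A l0 l2 l0 × V A l1 l2 l0
  a020 = from-classes A l2 l0 λ c (v , ψ , ψ') s → unlevel (hψ c v ψ ψ')

  b010 : V B l0 l1 l0
  b010 = [ (λ e → ⊥-elim (Exponent₁.out-A e (V-sw12 A l0 l2 l0 (proj₁ a020)))) , (λ e → V-sw12 (sw12 B) l1 l0 l0 (Exponent₁.in-B e)) ]′ (exponent₁ (pair12 T))

  -- Φ_{qr} and Φ_{pqr} together would balance the class c₂ of A in v and w.
  b111 : V A l0 l1 l1 → V B l1 l1 l1
  b111 a = [ (λ a' → ⊥-elim (W₂.not-vw-balanced λ v v' w w' → cross-at y v v' w w' (slice₁-zero A l1 l1 (v , v') (w , w') a a' c₂))) , (λ b → b) ]′ (alternative l1 l1 l1 λ ())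
    where
    y : Fin q → Fin r → ℕ
    y v w = NA l1 l1 l1 c₂ v w

  -- The sums m̄ of m over the classes have lines adding up to q and r, and are ≡ 1 mod p.
  b011 : V B l0 l1 l1
  b011 = [ (λ a → from-b111 (b111 a)) , (λ b → b) ]′ (alternative l0 l1 l1 λ ())
    where
    m̄ : Fin q → Fin r → ℕ
    m̄ v w = ∑ (λ d → m d v w)
    B-m̄ : ∀ v w → NB l0 l1 l1 tt v w ≡ p * m̄ v w
    B-m̄ v w = p₀ B ∙ (∑-cong λ d → m-≡ d v w) ∙ ∑-* p (λ d → m d v w)
    columns : ∀ w → ∑ (λ v → m̄ v w) ≡ q
    columns w = sym (∑-swap (λ d v → m d v w)) ∙ sum-m w
    rows : ∀ v → ∑ (λ w → m̄ v w) ≡ r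
    rows v = *-cancelˡ-≡ _ _ p (sym (∑-* p (m̄ v)) ∙ (∑-cong λ w → sym (B-m̄ v w)) ∙ sym (r₀ B) ∙ Basics.level₁ (swap12 distinct) (sw12 B) (total-B ∙ *-swap12 p q r) (V-sw12 B l0 l1 l0 b010) v)
    from-b111 : V B l1 l1 l1 → V B l0 l1 l1
    from-b111 b _ (v , v') (w , w') = uncross (x v w) (x v w') (x v' w) (x v' w') (cong₂ _+_ (const v w ∙ sym (const v w')) (const v' w' ∙ sym (const v' w)))
      where
      x : Fin q → Fin r → ℕ
      x v w = NB l0 l1 l1 tt v w
      D : Fin p → Fin q → Fin q → Fin r → Fin r → ℤ
      D d v v' w w' = (+ m d v w - + m d v w') - (+ m d v' w - + m d v' w')
      p-D : ∀ d v v' w w' → alt l1 (v , v') (λ y → alt l1 (w , w') (λ z → + NB l1 l1 l1 d y z)) ≡ + p · D d v v' w w'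
      p-D d v v' w w' = cong₂ _-_ (cong₂ _-_ (e v w) (e v w')) (cong₂ _-_ (e v' w) (e v' w')) ∙ lem (+ p) (+ m d v w) (+ m d v w') (+ m d v' w) (+ m d v' w')
        where
        e : ∀ v w → + NB l1 l1 l1 d v w ≡ + p · + m d v w
        e v w = cong +_ (m-≡ d v w) ∙ pos-* p (m d v w)
        lem : ∀ p a b c d → (p · a - p · b) - (p · c - p · d) ≡ p · ((a - b) - (c - d)); lem = ring
      D-const : ∀ d d' v v' w w' → D d v v' w w' ≡ D d' v v' w w'
      D-const d d' v v' w w' = ·-cancelˡ-≡ (+ p) _ _ {{nzp}} (sym (p-D d v v' w w') ∙ slice₁-const B l1 l1 (v , v') (w , w') b d d' ∙ p-D d' v v' w w')
      ∑ℤm : ∀ v w → + m̄ v w ≡ ∑ℤ (λ d → + m d v w)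
      ∑ℤm v w = +∑ (λ d → m d v w)
      -- By Φ_{pqr} the second differences of m agree in the p classes, so those of m̄ are multiples
      -- of p. Summing over v' and then over w', where the line sums are known, turns this into a
      -- congruence for m̄ itself.
      p∣₁ : ∀ v v' w w' → + p ∣ℤ ((+ m̄ v w - + m̄ v w') - (+ m̄ v' w - + m̄ v' w'))
      p∣₁ v v' w w' = ∣ℤ-cong (∑ℤ-sub (λ d → + m d v w - + m d v w') (λ d → + m d v' w - + m d v' w') ∙ cong₂ _-_ (back v) (back v')) (const-sum-div (λ d → D d v v' w w') (λ d d' → D-const d d' v v' w w'))
        where
        back : ∀ v → ∑ℤ (λ d → + m d v w - + m d v w') ≡ + m̄ v w - + m̄ v w'
        back v = ∑ℤ-sub (λ d → + m d v w) (λ d → + m d v w') ∙ cong₂ _-_ (sym (∑ℤm v w)) (sym (∑ℤm v w'))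
      p∣₂ : ∀ v w w' → + p ∣ℤ (+ m̄ v w - + m̄ v w')
      p∣₂ v w w' = [ (λ e → ⊥-elim (prime∤prime p-prime q-prime p≢q (pos∣⁻¹ e))) , (λ e → e) ]′ (prime-∣ℤ-* p-prime (+ q) (+ m̄ v w - + m̄ v w')
        (∣ℤ-cong (∑ℤ-sub (λ _ → + m̄ v w - + m̄ v w') (λ v' → + m̄ v' w - + m̄ v' w') ∙ cong₂ _-_ (∑ℤ-const q (+ m̄ v w - + m̄ v w')) zero-sum ∙ lem (+ q) _)
          (∑ℤ-div (λ v' → (+ m̄ v w - + m̄ v w') - (+ m̄ v' w - + m̄ v' w')) (λ v' → p∣₁ v v' w w'))))
        where
        lem : ∀ q a → q · a - + 0 ≡ q · a; lem = ring
        zero-sum : ∑ℤ (λ v' → + m̄ v' w - + m̄ v' w') ≡ + 0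
        zero-sum = ∑ℤ-sub (λ v' → + m̄ v' w) (λ v' → + m̄ v' w') ∙ cong₂ _-_ (c w) (c w') ∙ unlevel {q} refl
          where
          c : ∀ w → ∑ℤ (λ v' → + m̄ v' w) ≡ + q
          c w = sym (+∑ (λ v' → m̄ v' w)) ∙ cong +_ (columns w)
      p∣₃ : ∀ v w → + p ∣ℤ (+ m̄ v w - + 1)
      p∣₃ v w = [ (λ e → ⊥-elim (prime∤prime p-prime r-prime p≢r (pos∣⁻¹ e))) , (λ e → e) ]′ (prime-∣ℤ-* p-prime (+ r) (+ m̄ v w - + 1)
        (∣ℤ-cong (∑ℤ-sub (λ _ → + m̄ v w) (λ w' → + m̄ v w') ∙ cong₂ _-_ (∑ℤ-const r (+ m̄ v w)) (sym (+∑ (m̄ v)) ∙ cong +_ (rows v)) ∙ lem (+ r) (+ m̄ v w))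
          (∑ℤ-div (λ w' → + m̄ v w - + m̄ v w') (λ w' → p∣₂ v w w'))))
        where
        lem : ∀ r a → r · a - r ≡ r · (a - + 1); lem = ring
      m̄≥1 : ∀ v w → 1 ≤ m̄ v w
      m̄≥1 v w = n≢0⇒n>0 λ e → <⇒≱ 2<p (≤-trans (∣⇒≤ (pos∣⁻¹ {n = 1} (∣ℤ-cong (cong (λ k → - (+ k - + 1)) e ∙ refl) (neg∣ (p∣₃ v w))))) (s≤s z≤n))
      m̄≡1 : ∀ v w → m̄ v w ≡ 1
      m̄≡1 v w = ≤-antisym (≮⇒≥ λ lt → <⇒≢ (∑-strict (λ v → m̄ v w) (λ v → m̄≥1 v w) v lt) (sym (columns w))) (m̄≥1 v w)
      const : ∀ v w → x v w ≡ p
      const v w = B-m̄ v w ∙ cong (p *_) (m̄≡1 v w) ∙ *-identityʳ p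

setting23 : ∀ {p q r} (T : Pair p q r) → LevelOneSetting T → LevelOneSetting (pair23 T)
setting23 {p} {q} {r} T S = record { 2<p = 2<p ; a100 = V-sw23 (Pair.A T) l1 l0 l0 a100 ; fibred = λ c → [ inj₂ , inj₁ ]′ (fibred c) ; c₂ = c₃ ; c₃ = c₂ ; fibred₂ = fibred₃ ; fibred₃ = fibred₂ }
  where open LevelOneSetting S

unswap : ∀ {p q r} (P : Profile p q r) l m n → V (sw23 P) l n m → V P l m n
unswap P l m n = V-sw23 (sw23 P) l n m

divisors23 : ∀ {p q r} (T : Pair p q r) → LevelOneDivisors (pair23 T) → LevelOneDivisors T
divisors23 T D = record
  { a020 = unswap A l0 l2 l0 a002 ; a120 = unswap A l1 l2 l0 a102 ; a002 = unswap A l0 l0 l2 a020 ; a102 = unswap A l1 l0 l2 a120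
  ; b200 = unswap B l2 l0 l0 b200 ; b210 = unswap B l2 l1 l0 b201 ; b201 = unswap B l2 l0 l1 b210 ; b211 = unswap B l2 l1 l1 b211
  ; b011 = unswap B l0 l1 l1 b011
  ; slab12 = [ (λ b → inj₁ (unswap B l2 l1 l2 b)) , (λ (a , a') → inj₂ (unswap A l0 l1 l2 a , unswap A l1 l1 l2 a')) ]′ slab21
  ; slab21 = [ (λ b → inj₁ (unswap B l2 l2 l1 b)) , (λ (a , a') → inj₂ (unswap A l0 l2 l1 a , unswap A l1 l2 l1 a')) ]′ slab12 }
  where
  open LevelOneDivisors D
  open Pair T

ordered-divisors : ∀ {p q r} (T : Pair p q r) → LevelOneSetting T → q < r → LevelOneDivisors T
ordered-divisors {p} {q} {r} T S q<r = record
  { a020 = proj₁ O.a020 ; a120 = proj₂ O.a020 ; a002 = M.a002 ; a102 = proj₂ (L.ω-constant-divisors M.hω)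
  ; b200 = L.b200 ; b210 = M.b210 ; b201 = M.b201 ; b211 = M.b211 ; b011 = O.b011
  ; slab12 = L.slab M.hω
  ; slab21 = [ (λ b → inj₁ (unswap (Pair.B T) l2 l2 l1 b)) , (λ (a , a') → inj₂ (unswap (Pair.A T) l0 l2 l1 a , unswap (Pair.A T) l1 l2 l1 a')) ]′ (L'.slab O.hψ) }
  where
  module L = LevelOneBasics T S
  module L' = LevelOneBasics (pair23 T) (setting23 T S)
  module M = Ordered T S q<r
  module O = OrderedLevels T S q<r

level-one-divisors : ∀ {p q r} (T : Pair p q r) → LevelOneSetting T → LevelOneDivisors T
level-one-divisors {p} {q} {r} T S with <-cmp q r
... | tri< q<r _ _ = ordered-divisors T S q<r
... | tri≈ _ e _ = ⊥-elim (Distinct.q≢r (Pair.distinct T) e)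
... | tri> _ _ r<q = divisors23 T (ordered-divisors (pair23 T) (setting23 T S) r<q)

-- Profiles of lists of integers

md : ℕ → Lv → ℕ
md p l0 = 1
md p l1 = p
md p l2 = p ^ 2

rep : ∀ p l → Pos p l → ℤ
rep p l0 _ = + 0
rep p l1 c = + toℕ c
rep p l2 (c , σ) = + toℕ c ⊕ + p · + toℕ σ

one-∣ : ∀ z → + 1 ∣ℤ z
one-∣ z = dividesℤ z (sym (·-identityʳ z))

module _ {p : ℕ} (pr : Prime p) where
  private instance
    nz : NonZero p; nz = prime⇒nonZero pr

  residue : (z : ℤ) → ∃[ c ] + p ∣ℤ (z - + toℕ {p} c)
  residue z = fromℕ< (n%ℕd<d z p) , dividesℤ (z /ℕ p) (cong (λ k → z - + k) (toℕ-fromℕ< _) ∙ cong (λ k → k - + (z %ℕ p)) (a≡a%ℕn+[a/ℕn]*n z p) ∙ lem (+ (z %ℕ p)) _)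
    where lem : ∀ r k → (r ⊕ k) - r ≡ k; lem = ring

  sq-∣ : ∀ {z k} → z ≡ + p · k → + p ∣ℤ k → + (p ^ 2) ∣ℤ z
  sq-∣ {z} {k} e (dividesℤ j f) = dividesℤ j (e ∙ cong (λ w → + p · w) f ∙ lem (+ p) j ∙ cong (λ w → j · w) (sym (pos-* p p) ∙ cong (λ w → + (p * w)) (sym (*-identityʳ p))))
    where lem : ∀ p j → p · (j · p) ≡ j · (p · p); lem = ring

  sq-∣⁻ : ∀ {k} → + (p ^ 2) ∣ℤ (+ p · k) → + p ∣ℤ k
  sq-∣⁻ {k} (dividesℤ j f) = dividesℤ j (·-cancelˡ-≡ (+ p) _ _ (f ∙ cong (λ w → j · w) (cong (λ w → + (p * w)) (*-identityʳ p) ∙ pos-* p p) ∙ lem (+ p) j))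
    where lem : ∀ p j → j · (p · p) ≡ p · (j · p); lem = ring

  sq-p : + p ∣ℤ + (p ^ 2)
  sq-p = pos∣ (m∣m*n (p * 1))

  lift-residue : ∀ c z → + p ∣ℤ (z - + toℕ {p} c) → ∃[ σ ] + (p ^ 2) ∣ℤ (z - rep p l2 (c , σ))
  lift-residue c z (dividesℤ k e) = let (σ , d) = residue k in σ , sq-∣ (lem z (+ toℕ c) (+ p) (+ toℕ σ) ∙ cong (λ w → w - + p · + toℕ σ) e ∙ lem2 (+ p) k (+ toℕ σ)) d
    where lem : ∀ z c p σ → z - (c ⊕ p · σ) ≡ (z - c) - p · σ; lem = ring
          lem2 : ∀ p k σ → k · p - p · σ ≡ p · (k - σ); lem2 = ring

  covers : ∀ l z → ∃[ x ] + md p l ∣ℤ (z - rep p l x)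
  covers l0 z = tt , one-∣ (z - + 0)
  covers l1 z = residue z
  covers l2 z = let (c , d) = residue z ; (σ , e) = lift-residue c z d in (c , σ) , e

  toℕ-unique : ∀ (c c' : Fin p) → + p ∣ℤ (+ toℕ c - + toℕ c') → c ≡ c'
  toℕ-unique c c' d = toℕ-injective (small-∣ (toℕ<n c) (toℕ<n c') d)

  rep₂-mod : ∀ c σ → + p ∣ℤ (rep p l2 (c , σ) - + toℕ c)
  rep₂-mod c σ = dividesℤ (+ toℕ σ) (lem (+ toℕ c) (+ p) (+ toℕ σ))
    where lem : ∀ c p σ → (c ⊕ p · σ) - c ≡ σ · p; lem = ring

  ∣-sub : ∀ {k} a b c → + k ∣ℤ (a - b) → + k ∣ℤ (a - c) → + k ∣ℤ (b - c)
  ∣-sub a b c d e = ∣ℤ-cong (lem a b c) (sub∣ e d)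
    where lem : ∀ a b c → (a - c) - (a - b) ≡ b - c; lem = ring

  σ-unique : ∀ c σ σ' → + (p ^ 2) ∣ℤ (rep p l2 (c , σ) - rep p l2 (c , σ')) → σ ≡ σ'
  σ-unique c σ σ' d = toℕ-unique σ σ' (sq-∣⁻ (∣ℤ-cong (lem (+ toℕ c) (+ p) (+ toℕ σ) (+ toℕ σ')) d))
    where lem : ∀ c p σ σ' → (c ⊕ p · σ) - (c ⊕ p · σ') ≡ p · (σ - σ'); lem = ring

ind : ∀ p l → Pos p l → ℕ → ℕ
ind p l x a = ℤ.∣ δ (md p l) (rep p l x - + a) ∣

+ind : ∀ p l x a → + ind p l x a ≡ δ (md p l) (rep p l x - + a)
+ind p l x a = 0≤i⇒+∣i∣≡i (δ-nonneg (md p l) _)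

Hits : ∀ p l → Pos p l → ℕ → Set
Hits p l x a = + md p l ∣ℤ (rep p l x - + a)

hits? : ∀ p l x a → Dec (Hits p l x a)
hits? p l x a = + md p l ∣ℤ? (rep p l x - + a)

ind-yes : ∀ {p l x a} → Hits p l x a → ind p l x a ≡ 1
ind-yes h = cong ℤ.∣_∣ (δ-yes h)

ind-no : ∀ {p l x a} → ¬ Hits p l x a → ind p l x a ≡ 0
ind-no h = cong ℤ.∣_∣ (δ-no h)

ind-pos : ∀ {p l} x {a} → 1 ≤ ind p l x a → Hits p l x a
ind-pos {p} {l} x {a} h = decidable-stable (hits? p l x a) λ n → <⇒≢ h (sym (ind-no {p} {l} {x} {a} n))

ind-≤1 : ∀ p l x a → ind p l x a ≤ 1
ind-≤1 p l x a with hits? p l x a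
... | yes h = ≤-reflexive (ind-yes {p} {l} {x} {a} h)
... | no h = ≤-trans (≤-reflexive (ind-no {p} {l} {x} {a} h)) z≤n

ind-l0 : ∀ p x a → ind p l0 x a ≡ 1
ind-l0 p x a = ind-yes {p} {l0} {x} {a} (one-∣ (+ 0 - + a))

flip-∣ : ∀ {k} a b → k ∣ℤ (a - b) → k ∣ℤ (b - a)
flip-∣ a b d = ∣ℤ-cong (lem a b) (neg∣ d)
  where lem : ∀ a b → - (a - b) ≡ b - a; lem = ring

module _ {p : ℕ} (pr : Prime p) where
  ind-∑₀ : ∀ a → ind p l0 tt a ≡ ∑ (λ c → ind p l1 c a)
  ind-∑₀ a = let (c , d) = residue pr (+ a) in ind-l0 p tt a ∙ sym ((∑-single (λ c → ind p l1 c a) c λ c' ne → ind-no {p} {l1} {c'} {a} λ h → ne (toℕ-unique pr c' c (∣-sub pr (+ a) (+ toℕ c') (+ toℕ c) (flip-∣ (+ toℕ c') (+ a) h) d))) ∙ ind-yes {p} {l1} {c} {a} (flip-∣ (+ a) (+ toℕ c) d))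

  ind-∑₁ : ∀ c a → ind p l1 c a ≡ ∑ (λ σ → ind p l2 (c , σ) a)
  ind-∑₁ c a with hits? p l1 c a
  ... | yes h = let (σ , d) = lift-residue pr c (+ a) (flip-∣ (+ toℕ c) (+ a) h) in ind-yes {p} {l1} {c} {a} h ∙ sym ((∑-single (λ σ → ind p l2 (c , σ) a) σ λ σ' ne → ind-no {p} {l2} {c , σ'} {a} λ h' → ne (σ-unique pr c σ' σ (∣-sub pr (+ a) (rep p l2 (c , σ')) (rep p l2 (c , σ)) (flip-∣ (rep p l2 (c , σ')) (+ a) h') d))) ∙
       ind-yes {p} {l2} {c , σ} {a} (flip-∣ (+ a) (rep p l2 (c , σ)) d))
  ... | no h = ind-no {p} {l1} {c} {a} h ∙ sym (∑-0 λ σ → ind-no {p} {l2} {c , σ} {a} λ h' → h (∣-sub pr (rep p l2 (c , σ)) (+ toℕ c) (+ a) (rep₂-mod pr c σ) (trans∣ (sq-p pr) h')))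

sumN : List ℕ → (ℕ → ℕ) → ℕ
sumN [] f = 0
sumN (a ∷ X) f = f a + sumN X f

sumN-cong-∈ : ∀ X {f g} → (∀ a → a ∈L X → f a ≡ g a) → sumN X f ≡ sumN X g
sumN-cong-∈ [] h = refl
sumN-cong-∈ (a ∷ X) h = cong₂ _+_ (h a (here refl)) (sumN-cong-∈ X λ b m → h b (there m))

sumN-cong : ∀ X {f g} → (∀ a → f a ≡ g a) → sumN X f ≡ sumN X g
sumN-cong X h = sumN-cong-∈ X λ a _ → h a

sumN-+ : ∀ X f g → sumN X (λ a → f a + g a) ≡ sumN X f + sumN X g
sumN-+ [] f g = refl
sumN-+ (a ∷ X) f g = cong (λ k → f a + g a + k) (sumN-+ X f g) ∙ lem (f a) (g a) _ _
  where lem : ∀ a b c d → a + b + (c + d) ≡ a + c + (b + d); lem = ringℕ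

+sumN : ∀ X f → + sumN X f ≡ sumL X (λ a → + f a)
+sumN [] f = refl
+sumN (a ∷ X) f = cong (λ k → + f a ⊕ k) (+sumN X f)

sumN-pos : ∀ X f → 1 ≤ sumN X f → ∃[ a ] (a ∈L X × 1 ≤ f a)
sumN-pos (a ∷ X) f h with f a in e
... | suc k = a , here refl , subst (1 ≤_) (sym e) (s≤s z≤n)
... | zero = let (b , m , g) = sumN-pos X f h in b , there m , g

sumN-≥ : ∀ X f {a} → a ∈L X → f a ≤ sumN X f
sumN-≥ (a ∷ X) f (here refl) = m≤m+n (f a) _
sumN-≥ (b ∷ X) f (there m) = ≤-trans (sumN-≥ X f m) (m≤n+m _ (f b))

sumN-≤1 : ∀ X f → AllPairs _≢_ X → (∀ a → f a ≤ 1) → (∀ a b → a ∈L X → b ∈L X → 1 ≤ f a → 1 ≤ f b → a ≡ b) → sumN X f ≤ 1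
sumN-≤1 [] f _ _ _ = z≤n
sumN-≤1 (a ∷ X) f (ne ∷ u) ≤1 h with f a in e
... | zero = sumN-≤1 X f u ≤1 λ b c m m' → h b c (there m) (there m')
... | suc k = subst (_≤ 1) (sym (+-identityʳ (suc k)) ∙ cong (λ w → suc k + w) (sym rest)) (subst (_≤ 1) e (≤1 a))
  where
  rest : sumN X f ≡ 0
  rest with sumN X f in e'
  ... | zero = refl
  ... | suc j = let (b , m , g) = sumN-pos X f (subst (1 ≤_) (sym e') (s≤s z≤n)) in ⊥-elim (All.lookup ne m (h a b (here refl) (there m) (subst (1 ≤_) (sym e) (s≤s z≤n)) g))

sumN-slot : ∀ {k} X (H : ℕ → ℕ) (f : ℕ → ℕ) (g : Fin k → ℕ → ℕ) → (∀ a → f a ≡ ∑ (λ i → g i a)) → sumN X (λ a → f a * H a) ≡ ∑ (λ i → sumN X (λ a → g i a * H a))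
sumN-slot {k} [] H f g e = sym (∑-const k 0 ∙ *-zeroʳ k)
sumN-slot (a ∷ X) H f g e = cong₂ _+_ (cong (_* H a) (e a) ∙ *-comm _ (H a) ∙ sym (∑-* (H a) (λ i → g i a)) ∙ ∑-cong λ i → *-comm (H a) (g i a)) (sumN-slot X H f g e) ∙ sym (∑-+ (λ i → g i a * H a) _)

*-pos : ∀ {a b} → 1 ≤ a * b → 1 ≤ a × 1 ≤ b
*-pos {zero} ()
*-pos {suc a} {zero} h = ⊥-elim (<⇒≢ h (sym (*-zeroʳ (suc a))))
*-pos {suc a} {suc b} h = s≤s z≤n , s≤s z≤n

*-≤1 : ∀ {a b} → a ≤ 1 → b ≤ 1 → a * b ≤ 1
*-≤1 h g = *-mono-≤ h g

δ-translate : ∀ {k} x y a → + k ∣ℤ (x - y) → δ k (x - a) ≡ δ k (y - a)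
δ-translate x y a d = δ-≡ _ _ (∣ℤ-cong (lem x y a) d)
  where lem : ∀ x y a → x - y ≡ (x - a) - (y - a); lem = ring

module Lists {p q r : ℕ} (D : Distinct p q r) where
  open Distinct D

  term : (ℕ → ℕ) → ∀ l m n → Pos p l → Pos q m → Pos r n → ℕ → ℕ
  term w l m n x y z a = w a * (ind p l x a * (ind q m y a * ind r n z a))

  -- The weights allow one construction for a set, with weight 1, and for the part of it that has a
  -- given type of fibre.
  weighted : (ℕ → ℕ) → List ℕ → Profile p q r
  weighted w X = record
    { N = λ l m n x y z → sumN X (term w l m n x y z)
    ; p₀ = λ {m} {n} {y} {z} → slot₁ {l0} {l1} {m} {n} {tt} {λ c → c} {y} {z} (ind-∑₀ p-prime)
    ; p₁ = λ {m} {n} {c} {y} {z} → slot₁ {l1} {l2} {m} {n} {c} {λ σ → c , σ} {y} {z} (ind-∑₁ p-prime c)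
    ; q₀ = λ {l} {n} {x} {z} → slot₂ {l0} {l1} {l} {n} {tt} {λ c → c} {x} {z} (ind-∑₀ q-prime)
    ; q₁ = λ {l} {n} {x} {v} {z} → slot₂ {l1} {l2} {l} {n} {v} {λ σ → v , σ} {x} {z} (ind-∑₁ q-prime v)
    ; r₀ = λ {l} {m} {x} {y} → slot₃ {l0} {l1} {l} {m} {tt} {λ c → c} {x} {y} (ind-∑₀ r-prime)
    ; r₁ = λ {l} {m} {x} {y} {v} → slot₃ {l1} {l2} {l} {m} {v} {λ σ → v , σ} {x} {y} (ind-∑₁ r-prime v) }
    where
    slot₁ : ∀ {l l' m n x} {x' : Fin p → Pos p l'} {y z} → (∀ a → ind p l x a ≡ ∑ (λ i → ind p l' (x' i) a)) → sumN X (term w l m n x y z) ≡ ∑ (λ i → sumN X (term w l' m n (x' i) y z))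
    slot₁ {l} {l'} {m} {n} {x} {x'} {y} {z} e = (sumN-cong X λ a → lem (w a) (ind p l x a) (ind q m y a * ind r n z a)) ∙ sumN-slot X (λ a → w a * (ind q m y a * ind r n z a)) _ (λ i a → ind p l' (x' i) a) e ∙ ∑-cong λ i → sumN-cong X λ a → sym (lem (w a) (ind p l' (x' i) a) (ind q m y a * ind r n z a))
      where lem : ∀ w a b → w * (a * b) ≡ a * (w * b); lem = ringℕ
    slot₂ : ∀ {m m' l n y} {y' : Fin q → Pos q m'} {x z} → (∀ a → ind q m y a ≡ ∑ (λ i → ind q m' (y' i) a)) → sumN X (term w l m n x y z) ≡ ∑ (λ i → sumN X (term w l m' n x (y' i) z))
    slot₂ {m} {m'} {l} {n} {y} {y'} {x} {z} e = (sumN-cong X λ a → lem (w a) (ind p l x a) (ind q m y a) (ind r n z a)) ∙ sumN-slot X (λ a → w a * (ind p l x a * ind r n z a)) _ (λ i a → ind q m' (y' i) a) e ∙ ∑-cong λ i → sumN-cong X λ a → sym (lem (w a) (ind p l x a) (ind q m' (y' i) a) (ind r n z a))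
      where lem : ∀ w a b c → w * (a * (b * c)) ≡ b * (w * (a * c)); lem = ringℕ
    slot₃ : ∀ {n n' l m z} {z' : Fin r → Pos r n'} {x y} → (∀ a → ind r n z a ≡ ∑ (λ i → ind r n' (z' i) a)) → sumN X (term w l m n x y z) ≡ ∑ (λ i → sumN X (term w l m n' x y (z' i)))
    slot₃ {n} {n'} {l} {m} {z} {z'} {x} {y} e = (sumN-cong X λ a → lem (w a) (ind p l x a) (ind q m y a) (ind r n z a)) ∙ sumN-slot X (λ a → w a * (ind p l x a * ind q m y a)) _ (λ i a → ind r n' (z' i) a) e ∙ ∑-cong λ i → sumN-cong X λ a → sym (lem (w a) (ind p l x a) (ind q m y a) (ind r n' (z' i) a))
      where lem : ∀ w a b c → w * (a * (b * c)) ≡ c * (w * (a * b)); lem = ringℕ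

  profile : List ℕ → Profile p q r
  profile = weighted (λ _ → 1)

  weighted-total : ∀ w X → Profile.total (weighted w X) ≡ sumN X w
  weighted-total w X = sumN-cong X λ a → cong (w a *_) (cong₂ _*_ (ind-l0 p tt a) (cong₂ _*_ (ind-l0 q tt a) (ind-l0 r tt a)) ∙ refl) ∙ *-identityʳ (w a)

  profile-total : ∀ X → Profile.total (profile X) ≡ length X
  profile-total X = weighted-total (λ _ → 1) X ∙ go X
    where go : ∀ X → sumN X (λ _ → 1) ≡ length X
          go [] = refl
          go (a ∷ X) = cong suc (go X)

  term-pos : ∀ w l m n x y z {a} → 1 ≤ term w l m n x y z a → 1 ≤ w a × Hits p l x a × Hits q m y a × Hits r n z a
  term-pos w l m n x y z {a} h = let (h₀ , h') = *-pos {w a} h ; (h₁ , h'') = *-pos {ind p l x a} h' ; (h₂ , h₃) = *-pos {ind q m y a} h'' in h₀ , ind-pos {p} {l} x h₁ , ind-pos {q} {m} y h₂ , ind-pos {r} {n} z h₃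

  term-hit : ∀ w l m n x y z {a} → Hits p l x a → Hits q m y a → Hits r n z a → term w l m n x y z a ≡ w a
  term-hit w l m n x y z {a} h₁ h₂ h₃ = cong (w a *_) (cong₂ _*_ (ind-yes {p} {l} {x} {a} h₁) (cong₂ _*_ (ind-yes {q} {m} {y} {a} h₂) (ind-yes {r} {n} {z} {a} h₃)) ∙ refl) ∙ *-identityʳ (w a)

  term-≤1 : ∀ w → (∀ a → w a ≤ 1) → ∀ l m n x y z a → term w l m n x y z a ≤ 1
  term-≤1 w h l m n x y z a = *-≤1 (h a) (*-≤1 (ind-≤1 p l x a) (*-≤1 (ind-≤1 q m y a) (ind-≤1 r n z a)))

  restrict : ∀ l → Pos p l → List ℕ → List ℕ
  restrict l x = filter (hits? p l x)

  restrict-N : ∀ l x X m n y z → Profile.N (profile (restrict l x X)) l0 m n tt y z ≡ Profile.N (profile X) l m n x y z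
  restrict-N l x [] m n y z = refl
  restrict-N l x (a ∷ X) m n y z = go (hits? p l x a)
    where
    t₁ : ℕ; t₁ = term (λ _ → 1) l m n x y z a
    go : Dec (Hits p l x a) → sumN (restrict l x (a ∷ X)) (term (λ _ → 1) l0 m n tt y z) ≡ t₁ + sumN X (term (λ _ → 1) l m n x y z)
    go (yes h) = cong (λ L → sumN L (term (λ _ → 1) l0 m n tt y z)) (Lₚ.filter-accept (hits? p l x) h) ∙ cong₂ _+_ (cong (λ k → 1 * (k * (ind q m y a * ind r n z a))) (ind-l0 p tt a ∙ sym (ind-yes {p} {l} {x} {a} h))) (restrict-N l x X m n y z)
    go (no h) = cong (λ L → sumN L (term (λ _ → 1) l0 m n tt y z)) (Lₚ.filter-reject (hits? p l x) h) ∙ restrict-N l x X m n y z ∙ cong (λ k → k + sumN X (term (λ _ → 1) l m n x y z)) (sym (cong (λ k → 1 * (k * (ind q m y a * ind r n z a))) (ind-no {p} {l} {x} {a} h)))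

  toTest : ∀ {p} → Prime p → ∀ l → Test p l → TestZ p l
  toTest pr l0 _ = tt
  toTest {p} pr l1 (c , c') = rep p l1 c , rep p l1 c'
  toTest {p} pr l2 (c , σ , σ') = rep p l2 (c , σ) , rep p l2 (c , σ') , ∣-sub pr (+ toℕ c) (rep p l2 (c , σ)) (rep p l2 (c , σ')) (flip-∣ (rep p l2 (c , σ)) (+ toℕ c) (rep₂-mod pr c σ)) (flip-∣ (rep p l2 (c , σ')) (+ toℕ c) (rep₂-mod pr c σ'))

  alt-ind : ∀ {p} (pr : Prime p) l t a → alt l t (λ x → + ind p l x a) ≡ dz p l (toTest pr l t) (+ a)
  alt-ind {p} pr l0 t a = +ind p l0 tt a ∙ δ-1-const _
  alt-ind {p} pr l1 (c , c') a = cong₂ _-_ (+ind p l1 c a) (+ind p l1 c' a)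
  alt-ind {p} pr l2 (c , σ , σ') a = cong₂ _-_ (+ind p l2 (c , σ) a) (+ind p l2 (c , σ') a)

  alt-* : ∀ {p} l t k (f : Pos p l → ℤ) → alt l t (λ x → f x · k) ≡ alt l t f · k
  alt-* l0 t k f = refl
  alt-* l1 (c , c') k f = lem (f c) (f c') k
    where lem : ∀ a b k → a · k - b · k ≡ (a - b) · k; lem = ring
  alt-* l2 (c , σ , σ') k f = alt-* l1 (σ , σ') k (λ s → f (c , s))

  alt-sumL : ∀ {p} l t (X : List ℕ) (f : Pos p l → ℕ → ℤ) → alt l t (λ x → sumL X (f x)) ≡ sumL X (λ a → alt l t (λ x → f x a))
  alt-sumL l t [] f = alt-0 l t
  alt-sumL l t (a ∷ X) f = alt-+ l t (λ x → f x a) (λ x → sumL X (f x)) ∙ cong (λ k → alt l t (λ x → f x a) ⊕ k) (alt-sumL l t X f)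

  alternating : ∀ X l m n t u s → alt l t (λ x → alt m u (λ y → alt n s (λ z → + Profile.N (profile X) l m n x y z)))
    ≡ sumL X (λ a → dz p l (toTest p-prime l t) (+ a) · (dz q m (toTest q-prime m u) (+ a) · dz r n (toTest r-prime n s) (+ a)))
  alternating X l m n t u s = (alt-cong l t λ x → (alt-cong m u λ y → (alt-cong n s λ z → +sumN X _ ∙ sumL-cong X λ a → cast (ind p l x a) (ind q m y a) (ind r n z a)) ∙
      alt-sumL n s X _ ∙ sumL-cong X λ a → alt-* n s (+ ind q m y a · + ind p l x a) (λ z → + ind r n z a)) ∙
      alt-sumL m u X _ ∙ sumL-cong X λ a → (alt-cong m u λ y → rot (alt n s (λ z → + ind r n z a)) (+ ind q m y a) (+ ind p l x a)) ∙ alt-* m u (alt n s (λ z → + ind r n z a) · + ind p l x a) (λ y → + ind q m y a)) ∙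
      alt-sumL l t X _ ∙ sumL-cong X λ a → (alt-cong l t λ x → rot' (alt m u (λ y → + ind q m y a)) (alt n s (λ z → + ind r n z a)) (+ ind p l x a)) ∙
         alt-* l t (alt m u (λ y → + ind q m y a) · alt n s (λ z → + ind r n z a)) (λ x → + ind p l x a) ∙ cong₂ _·_ (alt-ind p-prime l t a) (cong₂ _·_ (alt-ind q-prime m u a) (alt-ind r-prime n s a))
    where
    cast : ∀ a b c → + (1 * (a * (b * c))) ≡ + c · (+ b · + a)
    cast a b c = cong +_ (lem a b c) ∙ pos-* c (b * a) ∙ cong (λ k → + c · k) (pos-* b a)
      where lem : ∀ a b c → 1 * (a * (b * c)) ≡ c * (b * a); lem = ringℕ
    rot : ∀ z y x → z · (y · x) ≡ y · (z · x); rot = ring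
    rot' : ∀ y z x → y · (z · x) ≡ x · (y · z); rot' = ring

  Vz⇒V : ∀ X l m n → Vz p q r l m n X → V (profile X) l m n
  Vz⇒V X l m n h t u s = alternating X l m n t u s ∙ h (toTest p-prime l t) (toTest q-prime m u) (toTest r-prime n s)

  -- Only residues of the test values matter, and at `l2` the two values share their residue c mod
  -- p, as `Test` requires.
  fromTest : ∀ {p} (pr : Prime p) l (t : TestZ p l) → ∃[ t' ] (∀ a → dz p l t a ≡ dz p l (toTest pr l t') a)
  fromTest pr l0 t = tt , λ a → refl
  fromTest {p} pr l1 (x , x') = let (c , d) = residue pr x ; (c' , d') = residue pr x' in (c , c') , λ a → cong₂ _-_ (δ-translate x (+ toℕ c) a d) (δ-translate x' (+ toℕ c') a d')
  fromTest {p} pr l2 (x , x' , e) =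
    let (c , d) = residue pr x
        (σ , f) = lift-residue pr c x d
        (σ' , f') = lift-residue pr c x' (∣-sub pr x x' (+ toℕ c) e d)
    in (c , σ , σ') , λ a → cong₂ _-_ (δ-translate x (rep p l2 (c , σ)) a f) (δ-translate x' (rep p l2 (c , σ')) a f')

  V⇒Vz : ∀ X l m n → V (profile X) l m n → Vz p q r l m n X
  V⇒Vz X l m n h t u s =
    let (t' , e₁) = fromTest p-prime l t ; (u' , e₂) = fromTest q-prime m u ; (s' , e₃) = fromTest r-prime n s
    in (sumL-cong X λ a → cong₂ _·_ (e₁ (+ a)) (cong₂ _·_ (e₂ (+ a)) (e₃ (+ a)))) ∙ sym (alternating X l m n t' u' s') ∙ h t' u' s'

-- (T2) for tilings of ℤ_{q²r²}

-- A pair of subsets of ℤ_{q²} × ℤ_{r²}; the coordinate p is carried along at level l0.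
record Plane {p q r : ℕ} (X Y : Profile p q r) : Set where
  open Profile
  field
    q-prime : Prime q
    r-prime : Prime r
    q≢r : q ≢ r
    alternative : ∀ m n → ¬ (m ≡ l0 × n ≡ l0) → V X l0 m n ⊎ V Y l0 m n
    total-X : total X ≡ q * r
    total-Y : total Y ≡ q * r
    simple-X : ∀ y z → N X l0 l2 l2 tt y z ≤ 1
    simple-Y : ∀ y z → N Y l0 l2 l2 tt y z ≤ 1

plane23 : ∀ {p q r} {X Y : Profile p q r} → Plane X Y → Plane (sw23 X) (sw23 Y)
plane23 {p} {q} {r} {X} {Y} P = record { q-prime = r-prime ; r-prime = q-prime ; q≢r = q≢r ∘ sym
  ; alternative = λ n m ne → [ (λ h → inj₁ (V-sw23 X l0 m n h)) , (λ h → inj₂ (V-sw23 Y l0 m n h)) ]′ (alternative m n λ (a , b) → ne (b , a))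
  ; total-X = total-X ∙ *-comm q r ; total-Y = total-Y ∙ *-comm q r
  ; simple-X = λ z y → simple-X y z ; simple-Y = λ z y → simple-Y y z }
  where open Plane P

plane-swap : ∀ {p q r} {X Y : Profile p q r} → Plane X Y → Plane Y X
plane-swap P = record { q-prime = q-prime ; r-prime = r-prime ; q≢r = q≢r
  ; alternative = λ m n ne → [ inj₂ , inj₁ ]′ (alternative m n ne)
  ; total-X = total-Y ; total-Y = total-X ; simple-X = simple-Y ; simple-Y = simple-X }
  where open Plane P

Flat₂ : ∀ {p q r} → Profile p q r → Set
Flat₂ {p} {q} {r} X = ∀ v ψ ψ' z → Profile.N X l0 l2 l2 tt (v , ψ) z ≡ Profile.N X l0 l2 l2 tt (v , ψ') z

private
  ≤1-cases : ∀ {a} → a ≤ 1 → a ≡ 0 ⊎ a ≡ 1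
  ≤1-cases {zero} _ = inj₁ refl
  ≤1-cases {suc zero} _ = inj₂ refl
  ≤1-cases {suc (suc a)} (s≤s ())

module _ {k l : ℕ} (x : Fin k → Fin l → ℕ) (cr : ∀ i i' j j' → x i j + x i' j' ≡ x i j' + x i' j) where
  full-row-flat : ∀ i → (∀ j j' → x i j ≡ x i j') → ∀ i' j j' → x i' j ≡ x i' j'
  full-row-flat i h i' j j' = +-cancelˡ-≡ (x i j) _ _ (cong (_+ x i' j) (h j j') ∙ sym (cr i i' j j'))

  -- If a column contains both 1 and 0, the row of the 1 exceeds the row of the 0 by one everywhere,
  -- so it consists of ones. Next to a constant row every row is constant.
  zero-one-matrix : (∀ i j → x i j ≤ 1) → (∀ i i' j → x i j ≡ x i' j) ⊎ (∀ i j j' → x i j ≡ x i j')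
  zero-one-matrix ≤1 with any? (λ i → any? (λ i' → any? (λ j → ¬? (x i j ≟ x i' j))))
  ... | no none = inj₁ λ i i' j → decidable-stable (x i j ≟ x i' j) λ ne → none (i , i' , j , ne)
  ... | yes (i , i' , j , ne) = inj₂ (go (≤1-cases (≤1 i j)) (≤1-cases (≤1 i' j)))
    where
    all-one : ∀ i i' → x i j ≡ 1 → x i' j ≡ 0 → ∀ j' → x i j' ≡ 1
    all-one i i' e e' j' = ≤-antisym (≤1 i j') (≤-trans (subst (_≤ x i j + x i' j') e (m≤m+n (x i j) _)) (≤-reflexive (cr i i' j j' ∙ cong (λ w → x i j' + w) e' ∙ +-identityʳ _)))
    go : x i j ≡ 0 ⊎ x i j ≡ 1 → x i' j ≡ 0 ⊎ x i' j ≡ 1 → ∀ i j j' → x i j ≡ x i j'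
    go (inj₁ e) (inj₁ e') = ⊥-elim (ne (e ∙ sym e'))
    go (inj₂ e) (inj₂ e') = ⊥-elim (ne (e ∙ sym e'))
    go (inj₂ e) (inj₁ e') = full-row-flat i λ j j' → all-one i i' e e' j ∙ sym (all-one i i' e e' j')
    go (inj₁ e) (inj₂ e') = full-row-flat i' λ j j' → all-one i' i e' e j ∙ sym (all-one i' i e' e j')

module PlaneX {p q r : ℕ} {X Y : Profile p q r} (P : Plane X Y) where
  open Plane P
  open Profile
  private
    instance
      nzq = prime⇒nonZero q-prime
      nzr = prime⇒nonZero r-prime
    oq = origin q-prime
    or = origin r-prime
    NX = λ m n y z → N X l0 m n tt y z

  q-line : V X l0 l1 l0 → ∀ v → NX l1 l0 v tt ≡ r
  q-line h v = *-cancelˡ-≡ _ _ q (sym (∑-const-≡ (λ v → NX l1 l0 v tt) v (λ v' → level (h tt (v' , v) tt))) ∙ sym (q₀ X) ∙ total-X)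

  exclusive : V X l0 l1 l0 → ¬ V X l0 l2 l0
  exclusive h h' = prime∤prime q-prime r-prime q≢r (divides (NX l2 l0 (oq , oq) tt) (sym (q-line h oq) ∙ q₁ X ∙ ∑-const-≡ (λ ψ → NX l2 l0 (oq , ψ) tt) oq (λ ψ → level (h' tt (oq , ψ , oq) tt)) ∙ *-comm q _))

  flat-l1 : Flat₂ X → ∀ v ψ ψ' w → NX l2 l1 (v , ψ) w ≡ NX l2 l1 (v , ψ') w
  flat-l1 f v ψ ψ' w = r₁ X ∙ (∑-cong λ ω → f v ψ ψ' (w , ω)) ∙ sym (r₁ X)

  flat-l0 : Flat₂ X → ∀ v ψ ψ' → NX l2 l0 (v , ψ) tt ≡ NX l2 l0 (v , ψ') tt
  flat-l0 f v ψ ψ' = r₀ X ∙ (∑-cong λ w → flat-l1 f v ψ ψ' w) ∙ sym (r₀ X)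

  flat-V : Flat₂ X → ∀ n → V X l0 l2 n
  flat-V f l0 _ (v , ψ , ψ') s = unlevel (flat-l0 f v ψ ψ')
  flat-V f l1 _ (v , ψ , ψ') s = i≡j⇒i-j≡0 (alt-cong l1 s λ w → cong +_ (flat-l1 f v ψ ψ' w))
  flat-V f l2 _ (v , ψ , ψ') s = i≡j⇒i-j≡0 (alt-cong l2 s λ z → cong +_ (f v ψ ψ' z))

  module _ (h : V X l0 l2 l2) where
    private
      x : Fin q → Fin r → Fin q → Fin r → ℕ
      x v w ψ ω = NX l2 l2 (v , ψ) (w , ω)
      Rows Columns : Fin q → Fin r → Set
      Rows v w = ∀ ψ ψ' ω → x v w ψ ω ≡ x v w ψ' ω
      Columns v w = ∀ ψ ω ω' → x v w ψ ω ≡ x v w ψ ω'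
      grid : ∀ v w → Rows v w ⊎ Columns v w
      grid v w = zero-one-matrix (x v w) (λ ψ ψ' ω ω' → cross-at (x v w) ψ ψ' ω ω' (h tt (v , ψ , ψ') (w , ω , ω'))) (λ ψ ω → simple-X (v , ψ) (w , ω))
      row-fibres column-fibres : ∀ v w → Rows v w ⊎ Columns v w → ℕ
      row-fibres v w = [ (λ _ → ∑ (x v w oq)) , (λ _ → 0) ]′
      column-fibres v w = [ (λ _ → 0) , (λ _ → ∑ (λ ψ → x v w ψ or)) ]′
      grid-size : ∀ v w g → NX l1 l1 v w ≡ q * row-fibres v w g + r * column-fibres v w g
      grid-size v w (inj₁ e) = q₁ X ∙ (∑-cong λ ψ → r₁ X ∙ ∑-cong λ ω → e ψ oq ω) ∙ ∑-const q (∑ (x v w oq)) ∙ sym (cong (λ k → q * ∑ (x v w oq) + k) (*-zeroʳ r) ∙ +-identityʳ _)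
      grid-size v w (inj₂ e) = q₁ X ∙ (∑-cong λ ψ → r₁ X ∙ ∑-const-≡ (x v w ψ) or (λ ω → e ψ ω or)) ∙ ∑-* r (λ ψ → x v w ψ or) ∙ cong (_+ r * ∑ (λ ψ → x v w ψ or)) (sym (*-zeroʳ q))
      R C : ℕ
      R = ∑ (λ v → ∑ (λ w → row-fibres v w (grid v w)))
      C = ∑ (λ v → ∑ (λ w → column-fibres v w (grid v w)))
      size : q * R + r * C ≡ q * r
      size = cong₂ _+_ (sym (∑∑-* q (λ v w → row-fibres v w (grid v w)))) (sym (∑∑-* r (λ v w → column-fibres v w (grid v w)))) ∙ sym ((∑-cong λ v → ∑-+ (λ w → q * row-fibres v w (grid v w)) _) ∙ ∑-+ (λ v → ∑ (λ w → q * row-fibres v w (grid v w))) _) ∙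
        (∑-cong λ v → (∑-cong λ w → sym (grid-size v w (grid v w))) ∙ sym (r₀ X)) ∙ sym (q₀ X) ∙ total-X
      no-rows : R ≡ 0 → ∀ v w → Columns v w
      no-rows e v w = go (grid v w) (∑-zero (λ w → row-fibres v w (grid v w)) (∑-zero (λ v → ∑ (λ w → row-fibres v w (grid v w))) e v) w)
        where
        go : ∀ g → row-fibres v w g ≡ 0 → Columns v w
        go (inj₁ g) z ψ ω ω' = g ψ oq ω ∙ ∑-zero (x v w oq) z ω ∙ sym (g ψ oq ω' ∙ ∑-zero (x v w oq) z ω')
        go (inj₂ g) z = g
      no-columns : C ≡ 0 → ∀ v w → Rows v w
      no-columns e v w = go (grid v w) (∑-zero (λ w → column-fibres v w (grid v w)) (∑-zero (λ v → ∑ (λ w → column-fibres v w (grid v w))) e v) w)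
        where
        go : ∀ g → column-fibres v w g ≡ 0 → Rows v w
        go (inj₁ g) z = g
        go (inj₂ g) z ψ ψ' ω = g ψ ω or ∙ ∑-zero (λ ψ → x v w ψ or) z ψ ∙ sym (g ψ' ω or ∙ ∑-zero (λ ψ → x v w ψ or) z ψ')

    -- Each cell (v, w) is a 0/1 matrix without cross differences, so it consists of R' whole
    -- q-fibres or of C' whole r-fibres. Over all cells q R + r C = qr, so one kind does not occur.
    flat : Flat₂ X ⊎ Flat₂ (sw23 X)
    flat = go (q * r ≤? q * R)
      where
      go : Dec (q * r ≤ q * R) → Flat₂ X ⊎ Flat₂ (sw23 X)
      go (yes le) = inj₁ λ v ψ ψ' (w , ω) → no-columns (*-cancelˡ-≡ _ 0 r (n≤0⇒n≡0 (+-cancelˡ-≤ (q * R) _ _ (≤-trans (≤-reflexive size) (≤-trans le (≤-reflexive (sym (+-identityʳ _)))))) ∙ sym (*-zeroʳ r))) v w ψ ψ' ω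
      go (no lt) = inj₂ λ w ω ω' (v , ψ) → no-rows (coin q-prime r-prime q≢r {R} {C} {0} {q} (size ∙ *-comm q r ∙ cong (_+ r * q) (sym (*-zeroʳ q))) (≰⇒> lt)
        (subst (_< q * r) (sym (*-zeroʳ q)) (*-mono-≤ (>-nonZero⁻¹ q) (>-nonZero⁻¹ r)))) v w ψ ω ω'

  module _ (f : Flat₂ X) where
    private
      κ : Fin q → Fin r → Fin r → ℕ
      κ v w ω = NX l2 l2 (v , oq) (w , ω)
      κ-≡ : ∀ v w ω → NX l1 l2 v (w , ω) ≡ q * κ v w ω
      κ-≡ v w ω = q₁ X ∙ ∑-const-≡ (λ ψ → NX l2 l2 (v , ψ) (w , ω)) oq (λ ψ → f v ψ oq (w , ω))
      tot : ∑ (λ v → ∑ (λ w → ∑ (κ v w))) ≡ r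
      tot = *-cancelˡ-≡ _ _ q (sym ((∑-cong λ v → ∑∑-* q (κ v)) ∙ ∑-* q (λ v → ∑ (λ w → ∑ (κ v w)))) ∙ (∑-cong λ v → (∑-cong λ w → (∑-cong λ ω → sym (κ-≡ v w ω)) ∙ sym (r₁ X)) ∙ sym (r₀ X)) ∙ sym (q₀ X) ∙ total-X)
      q∤r = prime∤prime q-prime r-prime q≢r
      class-w : V X l0 l0 l1 → ∀ w → NX l0 l1 tt w ≡ q
      class-w h w = *-cancelˡ-≡ _ _ r (sym (∑-const-≡ (λ w → NX l0 l1 tt w) w (λ w' → level (h tt tt (w' , w)))) ∙ sym (r₀ X) ∙ total-X ∙ *-comm q r)

    -- By `full-row` the r fibres of X would all lie over one class mod r, whereas Φ_r puts q points
    -- over each.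
    not-V12 : V X l0 l0 l1 → ¬ V X l0 l1 l2
    not-V12 h h' = ≢-nonZero⁻¹ q (sym (class-w h w') ∙ q₀ X ∙ ∑-0 λ v → r₁ X ∙ ∑-0 λ ω → κ-≡ v w' ω ∙ cong (q *_) (FullRow.empty-w row v w' ω (proj₂ (another (prime≥2 r-prime) (FullRow.w₀ row)))) ∙ *-zeroʳ q)
      where
      row : FullRow κ
      row = full-row κ (λ w v v' ω ω' → scale-cross q (κ-≡ v w ω) (κ-≡ v w ω') (κ-≡ v' w ω) (κ-≡ v' w ω') (cross-at (λ i j → NX l1 l2 i (w , j)) v v' ω ω' (h' tt (v , v') (w , ω , ω')))) tot q∤r
      w' = proj₁ (another (prime≥2 r-prime) (FullRow.w₀ row))

    -- Φ_{r²} and flatness put X over one class mod r. Next to an empty one Φ_{qr} would spread it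
    -- evenly over v, with r points each, but these numbers are multiples of q.
    not-V11 : V X l0 l0 l2 → ¬ V X l0 l1 l1
    not-V11 h h' = q∤r (divides (∑ (κ oq w₀)) (sym N≡r ∙ r₁ X ∙ (∑-cong λ ω → κ-≡ oq w₀ ω) ∙ ∑-* q (κ oq w₀) ∙ *-comm q _))
      where
      u : Fin r → ℕ
      u w = ∑ (λ v → κ v w or)
      N-u : ∀ w → NX l0 l1 tt w ≡ (q * r) * u w
      N-u w = r₁ X ∙ ∑-const-≡ (λ ω → NX l0 l2 tt (w , ω)) or (λ ω → level (h tt tt (w , ω , or))) ∙ cong (r *_) (q₀ X ∙ (∑-cong λ v → κ-≡ v w or) ∙ ∑-* q (λ v → κ v w or)) ∙ lem r q (u w)
        where lem : ∀ r q u → r * (q * u) ≡ q * r * u; lem = ringℕ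
      ∑u : ∑ u ≡ 1
      ∑u = *-cancelˡ-≡ _ _ (q * r) {{m*n≢0 q r}} (sym (∑-* (q * r) u) ∙ (∑-cong λ w → sym (N-u w)) ∙ sym (r₀ X) ∙ total-X ∙ sym (*-identityʳ (q * r)))
      w₀∃ : ∃[ w ] 1 ≤ u w; w₀∃ = ∑-pos u (≤-reflexive (sym ∑u))
      w₀ = proj₁ w₀∃
      w' = proj₁ (another (prime≥2 r-prime) w₀)
      u-w' : u w' ≡ 0; u-w' = ∑-dominated u w₀ (≤-trans (≤-reflexive ∑u) (proj₂ w₀∃)) w' (proj₂ (another (prime≥2 r-prime) w₀))
      z : ∀ v → NX l1 l1 v w' ≡ 0
      z v = n≤0⇒n≡0 (subst (NX l1 l1 v w' ≤_) (N-u w' ∙ cong (q * r *_) u-w' ∙ *-zeroʳ (q * r)) (≤-q₀ X tt v w'))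
      v-const : ∀ v → NX l1 l1 v w₀ ≡ NX l1 l1 oq w₀
      v-const v = sym (+-identityʳ _) ∙ subst₂ (λ a b → NX l1 l1 v w₀ + a ≡ b + NX l1 l1 oq w₀) (z oq) (z v) (cross-at (NX l1 l1) v oq w₀ w' (h' tt (v , oq) (w₀ , w')))
      N≡r : NX l1 l1 oq w₀ ≡ r
      N≡r = *-cancelˡ-≡ _ _ q (sym (∑-const-≡ (λ v → NX l1 l1 v w₀) oq v-const) ∙ sym (q₀ X) ∙ N-u w₀ ∙ cong (q * r *_) (≤-antisym (subst (u w₀ ≤_) ∑u (∑-≥ u w₀)) (proj₂ w₀∃)) ∙ *-identityʳ (q * r))

module _ {p q r : ℕ} {X Y : Profile p q r} (P : Plane X Y) where
  open Plane P
  private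
    module FX = PlaneX P
    module FY = PlaneX (plane-swap P)

  flat-X⇒V : Flat₂ X → ∀ b g → b ≢ l0 → V X l0 b l0 → V X l0 b g
  flat-X⇒V f l0 g b≢ h = ⊥-elim (b≢ refl)
  flat-X⇒V f l1 g b≢ h = ⊥-elim (FX.exclusive h (FX.flat-V f l0))
  flat-X⇒V f l2 g b≢ h = FX.flat-V f g

  -- A flat Y has Φ_{q²}, so X does not and b is 1. If Y had the mixed divisor in question, it would
  -- clash with its own divisor at r, which is the one that X lacks.
  flat-Y⇒V : Flat₂ Y → ∀ b g → b ≢ l0 → g ≢ l0 → V X l0 b l0 → V X l0 l0 g → V X l0 b g
  flat-Y⇒V f l0 g b≢ g≢ h h' = ⊥-elim (b≢ refl)
  flat-Y⇒V f l2 g b≢ g≢ h h' = ⊥-elim ([ (λ x → FX.exclusive x h) , (λ y → FY.exclusive y (FY.flat-V f l0)) ]′ (alternative l1 l0 λ ()))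
  flat-Y⇒V f l1 l0 b≢ g≢ h h' = ⊥-elim (g≢ refl)
  flat-Y⇒V f l1 l1 b≢ g≢ h h' = [ (λ x → x) , (λ y → ⊥-elim (FY.not-V11 f (go (alternative l0 l2 λ ())) y)) ]′ (alternative l1 l1 λ ())
    where go : V X l0 l0 l2 ⊎ V Y l0 l0 l2 → V Y l0 l0 l2
          go (inj₂ y) = y
          go (inj₁ x) = ⊥-elim (PlaneX.exclusive (plane23 P) (V-sw23 X l0 l0 l1 h') (V-sw23 X l0 l0 l2 x))
  flat-Y⇒V f l1 l2 b≢ g≢ h h' = [ (λ x → x) , (λ y → ⊥-elim (FY.not-V12 f (go (alternative l0 l1 λ ())) y)) ]′ (alternative l1 l2 λ ())
    where go : V X l0 l0 l1 ⊎ V Y l0 l0 l1 → V Y l0 l0 l1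
          go (inj₂ y) = y
          go (inj₁ x) = ⊥-elim (PlaneX.exclusive (plane23 P) (V-sw23 X l0 l0 l1 x) (V-sw23 X l0 l0 l2 h'))

-- Φ_{q²r²} divides X or Y, and the set that it divides is a union of fibres in one direction.
plane-T2 : ∀ {p q r} {X Y : Profile p q r} → Plane X Y → ∀ b g → b ≢ l0 → g ≢ l0 → V X l0 b l0 → V X l0 l0 g → V X l0 b g
plane-T2 {X = X} {Y} P b g b≢ g≢ h h' = go (Plane.alternative P l2 l2 λ ())
  where
  back : V (sw23 X) l0 g b → V X l0 b g
  back = V-sw23 (sw23 X) l0 g b
  h₁ = V-sw23 X l0 b l0 h
  h₂ = V-sw23 X l0 l0 g h'
  go : V X l0 l2 l2 ⊎ V Y l0 l2 l2 → V X l0 b g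
  go (inj₁ x) = [ (λ f → flat-X⇒V P f b g b≢ h) , (λ f → back (flat-X⇒V (plane23 P) f g b g≢ h₂)) ]′ (PlaneX.flat P x)
  go (inj₂ y) = [ (λ f → flat-Y⇒V P f b g b≢ g≢ h h') , (λ f → back (flat-Y⇒V (plane23 P) f g b g≢ b≢ h₂ h₁)) ]′ (PlaneX.flat (plane-swap P) y)

-- Reduction to tilings of ℤ_{q²r²}

sumL-≥ : ∀ {A : Set} (L : List A) {f} → (∀ x → + 0 ℤ.≤ f x) → ∀ {x} → x ∈L L → f x ℤ.≤ sumL L f
sumL-≥ (x ∷ L) {f} h (here refl) = subst (ℤ._≤ f x ⊕ sumL L f) (⊕-identityʳ (f x)) (⊕-monoʳ-≤ (f x) (sumL-nonneg L h))
sumL-≥ (y ∷ L) {f} h {x} (there m) = subst (ℤ._≤ f y ⊕ sumL L f) (+-identityˡ (f x)) (⊕-mono-≤ (h y) (sumL-≥ L h m))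

sumL-mono : ∀ {A : Set} (L : List A) {f g} → (∀ x → f x ℤ.≤ g x) → sumL L f ℤ.≤ sumL L g
sumL-mono [] h = ℤₚ.≤-refl
sumL-mono (x ∷ L) h = ⊕-mono-≤ (h x) (sumL-mono L h)

tile-swap : ∀ {N X Y} → TileL N X Y → TileL N Y X
tile-swap {N} {X} {Y} tile y = (sumL-cong Y λ b → sumL-cong X λ a → cong (δ N) (lem y (+ a) (+ b))) ∙ sumL-swap Y X _ ∙ tile y
  where lem : ∀ y a b → y - b - a ≡ y - a - b; lem = ring

tile-size : ∀ N .{{_ : NonZero N}} X Y → TileL N X Y → length X * length Y ≡ N
tile-size N X Y tile = +-injective (pos-* (length X) (length Y) ∙ sym (count-total N X Y) ∙ (sumL-cong (upTo N) λ y → tile (+ y)) ∙ sumL-const (upTo N) (+ 1) ∙ ·-identityʳ _ ∙ cong +_ (Lₚ.length-upTo N))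

upTo-sum : ∀ p .{{_ : NonZero p}} z → sumL (upTo p) (λ t → δ p (z - + t)) ≡ + 1
upTo-sum p z = (sumL-cong (upTo p) λ t → δ-⇔ (flip-∣ z (+ t)) (flip-∣ (+ t) z)) ∙ residue-sum p z

fibre-sum : ∀ {p} → Prime p → ∀ z → sumL (upTo p) (λ t → δ (p ^ 2) (z - + p · + t)) ≡ δ p z
fibre-sum {p} pr z = go (+ p ∣ℤ? z)
  where
  instance
    nz : NonZero p; nz = prime⇒nonZero pr
  go : Dec (+ p ∣ℤ z) → _
  go (yes d@(dividesℤ j e)) = (sumL-cong (upTo p) λ t → δ-⇔ (λ h → sq-∣⁻ pr (subst (+ (p ^ 2) ∣ℤ_) (eqn t) h)) (λ h → sq-∣ pr (eqn t) h)) ∙ upTo-sum p j ∙ sym (δ-yes d)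
    where
    eqn : ∀ t → z - + p · + t ≡ + p · (j - + t)
    eqn t = cong (λ w → w - + p · + t) e ∙ lem (+ p) j (+ t)
      where lem : ∀ p j t → j · p - p · t ≡ p · (j - t); lem = ring
  go (no nd) = (sumL-cong (upTo p) λ t → δ-no λ h → nd (∣ℤ-cong (lem z (+ p) (+ t)) (add∣ (trans∣ (sq-p pr) h) (mulʳ∣ (+ t) refl∣)))) ∙ sumL-0 (upTo p) ∙ sym (δ-no nd)
    where lem : ∀ z p t → (z - p · t) ⊕ p · t ≡ z; lem = ring

-- The tiling X ⊕ Y of ℤ_M is turned into tilings of ℤ_{q²r²} by a dilation that annihilates ℤ_{p²}.
module Reduction {p q r : ℕ} (D : Distinct p q r) where
  open Distinct D
  open Lists D
  open Profile
  private
    instance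
      nzp = prime⇒nonZero p-prime
      nzq = prime⇒nonZero q-prime
      nzr = prime⇒nonZero r-prime
      nzp² = sqnz p-prime
      nzq² = sqnz q-prime
      nzr² = sqnz r-prime
      nzpq² = m*n≢0 (p ^ 2) (q ^ 2)
    o = origin p-prime

  M K : ℕ
  M = p ^ 2 * q ^ 2 * r ^ 2
  K = q ^ 2 * r ^ 2

  instance
    nzM : NonZero M; nzM = m*n≢0 (p ^ 2 * q ^ 2) (r ^ 2)
    nzK : NonZero K; nzK = m*n≢0 (q ^ 2) (r ^ 2)

  δK : ∀ z → δ K z ≡ δ (q ^ 2) z · δ (r ^ 2) z
  δK = δ-* (pow-coprime D q-prime r-prime q≢r 2 2)

  δM : ∀ z → δ M z ≡ δ (p ^ 2) z · δ K z
  δM z = δ-modulus D l2 l2 l2 z ∙ cong (λ k → δ (p ^ 2) z · k) (sym (δK z))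

  δK-≡ : ∀ z z' → + (q ^ 2) ∣ℤ (z - z') → + (r ^ 2) ∣ℤ (z - z') → δ K z ≡ δ K z'
  δK-≡ z z' d e = δK z ∙ cong₂ _·_ (δ-≡ z z' d) (δ-≡ z z' e) ∙ sym (δK z')

  sumL-restrict : ∀ l x X f → sumL (restrict l x X) f ≡ sumL X (λ a → δ (md p l) (rep p l x - + a) · f a)
  sumL-restrict l x [] f = refl
  sumL-restrict l x (a ∷ X) f = go (hits? p l x a)
    where
    go : Dec (Hits p l x a) → _
    go (yes h) = cong (λ L → sumL L f) (Lₚ.filter-accept (hits? p l x) h) ∙ cong₂ _⊕_ (sym (cong (_· f a) (δ-yes h) ∙ ·-identityˡ (f a))) (sumL-restrict l x X f)
    go (no h) = cong (λ L → sumL L f) (Lₚ.filter-reject (hits? p l x) h) ∙ sumL-restrict l x X f ∙ sym (+-identityˡ _) ∙ cong (_⊕ sumL X (λ a → δ (md p l) (rep p l x - + a) · f a)) (sym (cong (_· f a) (δ-no h) ∙ *-zeroˡ (f a)))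

  G : ∀ m n → Pos q m → Pos r n → ℕ → ℤ
  G m n y z a = δ (md q m) (rep q m y - + a) · δ (md r n) (rep r n z - + a)

  N-δ : ∀ X l m n x y z → + N (profile X) l m n x y z ≡ sumL X (λ a → δ (md p l) (rep p l x - + a) · G m n y z a)
  N-δ X l m n x y z = +sumN X (term (λ _ → 1) l m n x y z) ∙ sumL-cong X λ a → cong +_ (+-identityʳ _) ∙ pos-* (ind p l x a) _ ∙ cong₂ _·_ (+ind p l x a) (pos-* (ind q m y a) _ ∙ cong₂ _·_ (+ind q m y a) (+ind r n z a))

  N-at : ∀ X l (u : ℤ) x y z → + md p l ∣ℤ (u - rep p l x) → + (q ^ 2) ∣ℤ (u - rep q l2 y) → + (r ^ 2) ∣ℤ (u - rep r l2 z) →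
    sumL X (λ a → δ (md p l) (u - + a) · δ K (u - + a)) ≡ + N (profile X) l l2 l2 x y z
  N-at X l u x y z d e f = (sumL-cong X λ a → cong₂ _·_ (δ-translate u (rep p l x) (+ a) d) (δK (u - + a) ∙ cong₂ _·_ (δ-translate u (rep q l2 y) (+ a) e) (δ-translate u (rep r l2 z) (+ a) f))) ∙ sym (N-δ X l l2 l2 x y z)

  md∣sq : ∀ q m → md q m ∣ q ^ 2
  md∣sq q l0 = 1∣ _
  md∣sq q l1 = m∣m*n (q * 1)
  md∣sq q l2 = ∣-refl

  G-shift : ∀ m n y z a b → + (q ^ 2) ∣ℤ (+ a - + b) → + (r ^ 2) ∣ℤ (+ a - + b) → G m n y z a ≡ G m n y z b
  G-shift m n y z a b d e = cong₂ _·_ (sh (rep q m y) (trans∣ (pos∣ (md∣sq q m)) d)) (sh (rep r n z) (trans∣ (pos∣ (md∣sq r n)) e))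
    where sh : ∀ {k} u → + k ∣ℤ (+ a - + b) → δ k (u - + a) ≡ δ k (u - + b)
          sh u d = δ-≡ _ _ (∣ℤ-cong (lem u (+ a) (+ b)) (neg∣ d))
            where lem : ∀ u a b → - (a - b) ≡ (u - a) - (u - b); lem = ring

  private
    module Q = CRT (crt₁ (swap12 D))
    module R = CRT (crt₁ (swap12 (swap23 D)))
    ℓ : ℕ; ℓ = Q.E + R.E
    p²∣ℓ : + (p ^ 2) ∣ℤ + ℓ; p²∣ℓ = pos∣ (∣m∣n⇒∣m+n Q.q∣E R.q∣E)
    q²∣ : + (q ^ 2) ∣ℤ (+ ℓ - + 1)
    q²∣ = ∣ℤ-cong (lem (+ Q.E) (+ R.E)) (add∣ Q.E≡1 (pos∣ R.r∣E))
      where lem : ∀ a b → (a - + 1) ⊕ b ≡ (a ⊕ b) - + 1; lem = ring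
    r²∣ : + (r ^ 2) ∣ℤ (+ ℓ - + 1)
    r²∣ = ∣ℤ-cong (lem (+ Q.E) (+ R.E)) (add∣ R.E≡1 (pos∣ Q.r∣E))
      where lem : ∀ a b → (b - + 1) ⊕ a ≡ (a ⊕ b) - + 1; lem = ring
    ∤ℓ : ∀ {π} → Prime π → + (π ^ 2) ∣ℤ (+ ℓ - + 1) → ¬ (π ∣ ℓ)
    ∤ℓ {π} pr d e = <⇒≱ (prime≥2 pr) (∣⇒≤ (pos∣⁻¹ {n = 1} (∣ℤ-cong (lem (+ ℓ)) (sub∣ (pos∣ e) (trans∣ (sq-p pr) d)))))
      where lem : ∀ a → a - (a - + 1) ≡ + 1; lem = ring
    instance
      nzℓ : NonZero ℓ; nzℓ = ≢-nonZero λ e → ∤ℓ q-prime q²∣ (subst (q ∣_) (sym e) (divides 0 refl))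

  -- `tijdeman` asks ℓ to be prime to |X| only. This is qr, so ℓ may be a multiple of p², and tiles
  -- have to be cut down to qr elements first. After the dilation X is 0 mod p², so a target that is
  -- s mod p² is reached only by elements of Y that are s mod p².
  tile-restrict : ∀ X Y → TileL M X Y → length X ≡ q * r → ∀ s → TileL K X (restrict l2 s Y)
  tile-restrict X Y tile len s y = (sumL-cong X λ a → sumL-restrict l2 s Y _) ∙ (sumL-cong X λ a → sumL-cong Y λ b → sym (point a b)) ∙ sym (sumL-map (ℓ *_) X _) ∙ dilated y'
    where
    dilated : TileL M (map (ℓ *_) X) Y
    dilated = tijdeman M X Y tile ℓ λ {π} pr d e → [ (λ f → ∤ℓ q-prime q²∣ (subst (_∣ ℓ) (prime-∣-prime pr q-prime f) d)) , (λ f → ∤ℓ r-prime r²∣ (subst (_∣ ℓ) (prime-∣-prime pr r-prime f) d)) ]′ (euclidsLemma q r pr (subst (π ∣_) len e))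
    y'∃ = crt₃ D (rep p l2 s) y y
    y' = proj₁ y'∃
    point : ∀ a b → δ M (y' - + (ℓ * a) - + b) ≡ δ (p ^ 2) (rep p l2 s - + b) · δ K (y - + a - + b)
    point a b = δM _ ∙ cong₂ _·_
      (δ-≡ _ _ (∣ℤ-cong (lem₁ y' (+ (ℓ * a)) (+ b) (rep p l2 s)) (sub∣ (proj₁ (proj₂ y'∃)) (pos∣ (∣m⇒∣m*n a (pos∣⁻¹ p²∣ℓ))))))
      (δK-≡ _ _ (near (proj₁ (proj₂ (proj₂ y'∃))) q²∣) (near (proj₂ (proj₂ (proj₂ y'∃))) r²∣))
      where
      lem₁ : ∀ y' la b s → (y' - s) - la ≡ (y' - la - b) - (s - b); lem₁ = ring
      near : ∀ {k} → + k ∣ℤ (y' - y) → + k ∣ℤ (+ ℓ - + 1) → + k ∣ℤ ((y' - + (ℓ * a) - + b) - (y - + a - + b))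
      near d e = ∣ℤ-cong (lem₂ y' y (+ ℓ) (+ a) (+ b) ∙ cong (λ k → (y' - k - + b) - (y - + a - + b)) (sym (pos-* ℓ a))) (sub∣ d (mulʳ∣ (+ a) e))
        where lem₂ : ∀ y' y l a b → (y' - y) - (l - + 1) · a ≡ (y' - l · a - b) - (y - a - b); lem₂ = ring

  -- Two elements of X in one class would represent the sum of that class and b twice.
  simple : ∀ X Y → TileL K X Y → ∀ {b} → b ∈L Y → ∀ y z → N (profile X) l0 l2 l2 tt y z ≤ 1
  simple X Y tile {b} b∈ y z = ℤₚ.drop‿+≤+ (ℤₚ.≤-trans (ℤₚ.≤-reflexive (sym ((sumL-cong X λ a → sym (·-identityˡ _) ∙ cong (_· δ K (u - + a)) (sym (δ-1-const _))) ∙ N-at X l0 u tt y z (one-∣ _) (proj₁ (proj₂ (proj₂ u∃))) (proj₂ (proj₂ (proj₂ u∃))))))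
     (ℤₚ.≤-trans (sumL-mono X λ a → ℤₚ.≤-trans (ℤₚ.≤-reflexive (cong (δ K) (lem u (+ a) (+ b)))) (sumL-≥ Y (λ b' → δ-nonneg K (u ⊕ + b - + a - + b')) b∈)) (ℤₚ.≤-reflexive (tile (u ⊕ + b)))))
    where
    u∃ = crt₃ D (+ 0) (rep q l2 y) (rep r l2 z)
    u = proj₁ u∃
    lem : ∀ u a b → u - a ≡ u ⊕ b - a - b; lem = ring

  plane-of : ∀ X Y → TileL K X Y → length X ≡ q * r → Plane (profile X) (profile Y)
  plane-of X Y tile len = record { q-prime = q-prime ; r-prime = r-prime ; q≢r = q≢r
    ; alternative = λ m n ne → [ (λ h → inj₁ (Vz⇒V X l0 m n h)) , (λ h → inj₂ (Vz⇒V Y l0 m n h)) ]′ (Vz-dichotomy₂ D X Y tile (λ {π} pr d → [ (λ e → ∣-trans e (∣-trans (m∣m*n (q * 1)) (m∣m*n (r ^ 2)))) , (λ e → ∣-trans e (∣-trans (m∣m*n (r * 1)) (n∣m*n (q ^ 2)))) ]′ (euclidsLemma q r pr (subst (π ∣_) len d))) m n ne)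
    ; total-X = profile-total X ∙ len
    ; total-Y = profile-total Y ∙ len'
    ; simple-X = simple X Y tile (proj₂ (member Y len'))
    ; simple-Y = simple Y X (tile-swap {K} {X} {Y} tile) (proj₂ (member X len)) }
    where
    instance
      nzqr : NonZero (q * r); nzqr = m*n≢0 q r
    len' : length Y ≡ q * r
    len' = *-cancelˡ-≡ _ _ (q * r) (cong (_* length Y) (sym len) ∙ tile-size K X Y tile ∙ lem q r)
      where lem : ∀ q r → q * (q * 1) * (r * (r * 1)) ≡ q * r * (q * r); lem = ringℕ
    member : ∀ L → length L ≡ q * r → ∃[ b ] b ∈L L
    member [] e = ⊥-elim (≢-nonZero⁻¹ (q * r) (sym e))
    member (b ∷ L) e = b , here refl

  private
    module P = CRT (crt₁ D)
    -- Adding j E moves the first coordinate by j and fixes the other two.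
    E = P.E

    p-shift : ∀ k → + (p ^ 2) ∣ℤ (k · + E - k)
    p-shift k = ∣ℤ-cong (lem k (+ E)) (mulˡ∣ k P.E≡1)
      where lem : ∀ k e → k · (e - + 1) ≡ k · e - k; lem = ring

    E-shift : ∀ {k} → k ∣ E → ∀ j a → + k ∣ℤ (+ (j * E + a) - + a)
    E-shift d j a = ∣ℤ-cong (lem (+ (j * E)) (+ a)) (pos∣ (∣n⇒∣m*n j d))
      where lem : ∀ j a → j ≡ (j ⊕ a) - a; lem = ring

    G-E : ∀ m n y z j a → G m n y z (j * E + a) ≡ G m n y z a
    G-E m n y z j a = G-shift m n y z (j * E + a) a (E-shift P.q∣E j a) (E-shift P.r∣E j a)

    δp-E : ∀ w j a → δ (p ^ 2) (w - + (j * E + a)) ≡ δ (p ^ 2) (w - + a - + j)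
    δp-E w j a = δ-≡ _ _ (∣ℤ-cong (lem w (+ j) (+ E) (+ a) ∙ cong (λ k → (w - (k ⊕ + a)) - (w - + a - + j)) (sym (pos-* j E))) (neg∣ (p-shift (+ j))))
      where lem : ∀ w j e a → - (j · e - j) ≡ (w - (j · e ⊕ a)) - (w - a - j); lem = ring

    δK-E : ∀ w j a → δ K (w - + (j * E + a)) ≡ δ K (w - + a)
    δK-E w j a = δK-≡ _ _ (sh (E-shift P.q∣E j a)) (sh (E-shift P.r∣E j a))
      where sh : ∀ {k} → + k ∣ℤ (+ (j * E + a) - + a) → + k ∣ℤ ((w - + (j * E + a)) - (w - + a))
            sh d = ∣ℤ-cong (lem w (+ (j * E + a)) (+ a)) (neg∣ d)
              where lem : ∀ w b a → - (b - a) ≡ (w - b) - (w - a); lem = ring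

  -- If X is `base` plus a p-fibre, the fibre may be handed to the other side: `base` tiles with the
  -- fibre plus Y. This brings the first tile down to qr elements.
  module FibredTile (X Y : List ℕ) (tile : TileL M X Y) (i₁ : Indep₁ (profile X)) (len : length X ≡ p * q * r) where
    InBase : ℕ → Set
    InBase a = ∃[ c ] Hits p l2 (c , o) a
    inBase? : ∀ a → Dec (InBase a)
    inBase? a = any? (λ c → hits? p l2 (c , o) a)

    base : List ℕ; base = filter inBase? X

    sumN-filter : ∀ L f → (∀ a → ¬ InBase a → f a ≡ 0) → sumN (filter inBase? L) f ≡ sumN L f
    sumN-filter [] f h = refl
    sumN-filter (a ∷ L) f h = go (inBase? a)
      where
      go : Dec (InBase a) → _
      go (yes b) = cong (λ L → sumN L f) (Lₚ.filter-accept inBase? b) ∙ cong (λ k → f a + k) (sumN-filter L f h)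
      go (no b) = cong (λ L → sumN L f) (Lₚ.filter-reject inBase? b) ∙ sumN-filter L f h ∙ cong (_+ sumN L f) (sym (h a b))

    hits-coarse : ∀ c σ a → Hits p l2 (c , σ) a → + p ∣ℤ (+ a - + toℕ c)
    hits-coarse c σ a h = ∣-sub p-prime (rep p l2 (c , σ)) (+ a) (+ toℕ c) (trans∣ (sq-p p-prime) h) (rep₂-mod p-prime c σ)

    base-N : ∀ m n c y z → N (profile base) l1 m n c y z ≡ N (profile X) l2 m n (c , o) y z
    base-N m n c y z = p₁ (profile base) {m} {n} {c} {y} {z} ∙ ∑-single (λ σ → N (profile base) l2 m n (c , σ) y z) o empty ∙ sumN-filter X (term (λ _ → 1) l2 m n (c , o) y z) λ a nb → zero-term a λ h → nb (c , h)
      where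
      zero-term : ∀ a → ¬ Hits p l2 (c , o) a → term (λ _ → 1) l2 m n (c , o) y z a ≡ 0
      zero-term a nh = n≤0⇒n≡0 (≮⇒≥ λ pos → nh (proj₁ (proj₂ (term-pos (λ _ → 1) l2 m n (c , o) y z pos))))
      empty : ∀ σ → σ ≢ o → N (profile base) l2 m n (c , σ) y z ≡ 0
      empty σ ne = n≤0⇒n≡0 (≮⇒≥ λ pos →
        let (a , a∈ , t) = sumN-pos base (term (λ _ → 1) l2 m n (c , σ) y z) pos
            h = proj₁ (proj₂ (term-pos (λ _ → 1) l2 m n (c , σ) y z t))
            (_ , (c' , h')) = ∈-filter⁻ inBase? {xs = X} a∈
            c≡ : c ≡ c'; c≡ = toℕ-unique p-prime c c' (∣-sub p-prime (+ a) (+ toℕ c) (+ toℕ c') (hits-coarse c σ a h) (hits-coarse c' o a h'))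
        in ne (σ-unique p-prime c σ o (∣-sub p-prime (+ a) (rep p l2 (c , σ)) (rep p l2 (c , o)) (flip-∣ (rep p l2 (c , σ)) (+ a) h)
             (flip-∣ (rep p l2 (c , o)) (+ a) (subst (λ k → Hits p l2 (k , o) a) (sym c≡) h')))))

    base-N₀ : ∀ m n y z → N (profile base) l0 m n tt y z ≡ ∑ (λ c → N (profile X) l2 m n (c , o) y z)
    base-N₀ m n y z = p₀ (profile base) {m} {n} {y} {z} ∙ ∑-cong λ c → base-N m n c y z

    base-length : length base ≡ q * r
    base-length = *-cancelˡ-≡ _ _ p (cong (p *_) (sym (profile-total base) ∙ base-N₀ l0 l0 tt tt) ∙ sym (∑-* p (λ c → N (profile X) l2 l0 l0 (c , o) tt tt)) ∙
      (∑-cong λ c → sym (indep₁-* {P = profile X} i₁ c o tt tt)) ∙ sym (p₀ (profile X) {l0} {l0} {tt} {tt}) ∙ profile-total X ∙ len ∙ *-assoc p q r)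

    fibresY : List ℕ; fibresY = cartesianProductWith (λ t b → (p * t) * E + b) (upTo p) Y

    base-tile : TileL M base fibresY
    base-tile y = (sumL-cong base λ a → sumL-cartesian _ (upTo p) Y _ ∙ sumL-swap (upTo p) Y _ ∙ sumL-cong Y λ b → fibre a b) ∙
      sumL-swap base Y _ ∙ (sumL-cong Y λ b → move (y - + b)) ∙ tile-swap {M} {X} {Y} tile y
      where
      fibre : ∀ a b → sumL (upTo p) (λ t → δ M (y - + a - + ((p * t) * E + b))) ≡ δ p (y - + b - + a) · δ K (y - + b - + a)
      fibre a b = (sumL-cong (upTo p) λ t → δM _ ∙ cong₂ _·_ (δp-E (y - + a) (p * t) b ∙ cong (δ (p ^ 2)) (cong (λ k → y - + a - + b - k) (pos-* p t) ∙ lem y (+ a) (+ b) (+ p · + t))) (δK-E (y - + a) (p * t) b ∙ cong (δ K) (lem' y (+ a) (+ b))) ∙ ·-comm (δ (p ^ 2) (y - + b - + a - + p · + t)) _) ∙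
        sumL-* (upTo p) (δ K (y - + b - + a)) (λ t → δ (p ^ 2) (y - + b - + a - + p · + t)) ∙ cong (λ k → δ K (y - + b - + a) · k) (fibre-sum p-prime (y - + b - + a)) ∙ ·-comm _ (δ p (y - + b - + a))
        where lem : ∀ y a b t → y - a - b - t ≡ y - b - a - t; lem = ring
              lem' : ∀ y a b → y - a - b ≡ y - b - a; lem' = ring
      -- A point of `base` that is near u mod p stands for a whole p-fibre of X, one point of which
      -- is near u mod p².
      move : ∀ u → sumL base (λ a → δ p (u - + a) · δ K (u - + a)) ≡ sumL X (λ a → δ M (u - + a))
      move u = let ((c , σ) , d) = covers p-prime l2 u ; (yy , e) = covers q-prime l2 u ; (zz , f) = covers r-prime l2 u in
        N-at base l1 u c yy zz (∣-sub p-prime (rep p l2 (c , σ)) u (+ toℕ c) (trans∣ (sq-p p-prime) (flip-∣ u (rep p l2 (c , σ)) d)) (rep₂-mod p-prime c σ)) e f ∙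
          cong +_ (base-N l2 l2 c yy zz ∙ i₁ l2 l2 c o σ yy zz) ∙ sym (N-at X l2 u (c , σ) yy zz d e f) ∙ sumL-cong X λ a → sym (δM (u - + a))

    -- Spread along the p-fibre, Y reaches each class mod p² once from every element in the class of
    -- c mod p; the sections of `fibresY` are thus the classes mod p of Y.
    fibresY-N : ∀ c m n y z → N (profile (restrict l2 (c , o) fibresY)) l0 m n tt y z ≡ N (profile Y) l1 m n c y z
    fibresY-N c m n y z = restrict-N l2 (c , o) fibresY m n y z ∙ +-injective (N-δ fibresY l2 m n (c , o) y z ∙ sumL-cartesian _ (upTo p) Y _ ∙ sumL-swap (upTo p) Y _ ∙
      (sumL-cong Y λ b → (sumL-cong (upTo p) λ t → cong₂ _·_ (δp-E (rep p l2 (c , o)) (p * t) b ∙ cong (λ k → δ (p ^ 2) (rep p l2 (c , o) - + b - k)) (pos-* p t)) (G-E m n y z (p * t) b) ∙ ·-comm _ (G m n y z b)) ∙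
         sumL-* (upTo p) (G m n y z b) (λ t → δ (p ^ 2) (rep p l2 (c , o) - + b - + p · + t)) ∙ cong (λ k → G m n y z b · k) (fibre-sum p-prime (rep p l2 (c , o) - + b) ∙ δ-≡ (rep p l2 (c , o) - + b) (+ toℕ c - + b) (∣ℤ-cong (lem (rep p l2 (c , o)) (+ toℕ c) (+ b)) (rep₂-mod p-prime c o))) ∙ ·-comm (G m n y z b) _) ∙
        sym (N-δ Y l1 m n c y z))
      where lem : ∀ r c b → r - c ≡ (r - b) - (c - b); lem = ring

    planes : ∀ c → Plane (profile base) (profile (restrict l2 (c , o) fibresY))
    planes c = plane-of base (restrict l2 (c , o) fibresY) (tile-restrict base fibresY base-tile base-length (c , o)) base-length

  -- Now Y is the tile that is cut down, to one class d mod p, and X is enlarged by the translations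
  -- j E with j < p. Since X lies in the class c₀, the representation of y - j E uses an element of
  -- the class d for exactly one j.
  module ClassTile (X Y : List ℕ) (tile : TileL M X Y) (c₀ : Fin p) (in-class : ∀ a → a ∈L X → Hits p l1 c₀ a)
    (sizes : ∀ d → N (profile Y) l1 l0 l0 d tt tt ≡ q * r) where

    sectionY : Fin p → List ℕ
    sectionY d = restrict l1 d Y

    sectionY-length : ∀ d → length (sectionY d) ≡ q * r
    sectionY-length d = sym (profile-total (sectionY d)) ∙ restrict-N l1 d Y l0 l0 tt tt ∙ sizes d

    translatesX : List ℕ; translatesX = cartesianProductWith (λ t a → t * E + a) (upTo p) X

    p∣M : + p ∣ℤ + M; p∣M = pos∣ (∣-trans (m∣m*n (p * 1)) (∣-trans (m∣m*n (q ^ 2)) (m∣m*n (r ^ 2))))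

    section-tile : ∀ d → TileL M (sectionY d) translatesX
    section-tile d y = sumL-restrict l1 d Y _ ∙ (sumL-cong Y λ b → cong (λ k → δ p (+ toℕ d - + b) · k) (sumL-cartesian _ (upTo p) X _) ∙
       sym (sumL-* (upTo p) (δ p (+ toℕ d - + b)) _) ∙ sumL-cong (upTo p) λ t → sym (sumL-* X (δ p (+ toℕ d - + b)) _) ∙ (sumL-cong-∈ X λ a a∈ → point a b t a∈) ∙ sumL-* X (δ p (w t - + toℕ c₀ - + toℕ d)) (λ a → δ M (w t - + b - + a))) ∙
       sumL-swap Y (upTo p) _ ∙ (sumL-cong (upTo p) λ t → sumL-* Y (δ p (w t - + toℕ c₀ - + toℕ d)) (λ b → sumL X (λ a → δ M (w t - + b - + a))) ∙ cong (λ k → δ p (w t - + toℕ c₀ - + toℕ d) · k) (tile-swap {M} {X} {Y} tile (w t)) ∙ ·-identityʳ _ ∙ unE t) ∙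
         upTo-sum p (y - + toℕ c₀ - + toℕ d)
      where
      w : ℕ → ℤ
      w t = y - + (t * E)
      unE : ∀ t → δ p (w t - + toℕ c₀ - + toℕ d) ≡ δ p (y - + toℕ c₀ - + toℕ d - + t)
      unE t = δ-≡ _ _ (∣ℤ-cong (lem y (+ t) (+ E) (+ toℕ c₀) (+ toℕ d) ∙ cong (λ k → (y - k - + toℕ c₀ - + toℕ d) - (y - + toℕ c₀ - + toℕ d - + t)) (sym (pos-* t E))) (neg∣ (trans∣ (sq-p p-prime) (p-shift (+ t)))))
        where lem : ∀ y t e c d → - (t · e - t) ≡ (y - t · e - c - d) - (y - c - d - t); lem = ring
      point : ∀ a b t → a ∈L X → δ p (+ toℕ d - + b) · δ M (y - + b - + (t * E + a)) ≡ δ p (w t - + toℕ c₀ - + toℕ d) · δ M (w t - + b - + a)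
      point a b t a∈ = cong (λ k → δ p (+ toℕ d - + b) · δ M k) (l₁ y (+ b) (+ (t * E)) (+ a)) ∙ go (+ M ∣ℤ? (w t - + b - + a))
        where
        l₁ : ∀ y b e a → y - b - (e ⊕ a) ≡ y - e - b - a; l₁ = ring
        c = + toℕ c₀
        go : Dec _ → δ p (+ toℕ d - + b) · δ M (w t - + b - + a) ≡ δ p (w t - c - + toℕ d) · δ M (w t - + b - + a)
        go (no n) = cong (λ k → δ p (+ toℕ d - + b) · k) (δ-no n) ∙ ·-zeroʳ (δ p (+ toℕ d - + b)) ∙ sym (cong (λ k → δ p (w t - c - + toℕ d) · k) (δ-no n) ∙ ·-zeroʳ (δ p (w t - c - + toℕ d)))
        go (yes h) = cong (_· δ M (w t - + b - + a)) (δ-⇔ (λ e → ∣ℤ-cong (l₂ (w t) (+ b) (+ a) c (+ toℕ d)) (sub∣ (sub∣ ph (in-class a a∈)) e))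
             (λ e → ∣ℤ-cong (l₃ (w t) (+ b) (+ a) c (+ toℕ d)) (sub∣ (sub∣ ph (in-class a a∈)) e)))
          where
          ph = trans∣ p∣M h
          l₂ : ∀ w b a c d → ((w - b - a) - (c - a)) - (d - b) ≡ w - c - d; l₂ = ring
          l₃ : ∀ w b a c d → ((w - b - a) - (c - a)) - (w - c - d) ≡ d - b; l₃ = ring

    layer : Fin p → List ℕ
    layer σ = restrict l2 (c₀ , σ) translatesX

    layer-N : ∀ σ m n y z → N (profile (layer σ)) l0 m n tt y z ≡ N (profile X) l2 m n (c₀ , σ) y z
    layer-N σ m n y z = restrict-N l2 (c₀ , σ) translatesX m n y z ∙ +-injective (N-δ translatesX l2 m n (c₀ , σ) y z ∙ sumL-cartesian _ (upTo p) X _ ∙ sumL-swap (upTo p) X _ ∙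
      (sumL-cong-∈ X λ a a∈ → (sumL-cong (upTo p) λ t → cong₂ _·_ (δp-E s t a) (G-E m n y z t a) ∙ ·-comm (δ (p ^ 2) (s - + a - + t)) (G m n y z a)) ∙
         sumL-* (upTo p) (G m n y z a) (λ t → δ (p ^ 2) (s - + a - + t)) ∙ cong (λ k → G m n y z a · k) (only-zero a a∈) ∙ ·-comm (G m n y z a) _) ∙
        sym (N-δ X l2 m n (c₀ , σ) y z))
      where
      s = rep p l2 (c₀ , σ)
      only-zero : ∀ a → a ∈L X → sumL (upTo p) (λ t → δ (p ^ 2) (s - + a - + t)) ≡ δ (p ^ 2) (s - + a)
      only-zero a a∈ = sumL-single (upTo p) (Uniqueₚ.upTo⁺ p) (∈-upTo⁺ (>-nonZero⁻¹ p)) (λ t t∈ ne → δ-no λ h → ne (small-∣ (∈-upTo⁻ t∈) (>-nonZero⁻¹ p)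
            (∣ℤ-cong (lem s (+ toℕ c₀) (+ a) (+ t)) (sub∣ (add∣ (rep₂-mod p-prime c₀ σ) (in-class a a∈)) (trans∣ (sq-p p-prime) h))))) ∙
          cong (δ (p ^ 2)) (⊕-identityʳ _)
        where lem : ∀ s c a t → ((s - c) ⊕ (c - a)) - (s - a - t) ≡ t - + 0; lem = ring

    planes : ∀ d σ → Plane (profile (sectionY d)) (profile (layer σ))
    planes d σ = plane-of (sectionY d) (layer σ) (tile-restrict (sectionY d) translatesX (section-tile d) (sectionY-length d) (c₀ , σ)) (sectionY-length d)

-- (T2) for both sets of a tiling

T2Profile : ∀ {p q r} → Profile p q r → Set
T2Profile P = ∀ l m n → (l ≢ l0 → V P l l0 l0) → (m ≢ l0 → V P l0 m l0) → (n ≢ l0 → V P l0 l0 n) → ¬ (l ≡ l0 × m ≡ l0 × n ≡ l0) → V P l m n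

fin-choice : ∀ {k} {P : Set} {Q : Fin k → Set} → (∀ j → P ⊎ Q j) → P ⊎ (∀ j → Q j)
fin-choice {zero} h = inj₂ λ ()
fin-choice {suc k} {P} {Q} h = go (h Fin.zero) (fin-choice (λ j → h (Fin.suc j)))
  where
  go : P ⊎ Q Fin.zero → P ⊎ (∀ j → Q (Fin.suc j)) → P ⊎ (∀ j → Q j)
  go (inj₁ x) _ = inj₁ x
  go _ (inj₁ x) = inj₁ x
  go (inj₂ y) (inj₂ ys) = inj₂ λ { Fin.zero → y ; (Fin.suc j) → ys j }

lv-zero? : ∀ l → l ≡ l0 ⊎ l ≢ l0
lv-zero? l0 = inj₁ refl
lv-zero? l1 = inj₂ λ ()
lv-zero? l2 = inj₂ λ ()

module _ {p q r k : ℕ} {X : Profile p q r} (Y : Fin k → Profile p q r) (planes : ∀ j → Plane X (Y j)) where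
  private
    from-alternative : ∀ m n → ¬ (m ≡ l0 × n ≡ l0) → ¬ (∀ j → V (Y j) l0 m n) → V X l0 m n
    from-alternative m n ne nv = [ (λ x → x) , (λ ys → ⊥-elim (nv ys)) ]′ (fin-choice (λ j → Plane.alternative (planes j) m n ne))

  -- The Y j are sections of one set, which has a divisor when all sections have it. A divisor that
  -- this set lacks is missing in some section, hence divides X; for a mixed divisor `plane-T2` with
  -- any one section then finishes.
  plane-family : Fin k → ∀ m n → ¬ (m ≡ l0 × n ≡ l0) → (m ≢ l0 → ¬ (∀ j → V (Y j) l0 m l0)) → (n ≢ l0 → ¬ (∀ j → V (Y j) l0 l0 n)) → V X l0 m n
  plane-family j m n ne hm hn = go (lv-zero? m) (lv-zero? n)
    where
    go : m ≡ l0 ⊎ m ≢ l0 → n ≡ l0 ⊎ n ≢ l0 → V X l0 m n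
    go (inj₁ e) (inj₁ f) = ⊥-elim (ne (e , f))
    go (inj₁ refl) (inj₂ f) = from-alternative l0 n ne (hn f)
    go (inj₂ e) (inj₁ refl) = from-alternative m l0 ne (hm e)
    go (inj₂ e) (inj₂ f) = plane-T2 (planes j) m n e f (from-alternative m l0 (λ x → e (proj₁ x)) (hm e)) (from-alternative l0 n (λ x → f (proj₂ x)) (hn f))

module PairExponents {p q r : ℕ} (T : Pair p q r) where
  open Pair T

  private
    not-both : ∀ {p q r} (T : Pair p q r) l → l ≢ l0 → V (Pair.A T) l l0 l0 → ¬ V (Pair.B T) l l0 l0
    not-both T l0 ne a b = ne refl
    not-both T l1 ne a b = [ (λ e → Exponent₁.out-B e b) , (λ e → Exponent₁.out-A e a) ]′ (exponent₁ T)
    not-both T l2 ne a b = [ (λ e → Exponent₁.out-A e a) , (λ e → Exponent₁.out-B e b) ]′ (exponent₁ T)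

  not-both₁ : ∀ l → l ≢ l0 → V A l l0 l0 → ¬ V B l l0 l0
  not-both₁ = not-both T

  not-both₂ : ∀ m → m ≢ l0 → V A l0 m l0 → ¬ V B l0 m l0
  not-both₂ m ne a b = not-both (pair12 T) m ne (V-sw12 A l0 m l0 a) (V-sw12 B l0 m l0 b)

  not-both₃ : ∀ n → n ≢ l0 → V A l0 l0 n → ¬ V B l0 l0 n
  not-both₃ n ne a b = not-both (pair-rev T) n ne (V-rev A l0 l0 n a) (V-rev B l0 l0 n b)

module Tiling {p q r : ℕ} (D : Distinct p q r) (X Y : List ℕ) (tile : TileL (p ^ 2 * q ^ 2 * r ^ 2) X Y)
  (len-X : length X ≡ p * q * r) (len-Y : length Y ≡ p * q * r) where
  open Distinct D
  open Lists D
  open Reduction D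
  open Profile

  A B : Profile p q r
  A = profile X
  B = profile Y

  T : Pair p q r
  T = record { distinct = D ; A = A ; B = B
    ; alternative = λ l m n ne → [ (λ h → inj₁ (Vz⇒V X l m n h)) , (λ h → inj₂ (Vz⇒V Y l m n h)) ]′ (Vz-dichotomy D X Y tile primes l m n ne)
    ; total-A = profile-total X ∙ len-X ; total-B = profile-total Y ∙ len-Y }
    where
    primes : ∀ {π} → Prime π → π ∣ length X → π ∣ p ^ 2 * q ^ 2 * r ^ 2
    primes {π} pr d = [ (λ e → ∣-trans e (∣-trans (*-pres-∣ (m∣m*n {p} (p * 1)) (m∣m*n {q} (q * 1))) (m∣m*n (r ^ 2)))) , (λ e → ∣-trans e (∣-trans (m∣m*n (r * 1)) (n∣m*n (p ^ 2 * q ^ 2)))) ]′ (euclidsLemma (p * q) r pr (subst (π ∣_) len-X d))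

  open PairExponents T
  module E₁ = PairExponents (pairAB T)

  private
    o = origin p-prime
    dual₂ : ∀ m → m ≢ l0 → V B l0 m l0 → ¬ V A l0 m l0; dual₂ = E₁.not-both₂
    dual₃ : ∀ n → n ≢ l0 → V B l0 l0 n → ¬ V A l0 l0 n; dual₃ = E₁.not-both₃

  B-sections : (Q : Fin p → Profile p q r) → (∀ c m n y z → N (Q c) l0 m n tt y z ≡ N B l1 m n c y z) → ∀ m n → (∀ c → V (Q c) l0 m n) → V B l0 m n × V B l1 m n
  B-sections Q e m n h = from-classes B m n λ c u s → (alt-cong m u λ y → alt-cong n s λ z → cong +_ (sym (e c m n y z))) ∙ h c tt u s

  -- The sections Q are the classes mod p of B. Vanishing on each class gives the exponents 0 and 1
  -- of p, and the exponent 2 is excluded.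
  T2-B : (Q : Fin p → Profile p q r) → (∀ c m n y z → N (Q c) l0 m n tt y z ≡ N B l1 m n c y z) → ¬ V B l2 l0 l0 →
    (∀ m n → ¬ (m ≡ l0 × n ≡ l0) → (m ≢ l0 → V B l0 m l0) → (n ≢ l0 → V B l0 l0 n) → ∀ c → V (Q c) l0 m n) → T2Profile B
  T2-B Q e no₂ sections l m n hl hm hn ne = go l hl ne
    where
    planar : ¬ (m ≡ l0 × n ≡ l0) → V B l0 m n × V B l1 m n
    planar ne' = B-sections Q e m n (sections m n ne' hm hn)
    go : ∀ l → (l ≢ l0 → V B l l0 l0) → ¬ (l ≡ l0 × m ≡ l0 × n ≡ l0) → V B l m n
    go l0 hl ne = proj₁ (planar λ (a , b) → ne (refl , a , b))
    go l2 hl ne = ⊥-elim (no₂ (hl λ ()))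
    go l1 hl ne = both (lv-zero? m) (lv-zero? n)
      where
      both : m ≡ l0 ⊎ m ≢ l0 → n ≡ l0 ⊎ n ≢ l0 → V B l1 m n
      both (inj₁ refl) (inj₁ refl) = hl λ ()
      both (inj₂ x) _ = proj₂ (planar λ (a , b) → x a)
      both _ (inj₂ x) = proj₂ (planar λ (a , b) → x b)

  module Fibred (i₁ : Indep₁ A) where
    open FibredTile X Y tile i₁ len-X

    flat : ∀ m n → V A l2 m n
    flat m n = from-layers A m n λ c σ σ' y z → i₁ m n c σ σ' y z

    private
      Bs : Fin p → Profile p q r
      Bs c = profile (restrict l2 (c , o) fibresY)
      B-eq : ∀ c m n y z → N (Bs c) l0 m n tt y z ≡ N B l1 m n c y z; B-eq = fibresY-N
      A-eq : ∀ m n y z → N A l0 m n tt y z ≡ p * N (profile base) l0 m n tt y z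
      A-eq m n y z = p₀ A {m} {n} {y} {z} ∙ (∑-cong λ c → indep₁-* {P = A} i₁ c o y z) ∙ ∑-* p (λ c → N A l2 m n (c , o) y z) ∙ cong (p *_) (sym (base-N₀ m n y z))
      base⇒A : ∀ m n → V (profile base) l0 m n → V A l0 m n
      base⇒A m n h _ u s = (alt-cong m u λ y → (alt-cong n s λ z → cong +_ (A-eq m n y z) ∙ pos-* p _ ∙ ·-comm (+ p) _) ∙ alt-* n s (+ p) (λ z → + N (profile base) l0 m n tt y z)) ∙
        alt-* m u (+ p) (λ y → alt n s (λ z → + N (profile base) l0 m n tt y z)) ∙ cong (_· + p) (h tt u s) ∙ *-zeroˡ (+ p)

    T2-A′ : T2Profile A
    T2-A′ l2 m n hl hm hn ne = flat m n
    T2-A′ l1 m n hl hm hn ne = ⊥-elim (Basics.exclusive₁ D A (Pair.total-A T) (hl λ ()) (flat l0 l0))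
    T2-A′ l0 m n hl hm hn ne = base⇒A m n (plane-family Bs planes o m n (λ (a , b) → ne (refl , a , b))
      (λ e all → not-both₂ m e (hm e) (proj₁ (B-sections Bs B-eq m l0 all))) (λ e all → not-both₃ n e (hn e) (proj₁ (B-sections Bs B-eq l0 n all))))

    T2-B′ : T2Profile B
    T2-B′ = T2-B Bs B-eq (not-both₁ l2 (λ ()) (flat l0 l0)) λ m n ne hm hn c →
      plane-family {k = 1} (λ _ → profile base) (λ _ → plane-swap (planes c)) Fin.zero m n ne
        (λ e all → dual₂ m e (hm e) (base⇒A m l0 (all Fin.zero))) (λ e all → dual₃ n e (hn e) (base⇒A l0 n (all Fin.zero)))

  module OneClass (c₀ : Fin p) (a200 : V A l2 l0 l0) (empty : ∀ c → c ≢ c₀ → N A l1 l0 l0 c tt tt ≡ 0) where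
    in-class : ∀ a → a ∈L X → Hits p l1 c₀ a
    in-class a a∈ = let (c , d) = residue p-prime (+ a) ; h = flip-∣ (+ a) (+ toℕ c) d in go c h (c Finₚ.≟ c₀)
      where
      go : ∀ c → Hits p l1 c a → Dec (c ≡ c₀) → Hits p l1 c₀ a
      go c h (yes refl) = h
      go c h (no ne) = ⊥-elim (<⇒≢ (≤-trans (≤-reflexive (sym (term-hit (λ _ → 1) l1 l0 l0 c tt tt {a} h (one-∣ (+ 0 - + a)) (one-∣ (+ 0 - + a))))) (sumN-≥ X (term (λ _ → 1) l1 l0 l0 c tt tt) a∈)) (sym (empty c ne)))

    private
      b100 : V B l1 l0 l0; b100 = [ (λ e → ⊥-elim (Exponent₁.out-A e a200)) , (λ e → Exponent₁.in-B e) ]′ (exponent₁ T)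
      open ClassTile X Y tile c₀ in-class (Basics.level₁ D B (Pair.total-B T) b100)

      A-layers : ∀ m n → (∀ σ → V (profile (layer σ)) l0 m n) → ∀ u s c σ → slice A m n u s l2 (c , σ) ≡ + 0
      A-layers m n h u s c σ = go (c Finₚ.≟ c₀)
        where
        go : Dec (c ≡ c₀) → slice A m n u s l2 (c , σ) ≡ + 0
        go (yes refl) = (alt-cong m u λ y → alt-cong n s λ z → cong +_ (sym (layer-N σ m n y z))) ∙ h σ tt u s
        go (no ne) = (alt-cong m u λ y → (alt-cong n s λ z → cong +_ (class-zero A (c , σ) (layer-zero A c (empty c ne) σ) m n y z)) ∙ alt-0 n s) ∙ alt-0 m u

      A₀ : ∀ m n → (∀ σ → V (profile (layer σ)) l0 m n) → V A l0 m n
      A₀ m n h = proj₁ (from-classes A m n λ c u s → slice₁-sum A m n u s (A-layers m n h u s) c)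

      A₂ : ∀ m n → (∀ σ → V (profile (layer σ)) l0 m n) → V A l2 m n
      A₂ m n h (c , σ , σ') u s = cong₂ _-_ (A-layers m n h u s c σ) (A-layers m n h u s c σ')

      Bs : Fin p → Profile p q r
      Bs d = profile (sectionY d)
      B-eq : ∀ c m n y z → N (Bs c) l0 m n tt y z ≡ N B l1 m n c y z
      B-eq c m n y z = restrict-N l1 c Y m n y z

    T2-A″ : T2Profile A
    T2-A″ l m n hl hm hn ne = go l hl ne
      where
      layers : ¬ (m ≡ l0 × n ≡ l0) → ∀ σ → V (profile (layer σ)) l0 m n
      layers ne' σ = plane-family Bs (λ d → plane-swap (planes d σ)) o m n ne'
        (λ e all → not-both₂ m e (hm e) (proj₁ (B-sections Bs B-eq m l0 all))) (λ e all → not-both₃ n e (hn e) (proj₁ (B-sections Bs B-eq l0 n all)))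
      go : ∀ l → (l ≢ l0 → V A l l0 l0) → ¬ (l ≡ l0 × m ≡ l0 × n ≡ l0) → V A l m n
      go l0 hl ne = A₀ m n (layers λ (a , b) → ne (refl , a , b))
      go l1 hl ne = ⊥-elim (Basics.exclusive₁ D A (Pair.total-A T) (hl λ ()) a200)
      go l2 hl ne = both (lv-zero? m) (lv-zero? n)
        where
        both : m ≡ l0 ⊎ m ≢ l0 → n ≡ l0 ⊎ n ≢ l0 → V A l2 m n
        both (inj₁ refl) (inj₁ refl) = a200
        both (inj₂ x) _ = A₂ m n (layers λ (a , b) → x a)
        both _ (inj₂ x) = A₂ m n (layers λ (a , b) → x b)

    T2-B″ : T2Profile B
    T2-B″ = T2-B Bs B-eq (not-both₁ l2 (λ ()) a200) λ m n ne hm hn d →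
      plane-family (λ σ → profile (layer σ)) (planes d) o m n ne (λ e all → dual₂ m e (hm e) (A₀ m l0 all)) (λ e all → dual₃ n e (hn e) (A₀ l0 n all))

-- The prime powers with Φ dividing A are p, q² and r², and those for B are p², q and r. So (T2)
-- asks for finitely many divisors, which have all been found.
module LevelOneT2 {p q r : ℕ} (T : Pair p q r) (S : LevelOneSetting T) where
  open LevelOneBasics T S hiding (b200)
  open LevelOneDivisors (level-one-divisors T S)
  open PairExponents T

  a22 : V A l0 l2 l2 × V A l1 l2 l2
  a22 = from-classes A l2 l2 on-class
    where
    on-class : ∀ c u s → slice A l2 l2 u s l1 c ≡ + 0
    on-class c (v , ψ , ψ') s@(w , ω , ω') with fibred c
    ... | inj₁ F = i≡j⇒i-j≡0 (alt-cong l2 s λ z → cong +_ (J.ψ-indep₁ F l2 v ψ ψ' z))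
    ... | inj₂ F = (alt-cong l2 (v , ψ , ψ') λ y → unlevel (K.ψ-indep₁ F l2 w ω ω' y)) ∙ alt-0 l2 (v , ψ , ψ')

  slab-alternative : ∀ m n → V B l2 m n ⊎ (V A l0 m n × V A l1 m n)
  slab-alternative l0 l0 = inj₁ b200
  slab-alternative l0 l1 = inj₁ b201
  slab-alternative l0 l2 = inj₂ (a002 , a102)
  slab-alternative l1 l0 = inj₁ b210
  slab-alternative l1 l1 = inj₁ b211
  slab-alternative l1 l2 = slab12
  slab-alternative l2 l0 = inj₂ (a020 , a120)
  slab-alternative l2 l1 = slab21
  slab-alternative l2 l2 = inj₂ a22

  private
    no-A₂ : ¬ V A l2 l0 l0
    no-A₂ h = Basics.exclusive₁ distinct A total-A a100 h
    no-A-q₁ : ¬ V A l0 l1 l0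
    no-A-q₁ h = Basics.exclusive₁ (swap12 distinct) (sw12 A) (total-A ∙ *-swap12 p q r) (V-sw12 A l0 l1 l0 h) (V-sw12 A l0 l2 l0 a020)
    no-A-r₁ : ¬ V A l0 l0 l1
    no-A-r₁ h = [ (λ e → Exponent₁.out-A e (V-rev A l0 l0 l2 a002)) , (λ e → Exponent₁.out-A e (V-rev A l0 l0 l1 h)) ]′ (exponent₁ (pair-rev T))

  T2-A : T2Profile A
  T2-A l2 m n hl hm hn ne = ⊥-elim (no-A₂ (hl λ ()))
  T2-A l l1 n hl hm hn ne = ⊥-elim (no-A-q₁ (hm λ ()))
  T2-A l m l1 hl hm hn ne = ⊥-elim (no-A-r₁ (hn λ ()))
  T2-A l0 l0 l0 hl hm hn ne = ⊥-elim (ne (refl , refl , refl))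
  T2-A l0 l0 l2 hl hm hn ne = a002
  T2-A l0 l2 l0 hl hm hn ne = a020
  T2-A l0 l2 l2 hl hm hn ne = proj₁ a22
  T2-A l1 l0 l0 hl hm hn ne = a100
  T2-A l1 l0 l2 hl hm hn ne = a102
  T2-A l1 l2 l0 hl hm hn ne = a120
  T2-A l1 l2 l2 hl hm hn ne = proj₂ a22

  T2-B : T2Profile B
  T2-B l1 m n hl hm hn ne = ⊥-elim (not-both₁ l1 (λ ()) a100 (hl λ ()))
  T2-B l l2 n hl hm hn ne = ⊥-elim (not-both₂ l2 (λ ()) a020 (hm λ ()))
  T2-B l m l2 hl hm hn ne = ⊥-elim (not-both₃ l2 (λ ()) a002 (hn λ ()))
  T2-B l0 l0 l0 hl hm hn ne = ⊥-elim (ne (refl , refl , refl))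
  T2-B l0 l0 l1 hl hm hn ne = hn λ ()
  T2-B l0 l1 l0 hl hm hn ne = hm λ ()
  T2-B l0 l1 l1 hl hm hn ne = b011
  T2-B l2 l0 l0 hl hm hn ne = b200
  T2-B l2 l0 l1 hl hm hn ne = b201
  T2-B l2 l1 l0 hl hm hn ne = b210
  T2-B l2 l1 l1 hl hm hn ne = b211

-- Passage between subsets of ℤ_M and profiles

tiles⇒TileL : ∀ {M} .{{_ : NonZero M}} (A B : Subset M) → Tiles M A B → TileL M (els A) (els B)
tiles⇒TileL {M} A B tiles y = sumL-single (els A) (els-unique A) (∈-els⁺ a∈) off-a ∙ sumL-single (els B) (els-unique B) (∈-els⁺ b∈) off-b ∙ δ-yes (to-y sum≡)
  where
  x : Fin M
  x = fromℕ< (n%ℕd<d y M)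
  y≡x : + M ∣ℤ (y - + toℕ x)
  y≡x = subst (λ k → + M ∣ℤ (y - + k)) (sym (toℕ-fromℕ< (n%ℕd<d y M))) (mod-reduce M y)
  solution = proj₁ (tiles x)
  a = proj₁ solution
  b = proj₁ (proj₂ solution)
  a∈ = proj₁ (proj₂ (proj₂ solution))
  b∈ = proj₁ (proj₂ (proj₂ (proj₂ solution)))
  sum≡ = proj₂ (proj₂ (proj₂ (proj₂ solution)))
  to-y : ∀ {a b : ℕ} → (a + b) ≡ toℕ x [mod M ] → + M ∣ℤ (y - + a - + b)
  to-y {a} {b} d = ∣ℤ-cong (lem y (+ a) (+ b) (+ toℕ x)) (sub∣ y≡x (∣ᵤ⇒∣ d))
    where lem : ∀ y a b x → (y - x) - ((a ⊕ b) - x) ≡ y - a - b; lem = ring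
  from-y : ∀ {a b : ℕ} → + M ∣ℤ (y - + a - + b) → (a + b) ≡ toℕ x [mod M ]
  from-y {a} {b} d = ∣⇒∣ᵤ (∣ℤ-cong (lem y (+ a) (+ b) (+ toℕ x)) (sub∣ y≡x d))
    where lem : ∀ y a b x → (y - x) - (y - a - b) ≡ (a ⊕ b) - x; lem = ring
  off-b : ∀ b' → b' ∈L els B → b' ≢ toℕ b → δ M (y - + toℕ a - + b') ≡ + 0
  off-b b' m ne = δ-no λ d → let (b₁ , b₁∈ , e) = ∈-els⁻ m in
    ne (sym e ∙ cong toℕ (proj₂ (proj₂ (tiles x) a b₁ a b a∈ b₁∈ a∈ b∈ (from-y {toℕ a} {toℕ b₁} (subst (λ b' → + M ∣ℤ (y - + toℕ a - + b')) (sym e) d)) sum≡)))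
  off-a : ∀ a' → a' ∈L els A → a' ≢ toℕ a → sumL (els B) (λ b' → δ M (y - + a' - + b')) ≡ + 0
  off-a a' m ne = (sumL-cong-∈ (els B) {g = λ _ → + 0} λ b' m' → δ-no λ d → let (a₁ , a₁∈ , e) = ∈-els⁻ m ; (b₁ , b₁∈ , e') = ∈-els⁻ m' in
      ne (sym e ∙ cong toℕ (proj₁ (proj₂ (tiles x) a₁ b₁ a b a₁∈ b₁∈ a∈ b∈ (from-y {toℕ a₁} {toℕ b₁} (subst₂ (λ a' b' → + M ∣ℤ (y - + a' - + b')) (sym e) (sym e') d)) sum≡)))) ∙ sumL-0 (els B)

level-of : ∀ k → k ≤ 2 → ∃[ l ] exponent l ≡ k
level-of 0 _ = l0 , refl
level-of 1 _ = l1 , refl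
level-of 2 _ = l2 , refl
level-of (suc (suc (suc k))) (s≤s (s≤s ()))

exponent-bound : ∀ {p q r} → Distinct p q r → ∀ k → p ^ k ∣ p ^ 2 * q ^ 2 * r ^ 2 → k ≤ 2
exponent-bound {p} {q} {r} D k d = ≮⇒≥ λ 2<k → [ (λ e → p≢q (prime-∣-prime p-prime q-prime (prime∣^ p-prime q 2 e))) , (λ e → p≢r (prime-∣-prime p-prime r-prime (prime∣^ p-prime r 2 e))) ]′
    (euclidsLemma (q ^ 2) (r ^ 2) p-prime (*-cancelˡ-∣ (p ^ 2) {{sqnz p-prime}} (∣-trans (∣-trans (cube 2<k) d) (∣-reflexive (*-assoc (p ^ 2) (q ^ 2) (r ^ 2))))))
  where
  open Distinct D
  cube : 2 < k → p ^ 2 * p ∣ p ^ k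
  cube lt = subst₂ _∣_ (lem p) (sym (^-distribˡ-+-* p 3 (k ∸ 3)) ∙ cong (p ^_) (m+[n∸m]≡n lt)) (m∣m*n (p ^ (k ∸ 3)))
    where lem : ∀ p → p * (p * (p * 1)) ≡ p * (p * 1) * p; lem = ringℕ

strip : ∀ {q} → Prime q → ∀ k s e → e ∣ q ^ k * s → ∃[ j ] ∃[ e' ] (j ≤ k × e ≡ q ^ j * e' × e' ∣ s)
strip {q} pr zero s e d = 0 , e , z≤n , sym (+-identityʳ e) , subst (e ∣_) (+-identityʳ s) d
strip {q} pr (suc k) s e d with q ∣? e
... | yes (divides e₁ refl) = let (j , e' , j≤k , eq' , d') = strip pr k s e₁ (*-cancelˡ-∣ q {{prime⇒nonZero pr}} (subst₂ _∣_ (*-comm e₁ q) (*-assoc q (q ^ k) s) d)) in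
      suc j , e' , s≤s j≤k , *-comm e₁ q ∙ cong (q *_) eq' ∙ sym (*-assoc q (q ^ j) e') , d'
... | no q∤e = let (j , e' , j≤k , eq' , d') = strip pr k s e (coprime-divisor (Cop′.sym (primes-coprime (≢-nonZero⁻¹ q {{prime⇒nonZero pr}}) λ {π} prπ x y → q∤e (subst (_∣ e) (prime-∣-prime prπ pr x) y))) (subst (e ∣_) (*-assoc q (q ^ k) s) d)) in
      j , e' , ≤-trans j≤k (n≤1+n k) , eq' , d'

module Cyclotomic {p q r M : ℕ} (D : Distinct p q r) (M≡ : M ≡ p ^ 2 * q ^ 2 * r ^ 2) where
  open Distinct D
  open Lists D

  V⇒Cyc : ∀ l m n (A : Subset M) → V (profile (els A)) l m n → CycDiv M (modulus p q r l m n) A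
  V⇒Cyc l m n A h = Vz⇒CycDiv D M≡ l m n A (V⇒Vz (els A) l m n h)

  Cyc⇒V : ∀ l m n (A : Subset M) → CycDiv M (modulus p q r l m n) A → V (profile (els A)) l m n
  Cyc⇒V l m n A h = Vz⇒V (els A) l m n (CycDiv⇒Vz D M≡ l m n A h)

  modulus₁ : ∀ l → p ^ exponent l ≡ modulus p q r l l0 l0
  modulus₁ l = lem (p ^ exponent l)
    where lem : ∀ a → a ≡ a * 1 * 1; lem = ringℕ

  modulus₂ : ∀ m → q ^ exponent m ≡ modulus p q r l0 m l0
  modulus₂ m = lem (q ^ exponent m)
    where lem : ∀ a → a ≡ 1 * a * 1; lem = ringℕ

  modulus₃ : ∀ n → r ^ exponent n ≡ modulus p q r l0 l0 n
  modulus₃ n = lem (r ^ exponent n)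
    where lem : ∀ a → a ≡ 1 * 1 * a; lem = ringℕ

  divisor-levels : ∀ e → p ^ 2 * e ∣ M → ∃[ m ] ∃[ n ] e ≡ q ^ exponent m * r ^ exponent n
  divisor-levels e d with strip q-prime 2 (r ^ 2) e (*-cancelˡ-∣ (p ^ 2) {{sqnz p-prime}} (subst (p ^ 2 * e ∣_) (M≡ ∙ *-assoc (p ^ 2) (q ^ 2) (r ^ 2)) d))
  ... | j , e' , j≤2 , eq₁ , d' with strip r-prime 2 1 e' (subst (e' ∣_) (sym (*-identityʳ (r ^ 2))) d')
  ... | i , e'' , i≤2 , eq₂ , d'' with level-of j j≤2 | level-of i i≤2
  ... | m , refl | n , refl = m , n , eq₁ ∙ cong (q ^ exponent m *_) (eq₂ ∙ cong (r ^ exponent n *_) (∣1⇒≡1 d'') ∙ *-identityʳ _)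

  -- Two monic divisors with a Bézout identity over ℚ have their product as a divisor.
  product-Φ : ∀ m n (A : Subset M) → V (profile (els A)) l0 m n → V (profile (els A)) l1 m n → ∀ {e} → e ≡ q ^ exponent m * r ^ exponent n → DividesMask M (Φ (p * e) *P Φ e) A
  product-Φ m n A h₀ h₁ {e} refl = ∣P⇒DividesMask A (cop-divides (Φ-mon _ ≥1₁) (Φ-mon _ ≥1₀) (Φ-cop _ _ ≥1₁ ≥1₀ pe≢e)
      (subst (λ k → Φ k ∣P mask A) (eq₁) (Vz⇒Φ∣ D M≡ l1 m n A (V⇒Vz (els A) l1 m n h₁))) (subst (λ k → Φ k ∣P mask A) eq₀ (Vz⇒Φ∣ D M≡ l0 m n A (V⇒Vz (els A) l0 m n h₀))))
    where
    eq₁ : modulus p q r l1 m n ≡ p * e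
    eq₁ = lem p (q ^ exponent m) (r ^ exponent n)
      where lem : ∀ p a b → p * 1 * a * b ≡ p * (a * b); lem = ringℕ
    eq₀ : modulus p q r l0 m n ≡ e
    eq₀ = lem (q ^ exponent m) (r ^ exponent n)
      where lem : ∀ a b → 1 * a * b ≡ a * b; lem = ringℕ
    ≥1₁ : 1 ≤ p * e; ≥1₁ = subst (1 ≤_) eq₁ (1≤modulus D l1 m n)
    ≥1₀ : 1 ≤ e; ≥1₀ = subst (1 ≤_) eq₀ (1≤modulus D l0 m n)
    pe≢e : p * e ≢ e
    pe≢e x = <⇒≢ (prime≥2 p-prime) (sym (*-cancelʳ-≡ p 1 e {{>-nonZero ≥1₀}} (x ∙ sym (*-identityˡ e))))

  square-modulus : ∀ m n → p ^ 2 * (q ^ exponent m * r ^ exponent n) ≡ modulus p q r l2 m n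
  square-modulus m n = sym (*-assoc (p ^ 2) (q ^ exponent m) (r ^ exponent n))

  module _ (A : Subset M) (t₂ : T2Profile (profile (els A))) where
    private
      P = profile (els A)
      pow : ℕ × ℕ → ℕ
      pow x = proj₁ x ^ proj₂ x

      Good : ℕ × ℕ → Set
      Good x = Prime (proj₁ x) × 1 ≤ proj₂ x × (proj₁ x ^ proj₂ x) ∣ M × CycDiv M (proj₁ x ^ proj₂ x) A

      -- The memberships let the next entry be added: its prime does not occur in the list so far,
      -- so the level of that prime is still `l0` and can be set.
      record Levels (L : List (ℕ × ℕ)) : Set where
        field
          l m n : Lv
          product≡ : product (map pow L) ≡ modulus p q r l m n
          at-p : l ≢ l0 → V P l l0 l0 × p ∈L map proj₁ L
          at-q : m ≢ l0 → V P l0 m l0 × q ∈L map proj₁ L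
          at-r : n ≢ l0 → V P l0 l0 n × r ∈L map proj₁ L
          non-trivial : L ≢ [] → ¬ (l ≡ l0 × m ≡ l0 × n ≡ l0)

      which : ∀ {π} → Prime π → ∀ k → 1 ≤ k → π ^ k ∣ M → π ≡ p ⊎ π ≡ q ⊎ π ≡ r
      which {π} pr (suc k) _ d = [ (λ e → [ (λ e → inj₁ (prime-∣-prime pr p-prime (prime∣^ pr p 2 e))) , (λ e → inj₂ (inj₁ (prime-∣-prime pr q-prime (prime∣^ pr q 2 e)))) ]′ (euclidsLemma (p ^ 2) (q ^ 2) pr e))
          , (λ e → inj₂ (inj₂ (prime-∣-prime pr r-prime (prime∣^ pr r 2 e)))) ]′ (euclidsLemma (p ^ 2 * q ^ 2) (r ^ 2) pr (subst (π ∣_) M≡ (∣-trans (m∣m*n (π ^ k)) d)))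

      nonzero-level : ∀ {l k} → exponent l ≡ k → 1 ≤ k → l ≢ l0
      nonzero-level {k = zero} e () refl
      nonzero-level {k = suc k} () h refl

      level-0 : ∀ {l} {P : Set} → (l ≢ l0 → P) → ¬ P → l ≡ l0
      level-0 {l} h n = [ (λ e → e) , (λ ne → ⊥-elim (n (h ne))) ]′ (lv-zero? l)

      levels : ∀ L → All Good L → AllPairs _≢_ (map proj₁ L) → Levels L
      levels [] _ _ = record { l = l0 ; m = l0 ; n = l0 ; product≡ = refl ; at-p = λ ne → ⊥-elim (ne refl) ; at-q = λ ne → ⊥-elim (ne refl) ; at-r = λ ne → ⊥-elim (ne refl) ; non-trivial = λ ne → ⊥-elim (ne refl) }
      levels ((π , k) ∷ L) ((pr , 1≤k , π^k∣M , cyc) ∷ good) (fresh ∷ distinct') = go (which pr k 1≤k π^k∣M)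
        where
        I = levels L good distinct'
        open Levels I
        absent : ∀ {x} {Q : Set} → π ≡ x → ¬ (Q × x ∈L map proj₁ L)
        absent e (_ , x∈) = All.lookup fresh x∈ e
        bound-M : ∀ {s} → M ≡ s → π ^ k ∣ s
        bound-M e = subst (π ^ k ∣_) e π^k∣M
        go : π ≡ p ⊎ π ≡ q ⊎ π ≡ r → Levels ((π , k) ∷ L)
        go (inj₁ refl) with level-of k (exponent-bound D k (bound-M M≡))
        ... | l' , refl = record { l = l' ; m = m ; n = n
          ; product≡ = cong (p ^ exponent l' *_) (product≡ ∙ cong (λ x → modulus p q r x m n) (level-0 at-p (absent refl))) ∙ lem (p ^ exponent l') (q ^ exponent m) (r ^ exponent n)
          ; at-p = λ _ → Cyc⇒V l' l0 l0 A (subst (λ x → CycDiv M x A) (modulus₁ l') cyc) , here refl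
          ; at-q = λ ne → let (a , b) = at-q ne in a , there b ; at-r = λ ne → let (a , b) = at-r ne in a , there b
          ; non-trivial = λ _ z → nonzero-level {l'} refl 1≤k (proj₁ z) }
          where lem : ∀ a b c → a * (1 * b * c) ≡ a * b * c; lem = ringℕ
        go (inj₂ (inj₁ refl)) with level-of k (exponent-bound (swap12 D) k (bound-M (M≡ ∙ cong (_* r ^ 2) (*-comm (p ^ 2) (q ^ 2)))))
        ... | m' , refl = record { l = l ; m = m' ; n = n
          ; product≡ = cong (q ^ exponent m' *_) (product≡ ∙ cong (λ x → modulus p q r l x n) (level-0 at-q (absent refl))) ∙ lem (q ^ exponent m') (p ^ exponent l) (r ^ exponent n)
          ; at-q = λ _ → Cyc⇒V l0 m' l0 A (subst (λ x → CycDiv M x A) (modulus₂ m') cyc) , here refl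
          ; at-p = λ ne → let (a , b) = at-p ne in a , there b ; at-r = λ ne → let (a , b) = at-r ne in a , there b
          ; non-trivial = λ _ z → nonzero-level {m'} refl 1≤k (proj₁ (proj₂ z)) }
          where lem : ∀ a b c → a * (b * 1 * c) ≡ b * a * c; lem = ringℕ
        go (inj₂ (inj₂ refl)) with level-of k (exponent-bound (swap12 (swap23 D)) k (bound-M (M≡ ∙ *-comm (p ^ 2 * q ^ 2) (r ^ 2) ∙ sym (*-assoc (r ^ 2) (p ^ 2) (q ^ 2)))))
        ... | n' , refl = record { l = l ; m = m ; n = n'
          ; product≡ = cong (r ^ exponent n' *_) (product≡ ∙ cong (λ x → modulus p q r l m x) (level-0 at-r (absent refl))) ∙ lem (r ^ exponent n') (p ^ exponent l) (q ^ exponent m)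
          ; at-r = λ _ → Cyc⇒V l0 l0 n' A (subst (λ x → CycDiv M x A) (modulus₃ n') cyc) , here refl
          ; at-p = λ ne → let (a , b) = at-p ne in a , there b ; at-q = λ ne → let (a , b) = at-q ne in a , there b
          ; non-trivial = λ _ z → nonzero-level {n'} refl 1≤k (proj₂ (proj₂ z)) }
          where lem : ∀ a b c → a * (b * c * 1) ≡ b * c * a; lem = ringℕ

    T2-from-profile : T2 M A
    T2-from-profile L ne good distinct' = subst (λ x → CycDiv M x A) (sym product≡) (V⇒Cyc l m n A (t₂ l m n (λ h → proj₁ (at-p h)) (λ h → proj₁ (at-q h)) (λ h → proj₁ (at-r h)) (non-trivial ne)))
      where open Levels (levels L good distinct')

-- Partitions of A into fibres

data Dir : Set where
  d₁ d₂ d₃ : Dir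

dir? : (d e : Dir) → Dec (d ≡ e)
dir? d₁ d₁ = yes refl
dir? d₁ d₂ = no λ ()
dir? d₁ d₃ = no λ ()
dir? d₂ d₁ = no λ ()
dir? d₂ d₂ = yes refl
dir? d₂ d₃ = no λ ()
dir? d₃ d₁ = no λ ()
dir? d₃ d₂ = no λ ()
dir? d₃ d₃ = yes refl

step : ℕ → ℕ → ℕ → Dir → ℕ
step p q r d₁ = step₁ p q r
step p q r d₂ = step₂ p q r
step p q r d₃ = step₃ p q r

-- A partition of A into fibres: the fibre of x in the direction τ x is contained in A and has the same type.
record Typing (p q r : ℕ) {M : ℕ} (A : Subset M) : Set where
  field
    τ : ℕ → Dir
    closed : ∀ {x y : Fin M} → x ∈ A → + step p q r (τ (toℕ x)) ∣ℤ (+ toℕ y - + toℕ x) → y ∈ A × τ (toℕ y) ≡ τ (toℕ x)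

Uses : ∀ {p q r M} {A : Subset M} → Typing p q r A → Dir → Set
Uses {M = M} {A} t d = ∃[ x ] (x ∈ A × Typing.τ t (toℕ {M} x) ≡ d)

uses? : ∀ {p q r M} {A : Subset M} (t : Typing p q r A) d → Dec (Uses t d)
uses? {A = A} t d = any? (λ x → x ∈? A ×-dec dir? (Typing.τ t (toℕ x)) d)

InDir : ∀ {M} → ℕ → Subset M → Fin M → Set
InDir s A a = a ∈ A × (∀ y → + s ∣ℤ (+ toℕ y - + toℕ a) → y ∈ A)

is : Dir → Dir → ℕ
is d e = if does (dir? d e) then 1 else 0

is-refl : ∀ {d e} → e ≡ d → is d e ≡ 1
is-refl {d₁} refl = refl
is-refl {d₂} refl = refl
is-refl {d₃} refl = refl

is-pos : ∀ d e → 1 ≤ is d e → e ≡ d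
is-pos d₁ d₁ _ = refl
is-pos d₂ d₂ _ = refl
is-pos d₃ d₃ _ = refl

is-≤1 : ∀ d e → is d e ≤ 1
is-≤1 d e with does (dir? d e)
... | true = ≤-refl
... | false = z≤n

is-sum : ∀ e → 1 ≡ is d₁ e + is d₂ e + is d₃ e
is-sum d₁ = refl
is-sum d₂ = refl
is-sum d₃ = refl

∣-via : ∀ {k} u s a → + k ∣ℤ (u - s) → + k ∣ℤ (s - a) → + k ∣ℤ (u - a)
∣-via u s a d e = ∣ℤ-cong (lem u s a) (add∣ d e)
  where lem : ∀ u s a → (u - s) ⊕ (s - a) ≡ u - a; lem = ring

-- Coarser counts are sums of the finest ones, so independence of σ need only be checked on single
-- points of ℤ_M.
indep₁-from-fine : ∀ {p q r} (P : Profile p q r) → (∀ c σ σ' y z → Profile.N P l2 l2 l2 (c , σ) y z ≡ Profile.N P l2 l2 l2 (c , σ') y z) → Indep₁ P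
indep₁-from-fine {p} {q} {r} P h = go
  where
  open Profile P
  fine : ∀ n → Set
  fine n = ∀ c σ σ' y z → N l2 l2 n (c , σ) y z ≡ N l2 l2 n (c , σ') y z
  fine₁ : fine l1
  fine₁ c σ σ' y w = r₁ ∙ (∑-cong λ ω → h c σ σ' y (w , ω)) ∙ sym r₁
  fine₀ : fine l0
  fine₀ c σ σ' y _ = r₀ ∙ (∑-cong λ w → fine₁ c σ σ' y w) ∙ sym r₀
  mid : ∀ n → fine n → ∀ c σ σ' v z → N l2 l1 n (c , σ) v z ≡ N l2 l1 n (c , σ') v z
  mid n f c σ σ' v z = q₁ ∙ (∑-cong λ ψ → f c σ σ' (v , ψ) z) ∙ sym q₁
  coarse : ∀ m n → fine n → ∀ c σ σ' y z → N l2 m n (c , σ) y z ≡ N l2 m n (c , σ') y z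
  coarse l2 n f = f
  coarse l1 n f = mid n f
  coarse l0 n f c σ σ' _ z = q₀ ∙ (∑-cong λ v → mid n f c σ σ' v z) ∙ sym q₀
  go : ∀ m n c σ σ' y z → N l2 m n (c , σ) y z ≡ N l2 m n (c , σ') y z
  go m l2 = coarse m l2 h
  go m l1 = coarse m l1 fine₁
  go m l0 = coarse m l0 fine₀

pow₁-∣ : ∀ k {w} → + k ∣ℤ w → + (k ^ 1) ∣ℤ w
pow₁-∣ k {w} = subst (λ j → + j ∣ℤ w) (sym (*-identityʳ k))

module Points {p q r M : ℕ} (D : Distinct p q r) (M≡ : M ≡ p ^ 2 * q ^ 2 * r ^ 2) where
  open Distinct D
  open Lists D
  open Profile

  instance
    nz-M : NonZero M; nz-M = subst NonZero (sym M≡) (Reduction.nzM D)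

  point : ℤ → Fin M
  point z = fromℕ< (n%ℕd<d z M)

  point-≡ : ∀ z → + M ∣ℤ (+ toℕ (point z) - z)
  point-≡ z = flip-∣ z (+ toℕ (point z)) (subst (λ k → + M ∣ℤ (z - + k)) (sym (toℕ-fromℕ< (n%ℕd<d z M))) (mod-reduce M z))

  near-point : ∀ {k} z a → k ∣ M → + k ∣ℤ (z - a) → + k ∣ℤ (+ toℕ (point z) - a)
  near-point z a d e = ∣-via (+ toℕ (point z)) z a (trans∣ (pos∣ d) (point-≡ z)) e

  p²∣M : p ^ 2 ∣ M
  p²∣M = subst (p ^ 2 ∣_) (sym M≡) (∣-trans (m∣m*n (q ^ 2)) (m∣m*n (r ^ 2)))
  q²∣M : q ^ 2 ∣ M
  q²∣M = subst (q ^ 2 ∣_) (sym M≡) (∣-trans (n∣m*n (p ^ 2)) (m∣m*n (r ^ 2)))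
  r²∣M : r ^ 2 ∣ M
  r²∣M = subst (r ^ 2 ∣_) (sym M≡) (n∣m*n (p ^ 2 * q ^ 2))

  step≡ : ∀ d → ∃[ l ] ∃[ m ] ∃[ n ] step p q r d ≡ modulus p q r l m n
  step≡ d₁ = l1 , l2 , l2 , cong (λ k → k * q ^ 2 * r ^ 2) (sym (*-identityʳ p))
  step≡ d₂ = l2 , l1 , l2 , cong (λ k → p ^ 2 * k * r ^ 2) (sym (*-identityʳ q))
  step≡ d₃ = l2 , l2 , l1 , cong (λ k → p ^ 2 * q ^ 2 * k) (sym (*-identityʳ r))

  step∣M : ∀ d → step p q r d ∣ M
  step∣M d = let (l , m , n , e) = step≡ d in subst₂ _∣_ (sym e) (sym M≡) (modulus-square p q r l m n)

  modulus-∣ℤ : ∀ l m n z → + (p ^ exponent l) ∣ℤ z → + (q ^ exponent m) ∣ℤ z → + (r ^ exponent n) ∣ℤ z → + modulus p q r l m n ∣ℤ z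
  modulus-∣ℤ l m n z d e f = ∣ᵤ⇒∣ (coprime-∣* (pow-coprime₂ D (exponent l) (exponent m) (exponent n)) (coprime-∣* (pow-coprime D p-prime q-prime p≢q (exponent l) (exponent m)) (∣⇒∣ᵤ d) (∣⇒∣ᵤ e)) (∣⇒∣ᵤ f))

  M-∣ℤ : ∀ z → + (p ^ 2) ∣ℤ z → + (q ^ 2) ∣ℤ z → + (r ^ 2) ∣ℤ z → + M ∣ℤ z
  M-∣ℤ z d e f = subst (λ k → + k ∣ℤ z) (sym M≡) (modulus-∣ℤ l2 l2 l2 z d e f)

  step₁-∣ : ∀ z → + p ∣ℤ z → + (q ^ 2) ∣ℤ z → + (r ^ 2) ∣ℤ z → + step p q r d₁ ∣ℤ z
  step₁-∣ z d e f = subst (λ k → + k ∣ℤ z) (sym (proj₂ (proj₂ (proj₂ (step≡ d₁))))) (modulus-∣ℤ l1 l2 l2 z (pow₁-∣ p d) e f)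
  step₂-∣ : ∀ z → + (p ^ 2) ∣ℤ z → + q ∣ℤ z → + (r ^ 2) ∣ℤ z → + step p q r d₂ ∣ℤ z
  step₂-∣ z d e f = subst (λ k → + k ∣ℤ z) (sym (proj₂ (proj₂ (proj₂ (step≡ d₂))))) (modulus-∣ℤ l2 l1 l2 z d (pow₁-∣ q e) f)
  step₃-∣ : ∀ z → + (p ^ 2) ∣ℤ z → + (q ^ 2) ∣ℤ z → + r ∣ℤ z → + step p q r d₃ ∣ℤ z
  step₃-∣ z d e f = subst (λ k → + k ∣ℤ z) (sym (proj₂ (proj₂ (proj₂ (step≡ d₃))))) (modulus-∣ℤ l2 l2 l1 z d e (pow₁-∣ r f))

  fine-≤1 : ∀ (A : Subset M) w → (∀ a → w a ≤ 1) → ∀ x y z → N (weighted w (els A)) l2 l2 l2 x y z ≤ 1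
  fine-≤1 A w w≤1 x y z = sumN-≤1 (els A) (term w l2 l2 l2 x y z) (els-unique A) (term-≤1 w w≤1 l2 l2 l2 x y z) λ a b a∈ b∈ ha hb →
    let (_ , a₁ , a₂ , a₃) = term-pos w l2 l2 l2 x y z ha ; (_ , b₁ , b₂ , b₃) = term-pos w l2 l2 l2 x y z hb
    in small-∣ (bound a∈) (bound b∈) (M-∣ℤ _ (∣-sub p-prime (rep p l2 x) (+ a) (+ b) a₁ b₁) (∣-sub p-prime (rep q l2 y) (+ a) (+ b) a₂ b₂) (∣-sub p-prime (rep r l2 z) (+ a) (+ b) a₃ b₃))
    where
    bound : ∀ {a} → a ∈L els A → a < M
    bound m = let (x , _ , e) = ∈-els⁻ {v = A} m in subst (_< M) e (toℕ<n x)

  fine-≥1 : ∀ (A : Subset M) w x y z {u} → u ∈ A → w (toℕ u) ≡ 1 → Hits p l2 x (toℕ u) → Hits q l2 y (toℕ u) → Hits r l2 z (toℕ u) → 1 ≤ N (weighted w (els A)) l2 l2 l2 x y z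
  fine-≥1 A w x y z {u} u∈ e h₁ h₂ h₃ = ≤-trans (≤-reflexive (sym (term-hit w l2 l2 l2 x y z {toℕ u} h₁ h₂ h₃ ∙ e))) (sumN-≥ (els A) (term w l2 l2 l2 x y z) (∈-els⁺ u∈))

  crt-point : ∀ x y z → ∃[ u ] (+ (p ^ 2) ∣ℤ (+ toℕ {M} u - x) × + (q ^ 2) ∣ℤ (+ toℕ u - y) × + (r ^ 2) ∣ℤ (+ toℕ u - z))
  crt-point x y z = let (u , d , e , f) = crt₃ D x y z in point u , near-point u x p²∣M d , near-point u y q²∣M e , near-point u z r²∣M f

  module _ {A : Subset M} (t : Typing p q r A) where
    open Typing t

    weight : Dir → ℕ → ℕ
    weight d a = is d (τ a)

    part : Dir → Profile p q r
    part d = weighted (weight d) (els A)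

    -- At the finest level a cell has at most one point. If it has one of type d and the target cell
    -- lies on its d-fibre, then the point there is in A and has type d as well.
    move : ∀ d x y z x' y' z' → (∀ a u → Hits p l2 x a → Hits q l2 y a → Hits r l2 z a →
        + (p ^ 2) ∣ℤ (u - rep p l2 x') → + (q ^ 2) ∣ℤ (u - rep q l2 y') → + (r ^ 2) ∣ℤ (u - rep r l2 z') → + step p q r d ∣ℤ (u - + a)) →
      N (part d) l2 l2 l2 x y z ≤ N (part d) l2 l2 l2 x' y' z'
    move d x y z x' y' z' h = go (1 ≤? N (part d) l2 l2 l2 x y z)
      where
      go : Dec (1 ≤ N (part d) l2 l2 l2 x y z) → N (part d) l2 l2 l2 x y z ≤ N (part d) l2 l2 l2 x' y' z'
      go (no n) = ≤-trans (≤-pred (≰⇒> n)) z≤n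
      go (yes pos) = ≤-trans (fine-≤1 A (weight d) (λ a → is-≤1 d (τ a)) x y z) (fine-≥1 A (weight d) x' y' z' (proj₁ v∈) (is-refl (proj₂ v∈ ∙ cong τ x₀≡ ∙ type-a))
           (flip-∣ (+ toℕ v) (rep p l2 x') v₁) (flip-∣ (+ toℕ v) (rep q l2 y') v₂) (flip-∣ (+ toℕ v) (rep r l2 z') v₃))
        where
        found = sumN-pos (els A) (term (weight d) l2 l2 l2 x y z) pos
        a = proj₁ found
        hits = term-pos (weight d) l2 l2 l2 x y z (proj₂ (proj₂ found))
        type-a : τ a ≡ d; type-a = is-pos d (τ a) (proj₁ hits)
        x₀∃ = ∈-els⁻ (proj₁ (proj₂ found))
        x₀ = proj₁ x₀∃
        x₀≡ : toℕ x₀ ≡ a; x₀≡ = proj₂ (proj₂ x₀∃)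
        v∃ = crt-point (rep p l2 x') (rep q l2 y') (rep r l2 z')
        v = proj₁ v∃
        v₁ = proj₁ (proj₂ v∃)
        v₂ = proj₁ (proj₂ (proj₂ v∃))
        v₃ = proj₂ (proj₂ (proj₂ v∃))
        v∈ : v ∈ A × τ (toℕ v) ≡ τ (toℕ x₀)
        v∈ = closed (proj₁ (proj₂ x₀∃)) (subst₂ (λ k b → + step p q r k ∣ℤ (+ toℕ v - + b)) (sym (cong τ x₀≡ ∙ type-a)) (sym x₀≡)
               (h a (+ toℕ v) (proj₁ (proj₂ hits)) (proj₁ (proj₂ (proj₂ hits))) (proj₂ (proj₂ (proj₂ hits))) v₁ v₂ v₃))

    rep-mod : ∀ {p} (pr : Prime p) c σ σ' u a → + (p ^ 2) ∣ℤ (u - rep p l2 (c , σ')) → + (p ^ 2) ∣ℤ (rep p l2 (c , σ) - a) → + p ∣ℤ (u - a)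
    rep-mod {p} pr c σ σ' u a d e = ∣-via u (rep p l2 (c , σ')) a (trans∣ (sq-p pr) d) (∣-via (rep p l2 (c , σ')) (rep p l2 (c , σ)) a
       (∣-via (rep p l2 (c , σ')) (+ toℕ c) (rep p l2 (c , σ)) (rep₂-mod pr c σ') (flip-∣ (rep p l2 (c , σ)) (+ toℕ c) (rep₂-mod pr c σ))) (trans∣ (sq-p pr) e))

    indep₁ : Indep₁ (part d₁)
    indep₁ = indep₁-from-fine (part d₁) λ c σ σ' y z → ≤-antisym (one c σ σ' y z) (one c σ' σ y z)
      where
      one : ∀ c σ σ' y z → N (part d₁) l2 l2 l2 (c , σ) y z ≤ N (part d₁) l2 l2 l2 (c , σ') y z
      one c σ σ' y z = move d₁ (c , σ) y z (c , σ') y z λ a u h₁ h₂ h₃ e₁ e₂ e₃ → step₁-∣ _ (rep-mod p-prime c σ σ' u (+ a) e₁ h₁) (∣-via u _ (+ a) e₂ h₂) (∣-via u _ (+ a) e₃ h₃)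

    indep₂ : Indep₂ (part d₂)
    indep₂ l n x v ψ ψ' z = indep₁-from-fine (sw12 (part d₂)) (λ v ψ ψ' x z → ≤-antisym (one v ψ ψ' x z) (one v ψ' ψ x z)) l n v ψ ψ' x z
      where
      one : ∀ v ψ ψ' x z → N (part d₂) l2 l2 l2 x (v , ψ) z ≤ N (part d₂) l2 l2 l2 x (v , ψ') z
      one v ψ ψ' x z = move d₂ x (v , ψ) z x (v , ψ') z λ a u h₁ h₂ h₃ e₁ e₂ e₃ → step₂-∣ _ (∣-via u _ (+ a) e₁ h₁) (rep-mod q-prime v ψ ψ' u (+ a) e₂ h₂) (∣-via u _ (+ a) e₃ h₃)

    indep₃ : Indep₃ (part d₃)
    indep₃ l m x y w ω ω' = indep₁-from-fine (rev (part d₃)) (λ w ω ω' y x → ≤-antisym (one w ω ω' x y) (one w ω' ω x y)) m l w ω ω' y x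
      where
      one : ∀ w ω ω' x y → N (part d₃) l2 l2 l2 x y (w , ω) ≤ N (part d₃) l2 l2 l2 x y (w , ω')
      one w ω ω' x y = move d₃ x y (w , ω) x y (w , ω') λ a u h₁ h₂ h₃ e₁ e₂ e₃ → step₃-∣ _ (∣-via u _ (+ a) e₁ h₁) (∣-via u _ (+ a) e₂ h₂) (rep-mod r-prime w ω ω' u (+ a) e₃ h₃)

    decomposition : Decomposition (profile (els A))
    decomposition = record { A₁ = part d₁ ; A₂ = part d₂ ; A₃ = part d₃ ; i₁ = indep₁ ; i₂ = indep₂ ; i₃ = indep₃
      ; split = λ l m n x y z → (sumN-cong (els A) λ a → cong (_* (ind p l x a * (ind q m y a * ind r n z a))) (is-sum (τ a)) ∙ lem (weight d₁ a) (weight d₂ a) (weight d₃ a) _) ∙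
          sumN-+ (els A) (λ a → term (weight d₁) l m n x y z a + term (weight d₂) l m n x y z a) (term (weight d₃) l m n x y z) ∙ cong (_+ sumN (els A) (term (weight d₃) l m n x y z)) (sumN-+ (els A) (term (weight d₁) l m n x y z) (term (weight d₂) l m n x y z)) }
      where lem : ∀ a b c k → (a + b + c) * k ≡ a * k + b * k + c * k; lem = ringℕ

    part-pos : ∀ d → Uses t d → 1 ≤ total (part d)
    part-pos d (x , x∈ , e) = ≤-trans (≤-reflexive (sym (is-refl e))) (≤-trans (sumN-≥ (els A) (weight d) (∈-els⁺ x∈)) (≤-reflexive (sym (weighted-total (weight d) (els A)))))

    part-zero : ∀ d → ¬ Uses t d → total (part d) ≡ 0
    part-zero d n = n≤0⇒n≡0 (≮⇒≥ λ pos →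
      let (a , a∈ , h) = sumN-pos (els A) (weight d) (subst (1 ≤_) (weighted-total (weight d) (els A)) pos) ; (x , x∈ , e) = ∈-els⁻ a∈
      in n (x , x∈ , cong τ e ∙ is-pos d (τ a) h))

-- Two fibres with steps s and s' span the coset of gℤ_M, a plane; u and v split a move in it into
-- one along each fibre.
record Combination (s s' g : ℕ) : Set where
  field
    g∣s : g ∣ s
    g∣s' : g ∣ s'
    u v : ℤ
    bezout : + g ≡ u · + s ⊕ v · + s'

gcd-combination : ∀ s s' → Combination s s' (gcd s s')
gcd-combination s s' = go (Bézout.identity (gcd-GCD s s'))
  where
  go : Bézout.Identity (gcd s s') s s' → Combination s s' (gcd s s')
  go (Bézout.+- x y e) = record { g∣s = gcd[m,n]∣m s s' ; g∣s' = gcd[m,n]∣n s s' ; u = + x ; v = - + y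
    ; bezout = lem (+ gcd s s') (+ (y * s')) ∙ cong (λ w → + w - + (y * s')) e ∙ cong₂ _⊕_ (pos-* x s) (cong -_ (pos-* y s') ∙ neg-distribˡ-* (+ y) (+ s')) }
    where lem : ∀ g k → g ≡ (g ⊕ k) - k; lem = ring
  go (Bézout.-+ x y e) = record { g∣s = gcd[m,n]∣m s s' ; g∣s' = gcd[m,n]∣n s s' ; u = - + x ; v = + y
    ; bezout = lem (+ gcd s s') (+ (x * s)) ∙ cong₂ _⊕_ (cong -_ (pos-* x s) ∙ neg-distribˡ-* (+ x) (+ s)) (cong +_ e ∙ pos-* y s') }
    where lem : ∀ g k → g ≡ - k ⊕ (g ⊕ k); lem = ring

choose : {P : Set} → Dec P → Dir → Dir → Dir
choose (yes _) d e = d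
choose (no _) d e = e

choose-yes : {P : Set} (x : Dec P) {d e : Dir} → P → choose x d e ≡ d
choose-yes (yes _) _ = refl
choose-yes (no n) y = ⊥-elim (n y)

choose-no : {P : Set} (x : Dec P) {d e : Dir} → ¬ P → choose x d e ≡ e
choose-no (yes y) n = ⊥-elim (n y)
choose-no (no _) _ = refl

-- The points of A on the plane have type e, and the d-fibre of a lies in A. The e-fibres through
-- that d-fibre fill the plane, so the whole plane lies in A and can be cut into d-fibres instead.
module Reassign {p q r M : ℕ} (D : Distinct p q r) (M≡ : M ≡ p ^ 2 * q ^ 2 * r ^ 2) {A : Subset M} (t : Typing p q r A) (d e : Dir) {g : ℕ}
  (C : Combination (step p q r d) (step p q r e) g) {a : Fin M} (a-in : InDir (step p q r d) A a)
  (typed : ∀ y → y ∈ A → + g ∣ℤ (+ toℕ y - + toℕ a) → Typing.τ t (toℕ y) ≡ e) where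
  open Typing t
  open Combination C
  open Points D M≡

  OnPlane : ℕ → Set
  OnPlane y = + g ∣ℤ (+ y - + toℕ a)

  onPlane? : ∀ y → Dec (OnPlane y)
  onPlane? y = + g ∣ℤ? (+ y - + toℕ a)

  plane⊆A : ∀ y → OnPlane (toℕ y) → y ∈ A
  plane⊆A y on@(dividesℤ k eqk) = proj₁ (closed y'∈ (subst (λ f → + step p q r f ∣ℤ (+ toℕ y - + toℕ y')) (sym (typed y' y'∈ (trans∣ (pos∣ g∣s) y'-a))) y-y'))
    where
    s = step p q r d
    s' = step p q r e
    -- The d-part of the move from a to y; what remains is a move along an e-fibre.
    z : ℤ; z = + toℕ a ⊕ k · u · + s
    y' = point z
    y'-a : + s ∣ℤ (+ toℕ y' - + toℕ a)
    y'-a = near-point z (+ toℕ a) (step∣M d) (dividesℤ (k · u) (lem (+ toℕ a) (k · u) (+ s)))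
      where lem : ∀ a k s → (a ⊕ k · s) - a ≡ k · s; lem = ring
    y'∈ : y' ∈ A; y'∈ = proj₂ a-in y' y'-a
    y-y' : + s' ∣ℤ (+ toℕ y - + toℕ y')
    y-y' = ∣-via (+ toℕ y) z (+ toℕ y') (dividesℤ (k · v) (lem (+ toℕ y) (+ toℕ a) (k · u · + s) ∙ cong (λ w → w - k · u · + s) (eqk ∙ cong (λ w → k · w) bezout) ∙ lem' k u v (+ s) (+ s')))
      (trans∣ (pos∣ (step∣M e)) (flip-∣ (+ toℕ y') z (point-≡ z)))
      where lem : ∀ y a w → y - (a ⊕ w) ≡ (y - a) - w; lem = ring
            lem' : ∀ k u v s s' → k · (u · s ⊕ v · s') - k · u · s ≡ k · v · s'; lem' = ring

  τ′ : ℕ → Dir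
  τ′ y = choose (onPlane? y) d (τ y)

  τ′-on : ∀ {y} → OnPlane y → τ′ y ≡ d
  τ′-on {y} = choose-yes (onPlane? y)

  τ′-off : ∀ {y} → ¬ OnPlane y → τ′ y ≡ τ y
  τ′-off {y} = choose-no (onPlane? y)

  reassigned : Typing p q r A
  reassigned = record { τ = τ′ ; closed = λ {x} {y} x∈ h → go x y x∈ h (onPlane? (toℕ x)) }
    where
    go : ∀ x y → x ∈ A → + step p q r (τ′ (toℕ x)) ∣ℤ (+ toℕ y - + toℕ x) → Dec (OnPlane (toℕ x)) → y ∈ A × τ′ (toℕ y) ≡ τ′ (toℕ x)
    go x y x∈ h (yes on) = plane⊆A y on' , τ′-on on' ∙ sym (τ′-on on)
      where
      on' : OnPlane (toℕ y)
      on' = ∣-via (+ toℕ y) (+ toℕ x) (+ toℕ a) (trans∣ (pos∣ g∣s) (subst (λ f → + step p q r f ∣ℤ (+ toℕ y - + toℕ x)) (τ′-on on) h)) on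
    go x y x∈ h (no off) = y∈ , τ′-off off' ∙ τ≡ ∙ sym (τ′-off off)
      where
      h' : + step p q r (τ (toℕ x)) ∣ℤ (+ toℕ y - + toℕ x); h' = subst (λ f → + step p q r f ∣ℤ (+ toℕ y - + toℕ x)) (τ′-off off) h
      c = closed x∈ h'
      y∈ = proj₁ c
      τ≡ = proj₂ c
      -- A fibre that reaches the plane there has type e and so runs inside the plane; no fibre is
      -- cut by the change.
      off' : ¬ OnPlane (toℕ y)
      off' on = off (∣-via (+ toℕ x) (+ toℕ y) (+ toℕ a) (trans∣ (pos∣ g∣s') (flip-∣ (+ toℕ y) (+ toℕ x) (subst (λ f → + step p q r f ∣ℤ (+ toℕ y - + toℕ x)) (sym τ≡ ∙ typed y y∈ on) h'))) on)

-- Counting in a tile that is partitioned into fibres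

module Tiled {M p q r : ℕ} (D : Distinct p q r) (M≡ : M ≡ p ^ 2 * q ^ 2 * r ^ 2) (A B : Subset M) (tiles : Tiles M A B)
  (size-A : ∣ A ∣ ≡ p * q * r) (size-B : ∣ B ∣ ≡ p * q * r) where
  open Distinct D
  open Lists D
  open Points D M≡
  open Cyclotomic D M≡
  open Profile

  private
    X Y : List ℕ
    X = els A
    Y = els B
    tile : TileL (p ^ 2 * q ^ 2 * r ^ 2) X Y; tile = subst (λ k → TileL k X Y) M≡ (tiles⇒TileL A B tiles)
    PA = profile X
    PB = profile Y
    module Tl = Tiling D X Y tile (length-els A ∙ size-A) (length-els B ∙ size-B)

  T : Pair p q r
  T = Tl.T

  module _ (fibred : ∀ x → x ∈ A → ∀ y → + step p q r d₁ ∣ℤ (+ toℕ y - + toℕ x) → y ∈ A) where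
    private
      constant : Typing p q r A; constant = record { τ = λ _ → d₁ ; closed = λ {x} {y} x∈ h → fibred x x∈ y h , refl }
      module F = Tl.Fibred (indep₁ constant)

    fibred-Φ : ∀ e → p ^ 2 * e ∣ M → CycDiv M (p ^ 2 * e) A
    fibred-Φ e d = let (m , n , e≡) = divisor-levels e d in
      subst (λ k → CycDiv M k A) (sym (cong (p ^ 2 *_) e≡ ∙ square-modulus m n)) (V⇒Cyc l2 m n A (F.flat m n))

    fibred-T2 : T2 M A × T2 M B; fibred-T2 = T2-from-profile A F.T2-A′ , T2-from-profile B F.T2-B′

  three-uses : (t : Typing p q r A) → Uses t d₁ → Uses t d₂ → Uses t d₃ → ⊥
  three-uses t u₁ u₂ u₃ = three-directions T (decomposition t) (part-pos t d₁ u₁) (part-pos t d₂ u₂) (part-pos t d₃ u₃)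

  module TwoDirections (t : Typing p q r A) (none : ¬ Uses t d₁) (u₂ : Uses t d₂) (u₃ : Uses t d₃) where
    private
      dec = decomposition t
      module Dc = Decomposition dec
      A₁ = part t d₁
      A₂ = part t d₂
      A₃ = part t d₃
      open NonZeros D
      oq = origin q-prime
      or = origin r-prime

      zero₁ : ∀ c → N A₁ l1 l0 l0 c tt tt ≡ 0
      zero₁ c = n≤0⇒n≡0 (subst (N A₁ l1 l0 l0 c tt tt ≤_) (part-zero t d₁ none) (≤-p₀ A₁ c tt tt))

    module _ (a₁ : V PA l1 l0 l0) (2<p : 2 < p) where
      private
        Y′ Z′ : Fin p → ℕ
        Y′ c = fibres₂ A₂ oq l1 l0 c tt
        Z′ c = fibres₃ A₃ or l1 l0 c tt
        Y-≡ : ∀ c → N A₂ l1 l0 l0 c tt tt ≡ q * Y′ c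
        Y-≡ c = fibres₂-* {P = A₂} (indep₂ t) c tt oq
        Z-≡ : ∀ c → N A₃ l1 l0 l0 c tt tt ≡ r * Z′ c
        Z-≡ c = fibres₃-* {P = A₃} (indep₃ t) c tt or
        size₁ : ∀ c → N PA l1 l0 l0 c tt tt ≡ q * r; size₁ = Basics.level₁ D PA (Pair.total-A T) a₁
        size : ∀ c → q * Y′ c + r * Z′ c ≡ q * r
        size c = cong₂ _+_ (sym (Y-≡ c)) (sym (Z-≡ c)) ∙ cong (λ k → k + N A₂ l1 l0 l0 c tt tt + N A₃ l1 l0 l0 c tt tt) (sym (zero₁ c)) ∙ sym (Dc.split l1 l0 l0 c tt tt) ∙ size₁ c

        -- A class mod p has qr = q Y + r Z points in Y q-fibres and Z r-fibres, so only one kind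
        -- occurs in it.
        pure : ∀ c → N A₃ l1 l0 l0 c tt tt ≡ 0 ⊎ N A₂ l1 l0 l0 c tt tt ≡ 0
        pure c with q * r ≤? q * Y′ c
        ... | yes le = inj₁ (Z-≡ c ∙ n≤0⇒n≡0 (+-cancelˡ-≤ (q * Y′ c) _ _ (≤-trans (≤-reflexive (size c)) (≤-trans le (≤-reflexive (sym (+-identityʳ _)))))))
        ... | no lt = inj₂ (Y-≡ c ∙ cong (q *_) (coin q-prime r-prime q≢r {Y′ c} {Z′ c} {0} {q} (size c ∙ *-comm q r ∙ cong (_+ r * q) (sym (*-zeroʳ q))) (≰⇒> lt)
              (subst (_< q * r) (sym (*-zeroʳ q)) (*-mono-≤ (>-nonZero⁻¹ q) (>-nonZero⁻¹ r)))) ∙ *-zeroʳ q)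

        split₁ : ∀ c m n y z → N PA l1 m n c y z ≡ N A₂ l1 m n c y z + N A₃ l1 m n c y z
        split₁ c m n y z = Dc.split l1 m n c y z ∙ cong (λ k → k + N A₂ l1 m n c y z + N A₃ l1 m n c y z) (class-zero A₁ c (zero₁ c) m n y z)
        split₂ : ∀ c σ m n y z → N PA l2 m n (c , σ) y z ≡ N A₂ l2 m n (c , σ) y z + N A₃ l2 m n (c , σ) y z
        split₂ c σ m n y z = Dc.split l2 m n (c , σ) y z ∙ cong (λ k → k + N A₂ l2 m n (c , σ) y z + N A₃ l2 m n (c , σ) y z) (class-zero A₁ (c , σ) (layer-zero A₁ c (zero₁ c) σ) m n y z)

        class₂ : ∀ c → N A₃ l1 l0 l0 c tt tt ≡ 0 → FibredClass PA c
        class₂ c e = record { A₂ = A₂ ; i₂ = indep₂ t ; size = size₁ c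
          ; e₁ = λ m n y z → split₁ c m n y z ∙ cong (λ k → N A₂ l1 m n c y z + k) (class-zero A₃ c e m n y z) ∙ +-identityʳ _
          ; e₂ = λ m n σ y z → split₂ c σ m n y z ∙ cong (λ k → N A₂ l2 m n (c , σ) y z + k) (class-zero A₃ (c , σ) (layer-zero A₃ c e σ) m n y z) ∙ +-identityʳ _ }
        class₃ : ∀ c → N A₂ l1 l0 l0 c tt tt ≡ 0 → FibredClass (sw23 PA) c
        class₃ c e = record { A₂ = sw23 A₃ ; i₂ = λ l n x v ψ ψ' z → indep₃ t l n x z v ψ ψ' ; size = size₁ c ∙ *-comm q r
          ; e₁ = λ m n y z → split₁ c n m z y ∙ cong (λ k → k + N A₃ l1 n m c z y) (class-zero A₂ c e n m z y)
          ; e₂ = λ m n σ y z → split₂ c σ n m z y ∙ cong (λ k → k + N A₃ l2 n m (c , σ) z y) (class-zero A₂ (c , σ) (layer-zero A₂ c e σ) n m z y) }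

        exists₂ : ∃[ c ] FibredClass PA c
        exists₂ = let (c , h) = ∑-pos (λ c → N A₂ l1 l0 l0 c tt tt) (subst (1 ≤_) (p₀ A₂ {l0} {l0} {tt} {tt}) (part-pos t d₂ u₂)) in c , [ class₂ c , (λ e → ⊥-elim (<⇒≢ h (sym e))) ]′ (pure c)
        exists₃ : ∃[ c ] FibredClass (sw23 PA) c
        exists₃ = let (c , h) = ∑-pos (λ c → N A₃ l1 l0 l0 c tt tt) (subst (1 ≤_) (p₀ A₃ {l0} {l0} {tt} {tt}) (part-pos t d₃ u₃)) in c , [ (λ e → ⊥-elim (<⇒≢ h (sym e))) , class₃ c ]′ (pure c)

        setting : LevelOneSetting T
        setting = record { 2<p = 2<p ; a100 = a₁ ; fibred = λ c → [ (λ e → inj₁ (class₂ c e)) , (λ e → inj₂ (class₃ c e)) ]′ (pure c)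
          ; c₂ = proj₁ exists₂ ; c₃ = proj₁ exists₃ ; fibred₂ = proj₂ exists₂ ; fibred₃ = proj₂ exists₃ }
        module L = LevelOneT2 T setting

      level-one : CycDiv M (p ^ 2) B × (∀ e → p ^ 2 * e ∣ M → CycDiv M (p ^ 2 * e) B ⊎ DividesMask M (Φ (p * e) *P Φ e) A) × T2 M A × T2 M B
      level-one = subst (λ k → CycDiv M k B) (sym (modulus₁ l2)) (V⇒Cyc l2 l0 l0 B (LevelOneDivisors.b200 (level-one-divisors T setting)))
        , (λ e d → slab e (divisor-levels e d)) , T2-from-profile A L.T2-A , T2-from-profile B L.T2-B
        where
        slab : ∀ e → ∃[ m ] ∃[ n ] e ≡ q ^ exponent m * r ^ exponent n → CycDiv M (p ^ 2 * e) B ⊎ DividesMask M (Φ (p * e) *P Φ e) A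
        slab e (m , n , e≡) = [ (λ b → inj₁ (subst (λ k → CycDiv M k B) (sym (cong (p ^ 2 *_) e≡ ∙ square-modulus m n)) (V⇒Cyc l2 m n B b))) , (λ (a , a') → inj₂ (product-Φ m n A a a' e≡)) ]′ (L.slab-alternative m n)

    module _ (a₂ : V PA l2 l0 l0) where
      private
        class = WithDecomposition.single-class T dec a₂ (part-zero t d₁ none) (part-pos t d₂ u₂) (part-pos t d₃ u₃)
        module O = Tl.OneClass (proj₁ class) a₂ (proj₂ class)

      one-class : (∀ a → a ∈ A → ∀ y → y ∈ A → toℕ y ≡ toℕ a [mod p ]) × T2 M A × T2 M B
      one-class = (λ a a∈ y y∈ → ∣⇒∣ᵤ (∣-sub p-prime (+ toℕ (proj₁ class)) (+ toℕ y) (+ toℕ a) (O.in-class (toℕ y) (∈-els⁺ y∈)) (O.in-class (toℕ a) (∈-els⁺ a∈))))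
        , T2-from-profile A O.T2-A″ , T2-from-profile B O.T2-B″

    cyclotomic-cases : 2 < p → (CycDiv M p A → CycDiv M (p ^ 2) B × (∀ e → p ^ 2 * e ∣ M → CycDiv M (p ^ 2 * e) B ⊎ DividesMask M (Φ (p * e) *P Φ e) A) × T2 M A × T2 M B)
      × (CycDiv M (p ^ 2) A → (∀ a → a ∈ A → ∀ y → y ∈ A → toℕ y ≡ toℕ a [mod p ]) × T2 M A × T2 M B)
    cyclotomic-cases 2<p = (λ h → level-one (Cyc⇒V l1 l0 l0 A (subst (λ k → CycDiv M k A) (sym (*-identityʳ p) ∙ modulus₁ l1) h)) 2<p)
      , (λ h → one-class (Cyc⇒V l2 l0 l0 A (subst (λ k → CycDiv M k A) (modulus₁ l2) h)))

  -- A plane in the first two directions has pq points, which no number of r-fibres complements.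
  module PlaneSize (t : Typing p q r A) (none₂ : ¬ Uses t d₂) {a : Fin M} (a∈ : a ∈ A)
    (on⇒d₁ : ∀ y → + (p * q * r ^ 2) ∣ℤ (+ toℕ y - + toℕ a) → y ∈ A × Typing.τ t (toℕ y) ≡ d₁)
    (d₁⇒on : ∀ y → y ∈ A → Typing.τ t (toℕ y) ≡ d₁ → + (p * q * r ^ 2) ∣ℤ (+ toℕ y - + toℕ a)) where
    private
      A₁ = part t d₁
      A₃ = part t d₃
      or = origin r-prime
      c∃ = residue p-prime (+ toℕ a)
      v∃ = residue q-prime (+ toℕ a)
      z∃ = covers r-prime l2 (+ toℕ a)
      c = proj₁ c∃
      v = proj₁ v∃
      z = proj₁ z∃
      on : ∀ y → + p ∣ℤ (+ toℕ {M} y - + toℕ c) → + q ∣ℤ (+ toℕ y - + toℕ v) → + (r ^ 2) ∣ℤ (+ toℕ y - rep r l2 z) → + (p * q * r ^ 2) ∣ℤ (+ toℕ y - + toℕ a)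
      on y e₁ e₂ e₃ = subst (λ k → + k ∣ℤ (+ toℕ y - + toℕ a)) (cong₂ (λ a b → a * b * r ^ 2) (*-identityʳ p) (*-identityʳ q)) (modulus-∣ℤ l1 l1 l2 _
        (pow₁-∣ p (∣-via (+ toℕ y) (+ toℕ c) (+ toℕ a) e₁ (flip-∣ (+ toℕ a) (+ toℕ c) (proj₂ c∃)))) (pow₁-∣ q (∣-via (+ toℕ y) (+ toℕ v) (+ toℕ a) e₂ (flip-∣ (+ toℕ a) (+ toℕ v) (proj₂ v∃)))) (∣-via (+ toℕ y) (rep r l2 z) (+ toℕ a) e₃ (flip-∣ (+ toℕ a) (rep r l2 z) (proj₂ z∃))))
      fine-one : ∀ σ ψ → N PA l2 l2 l2 (c , σ) (v , ψ) z ≡ 1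
      fine-one σ ψ = ≤-antisym (fine-≤1 A (λ _ → 1) (λ _ → ≤-refl) (c , σ) (v , ψ) z)
        (let (u , e₁ , e₂ , e₃) = crt-point (rep p l2 (c , σ)) (rep q l2 (v , ψ)) (rep r l2 z) in
         fine-≥1 A (λ _ → 1) (c , σ) (v , ψ) z {u} (proj₁ (on⇒d₁ u (on u (∣-via (+ toℕ u) (rep p l2 (c , σ)) (+ toℕ c) (trans∣ (sq-p p-prime) e₁) (rep₂-mod p-prime c σ)) (∣-via (+ toℕ u) (rep q l2 (v , ψ)) (+ toℕ v) (trans∣ (sq-p q-prime) e₂) (rep₂-mod q-prime v ψ)) e₃)))
           refl (flip-∣ (+ toℕ u) (rep p l2 (c , σ)) e₁) (flip-∣ (+ toℕ u) (rep q l2 (v , ψ)) e₂) (flip-∣ (+ toℕ u) (rep r l2 z) e₃))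
      plane-count : N PA l1 l1 l2 c v z ≡ p * q
      plane-count = p₁ PA {l1} {l2} {c} {v} {z} ∙ (∑-cong λ σ → q₁ PA {l2} {l2} {c , σ} {v} {z} ∙ (∑-cong λ ψ → fine-one σ ψ) ∙ ∑-const q 1 ∙ *-identityʳ q) ∙ ∑-const p q
      total₁ : total A₁ ≡ p * q
      total₁ = weighted-total (weight t d₁) X ∙ sumN-cong-∈ X same ∙ plane-count
        where
        same : ∀ b → b ∈L X → weight t d₁ b ≡ term (λ _ → 1) l1 l1 l2 c v z b
        same b b∈ = let (y , y∈ , e) = ∈-els⁻ b∈ in subst (λ b → weight t d₁ b ≡ term (λ _ → 1) l1 l1 l2 c v z b) e (go y y∈ (dir? (Typing.τ t (toℕ y)) d₁))
          where
          go : ∀ y → y ∈ A → Dec (Typing.τ t (toℕ y) ≡ d₁) → weight t d₁ (toℕ y) ≡ term (λ _ → 1) l1 l1 l2 c v z (toℕ y)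
          go y y∈ (yes e) = is-refl e ∙ sym (term-hit (λ _ → 1) l1 l1 l2 c v z {toℕ y} (hit c (proj₂ c∃) (m∣m*n′ p q (r ^ 2))) (hit v (proj₂ v∃) (∣-trans (n∣m*n p) (m∣m*n (r ^ 2))))
               (∣-via (rep r l2 z) (+ toℕ a) (+ toℕ y) (flip-∣ (+ toℕ a) (rep r l2 z) (proj₂ z∃)) (flip-∣ (+ toℕ y) (+ toℕ a) (trans∣ (pos∣ (n∣m*n (p * q))) (d₁⇒on y y∈ e)))))
            where
            m∣m*n′ : ∀ p q s → p ∣ p * q * s
            m∣m*n′ p q s = ∣-trans (m∣m*n q) (m∣m*n s)
            hit : ∀ {k} (c : Fin k) → + k ∣ℤ (+ toℕ a - + toℕ c) → k ∣ p * q * r ^ 2 → + k ∣ℤ (+ toℕ c - + toℕ y)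
            hit c d d' = ∣-via (+ toℕ c) (+ toℕ a) (+ toℕ y) (flip-∣ (+ toℕ a) (+ toℕ c) d) (flip-∣ (+ toℕ y) (+ toℕ a) (trans∣ (pos∣ d') (d₁⇒on y y∈ e)))
          go y y∈ (no ne) = n≤0⇒n≡0 (≮⇒≥ λ pos → ne (is-pos d₁ _ pos)) ∙ sym (n≤0⇒n≡0 (≮⇒≥ λ pos →
              let (_ , h₁ , h₂ , h₃) = term-pos (λ _ → 1) l1 l1 l2 c v z {toℕ y} pos
              in ne (proj₂ (on⇒d₁ y (on y (flip-∣ (+ toℕ c) (+ toℕ y) h₁) (flip-∣ (+ toℕ v) (+ toℕ y) h₂) (flip-∣ (rep r l2 z) (+ toℕ y) h₃))))))

    contradiction : ⊥
    contradiction = [ (λ e → prime∤prime r-prime p-prime (p≢r ∘ sym) e) , (λ e → prime∤prime r-prime q-prime (q≢r ∘ sym) e) ]′ (euclidsLemma p q r-prime r∣pq)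
      where
      total≡ : total A₃ + p * q ≡ p * q * r
      total≡ = +-comm (total A₃) _ ∙ cong (_+ total A₃) (sym total₁ ∙ sym (cong (λ k → total A₁ + k) (part-zero t d₂ none₂) ∙ +-identityʳ _)) ∙ sym (Decomposition.split (decomposition t) l0 l0 l0 tt tt tt) ∙ Pair.total-A T
      r∣pq : r ∣ p * q
      r∣pq = ∣m+n∣m⇒∣n (subst (r ∣_) (sym total≡) (n∣m*n (p * q))) (divides (fibres₃ A₃ or l0 l0 tt tt) (fibres₃-* {P = A₃} (indep₃ t) tt tt or ∙ *-comm r _))

-- Permutations of the primes and retyping of planes

swap-d12 swap-d23 : Dir → Dir
swap-d12 d₁ = d₂
swap-d12 d₂ = d₁
swap-d12 d₃ = d₃
swap-d23 d₁ = d₁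
swap-d23 d₂ = d₃
swap-d23 d₃ = d₂

swap-d12-involutive : ∀ d → swap-d12 (swap-d12 d) ≡ d
swap-d12-involutive d₁ = refl
swap-d12-involutive d₂ = refl
swap-d12-involutive d₃ = refl

swap-d23-involutive : ∀ d → swap-d23 (swap-d23 d) ≡ d
swap-d23-involutive d₁ = refl
swap-d23-involutive d₂ = refl
swap-d23-involutive d₃ = refl

step-swap12 : ∀ p q r d → step q p r (swap-d12 d) ≡ step p q r d
step-swap12 p q r d₁ = cong (_* r ^ 2) (*-comm (q ^ 2) p)
step-swap12 p q r d₂ = cong (_* r ^ 2) (*-comm q (p ^ 2))
step-swap12 p q r d₃ = cong (_* r) (*-comm (q ^ 2) (p ^ 2))

step-swap23 : ∀ p q r d → step p r q (swap-d23 d) ≡ step p q r d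
step-swap23 p q r d₁ = *-swap23 p (r ^ 2) (q ^ 2)
step-swap23 p q r d₂ = *-swap23 (p ^ 2) (r ^ 2) q
step-swap23 p q r d₃ = *-swap23 (p ^ 2) r (q ^ 2)

pqr∣step : ∀ p q r d → p * q * r ∣ step p q r d
pqr∣step p q r d₁ = *-pres-∣ (*-monoʳ-∣ p (m∣m*n {q} (q * 1))) (m∣m*n {r} (r * 1))
pqr∣step p q r d₂ = *-pres-∣ (*-monoˡ-∣ q (m∣m*n {p} (p * 1))) (m∣m*n {r} (r * 1))
pqr∣step p q r d₃ = *-monoˡ-∣ r (*-pres-∣ (m∣m*n {p} (p * 1)) (m∣m*n {q} (q * 1)))

record Setting {M : ℕ} (A B : Subset M) (p q r : ℕ) : Set where
  field
    D : Distinct p q r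
    2<p : 2 < p
    M≡ : M ≡ p ^ 2 * q ^ 2 * r ^ 2
    tiles : Tiles M A B
    size-A : ∣ A ∣ ≡ p * q * r
    size-B : ∣ B ∣ ≡ p * q * r
    t : Typing p q r A
    -- A plane spanned by two fibres lies in one coset of pqrℤ_M, so all points of A on it have the
    -- same type and `Reassign` applies.
    grid : ∀ (x y : Fin M) → + (p * q * r) ∣ℤ (+ toℕ y - + toℕ x) → Typing.τ t (toℕ y) ≡ Typing.τ t (toℕ x)

  In : Dir → Fin M → Set
  In d = InDir (step p q r d) A

  Triple : Set
  Triple = ∃[ a ] (In d₁ a × In d₂ a × In d₃ a)

module _ {M : ℕ} {A B : Subset M} {p q r : ℕ} where
  setting12 : 2 < q → Setting A B p q r → Setting A B q p r
  setting12 2<q S = record { D = swap12 D ; 2<p = 2<q ; M≡ = M≡ ∙ *-swap12 (p ^ 2) (q ^ 2) (r ^ 2) ; tiles = tiles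
    ; size-A = size-A ∙ *-swap12 p q r ; size-B = size-B ∙ *-swap12 p q r
    ; t = record { τ = λ n → swap-d12 (τ n) ; closed = λ {x} {y} x∈ h → let (y∈ , e) = closed x∈ (subst (λ k → + k ∣ℤ (+ toℕ y - + toℕ x)) (step-swap12 p q r (τ (toℕ x))) h) in y∈ , cong swap-d12 e }
    ; grid = λ x y h → cong swap-d12 (grid x y (subst (λ k → + k ∣ℤ (+ toℕ y - + toℕ x)) (*-swap12 q p r) h)) }
    where open Setting S
          open Typing t

  setting-sw23 : Setting A B p q r → Setting A B p r q
  setting-sw23 S = record { D = swap23 D ; 2<p = 2<p ; M≡ = M≡ ∙ *-swap23 (p ^ 2) (q ^ 2) (r ^ 2) ; tiles = tiles
    ; size-A = size-A ∙ *-swap23 p q r ; size-B = size-B ∙ *-swap23 p q r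
    ; t = record { τ = λ n → swap-d23 (τ n) ; closed = λ {x} {y} x∈ h → let (y∈ , e) = closed x∈ (subst (λ k → + k ∣ℤ (+ toℕ y - + toℕ x)) (step-swap23 p q r (τ (toℕ x))) h) in y∈ , cong swap-d23 e }
    ; grid = λ x y h → cong swap-d23 (grid x y (subst (λ k → + k ∣ℤ (+ toℕ y - + toℕ x)) (*-swap23 p r q) h)) }
    where open Setting S
          open Typing t

in12 : ∀ p q r {M} {A : Subset M} d a → InDir (step p q r d) A a → InDir (step q p r (swap-d12 d)) A a
in12 p q r {A = A} d a = subst (λ k → InDir k A a) (sym (step-swap12 p q r d))

in23 : ∀ p q r {M} {A : Subset M} d a → InDir (step p q r d) A a → InDir (step p r q (swap-d23 d)) A a
in23 p q r {A = A} d a = subst (λ k → InDir k A a) (sym (step-swap23 p q r d))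

module WithSetting {M : ℕ} {A B : Subset M} {p q r : ℕ} (S : Setting A B p q r) where
  open Setting S
  open Distinct D
  open Typing t
  open Points D M≡
  module Td = Tiled D M≡ A B tiles size-A size-B

  open NonZeros D

  -- The gcd is written out as pqr² because the count of the points of the plane in `PlaneSize`
  -- needs this form.
  combination12 : Combination (step p q r d₁) (step p q r d₂) (p * q * r ^ 2)
  combination12 = record { g∣s = divides q (lem₁ p q r) ; g∣s' = divides p (lem₂ p q r) ; u = C.u ; v = C.v
    ; bezout = sym (·-identityˡ (+ g)) ∙ cong (λ k → k · + g) (cong +_ (sym one) ∙ C.bezout) ∙ lem₃ C.u (+ q) C.v (+ p) (+ g) ∙ cong₂ (λ a b → C.u · a ⊕ C.v · b) (sym (pos-* q g) ∙ cong +_ (sym (lem₁ p q r))) (sym (pos-* p g) ∙ cong +_ (sym (lem₂ p q r))) }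
    where
    g = p * q * r ^ 2
    module C = Combination (gcd-combination q p)
    one : gcd q p ≡ 1
    one = Cop′.coprime⇒gcd≡1 (primes-coprime (≢-nonZero⁻¹ q) λ pr d e → p≢q (sym (prime-∣-prime pr p-prime e) ∙ prime-∣-prime pr q-prime d))
    lem₁ : ∀ p q r → p * (q * (q * 1)) * (r * (r * 1)) ≡ q * (p * q * (r * (r * 1))); lem₁ = ringℕ
    lem₂ : ∀ p q r → (p * (p * 1)) * q * (r * (r * 1)) ≡ p * (p * q * (r * (r * 1))); lem₂ = ringℕ
    lem₃ : ∀ u q v p g → (u · q ⊕ v · p) · g ≡ u · (q · g) ⊕ v · (p · g); lem₃ = ring

  self : ∀ {g} (a : Fin M) → + g ∣ℤ (+ toℕ a - + toℕ a)
  self {g} a = dividesℤ (+ 0) (+-inverseʳ (+ toℕ a) ∙ sym (*-zeroˡ (+ g)))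

  -- A p-fibre meeting the fibres of the second type spans a plane, which can be retyped.
  fibre-in-second : ¬ Uses t d₁ → Uses t d₃ → ∀ {a} → In d₁ a → τ (toℕ a) ≡ d₂ → ⊥
  fibre-in-second none (x , x∈ , ex) {a} a-in ea = go (uses? R.reassigned d₂)
    where
    typed : ∀ y → y ∈ A → + (p * q * r ^ 2) ∣ℤ (+ toℕ y - + toℕ a) → τ (toℕ y) ≡ d₂
    typed y y∈ on = grid a y (trans∣ (pos∣ (*-monoʳ-∣ (p * q) (m∣m*n {r} (r * 1)))) on) ∙ ea
    module R = Reassign D M≡ t d₁ d₂ combination12 a-in typed
    off-x : ¬ R.OnPlane (toℕ x)
    off-x on = d₂≢d₃ (sym (typed x x∈ on) ∙ ex)
      where d₂≢d₃ : d₂ ≢ d₃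
            d₂≢d₃ ()
    on⇒ : ∀ y → R.OnPlane (toℕ y) → y ∈ A × R.τ′ (toℕ y) ≡ d₁
    on⇒ y on = R.plane⊆A y on , R.τ′-on on
    ⇒on : ∀ y → y ∈ A → R.τ′ (toℕ y) ≡ d₁ → R.OnPlane (toℕ y)
    ⇒on y y∈ e = decidable-stable (R.onPlane? (toℕ y)) λ off → none (y , y∈ , sym (R.τ′-off off) ∙ e)
    go : Dec (Uses R.reassigned d₂) → ⊥
    go (yes u) = Td.three-uses R.reassigned (a , proj₁ a-in , R.τ′-on (self a)) u (x , x∈ , R.τ′-off off-x ∙ ex)
    go (no n) = Td.PlaneSize.contradiction R.reassigned n (proj₁ a-in) on⇒ ⇒on

  -- Without a common point of the three kinds, the plane through a and the plane through c are
  -- disjoint, and both can be retyped, as `d₁` and as `d₃`. Points of type `d₂` that remain give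
  -- three directions; if none remain, the size of the first plane is contradictory.
  only-second : (∀ y → y ∈ A → τ (toℕ y) ≡ d₂) → ∀ {a c} → In d₁ a → In d₃ c → ¬ Triple → ⊥
  only-second all {a} {c} a-in c-in no-triple = go (uses? R₂.reassigned d₂)
    where
    C₃ = gcd-combination (step p q r d₃) (step p q r d₂)
    module R₁ = Reassign D M≡ t d₁ d₂ combination12 a-in (λ y y∈ _ → all y y∈)
    module R₀ = Reassign D M≡ t d₃ d₂ C₃ c-in (λ y y∈ _ → all y y∈)
    disjoint : ∀ y → R₁.OnPlane (toℕ y) → ¬ R₀.OnPlane (toℕ y)
    disjoint y on on' = no-triple (y
      , (y∈ , λ z h → R₁.plane⊆A z (∣-via (+ toℕ z) (+ toℕ y) (+ toℕ a) (trans∣ (pos∣ (Combination.g∣s combination12)) h) on))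
      , (y∈ , λ z h → proj₁ (closed y∈ (subst (λ f → + step p q r f ∣ℤ (+ toℕ z - + toℕ y)) (sym (all y y∈)) h)))
      , (y∈ , λ z h → R₀.plane⊆A z (∣-via (+ toℕ z) (+ toℕ y) (+ toℕ c) (trans∣ (pos∣ (Combination.g∣s C₃)) h) on')))
      where y∈ = R₁.plane⊆A y on
    module R₂ = Reassign D M≡ R₁.reassigned d₃ d₂ C₃ c-in (λ y y∈ on' → R₁.τ′-off (λ on → disjoint y on on') ∙ all y y∈)
    on⇒ : ∀ y → R₁.OnPlane (toℕ y) → y ∈ A × R₂.τ′ (toℕ y) ≡ d₁
    on⇒ y on = R₁.plane⊆A y on , R₂.τ′-off (disjoint y on) ∙ R₁.τ′-on on
    ⇒on : ∀ y → y ∈ A → R₂.τ′ (toℕ y) ≡ d₁ → R₁.OnPlane (toℕ y)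
    ⇒on y y∈ e = second (R₂.onPlane? (toℕ y)) (R₁.onPlane? (toℕ y))
      where
      second : Dec (R₂.OnPlane (toℕ y)) → Dec (R₁.OnPlane (toℕ y)) → R₁.OnPlane (toℕ y)
      second _ (yes on) = on
      second (yes on') (no off) = ⊥-elim (absurd (sym (R₂.τ′-on on') ∙ e))
        where absurd : d₃ ≢ d₁
              absurd ()
      second (no off') (no off) = ⊥-elim (absurd (sym (all y y∈) ∙ sym (R₂.τ′-off off' ∙ R₁.τ′-off off) ∙ e))
        where absurd : d₂ ≢ d₁
              absurd ()
    go : Dec (Uses R₂.reassigned d₂) → ⊥
    go (yes u) = Td.three-uses R₂.reassigned (a , proj₁ a-in , proj₂ (on⇒ a (self a))) u (c , proj₁ c-in , R₂.τ′-on (self c))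
    go (no n) = Td.PlaneSize.contradiction R₂.reassigned n (proj₁ a-in) on⇒ ⇒on

  -- The plane through a in the directions 1 and 3 is retyped as `d₃`. The `d₂`-fibre of a leaves
  -- this plane at points that keep the type `d₁`, so together with a point of type `d₂` all three
  -- types would be in use.
  triple-excludes-second : ∀ {a} → τ (toℕ a) ≡ d₁ → In d₂ a → In d₃ a → ¬ Uses t d₂
  triple-excludes-second {a} ea a₂ a₃ (x , x∈ , ex) = Td.three-uses R.reassigned (y , y∈ , R.τ′-off off-y ∙ grid a y (trans∣ (pos∣ (pqr∣step p q r d₂)) y-a) ∙ ea)
      (x , x∈ , R.τ′-off off-x ∙ ex) (a , proj₁ a₃ , R.τ′-on (self a))
    where
    g = gcd (step p q r d₃) (step p q r d₁)
    typed : ∀ y → y ∈ A → + g ∣ℤ (+ toℕ y - + toℕ a) → τ (toℕ y) ≡ d₁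
    typed y y∈ on = grid a y (trans∣ (pos∣ (gcd-greatest (pqr∣step p q r d₃) (pqr∣step p q r d₁))) on) ∙ ea
    module R = Reassign D M≡ t d₃ d₁ (gcd-combination (step p q r d₃) (step p q r d₁)) a₃ typed
    off-x : ¬ R.OnPlane (toℕ x)
    off-x on = absurd (sym (typed x x∈ on) ∙ ex)
      where absurd : d₁ ≢ d₂
            absurd ()
    s = step p q r d₂
    -- The next point on the `d₂`-fibre of a; it is off the plane because q² divides g but not s.
    y = point (+ toℕ a ⊕ + s)
    shift : ∀ a s → (a ⊕ s) - a ≡ s; shift = ring
    y-a : + s ∣ℤ (+ toℕ y - + toℕ a); y-a = near-point (+ toℕ a ⊕ + s) (+ toℕ a) (step∣M d₂) (∣ℤ-cong (sym (shift (+ toℕ a) (+ s))) refl∣)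
    y∈ : y ∈ A; y∈ = proj₂ a₂ y y-a
    q²∣g : q ^ 2 ∣ g; q²∣g = gcd-greatest (∣-trans (n∣m*n (p ^ 2)) (m∣m*n r)) (∣-trans (n∣m*n p) (m∣m*n (r ^ 2)))
    off-y : ¬ R.OnPlane (toℕ y)
    off-y on = [ (λ e → prime∤prime q-prime p-prime (p≢q ∘ sym) (prime∣^ q-prime p 2 e)) , (λ e → prime∤prime q-prime r-prime q≢r (prime∣^ q-prime r 2 e)) ]′
        (euclidsLemma (p ^ 2) (r ^ 2) q-prime (*-cancelˡ-∣ q (subst₂ _∣_ (cong (q *_) (*-identityʳ q)) (lem p q r) (pos∣⁻¹ q²∣s))))
      where
      lem : ∀ p q r → (p * (p * 1)) * q * (r * (r * 1)) ≡ q * ((p * (p * 1)) * (r * (r * 1))); lem = ringℕ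
      q²∣s : + (q ^ 2) ∣ℤ + s
      q²∣s = ∣ℤ-cong (shift (+ toℕ a) (+ s)) (∣-via (+ toℕ a ⊕ + s) (+ toℕ y) (+ toℕ a) (flip-∣ (+ toℕ y) (+ toℕ a ⊕ + s) (trans∣ (pos∣ q²∣M) (point-≡ (+ toℕ a ⊕ + s)))) (trans∣ (pos∣ q²∣g) on))

module _ {M : ℕ} {A B : Subset M} {p q r : ℕ} where
  unused12 : ∀ 2<q (S : Setting A B p q r) d → ¬ Uses (Setting.t S) d → ¬ Uses (Setting.t (setting12 2<q S)) (swap-d12 d)
  unused12 2<q S d n (x , x∈ , e) = n (x , x∈ , sym (swap-d12-involutive _) ∙ cong swap-d12 e ∙ swap-d12-involutive d)

  unused23 : (S : Setting A B p q r) → ∀ d → ¬ Uses (Setting.t S) d → ¬ Uses (Setting.t (setting-sw23 S)) (swap-d23 d)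
  unused23 S d n (x , x∈ , e) = n (x , x∈ , sym (swap-d23-involutive _) ∙ cong swap-d23 e ∙ swap-d23-involutive d)

  first-unused : (S : Setting A B p q r) → ¬ Uses (Setting.t S) d₁ → Uses (Setting.t S) d₂ → Uses (Setting.t S) d₃ → ∀ {a} → Setting.In S d₁ a → ⊥
  first-unused S none u₂@(x , x∈ , ex) u₃ {a} a-in = go (Typing.τ (Setting.t S) (toℕ a)) refl
    where
    go : ∀ d → Typing.τ (Setting.t S) (toℕ a) ≡ d → ⊥
    go d₁ e = none (a , proj₁ a-in , e)
    go d₂ e = WithSetting.fibre-in-second S none u₃ a-in e
    go d₃ e = WithSetting.fibre-in-second (setting-sw23 S) (unused23 S d₁ none) (x , x∈ , cong swap-d23 ex) (in23 p q r d₁ a a-in) (cong swap-d23 e)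

  only-used : (t : Typing p q r A) (d : Dir) → (∀ e → e ≢ d → ¬ Uses t e) → ∀ y → y ∈ A → Typing.τ t (toℕ y) ≡ d
  only-used t d h y y∈ = decidable-stable (dir? (Typing.τ t (toℕ y)) d) λ ne → h (Typing.τ t (toℕ y)) ne (y , y∈ , refl)

some-direction-empty : ∀ {M} {A B : Subset M} {p q r} (S : Setting A B p q r) → 2 < q → 2 < r → ¬ Setting.Triple S →
  (∃[ a ] Setting.In S d₁ a) → (∃[ b ] Setting.In S d₂ b) → (∃[ c ] Setting.In S d₃ c) → ⊥
some-direction-empty {M} {A} {B} {p} {q} {r} S 2<q 2<r no-triple (a , a-in) (b , b-in) (c , c-in) = go (uses? t d₁) (uses? t d₂) (uses? t d₃)
  where
  open Setting S
  S12 = setting12 2<q S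
  S23 = setting-sw23 S
  S31 = setting12 2<r S23
  triple12 : ¬ Setting.Triple S12
  triple12 (x , i , j , k) = no-triple (x , subst (λ s → InDir s A x) (step-swap12 p q r d₁) j , subst (λ s → InDir s A x) (step-swap12 p q r d₂) i , subst (λ s → InDir s A x) (step-swap12 p q r d₃) k)
  triple23 : ¬ Setting.Triple S23
  triple23 (x , i , j , k) = no-triple (x , subst (λ s → InDir s A x) (step-swap23 p q r d₁) i , subst (λ s → InDir s A x) (step-swap23 p q r d₂) k , subst (λ s → InDir s A x) (step-swap23 p q r d₃) j)
  only : ∀ d → (∀ e → e ≢ d → ¬ Uses t e) → ∀ y → y ∈ A → Typing.τ t (toℕ y) ≡ d
  only = only-used {A = A} {B} t
  go : Dec (Uses t d₁) → Dec (Uses t d₂) → Dec (Uses t d₃) → ⊥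
  go (yes u₁) (yes u₂) (yes u₃) = WithSetting.Td.three-uses S t u₁ u₂ u₃
  go (no n) (yes u₂) (yes u₃) = first-unused S n u₂ u₃ a-in
  go (yes (x , x∈ , e)) (no n) (yes (y , y∈ , f)) = first-unused S12 (unused12 2<q S d₂ n) (x , x∈ , cong swap-d12 e) (y , y∈ , cong swap-d12 f) (in12 p q r d₂ b b-in)
  go (yes (x , x∈ , e)) (yes (y , y∈ , f)) (no n) = first-unused S31 (unused12 2<r S23 d₂ (unused23 S d₃ n)) (x , x∈ , cong (swap-d12 ∘ swap-d23) e) (y , y∈ , cong (swap-d12 ∘ swap-d23) f)
      (in12 p r q d₂ c (in23 p q r d₃ c c-in))
  go (no n₁) (yes _) (no n₃) = WithSetting.only-second S (only d₂ λ { d₁ _ → n₁ ; d₂ ne → ⊥-elim (ne refl) ; d₃ _ → n₃ }) a-in c-in no-triple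
  go (yes _) (no n₂) (no n₃) = WithSetting.only-second S12 (λ y y∈ → cong swap-d12 (only d₁ (λ { d₁ ne → ⊥-elim (ne refl) ; d₂ _ → n₂ ; d₃ _ → n₃ }) y y∈)) (in12 p q r d₂ b b-in) (in12 p q r d₃ c c-in) triple12
  go (no n₁) (no n₂) (yes _) = WithSetting.only-second S23 (λ y y∈ → cong swap-d23 (only d₃ (λ { d₁ _ → n₁ ; d₂ _ → n₂ ; d₃ ne → ⊥-elim (ne refl) }) y y∈)) (in23 p q r d₁ a a-in) (in23 p q r d₂ b b-in) triple23
  go (no n₁) (no n₂) (no n₃) = none (only d₁ (λ { d₁ ne → ⊥-elim (ne refl) ; d₂ _ → n₂ ; d₃ _ → n₃ }) a (proj₁ a-in))
    where
    none : Typing.τ t (toℕ a) ≢ d₁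
    none e = n₁ (a , proj₁ a-in , e)

-- The conclusions of the two cases

∑-full : ∀ {n k} (f : Fin n → ℕ) → (∀ i → f i ≤ k) → ∑ f ≡ n * k → ∀ i → f i ≡ k
∑-full {suc n} {k} f h e = λ { Fin.zero → head ; (Fin.suc i) → ∑-full (f ∘ Fin.suc) (λ j → h (Fin.suc j)) tail i }
  where
  tail≤ : ∑ (f ∘ Fin.suc) ≤ n * k
  tail≤ = ≤-trans (∑-mono (λ i → h (Fin.suc i))) (≤-reflexive (∑-const n k))
  head : f Fin.zero ≡ k
  head = ≤-antisym (h Fin.zero) (+-cancelʳ-≤ (n * k) _ _ (≤-trans (≤-reflexive (sym e)) (+-monoʳ-≤ (f Fin.zero) tail≤)))
  tail : ∑ (f ∘ Fin.suc) ≡ n * k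
  tail = +-cancelˡ-≡ k _ _ (cong (_+ ∑ (f ∘ Fin.suc)) (sym head) ∙ e)

mod⇒∣ : ∀ {M} x y → x ≡ y [mod M ] → + M ∣ℤ (+ x - + y)
mod⇒∣ x y h = ∣ᵤ⇒∣ h

shifted-difference : ∀ {k} x y b b' v {u} → v ⊕ (b - b') ≡ u → + k ∣ℤ (x - u) → + k ∣ℤ (y - v) → + k ∣ℤ ((x ⊕ b') - (y ⊕ b))
shifted-difference x y b b' v refl e f = ∣ℤ-cong (lem₁ x v (b - b') y ∙ lem₂ x y b b') (sub∣ e f)
  where lem₁ : ∀ x v h y → (x - (v ⊕ h)) - (y - v) ≡ (x - y) - h; lem₁ = ring
        lem₂ : ∀ x y b b' → (x - y) - (b - b') ≡ (x ⊕ b') - (y ⊕ b); lem₂ = ring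

does-true : ∀ {P : Set} (d : Dec P) → does d ≡ true → P
does-true (yes y) _ = y

∈-tabulate⁻ : ∀ {n} (f : Fin n → Bool) {x} → x ∈ Vec.tabulate f → f x ≡ true
∈-tabulate⁻ f {x} h = sym (lookup∘tabulate f x) ∙ []=⇒lookup h

∈-tabulate⁺ : ∀ {n} (f : Fin n → Bool) {x} → f x ≡ true → x ∈ Vec.tabulate f
∈-tabulate⁺ f {x} h = lookup⇒[]= x (Vec.tabulate f) (lookup∘tabulate f x ∙ h)

∈-Λ₀⁻ : ∀ {M} D {x : Fin M} → x ∈ Λ₀ M D → D ∣ toℕ x
∈-Λ₀⁻ D {x} h = does-true (D ∣? toℕ x) (∈-tabulate⁻ _ h)

∈-Λ₀⁺ : ∀ {M} D {x : Fin M} → D ∣ toℕ x → x ∈ Λ₀ M D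
∈-Λ₀⁺ D {x} h = ∈-tabulate⁺ _ (dec-true (D ∣? toℕ x) h)

module _ {M D : ℕ} (D∣M : D ∣ M) (a x : Fin M) where
  private
    shifted : + ((toℕ x + M) ∸ toℕ a) ≡ (+ toℕ x - + toℕ a) ⊕ + M
    shifted = sym (m-n≡m⊖n (toℕ x + M) (toℕ a) ∙ ⊖-≥ (≤-trans (<⇒≤ (toℕ<n a)) (m≤n+m M (toℕ x)))) ∙ lem (+ toℕ x) (+ M) (+ toℕ a)
      where lem : ∀ x m a → (x ⊕ m) - a ≡ (x - a) ⊕ m; lem = ring

  ∈-Λ⁺ : + D ∣ℤ (+ toℕ x - + toℕ a) → x ∈ Λ M D a
  ∈-Λ⁺ d = ∈-tabulate⁺ _ (dec-true (D ∣? _) (pos∣⁻¹ (∣ℤ-cong (sym shifted) (add∣ d (pos∣ D∣M)))))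

module _ {M π s : ℕ} (M≡ : M ≡ π * s) .{{_ : NonZero π}} where
  in-fibre : ∀ (x y : Fin M) → + s ∣ℤ (+ toℕ y - + toℕ x) → InFiber M π s x y
  in-fibre x y (dividesℤ k e) = t , n%ℕd<d k π , ∣⇒∣ᵤ (dividesℤ (k /ℕ π) (lem (+ toℕ y) (+ toℕ x) (+ (t * s)) ∙ cong₂ _-_ e (pos-* t s) ∙ cong (λ w → w · + s - + t · + s) (a≡a%ℕn+[a/ℕn]*n k π) ∙ lem' (+ t) (k /ℕ π) (+ π) (+ s) ∙ cong (λ w → k /ℕ π · w) (sym (pos-* π s) ∙ cong +_ (sym M≡))))
    where
    t = k %ℕ π
    lem : ∀ y x w → y - (x ⊕ w) ≡ (y - x) - w; lem = ring
    lem' : ∀ t j π s → (t ⊕ j · π) · s - t · s ≡ j · (π · s); lem' = ring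

  out-fibre : ∀ (x y : Fin M) → InFiber M π s x y → + s ∣ℤ (+ toℕ y - + toℕ x)
  out-fibre x y (t , _ , h) = ∣ℤ-cong (lem (+ toℕ y) (+ toℕ x) (+ (t * s))) (add∣ (trans∣ (pos∣ (subst (s ∣_) (sym M≡) (n∣m*n π))) (mod⇒∣ (toℕ y) (toℕ x + t * s) h)) (pos∣ (n∣m*n t)))
    where lem : ∀ y x w → (y - (x ⊕ w)) ⊕ w ≡ y - x; lem = ring

  fibred-closed : ∀ {S : Subset M} → Fibered M π s S → ∀ {x y} → x ∈ S → + s ∣ℤ (+ toℕ y - + toℕ x) → y ∈ S
  fibred-closed (S' , S'⊆S , h) {x} {y} x∈ d = let (a , a∈ , f) = Equivalence.to (h x) x∈ in
    Equivalence.from (h y) (a , a∈ , in-fibre a y (∣-via (+ toℕ y) (+ toℕ x) (+ toℕ a) d (out-fibre a x f)))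

  closed-fibred : ∀ {S : Subset M} → (∀ x → x ∈ S → ∀ y → + s ∣ℤ (+ toℕ y - + toℕ x) → y ∈ S) → Fibered M π s S
  closed-fibred {S} h = S , (λ x∈ → x∈) , λ y → mk⇔ (λ y∈ → y , y∈ , in-fibre y y (dividesℤ (+ 0) (+-inverseʳ (+ toℕ y) ∙ sym (*-zeroˡ (+ s))))) λ (x , x∈ , f) → h x x∈ y (out-fibre x y f)

  dirSet⇒ : ∀ {A : Subset M} {a} → DirSet M π s A a → InDir s A a
  dirSet⇒ {a = a} (a∈ , f) = a∈ , λ y d → f y (in-fibre a y d)

  ⇒dirSet : ∀ {A : Subset M} {a} → InDir s A a → DirSet M π s A a
  ⇒dirSet {a = a} (a∈ , f) = a∈ , λ y d → f y (out-fibre a y d)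

module _ {M : ℕ} (p q r : ℕ) (M≡ : M ≡ p ^ 2 * q ^ 2 * r ^ 2) where
  order₁ : M ≡ p * step p q r d₁
  order₁ = M≡ ∙ lem p q r
    where lem : ∀ p q r → (p * (p * 1)) * (q * (q * 1)) * (r * (r * 1)) ≡ p * (p * (q * (q * 1)) * (r * (r * 1))); lem = ringℕ

  order₂ : M ≡ q * step p q r d₂
  order₂ = M≡ ∙ lem p q r
    where lem : ∀ p q r → (p * (p * 1)) * (q * (q * 1)) * (r * (r * 1)) ≡ q * ((p * (p * 1)) * q * (r * (r * 1))); lem = ringℕ

  order₃ : M ≡ r * step p q r d₃
  order₃ = M≡ ∙ lem p q r
    where lem : ∀ p q r → (p * (p * 1)) * (q * (q * 1)) * (r * (r * 1)) ≡ r * ((p * (p * 1)) * (q * (q * 1)) * r); lem = ringℕ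

inDir? : ∀ {M} s (A : Subset M) a → Dec (InDir s A a)
inDir? s A a = (a ∈? A) ×-dec all? (λ y → (+ s ∣ℤ? (+ toℕ y - + toℕ a)) →-dec (y ∈? A))

module Conclusions {M : ℕ} {A B : Subset M} {p q r : ℕ} (S : Setting A B p q r) where
  open Setting S
  open Distinct D
  open Typing t
  open Points D M≡
  open Profile
  module Td = Tiled D M≡ A B tiles size-A size-B

  open NonZeros D

  M≡₁ = order₁ p q r M≡
  M≡₂ = order₂ p q r M≡
  M≡₃ = order₃ p q r M≡

  conclusion-IIb : (∀ a → a ∈ A → InDir (step p q r d₁) A a) → ConclIIb M p (step p q r d₁) A B
  conclusion-IIb h = closed-fibred M≡₁ (λ x x∈ → proj₂ (h x x∈)) , subst (λ k → CycDiv M k A) (*-identityʳ (p ^ 2)) (Td.fibred-Φ fib 1 (subst (_∣ M) (sym (*-identityʳ (p ^ 2))) p²∣M))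
    , (λ e d → inj₁ (Td.fibred-Φ fib e d)) , Td.fibred-T2 fib
    where fib = λ x x∈ → proj₂ (h x x∈)

  module Triples {a : Fin M} (a₁ : In d₁ a) (a₂ : In d₂ a) (a₃ : In d₃ a) (all₁ : ∀ x → x ∈ A → τ (toℕ x) ≡ d₁) where
    fibred : ∀ x → x ∈ A → ∀ y → + step p q r d₁ ∣ℤ (+ toℕ y - + toℕ x) → y ∈ A
    fibred x x∈ y d = proj₁ (closed x∈ (subst (λ f → + step p q r f ∣ℤ (+ toℕ y - + toℕ x)) (sym (all₁ x x∈)) d))

    G : ℕ; G = p * q * r
    G∣M : G ∣ M; G∣M = ∣-trans (pqr∣step p q r d₁) (step∣M d₁)
    p∣G : p ∣ G; p∣G = ∣-trans (m∣m*n q) (m∣m*n r)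
    q∣G : q ∣ G; q∣G = ∣-trans (n∣m*n p) (m∣m*n r)
    r∣G : r ∣ G; r∣G = n∣m*n (p * q)

    -- Every multiple of pqr is a difference of two points of A near a.
    B-distinct : ∀ b b' → b ∈ B → b' ∈ B → + G ∣ℤ (+ toℕ b - + toℕ b') → b ≡ b'
    B-distinct b b' b∈ b'∈ d = sym (proj₂ (proj₂ (tiles z) x b' y b x∈ b'∈ y∈ b∈ z₁ z₂))
      where
      α h : ℤ
      α = + toℕ a
      h = + toℕ b - + toℕ b'
      add : ∀ {k} u w → + k ∣ℤ (u - (α ⊕ w)) → + k ∣ℤ w → + k ∣ℤ (u - α)
      add u w e f = ∣ℤ-cong (lem u α w) (add∣ e f)
        where lem : ∀ u α w → (u - (α ⊕ w)) ⊕ w ≡ u - α; lem = ring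
      -- y differs from a by -h in the third coordinate, x' by h in the second, and x moves on from
      -- x' by h in the first. So x - y is h in all three coordinates, which gives x + b' = y + b.
      y∃ = crt-point α α (α - h)
      y = proj₁ y∃
      y∈ : y ∈ A
      y∈ = proj₂ a₃ y (step₃-∣ _ (proj₁ (proj₂ y∃)) (proj₁ (proj₂ (proj₂ y∃))) (add (+ toℕ y) (- h) (trans∣ (sq-p r-prime) (proj₂ (proj₂ (proj₂ y∃)))) (neg∣ (trans∣ (pos∣ r∣G) d))))
      x'∃ = crt-point α (α ⊕ h) α
      x' = proj₁ x'∃
      x'∈ : x' ∈ A
      x'∈ = proj₂ a₂ x' (step₂-∣ _ (proj₁ (proj₂ x'∃)) (add (+ toℕ x') h (trans∣ (sq-p q-prime) (proj₁ (proj₂ (proj₂ x'∃)))) (trans∣ (pos∣ q∣G) d)) (proj₂ (proj₂ (proj₂ x'∃))))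
      x∃ = crt-point (α ⊕ h) (α ⊕ h) α
      x = proj₁ x∃
      x∈ : x ∈ A
      x∈ = fibred x' x'∈ x (step₁-∣ _
        (∣-via (+ toℕ x) α (+ toℕ x') (add (+ toℕ x) h (trans∣ (sq-p p-prime) (proj₁ (proj₂ x∃))) (trans∣ (pos∣ p∣G) d)) (flip-∣ (+ toℕ x') α (trans∣ (sq-p p-prime) (proj₁ (proj₂ x'∃)))))
        (∣-via (+ toℕ x) (α ⊕ h) (+ toℕ x') (proj₁ (proj₂ (proj₂ x∃))) (flip-∣ (+ toℕ x') (α ⊕ h) (proj₁ (proj₂ (proj₂ x'∃)))))
        (∣-via (+ toℕ x) α (+ toℕ x') (proj₂ (proj₂ (proj₂ x∃))) (flip-∣ (+ toℕ x') α (proj₂ (proj₂ (proj₂ x'∃))))))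
      diff : ∀ {k u} v → v ⊕ h ≡ u → + k ∣ℤ (+ toℕ x - u) → + k ∣ℤ (+ toℕ y - v) → + k ∣ℤ ((+ toℕ x ⊕ + toℕ b') - (+ toℕ y ⊕ + toℕ b))
      diff v = shifted-difference (+ toℕ x) (+ toℕ y) (+ toℕ b) (+ toℕ b') v
      M∣ : + M ∣ℤ ((+ toℕ x ⊕ + toℕ b') - (+ toℕ y ⊕ + toℕ b))
      M∣ = M-∣ℤ _ (diff α refl (proj₁ (proj₂ x∃)) (proj₁ (proj₂ y∃))) (diff α refl (proj₁ (proj₂ (proj₂ x∃))) (proj₁ (proj₂ (proj₂ y∃))))
        (diff (α - h) (lem α h) (proj₂ (proj₂ (proj₂ x∃))) (proj₂ (proj₂ (proj₂ y∃))))
        where lem : ∀ α h → α - h ⊕ h ≡ α; lem = ring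
      z = point (+ toℕ y ⊕ + toℕ b)
      to-z : + M ∣ℤ ((+ toℕ y ⊕ + toℕ b) - + toℕ z); to-z = flip-∣ (+ toℕ z) (+ toℕ y ⊕ + toℕ b) (point-≡ (+ toℕ y ⊕ + toℕ b))
      z₂ : (toℕ y + toℕ b) ≡ toℕ z [mod M ]; z₂ = ∣⇒∣ᵤ to-z
      z₁ : (toℕ x + toℕ b') ≡ toℕ z [mod M ]; z₁ = ∣⇒∣ᵤ (∣-via (+ toℕ x ⊕ + toℕ b') (+ toℕ y ⊕ + toℕ b) (+ toℕ z) M∣ to-z)

    open Lists D
    private
      PB = profile (els B)
      G-∣ℤ : ∀ z → + p ∣ℤ z → + q ∣ℤ z → + r ∣ℤ z → + G ∣ℤ z
      G-∣ℤ z d e f = subst (λ k → + k ∣ℤ z) (cong₂ _*_ (cong₂ _*_ (*-identityʳ p) (*-identityʳ q)) (*-identityʳ r)) (modulus-∣ℤ l1 l1 l1 z (pow₁-∣ p d) (pow₁-∣ q e) (pow₁-∣ r f))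
      B-≤1 : ∀ c v w → N PB l1 l1 l1 c v w ≤ 1
      B-≤1 c v w = sumN-≤1 (els B) (term (λ _ → 1) l1 l1 l1 c v w) (els-unique B) (term-≤1 (λ _ → 1) (λ _ → ≤-refl) l1 l1 l1 c v w) λ a b a∈ b∈ ha hb →
        let (x , x∈ , e) = ∈-els⁻ {v = B} a∈ ; (y , y∈ , f) = ∈-els⁻ {v = B} b∈
            (_ , a₁ , a₂ , a₃) = term-pos (λ _ → 1) l1 l1 l1 c v w {a} ha ; (_ , b₁ , b₂ , b₃) = term-pos (λ _ → 1) l1 l1 l1 c v w {b} hb
        in sym e ∙ cong toℕ (B-distinct x y x∈ y∈ (subst₂ (λ a b → + G ∣ℤ (+ a - + b)) (sym e) (sym f)
             (G-∣ℤ (+ a - + b) (∣-sub p-prime (+ toℕ c) (+ a) (+ b) a₁ b₁) (∣-sub p-prime (+ toℕ v) (+ a) (+ b) a₂ b₂) (∣-sub p-prime (+ toℕ w) (+ a) (+ b) a₃ b₃)))) ∙ f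
      -- B has pqr points, and by `B-distinct` at most one in each of the pqr classes mod pqr.
      B-1 : ∀ c v w → N PB l1 l1 l1 c v w ≡ 1
      B-1 c v = ∑-full (λ w → N PB l1 l1 l1 c v w) (B-≤1 c v) (sym (r₀ PB {l1} {l1} {c} {v}) ∙ B-r c v ∙ sym (*-identityʳ r))
        where
        B-r≤ : ∀ c v → N PB l1 l1 l0 c v tt ≤ r
        B-r≤ c v = ≤-trans (≤-reflexive (r₀ PB {l1} {l1} {c} {v})) (≤-trans (∑-mono (B-≤1 c v)) (≤-reflexive (∑-const r 1 ∙ *-identityʳ r)))
        B-qr : ∀ c → N PB l1 l0 l0 c tt tt ≡ q * r
        B-qr = ∑-full (λ c → N PB l1 l0 l0 c tt tt) (λ c → ≤-trans (≤-reflexive (q₀ PB {l1} {l0} {c} {tt})) (≤-trans (∑-mono (B-r≤ c)) (≤-reflexive (∑-const q r))))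
          (sym (p₀ PB {l0} {l0} {tt} {tt}) ∙ Pair.total-B Td.T ∙ *-assoc p q r)
        B-r : ∀ c v → N PB l1 l1 l0 c v tt ≡ r
        B-r c = ∑-full (λ v → N PB l1 l1 l0 c v tt) (B-r≤ c) (sym (q₀ PB {l1} {l0} {c} {tt}) ∙ B-qr c)
      B-hits : ∀ z → ∃[ b ] (b ∈ B × + G ∣ℤ (z - + toℕ b))
      B-hits z = let (c , d) = residue p-prime z ; (v , e) = residue q-prime z ; (w , f) = residue r-prime z
                     (b , b∈ , h) = sumN-pos (els B) (term (λ _ → 1) l1 l1 l1 c v w) (≤-reflexive (sym (B-1 c v w)))
                     (_ , h₁ , h₂ , h₃) = term-pos (λ _ → 1) l1 l1 l1 c v w {b} h
                     (x , x∈ , eq′) = ∈-els⁻ {v = B} b∈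
                 in x , x∈ , subst (λ k → + G ∣ℤ (z - + k)) (sym eq′) (G-∣ℤ (z - + b) (∣-via z (+ toℕ c) (+ b) d h₁) (∣-via z (+ toℕ v) (+ b) e h₂) (∣-via z (+ toℕ w) (+ b) f h₃))

    Λ-tiles : Tiles M (Λ₀ M G) B
    Λ-tiles x = existence , λ λ₁ b λ₂ b' λ₁∈ b∈ λ₂∈ b'∈ h h' →
      let b≡ = B-distinct b b' b∈ b'∈ (∣ℤ-cong (lem₁ (+ toℕ λ₁) (+ toℕ b) (+ toℕ x) (+ toℕ λ₂) (+ toℕ b'))
                 (add∣ (sub∣ (trans∣ (pos∣ G∣M) (sub∣ (mod⇒∣ (toℕ λ₁ + toℕ b) (toℕ x) h) (mod⇒∣ (toℕ λ₂ + toℕ b') (toℕ x) h'))) (pos∣ (∈-Λ₀⁻ G λ₁∈))) (pos∣ (∈-Λ₀⁻ G λ₂∈))))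
      in toℕ-injective (small-∣ (toℕ<n λ₁) (toℕ<n λ₂) (∣ℤ-cong (cong (λ k → ((+ toℕ λ₁ ⊕ + toℕ b) - + toℕ x) - ((+ toℕ λ₂ ⊕ + toℕ k) - + toℕ x)) (sym b≡) ∙ lem₂ (+ toℕ λ₁) (+ toℕ b) (+ toℕ x) (+ toℕ λ₂))
             (sub∣ (mod⇒∣ (toℕ λ₁ + toℕ b) (toℕ x) h) (mod⇒∣ (toℕ λ₂ + toℕ b') (toℕ x) h')))) , b≡
      where
      lem₁ : ∀ l b x l' b' → (((l ⊕ b) - x) - ((l' ⊕ b') - x)) - l ⊕ l' ≡ b - b'; lem₁ = ring
      lem₂ : ∀ l b x l' → ((l ⊕ b) - x) - ((l' ⊕ b) - x) ≡ l - l'; lem₂ = ring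
      existence : ∃[ l ] ∃[ b ] (l ∈ Λ₀ M G × b ∈ B × (toℕ l + toℕ b) ≡ toℕ x [mod M ])
      existence = let (b , b∈ , d) = B-hits (+ toℕ x) ; z = + toℕ x - + toℕ b in
        point z , b , ∈-Λ₀⁺ G (pos∣⁻¹ (∣ℤ-cong (⊕-identityʳ _) (near-point z (+ 0) G∣M (∣ℤ-cong (sym (⊕-identityʳ z)) d)))) , b∈
          , ∣⇒∣ᵤ (∣ℤ-cong (lem (+ toℕ (point z)) (+ toℕ x) (+ toℕ b)) (point-≡ z))
        where lem : ∀ l x b → l - (x - b) ≡ (l ⊕ b) - x; lem = ring

    Λ-size : ∣ Λ₀ M G ∣ ≡ G
    Λ-size = *-cancelʳ-≡ _ _ G {{m*n≢0 (p * q) r {{m*n≢0 p q}}}} (cong₂ _*_ (sym (length-els (Λ₀ M G))) (sym (length-els B ∙ size-B)) ∙ tile-size M (els (Λ₀ M G)) (els B) (tiles⇒TileL (Λ₀ M G) B Λ-tiles) ∙ M≡ ∙ lem p q r)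
      where lem : ∀ p q r → (p * (p * 1)) * (q * (q * 1)) * (r * (r * 1)) ≡ p * q * r * (p * q * r); lem = ringℕ

    module Tλ = Tiled D M≡ (Λ₀ M G) B Λ-tiles Λ-size size-B

    -- The standard set is a tile of the same size and is itself a union of p-fibres, so the
    -- argument for A applies to it.
    Λ-T2 : T2 M (Λ₀ M G)
    Λ-T2 = proj₁ (Tλ.fibred-T2 λ x x∈ y d → ∈-Λ₀⁺ G (pos∣⁻¹ (∣ℤ-cong (lem (+ toℕ y) (+ toℕ x)) (add∣ (trans∣ (pos∣ (pqr∣step p q r d₁)) d) (pos∣ (∈-Λ₀⁻ G x∈))))))
      where lem : ∀ y x → (y - x) ⊕ x ≡ y; lem = ring

    conclusion-I : T2Equivalent M A (Λ₀ M G) B × T2 M A × T2 M B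
    conclusion-I = (tiles , Λ-tiles , mk⇔ (λ _ → Λ-T2) (λ _ → proj₁ T2s)) , T2s
      where T2s = Td.fibred-T2 fibred

module _ {M : ℕ} {A B : Subset M} where
  all-first : ∀ {p q r} (S : Setting A B p q r) {a} → Setting.In S d₂ a → Setting.In S d₃ a → Typing.τ (Setting.t S) (toℕ a) ≡ d₁ → ∀ x → x ∈ A → Typing.τ (Setting.t S) (toℕ x) ≡ d₁
  all-first {p} {q} {r} S {a} a₂ a₃ ea x x∈ = go (Typing.τ (Setting.t S) (toℕ x)) refl
    where
    go : ∀ d → Typing.τ (Setting.t S) (toℕ x) ≡ d → Typing.τ (Setting.t S) (toℕ x) ≡ d₁
    go d₁ e = e
    go d₂ e = ⊥-elim (WithSetting.triple-excludes-second S ea a₂ a₃ (x , x∈ , e))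
    go d₃ e = ⊥-elim (WithSetting.triple-excludes-second (setting-sw23 S) {a} (cong swap-d23 ea) (in23 p q r d₃ a a₃) (in23 p q r d₂ a a₂) (x , x∈ , cong swap-d23 e))

  triple-conclusion : ∀ {p q r} (S : Setting A B p q r) → 2 < q → 2 < r → Setting.Triple S → T2Equivalent M A (Λ₀ M (p * q * r)) B × T2 M A × T2 M B
  triple-conclusion {p} {q} {r} S 2<q 2<r (a , a₁ , a₂ , a₃) = go (Typing.τ (Setting.t S) (toℕ a)) refl
    where
    S12 = setting12 2<q S
    S31 = setting12 2<r (setting-sw23 S)
    in31 : ∀ d → InDir (step p q r d) A a → InDir (step r p q (swap-d12 (swap-d23 d))) A a
    in31 d h = in12 p r q (swap-d23 d) a (in23 p q r d a h)
    go : ∀ d → Typing.τ (Setting.t S) (toℕ a) ≡ d → T2Equivalent M A (Λ₀ M (p * q * r)) B × T2 M A × T2 M B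
    go d₁ e = Conclusions.Triples.conclusion-I S a₁ a₂ a₃ (all-first S a₂ a₃ e)
    go d₂ e = subst (λ k → T2Equivalent M A (Λ₀ M k) B × T2 M A × T2 M B) (*-swap12 q p r) (Conclusions.Triples.conclusion-I S12 (in12 p q r d₂ a a₂) (in12 p q r d₁ a a₁) (in12 p q r d₃ a a₃) (all-first S12 {a} (in12 p q r d₁ a a₁) (in12 p q r d₃ a a₃) (cong swap-d12 e)))
    go d₃ e = subst (λ k → T2Equivalent M A (Λ₀ M k) B × T2 M A × T2 M B) (lem p q r) (Conclusions.Triples.conclusion-I S31 (in31 d₃ a₃) (in31 d₁ a₁) (in31 d₂ a₂) (all-first S31 {a} (in31 d₁ a₁) (in31 d₂ a₂) (cong (swap-d12 ∘ swap-d23) e)))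
      where lem : ∀ p q r → r * p * q ≡ p * q * r; lem = ringℕ

  conclusion-II : ∀ {p q r} (S : Setting A B p q r) → 2 < q → 2 < r → (∀ a → ¬ Setting.In S d₁ a) → ConclII M A B p q r
  conclusion-II {p} {q} {r} S 2<q 2<r empty = ((λ a h → empty a (dirSet⇒ C.M≡₁ h)) , (λ a a∈ → two a a∈ (τ (toℕ a)) refl))
    , (λ all → subst (λ k → ConclIIb M q k A B) (step-swap12 p q r d₂) (Conclusions.conclusion-IIb S12 λ a a∈ → in12 p q r d₂ a (dirSet⇒ C.M≡₂ (all a a∈))))
    , (λ all → subst (λ k → ConclIIb M r k A B) (step-swap12 p r q d₂ ∙ step-swap23 p q r d₃) (Conclusions.conclusion-IIb S31 λ a a∈ → in12 p r q d₂ a (in23 p q r d₃ a (dirSet⇒ C.M≡₃ (all a a∈)))))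
    , λ _ (a , aJ , a¬K) (b , bK , b¬J) → C.Td.TwoDirections.cyclotomic-cases t none
        (a , proj₁ aJ , [ (λ e → e) , (λ e → ⊥-elim (a¬K (third-set a (proj₁ aJ) e))) ]′ (type a (proj₁ aJ)))
        (b , proj₁ bK , [ (λ e → ⊥-elim (b¬J (second-set b (proj₁ bK) e))) , (λ e → e) ]′ (type b (proj₁ bK))) 2<p
    where
    open Setting S
    open Typing t
    module C = Conclusions S
    open NonZeros D
    S12 = setting12 2<q S
    S31 = setting12 2<r (setting-sw23 S)
    typed : ∀ a → a ∈ A → ∀ d → τ (toℕ a) ≡ d → InDir (step p q r d) A a
    typed a a∈ d refl = a∈ , λ y h → proj₁ (closed a∈ h)
    none : ¬ Uses t d₁
    none (x , x∈ , e) = empty x (typed x x∈ d₁ e)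
    type : ∀ a → a ∈ A → τ (toℕ a) ≡ d₂ ⊎ τ (toℕ a) ≡ d₃
    type a a∈ = go (τ (toℕ a)) refl
      where
      go : ∀ d → τ (toℕ a) ≡ d → τ (toℕ a) ≡ d₂ ⊎ τ (toℕ a) ≡ d₃
      go d₁ e = ⊥-elim (none (a , a∈ , e))
      go d₂ e = inj₁ e
      go d₃ e = inj₂ e
    second-set : ∀ a → a ∈ A → τ (toℕ a) ≡ d₂ → DirSet M q (step₂ p q r) A a
    second-set a a∈ e = ⇒dirSet C.M≡₂ (typed a a∈ d₂ e)
    third-set : ∀ a → a ∈ A → τ (toℕ a) ≡ d₃ → DirSet M r (step₃ p q r) A a
    third-set a a∈ e = ⇒dirSet C.M≡₃ (typed a a∈ d₃ e)
    two : ∀ a → a ∈ A → ∀ d → τ (toℕ a) ≡ d → DirSet M q (step₂ p q r) A a ⊎ DirSet M r (step₃ p q r) A a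
    two a a∈ d₁ e = ⊥-elim (none (a , a∈ , e))
    two a a∈ d₂ e = inj₁ (second-set a a∈ e)
    two a a∈ d₃ e = inj₂ (third-set a a∈ e)

-- The partition into fibres given by the hypothesis

module GridTyping {M p q r : ℕ} (D : Distinct p q r) (M≡ : M ≡ p ^ 2 * q ^ 2 * r ^ 2) (A : Subset M)
  (hyp : ∀ a → a ∈ A → Fibered M p (step p q r d₁) (A ∩ Λ M (p * q * r) a) ⊎ Fibered M q (step p q r d₂) (A ∩ Λ M (p * q * r) a) ⊎ Fibered M r (step p q r d₃) (A ∩ Λ M (p * q * r) a)) where
  open Distinct D
  private
    G : ℕ; G = p * q * r
    instance
      nzp = prime⇒nonZero p-prime
      nzq = prime⇒nonZero q-prime
      nzr = prime⇒nonZero r-prime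
      nzpq = m*n≢0 p q
      nzG = m*n≢0 (p * q) r

    G∣M : G ∣ M; G∣M = ∣-trans (pqr∣step p q r d₁) (Points.step∣M D M≡ d₁)

    GridClosed : Dir → Fin M → Set
    GridClosed d a = ∀ x y → x ∈ A → + G ∣ℤ (+ toℕ x - + toℕ a) → + step p q r d ∣ℤ (+ toℕ y - + toℕ x) → y ∈ A

    grid-closed : ∀ {π} .{{_ : NonZero π}} d a → M ≡ π * step p q r d → Fibered M π (step p q r d) (A ∩ Λ M G a) → GridClosed d a
    grid-closed d a e f x y x∈ g h = proj₁ (x∈p∩q⁻ A (Λ M G a) (fibred-closed e f {x} {y} (x∈p∩q⁺ (x∈ , ∈-Λ⁺ G∣M a x g)) h))

    direction : ∀ a → a ∈ A → ∃[ d ] GridClosed d a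
    direction a a∈ = [ (λ f → d₁ , grid-closed d₁ a (order₁ p q r M≡) f) , [ (λ f → d₂ , grid-closed d₂ a (order₂ p q r M≡) f) , (λ f → d₃ , grid-closed d₃ a (order₃ p q r M≡) f) ]′ ]′ (hyp a a∈)

    Near : ℕ → Set
    Near k = ∃[ b ] (b ∈ A × + G ∣ℤ (+ k - + toℕ {M} b))

    near? : ∀ k → Dec (Near k)
    near? k = any? (λ b → (b ∈? A) ×-dec (+ G ∣ℤ? (+ k - + toℕ b)))

    pick : ∀ {k} → Dec (Near k) → Dir
    pick (yes (b , b∈ , _)) = proj₁ (direction b b∈)
    -- A coset that does not meet A gets an arbitrary type.
    pick (no _) = d₁

    pick-closed : ∀ k (near : Dec (Near k)) x y → x ∈ A → + G ∣ℤ (+ k - + toℕ x) → + step p q r (pick near) ∣ℤ (+ toℕ y - + toℕ x) → y ∈ A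
    pick-closed k (yes (b , b∈ , d)) x y x∈ e h = proj₂ (direction b b∈) x y x∈ (∣-sub p-prime (+ k) (+ toℕ x) (+ toℕ b) e d) h
    pick-closed k (no n) x y x∈ e h = ⊥-elim (n (x , x∈ , e))

    -- Different points of one coset of pqrℤ_M may be given different directions by the hypothesis.
    -- Choosing from the canonical representative makes the type depend on the coset only.
    grid-of : ℕ → ℕ
    grid-of n = (+ n) %ℕ G

    grid-of-≡ : ∀ n → + G ∣ℤ (+ grid-of n - + n)
    grid-of-≡ n = flip-∣ (+ n) (+ grid-of n) (mod-reduce G (+ n))

    τ : ℕ → Dir
    τ n = pick (near? (grid-of n))

  τ-grid : ∀ (x y : Fin M) → + G ∣ℤ (+ toℕ y - + toℕ x) → τ (toℕ y) ≡ τ (toℕ x)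
  τ-grid x y d = cong (λ k → pick (near? k)) (small-∣ (n%ℕd<d (+ toℕ y) G) (n%ℕd<d (+ toℕ x) G)
    (∣-via (+ grid-of (toℕ y)) (+ toℕ y) (+ grid-of (toℕ x)) (grid-of-≡ (toℕ y)) (∣-via (+ toℕ y) (+ toℕ x) (+ grid-of (toℕ x)) d (flip-∣ (+ grid-of (toℕ x)) (+ toℕ x) (grid-of-≡ (toℕ x))))))

  typing : Typing p q r A
  typing = record { τ = τ ; closed = λ {x} {y} x∈ h → pick-closed (grid-of (toℕ x)) (near? (grid-of (toℕ x))) x y x∈ (grid-of-≡ (toℕ x)) h
    , τ-grid x y (trans∣ (pos∣ (pqr∣step p q r (τ (toℕ x)))) h) }

odd-prime : ∀ {p} → Prime p → ¬ (2 ∣ p) → 2 < p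
odd-prime {p} pr odd = ≤∧≢⇒< (prime≥2 pr) λ e → odd (subst (2 ∣_) e ∣-refl)

theorem9p1 : (M pi pj pk : ℕ) →
    Prime pi → Prime pj → Prime pk →
    ¬ (2 ∣ pi) → ¬ (2 ∣ pj) → ¬ (2 ∣ pk) →
    pi ≢ pj → pi ≢ pk → pj ≢ pk →
    M ≡ pi ^ 2 * pj ^ 2 * pk ^ 2 →
    (A B : Subset M) →
    Tiles M A B →
    ∣ A ∣ ≡ pi * pj * pk → ∣ B ∣ ≡ pi * pj * pk →
    CycDiv M M A →
    (∀ a → a ∈ A →
       Fibered M pi (step₁ pi pj pk) (A ∩ Λ M (pi * pj * pk) a)
       ⊎ Fibered M pj (step₂ pi pj pk) (A ∩ Λ M (pi * pj * pk) a)
       ⊎ Fibered M pk (step₃ pi pj pk) (A ∩ Λ M (pi * pj * pk) a)) →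
    -- (I)
    ((∃[ a ] (DirSet M pi (step₁ pi pj pk) A a
              × DirSet M pj (step₂ pi pj pk) A a
              × DirSet M pk (step₃ pi pj pk) A a)) →
       T2Equivalent M A (Λ₀ M (pi * pj * pk)) B × T2 M A × T2 M B)
    -- (II)
    × (¬ (∃[ a ] (DirSet M pi (step₁ pi pj pk) A a
                  × DirSet M pj (step₂ pi pj pk) A a
                  × DirSet M pk (step₃ pi pj pk) A a)) →
       ∃[ q1 ] ∃[ q2 ] ∃[ q3 ]
         (Perm3 (q1 , q2 , q3) (pi , pj , pk) × ConclII M A B q1 q2 q3))
theorem9p1 M p q r p-prime q-prime r-prime p-odd q-odd r-odd p≢q p≢r q≢r M≡ A B tiles size-A size-B _ hyp =
    (λ (a , h₁ , h₂ , h₃) → triple-conclusion S 2<q 2<r (a , dirSet⇒ (order₁ p q r M≡) h₁ , dirSet⇒ (order₂ p q r M≡) h₂ , dirSet⇒ (order₃ p q r M≡) h₃))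
  , λ no-triple → go no-triple (any? (inDir? (step p q r d₁) A)) (any? (inDir? (step p q r d₂) A)) (any? (inDir? (step p q r d₃) A))
  where
  D : Distinct p q r
  D = record { p-prime = p-prime ; q-prime = q-prime ; r-prime = r-prime ; p≢q = p≢q ; p≢r = p≢r ; q≢r = q≢r }
  open NonZeros D
  2<p = odd-prime p-prime p-odd
  2<q = odd-prime q-prime q-odd
  2<r = odd-prime r-prime r-odd
  S : Setting A B p q r
  S = record { D = D ; 2<p = 2<p ; M≡ = M≡ ; tiles = tiles ; size-A = size-A ; size-B = size-B ; t = GridTyping.typing D M≡ A hyp ; grid = GridTyping.τ-grid D M≡ A hyp }
  go : ¬ (∃[ a ] (DirSet M p (step₁ p q r) A a × DirSet M q (step₂ p q r) A a × DirSet M r (step₃ p q r) A a)) →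
    Dec (∃[ a ] InDir (step p q r d₁) A a) → Dec (∃[ a ] InDir (step p q r d₂) A a) → Dec (∃[ a ] InDir (step p q r d₃) A a) →
    ∃[ q1 ] ∃[ q2 ] ∃[ q3 ] (Perm3 (q1 , q2 , q3) (p , q , r) × ConclII M A B q1 q2 q3)
  go no-triple (no n) _ _ = p , q , r , σ123 , conclusion-II S 2<q 2<r (λ a h → n (a , h))
  go no-triple _ (no n) _ = q , p , r , σ213 , conclusion-II (setting12 2<q S) 2<p 2<r (λ a h → n (a , subst (λ s → InDir s A a) (step-swap12 p q r d₂) h))
  go no-triple _ _ (no n) = r , p , q , σ312 , conclusion-II (setting12 2<r (setting-sw23 S)) 2<p 2<q (λ a h → n (a , subst (λ s → InDir s A a) (step-swap12 p r q d₂ ∙ step-swap23 p q r d₃) h))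
  go no-triple (yes i) (yes j) (yes k) = ⊥-elim (some-direction-empty S 2<q 2<r (λ (a , h₁ , h₂ , h₃) → no-triple (a , ⇒dirSet (order₁ p q r M≡) h₁ , ⇒dirSet (order₂ p q r M≡) h₂ , ⇒dirSet (order₃ p q r M≡) h₃)) i j k)
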